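{- Consider an instance of the set cover problem, given by a bipartite graph $G$ with vertex set $U\sqcup V$, where every element $u\in U$ has $\deg(u)\le t$ and every set $v\in V$ has $\deg(v)\le s$. There is a deterministic distributed algorithm that computes a set $V_{out}\subseteq V$ with $N(V_{out})=U$ and $|V_{out}|\le O(\log s)\cdot OPT$, where $OPT$ is the minimum size of a subfamily $V^*\subseteq V$ with $N(V^*)=U$, with round complexity (1) $O(\log s\cdot\log^2 t+\log^* n)$ in the $\mathsf{LOCAL}$ model, and (2) $O\big(\log s\cdot(\log^2 t\cdot\log\log t+\log t\cdot\log^* n)\big)$ in the $\mathsf{CONGEST}$ model.
   Context: Set cover problem: the input is a bipartite graph $G$ with $V(G)=U\sqcup V$ (elements $U$, sets $V$; $u\in U$ belongs to set $v\in V$ iff they are adjacent); the goal is a smallest $V_{out}\subseteq V$ with $N(V_{out})=U$, where $N(S)$ denotes the set of neighbors of nodes in $S$. The communication network is $G$ itself, with $n=|U|+|V|$ nodes having unique $O(\log n)$-bit identifiers; computation proceeds in synchronous rounds in which each node may send a message to each neighbor; messages are unbounded in $\mathsf{LOCAL}$ and of $O(\log n)$ bits in $\mathsf{CONGEST}$. At the end each node $v\in V$ knows whether $v\in V_{out}$. -}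

module Defs where

open import Data.Nat using (ℕ; zero; suc; _+_; _*_; _^_; _≤_; _<_; _≤ᵇ_)
open import Data.Nat.Logarithm using (⌊log₂_⌋)
open import Data.Bool using (Bool; true; false; T; if_then_else_)
open import Data.Fin using (Fin)
open import Data.Fin.Subset using (Subset; _∈_; ∣_∣)
open import Data.Vec using (tabulate)
open import Data.List using (List; map; filterᵇ; allFin; length)
open import Data.Product using (_×_; _,_; ∃-syntax)
open import Data.Sum using (_⊎_; inj₁; inj₂)
open import Data.List.Membership.Propositional using () renaming (_∈_ to _∈ₗ_)
open import Function.Definitions using (Injective)
open import Relation.Binary.PropositionalEquality using (_≡_)

-- Logarithms used in the O(·) bounds.
-- lg x = ⌊log₂ x⌋ + 1  (so that lg x ≥ 1; avoids degenerate zero factors)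

lg : ℕ → ℕ
lg x = suc ⌊log₂ x ⌋

-- iterated logarithm log* n : number of applications of ⌊log₂⌋ until ≤ 1
-- (fuel n is always enough since ⌊log₂ n⌋ < n for n ≥ 2)
logStarAux : ℕ → ℕ → ℕ
logStarAux zero    _ = zero
logStarAux (suc f) m = if m ≤ᵇ 1 then zero else suc (logStarAux f ⌊log₂ m ⌋)

logStar : ℕ → ℕ
logStar n = logStarAux n n

record Instance : Set where
  field
    nU  : ℕ
    nV  : ℕ
    adj : Fin nU → Fin nV → Bool

module _ (I : Instance) where
  open Instance I

  Node : Set
  Node = Fin nU ⊎ Fin nV

  size : ℕ
  size = nU + nV

  isSet : Node → Bool
  isSet (inj₁ _) = false
  isSet (inj₂ _) = true

  nbrs : Node → List Node
  nbrs (inj₁ u) = map inj₂ (filterᵇ (λ v → adj u v) (allFin nV))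
  nbrs (inj₂ v) = map inj₁ (filterᵇ (λ u → adj u v) (allFin nU))

  deg : Node → ℕ
  deg x = length (nbrs x)

  IsCover : Subset nV → Set
  IsCover S = (u : Fin nU) → ∃[ v ] (v ∈ S × T (adj u v))

-- Deterministic synchronous message-passing algorithms.
-- Each node starts knowing its identifier, whether it is a set node,
-- the identifiers of its neighbours, and the global parameters n, s, t.
-- In each round every node sends to each neighbour (addressed by its id)
-- a message computed from its state, then updates its state from the
-- list of (sender id, message) pairs received.  After `rounds n s t`
-- rounds, each set node outputs whether it is in V_out.

record Algorithm (Msg : Set) : Set₁ where
  field
    State   : Set
    init    : (myId : ℕ) → (amSet : Bool) → (nbrIds : List ℕ) → (n s t : ℕ) → State
    send    : State → (receiverId : ℕ) → Msg
    receive : State → List (ℕ × Msg) → State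
    output  : State → Bool
    rounds  : (n s t : ℕ) → ℕ

-- A valid input: instance with degree bounds s (sets) and t (elements),
-- a feasible instance, and injective O(log n)-bit identifiers (< n^c).
record Input (c : ℕ) : Set where
  field
    inst   : Instance
    s      : ℕ
    t      : ℕ
    degU   : (u : Fin (Instance.nU inst)) → deg inst (inj₁ u) ≤ t
    degV   : (v : Fin (Instance.nV inst)) → deg inst (inj₂ v) ≤ s
    feasible : (u : Fin (Instance.nU inst)) → ∃[ v ] T (Instance.adj inst u v)
    ids    : Node inst → ℕ
    idsInj : Injective _≡_ _≡_ ids
    idsBnd : (x : Node inst) → ids x < size inst ^ c

module Run {Msg : Set} (A : Algorithm Msg) {c : ℕ} (In : Input c) where
  open Algorithm A
  open Input In
  open Instance inst

  n : ℕ
  n = size inst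

  run : ℕ → Node inst → State
  run zero    x = init (ids x) (isSet inst x) (map ids (nbrs inst x)) n s t
  run (suc k) x = receive (run k x) (map (λ y → ids y , send (run k y) (ids x)) (nbrs inst x))

  R : ℕ
  R = rounds n s t

  Vout : Subset nV
  Vout = tabulate (λ v → output (run R (inj₂ v)))

Correct : {Msg : Set} → Algorithm Msg → (c a : ℕ) → Set
Correct A c a = (In : Input c) → let open Run A In in
  IsCover (Input.inst In) Vout ×
  ((S : Subset (Instance.nV (Input.inst In))) → IsCover (Input.inst In) S →
     ∣ Vout ∣ ≤ a * lg (Input.s In) * ∣ S ∣)

-- CONGEST: every message sent during the execution has O(log n) bits,
-- i.e. is a number < (n+1)^b
Bandwidth : Algorithm ℕ → (c b : ℕ) → Set
Bandwidth A c b = (In : Input c) → let open Run A In in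
  (k : ℕ) → k < R → (x y : Node (Input.inst In)) → y ∈ₗ nbrs (Input.inst In) x →
  Algorithm.send A (run k y) (Input.ids In x) < suc n ^ b

{-# OPTIONS --safe #-}

-- One CONGEST algorithm, of round complexity O(log s · log² t + log* n), serves
-- both models.  If t ≤ log s, doubling dual variables until they make sets
-- tight gives a 2t-approximation in O(log s) rounds.  Otherwise a threshold λ
-- falls from s to 1 by powers of two, keeping the number of uncovered elements
-- O(λ·OPT).  For each λ a constant number of times:
--   * x is doubled on the sets containing at least λ unsaturated elements; this
--     costs λ·Σx ≤ O(number of uncovered elements) and leaves at most λ·OPT of
--     them unsaturated;
--   * x is rounded, level by level: sets on the smallest positive value double
--     it or drop to 0, whichever increases the multilinear potential
--     Σ_u (X_u − Σ_pairs x x′) − λ Σ x / 16.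
-- Sets deciding simultaneously lose only the pairs they form among themselves,
-- so on each level the sets are first split into O(log t) classes containing
-- an O(1/log t)-fraction of the pairs, in eight stages with ρ ≈ (log t)^(1/8)
-- labels each.  In a stage a proper colouring is shrunk by four code-based
-- colour reductions to poly(ρ) colours, and then the colours in turn
-- choose the label least used among the earlier ones.  Four reductions suffice
-- since the initial colouring has 2^(2^O(t)) colours: either the identifiers
-- do, or n is so large that log* n steps of a distance-two colouring fit
-- into messages of O(log n) bits.

module Submission where

open import Defs
open import Data.Nat
open import Data.Nat.Properties
open import Data.Nat.Tactic.RingSolver using (solve-∀)
open import Data.Bool using (Bool; true; false; T; if_then_else_; _∧_; _∨_; not)
open import Data.Fin using (Fin; toℕ) renaming (zero to fz; suc to fs)
open import Data.Fin.Subset using (Subset; ∣_∣; inside; outside)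
open import Data.Fin.Subset.Properties using (∣p∣≤n)
open import Data.Product using (_×_; _,_; proj₁; proj₂; Σ; ∃; ∃-syntax)
open import Data.Bool.Properties using (∨-zeroʳ; ∧-zeroʳ)
open import Data.Sum using (_⊎_; inj₁; inj₂)
open import Data.Unit using (⊤; tt)
open import Data.Empty using (⊥-elim)
open import Data.List using (List; []; _∷_; _++_; map; filterᵇ; allFin; tabulate; length; applyUpTo)
open import Data.Vec using (Vec; []; _∷_; lookup)
open import Data.Vec.Properties using (lookup∘tabulate; lookup⇒[]=; []=⇒lookup)
open import Function using (_∘_; id)
open import Relation.Nullary using (¬_; yes; no)
open import Relation.Binary.Definitions using (tri<; tri≈; tri>)
open import Relation.Binary.PropositionalEquality hiding ([_])
open import Algebra.Properties.Semiring.Sum +-*-semiring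
  using (*-distribˡ-sum; *-distribʳ-sum)
  renaming (sum to ∑; sum-cong-≗ to ∑-cong; ∑-distrib-+ to ∑-+; ∑-comm to ∑-swap)
open import Data.Nat.Logarithm
open import Data.Nat.Induction using (<-wellFounded; Acc) renaming (acc to wf-acc)
open import Data.Nat.DivMod
open import Data.Vec.Relation.Unary.All using (All; []; _∷_)
open import Data.List.Properties using (map-∘; map-cong; applyUpTo-∷ʳ; length-++; length-applyUpTo)

-- A level may cost only O(log t) rounds, but a split directly into ρ^8 labels would need poly(ρ^8)
-- colours acting in turn. With ρ labels per stage there are about ρ^5 colours and ρ+1 messages per
-- turn, and the reductions send O(ρ^2) blocks of bits, so a stage fits into ρ^8 rounds; eight
-- stages cost only a constant factor 2^8 in the pairs. Paying log* n on every level is too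
-- expensive. Hence one proper colouring is computed at the start and serves every stage. Its length
-- depends on the degree of the sets, and the separate case t ≤ log s is what leaves s < 2^t here.
-- An element cannot describe pairs of its sets in O(log n) bits. It therefore sends only sums and
-- blocks of single bits, and it fixes the sets that it counts by one bound on their identifiers.
-- Every choice that could be random (letters of a code, positions, labels) is a minimum, compared
-- with the average. Potentials are never subtracted: each inequality between them has its negative
-- terms moved to the other side.

⟦_⟧ : Bool → ℕ
⟦ true ⟧ = 1
⟦ false ⟧ = 0

⟦⟧≤1 : ∀ b → ⟦ b ⟧ ≤ 1
⟦⟧≤1 true = s≤s z≤n
⟦⟧≤1 false = z≤n

T⇒≡ : ∀ {b} → T b → b ≡ true
T⇒≡ {true} _ = refl

≡⇒T : ∀ {b} → b ≡ true → T b
≡⇒T refl = tt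

¬T⇒≡ : ∀ {b} → ¬ T b → b ≡ false
¬T⇒≡ {true} p = ⊥-elim (p tt)
¬T⇒≡ {false} _ = refl

≡ᵇ-true : ∀ {m n} → m ≡ n → (m ≡ᵇ n) ≡ true
≡ᵇ-true {m} {n} p = T⇒≡ (≡⇒≡ᵇ m n p)

≡ᵇ-false : ∀ {m n} → m ≢ n → (m ≡ᵇ n) ≡ false
≡ᵇ-false {m} {n} p = ¬T⇒≡ (p ∘ ≡ᵇ⇒≡ m n)

<ᵇ-true : ∀ {m n} → m < n → (m <ᵇ n) ≡ true
<ᵇ-true p = T⇒≡ (<⇒<ᵇ p)

<ᵇ-false : ∀ {m n} → n ≤ m → (m <ᵇ n) ≡ false
<ᵇ-false {m} {n} p = ¬T⇒≡ (λ q → <⇒≱ (<ᵇ⇒< m n q) p)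

≤ᵇ-true : ∀ {m n} → m ≤ n → (m ≤ᵇ n) ≡ true
≤ᵇ-true p = T⇒≡ (≤⇒≤ᵇ p)

≤ᵇ-false : ∀ {m n} → n < m → (m ≤ᵇ n) ≡ false
≤ᵇ-false {m} {n} p = ¬T⇒≡ (λ q → <⇒≱ p (≤ᵇ⇒≤ m n q))

≡ᵇ-cases : ∀ m n → (m ≡ n × (m ≡ᵇ n) ≡ true) ⊎ (m ≢ n × (m ≡ᵇ n) ≡ false)
≡ᵇ-cases m n with m ≟ n
... | yes p = inj₁ (p , ≡ᵇ-true p)
... | no p = inj₂ (p , ≡ᵇ-false p)

<ᵇ-cases : ∀ m n → (m < n × (m <ᵇ n) ≡ true) ⊎ (n ≤ m × (m <ᵇ n) ≡ false)
<ᵇ-cases m n with m <? n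
... | yes p = inj₁ (p , <ᵇ-true p)
... | no p = inj₂ (≮⇒≥ p , <ᵇ-false (≮⇒≥ p))

≤ᵇ-cases : ∀ m n → (m ≤ n × (m ≤ᵇ n) ≡ true) ⊎ (n < m × (m ≤ᵇ n) ≡ false)
≤ᵇ-cases m n with m ≤? n
... | yes p = inj₁ (p , ≤ᵇ-true p)
... | no p = inj₂ (≰⇒> p , ≤ᵇ-false (≰⇒> p))

zero∨pos : ∀ n → n ≡ 0 ⊎ 0 < n
zero∨pos zero = inj₁ refl
zero∨pos (suc n) = inj₂ (s≤s z≤n)

∨-true : ∀ a {b} → a ∨ b ≡ true → a ≡ true ⊎ b ≡ true
∨-true true _ = inj₁ refl
∨-true false p = inj₂ p

∨-false : ∀ a {b} → a ∨ b ≡ false → a ≡ false × b ≡ false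
∨-false false p = refl , p

bool? : ∀ b → b ≡ true ⊎ b ≡ false
bool? true = inj₁ refl
bool? false = inj₂ refl

true≢false : true ≢ false
true≢false ()

<ᵇ-suc : ∀ m k → ⟦ m <ᵇ suc k ⟧ ≡ ⟦ m <ᵇ k ⟧ + ⟦ m ≡ᵇ k ⟧
<ᵇ-suc zero zero = refl
<ᵇ-suc zero (suc k) = refl
<ᵇ-suc (suc m) zero = refl
<ᵇ-suc (suc m) (suc k) = <ᵇ-suc m k

-- Finite sums

∑-mono : ∀ {n} {f g : Fin n → ℕ} → (∀ i → f i ≤ g i) → ∑ f ≤ ∑ g
∑-mono {zero} h = z≤n
∑-mono {suc n} h = +-mono-≤ (h fz) (∑-mono (h ∘ fs))

∑-const : ∀ n c → ∑ {n} (λ _ → c) ≡ n * c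
∑-const zero c = refl
∑-const (suc n) c = cong (c +_) (∑-const n c)

∑-zero : ∀ {n} {f : Fin n → ℕ} → (∀ i → f i ≡ 0) → ∑ f ≡ 0
∑-zero {zero} h = refl
∑-zero {suc n} h = cong₂ _+_ (h fz) (∑-zero (h ∘ fs))

term≤∑ : ∀ {n} (f : Fin n → ℕ) i → f i ≤ ∑ f
term≤∑ f fz = m≤m+n _ _
term≤∑ f (fs i) = m≤n⇒m≤o+n (f fz) (term≤∑ (f ∘ fs) i)

∑-single : ∀ {n} {f : Fin n → ℕ} i → (∀ j → j ≢ i → f j ≡ 0) → ∑ f ≡ f i
∑-single {f = f} fz h = trans (cong (f fz +_) (∑-zero (λ j → h (fs j) (λ ())))) (+-identityʳ _)
∑-single {f = f} (fs i) h = trans (cong (_+ ∑ (f ∘ fs)) (h fz (λ ())))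
  (∑-single i (λ j p → h (fs j) (λ { refl → p refl })))

∑-atMostOne : ∀ {n} (f : Fin n → ℕ) M → (∀ i → f i ≤ M) → (∀ i j → f i ≢ 0 → f j ≢ 0 → i ≡ j) → ∑ f ≤ M
∑-atMostOne {zero} f M h o = z≤n
∑-atMostOne {suc n} f M h o with f fz ≟ 0
... | yes e = subst (λ z → z + ∑ (f ∘ fs) ≤ M) (sym e) (∑-atMostOne (f ∘ fs) M (h ∘ fs) (λ i j p q → fs-inj (o (fs i) (fs j) p q)))
  where
  fs-inj : ∀ {n} {i j : Fin n} → fs i ≡ fs j → i ≡ j
  fs-inj refl = refl
... | no ne = subst (λ z → f fz + z ≤ M) (sym (∑-zero rest)) (≤-trans (≤-reflexive (+-identityʳ _)) (h fz))
  where
  rest : ∀ i → f (fs i) ≡ 0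
  rest i with f (fs i) ≟ 0
  ... | yes e = e
  ... | no ne′ with o fz (fs i) ne ne′
  ... | ()

∑-*ˡ : ∀ {n} x (f : Fin n → ℕ) → x * ∑ f ≡ ∑ (λ i → x * f i)
∑-*ˡ x f = *-distribˡ-sum x f

∑-*ʳ : ∀ {n} x (f : Fin n → ℕ) → ∑ f * x ≡ ∑ (λ i → f i * x)
∑-*ʳ x f = *-distribʳ-sum x f

∑-≡0⇒ : ∀ {n} {f : Fin n → ℕ} → ∑ f ≡ 0 → ∀ i → f i ≡ 0
∑-≡0⇒ {f = f} h i = n≤0⇒n≡0 (subst (f i ≤_) h (term≤∑ f i))

∑-*mono : ∀ {n} c d {f g : Fin n → ℕ} → (∀ i → c * f i ≤ d * g i) → c * ∑ f ≤ d * ∑ g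
∑-*mono c d {f} {g} h = ≤-trans (≤-reflexive (∑-*ˡ c f)) (≤-trans (∑-mono h) (≤-reflexive (sym (∑-*ˡ d g))))

∑-pos : ∀ {n} (f : Fin n → ℕ) → 0 < ∑ f → ∃ λ i → 0 < f i
∑-pos {suc n} f p with zero∨pos (f fz)
... | inj₂ q = fz , q
... | inj₁ z = let i , q = ∑-pos (f ∘ fs) (subst (λ z → 0 < z + ∑ (f ∘ fs)) z p) in fs i , q

-- Positions, letters and labels travel in messages and are plain numbers, so they need sums that
-- are not indexed by `Fin`.
Σ< : ℕ → (ℕ → ℕ) → ℕ
Σ< zero f = 0
Σ< (suc n) f = f n + Σ< n f

Σ<-mono : ∀ n {f g : ℕ → ℕ} → (∀ i → i < n → f i ≤ g i) → Σ< n f ≤ Σ< n g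
Σ<-mono zero h = z≤n
Σ<-mono (suc n) h = +-mono-≤ (h n ≤-refl) (Σ<-mono n (λ i p → h i (m<n⇒m<1+n p)))

Σ<-cong : ∀ n {f g : ℕ → ℕ} → (∀ i → i < n → f i ≡ g i) → Σ< n f ≡ Σ< n g
Σ<-cong zero h = refl
Σ<-cong (suc n) h = cong₂ _+_ (h n ≤-refl) (Σ<-cong n (λ i p → h i (m<n⇒m<1+n p)))

Σ<-const : ∀ n c → Σ< n (λ _ → c) ≡ n * c
Σ<-const zero c = refl
Σ<-const (suc n) c = cong (c +_) (Σ<-const n c)

Σ<-zero : ∀ n → Σ< n (λ _ → 0) ≡ 0
Σ<-zero n = trans (Σ<-const n 0) (*-zeroʳ n)

Σ<-+ : ∀ n (f g : ℕ → ℕ) → Σ< n (λ i → f i + g i) ≡ Σ< n f + Σ< n g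
Σ<-+ zero f g = refl
Σ<-+ (suc n) f g rewrite Σ<-+ n f g = lem (f n) (g n) (Σ< n f) (Σ< n g)
  where
  lem : ∀ a b c d → a + b + (c + d) ≡ a + c + (b + d)
  lem = solve-∀

Σ<-*ˡ : ∀ n x (f : ℕ → ℕ) → x * Σ< n f ≡ Σ< n (λ i → x * f i)
Σ<-*ˡ zero x f = *-zeroʳ x
Σ<-*ˡ (suc n) x f = trans (*-distribˡ-+ x (f n) (Σ< n f)) (cong (x * f n +_) (Σ<-*ˡ n x f))

∑-Σ<-swap : ∀ {k} n (f : Fin k → ℕ → ℕ) → Σ< n (λ a → ∑ (λ i → f i a)) ≡ ∑ (λ i → Σ< n (f i))
∑-Σ<-swap {k} zero f = sym (∑-zero {k} (λ _ → refl))
∑-Σ<-swap (suc n) f = trans (cong (∑ (λ i → f i n) +_) (∑-Σ<-swap n f))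
  (sym (∑-+ (λ i → f i n) (λ i → Σ< n (f i))))

Σ<-≡ᵇ≤1 : ∀ n x → Σ< n (λ a → ⟦ x ≡ᵇ a ⟧) ≤ 1
Σ<-≡ᵇ≤1 n x = proj₁ (go n)
  where
  go : ∀ n → Σ< n (λ a → ⟦ x ≡ᵇ a ⟧) ≤ 1 × (n ≤ x → Σ< n (λ a → ⟦ x ≡ᵇ a ⟧) ≡ 0)
  go zero = z≤n , λ _ → refl
  go (suc n) with ≡ᵇ-cases x n
  ... | inj₁ (refl , e) rewrite e | proj₂ (go n) ≤-refl = ≤-refl , λ p → ⊥-elim (<-irrefl refl p)
  ... | inj₂ (p , e) rewrite e = proj₁ (go n) , λ q → proj₂ (go n) (<⇒≤ q)

-- Averaging

-- An argmin below the bound. The value at 0 is a dummy that makes the comparison at 1 read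
-- `f 0 ≤ᵇ f 0`.
best : (ℕ → ℕ) → ℕ → ℕ
best f zero = 0
best f (suc n) = if f n ≤ᵇ f (best f n) then n else best f n

best< : ∀ (f : ℕ → ℕ) n → 0 < n → best f n < n
best< f (suc n) _ with ≤ᵇ-cases (f n) (f (best f n))
... | inj₁ (p , e) rewrite e = ≤-refl
... | inj₂ (p , e) rewrite e = aux n p
  where
  aux : ∀ n → f (best f n) < f n → best f n < suc n
  aux zero p = ≤-refl
  aux (suc n) p = m<n⇒m<1+n (best< f (suc n) (s≤s z≤n))

best-min : ∀ (f : ℕ → ℕ) n i → i < n → f (best f n) ≤ f i
best-min f (suc n) i i<n with ≤ᵇ-cases (f n) (f (best f n)) | m≤n⇒m<n∨m≡n (s≤s⁻¹ i<n)
... | inj₁ (p , e) | inj₁ q rewrite e = ≤-trans p (best-min f n i q)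
... | inj₁ (p , e) | inj₂ refl rewrite e = ≤-refl
... | inj₂ (p , e) | inj₁ q rewrite e = best-min f n i q
... | inj₂ (p , e) | inj₂ refl rewrite e = <⇒≤ p

best-avg : ∀ (f : ℕ → ℕ) n → n * f (best f n) ≤ Σ< n f
best-avg f n = ≤-trans (≤-reflexive (sym (Σ<-const n (f (best f n))))) (Σ<-mono n (best-min f n))

-- A node computes a cost from the replies it has stored, which agrees with the mathematical cost
-- only below `n`.
best-cong : ∀ {f g} n → (∀ i → i < n → f i ≡ g i) → best f n ≡ best g n
best-cong zero h = refl
best-cong {f} {g} (suc n) h = aux n h (best-cong n (λ i p → h i (m<n⇒m<1+n p)))
  where
  aux : ∀ n → (∀ i → i < suc n → f i ≡ g i) → best f n ≡ best g n → best f (suc n) ≡ best g (suc n)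
  aux zero h e rewrite h 0 (s≤s z≤n) = refl
  aux (suc n) h e rewrite sym e | h (suc n) ≤-refl
    | h (best f (suc n)) (m<n⇒m<1+n (best< f (suc n) (s≤s z≤n))) = refl

-- A greedy Gilbert–Varshamov code

agree : ℕ → (ℕ → ℕ) → (ℕ → ℕ) → ℕ
agree L v w = Σ< L (λ l → ⟦ v l ≡ᵇ w l ⟧)

≡ᵇ-sym : ∀ m n → (m ≡ᵇ n) ≡ (n ≡ᵇ m)
≡ᵇ-sym zero zero = refl
≡ᵇ-sym zero (suc n) = refl
≡ᵇ-sym (suc m) zero = refl
≡ᵇ-sym (suc m) (suc n) = ≡ᵇ-sym m n

agree-sym : ∀ L v w → agree L v w ≡ agree L w v
agree-sym L v w = Σ<-cong L (λ l _ → cong ⟦_⟧ (≡ᵇ-sym (v l) (w l)))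

-- A further codeword is chosen letter by letter, so that the potential
-- Σ_c 2^(agreement with codeword c) grows by at most 1 + 1/q per letter.
module Greedy (E : ℕ → ℕ → ℕ) (N q : ℕ) where

  wt : ℕ → ℕ → ℕ
  hits : ℕ → ℕ → ℕ
  letter : ℕ → ℕ

  wt zero c = 1
  wt (suc l) c = ⟦ E c l ≡ᵇ letter l ⟧ * wt l c + wt l c
  hits l a = Σ< N (λ c → ⟦ E c l ≡ᵇ a ⟧ * wt l c)
  letter l = best (hits l) q

  wt≡2^agree : ∀ l c → wt l c ≡ 2 ^ agree l (E c) letter
  wt≡2^agree zero c = refl
  wt≡2^agree (suc l) c rewrite wt≡2^agree l c with E c l ≡ᵇ letter l
  ... | true = lem (2 ^ agree l (E c) letter)
    where
    lem : ∀ x → 1 * x + x ≡ x + (x + 0)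
    lem = solve-∀
  ... | false = refl

  pot : ℕ → ℕ
  pot l = Σ< N (wt l)

  pot-step : ∀ l → q * pot (suc l) ≤ suc q * pot l
  pot-step l = begin
    q * pot (suc l)                                    ≡⟨ cong (q *_) (Σ<-+ N _ (wt l)) ⟩
    q * (hits l (letter l) + pot l)                    ≡⟨ *-distribˡ-+ q (hits l (letter l)) (pot l) ⟩
    q * hits l (letter l) + q * pot l                  ≤⟨ +-monoˡ-≤ _ (best-avg (hits l) q) ⟩
    Σ< q (hits l) + q * pot l                          ≤⟨ +-monoˡ-≤ _ (sw N) ⟩
    suc q * pot l                                      ∎
    where
    open ≤-Reasoning
    -- A codeword has one letter at place `l`, so its weight enters at most one of the `q` sums.
    sw : ∀ N → Σ< q (λ a → Σ< N (λ c → ⟦ E c l ≡ᵇ a ⟧ * wt l c)) ≤ Σ< N (wt l)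
    sw zero = ≤-reflexive (Σ<-zero q)
    sw (suc N) = begin
      Σ< q (λ a → ⟦ E N l ≡ᵇ a ⟧ * wt l N + Σ< N (λ c → ⟦ E c l ≡ᵇ a ⟧ * wt l c))
        ≡⟨ Σ<-+ q _ _ ⟩
      Σ< q (λ a → ⟦ E N l ≡ᵇ a ⟧ * wt l N) + Σ< q (λ a → Σ< N (λ c → ⟦ E c l ≡ᵇ a ⟧ * wt l c))
        ≤⟨ +-mono-≤ one (sw N) ⟩
      wt l N + Σ< N (wt l) ∎
      where
      one : Σ< q (λ a → ⟦ E N l ≡ᵇ a ⟧ * wt l N) ≤ wt l N
      one = begin
        Σ< q (λ a → ⟦ E N l ≡ᵇ a ⟧ * wt l N) ≡⟨ Σ<-cong q (λ a _ → *-comm ⟦ E N l ≡ᵇ a ⟧ (wt l N)) ⟩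
        Σ< q (λ a → wt l N * ⟦ E N l ≡ᵇ a ⟧) ≡⟨ Σ<-*ˡ q (wt l N) _ ⟨
        wt l N * Σ< q (λ a → ⟦ E N l ≡ᵇ a ⟧) ≤⟨ *-monoʳ-≤ (wt l N) (Σ<-≡ᵇ≤1 q (E N l)) ⟩
        wt l N * 1                            ≡⟨ *-identityʳ _ ⟩
        wt l N                                ∎

  pot-bound : ∀ l → q ^ l * pot l ≤ suc q ^ l * N
  pot-bound zero = ≤-reflexive (cong (1 *_) (trans (Σ<-const N 1) (*-identityʳ N)))
  pot-bound (suc l) = begin
    q * q ^ l * pot (suc l)     ≡⟨ lem q (q ^ l) (pot (suc l)) ⟩
    q ^ l * (q * pot (suc l))   ≤⟨ *-monoʳ-≤ (q ^ l) (pot-step l) ⟩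
    q ^ l * (suc q * pot l)     ≡⟨ lem (suc q) (q ^ l) (pot l) ⟨
    suc q * q ^ l * pot l       ≡⟨ *-assoc (suc q) (q ^ l) (pot l) ⟩
    suc q * (q ^ l * pot l)     ≤⟨ *-monoʳ-≤ (suc q) (pot-bound l) ⟩
    suc q * (suc q ^ l * N)     ≡⟨ *-assoc (suc q) (suc q ^ l) N ⟨
    suc q * suc q ^ l * N       ∎
    where
    open ≤-Reasoning
    lem : ∀ a b c → a * b * c ≡ b * (a * c)
    lem = solve-∀

Σ<-term : ∀ n (f : ℕ → ℕ) i → i < n → f i ≤ Σ< n f
Σ<-term (suc n) f i p with m≤n⇒m<n∨m≡n (s≤s⁻¹ p)
... | inj₁ q = m≤n⇒m≤o+n (f n) (Σ<-term n f i q)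
... | inj₂ refl = m≤m+n (f n) _

-- Bernoulli's inequality 1 - k/(q+1) ≤ (1 - 1/(q+1))^k, multiplied by (q+1)^(k+1).
bernoulli : ∀ q k → suc q ^ k * suc q ≤ suc q * q ^ k + k * suc q ^ k
bernoulli q zero = ≤-reflexive (e q)
  where
  e : ∀ q → 1 * suc q ≡ suc q * 1 + 0 * 1
  e = solve-∀
bernoulli q (suc k) = begin
  suc q * suc q ^ k * suc q                          ≡⟨ *-assoc (suc q) (suc q ^ k) (suc q) ⟩
  suc q * (suc q ^ k * suc q)                        ≤⟨ *-monoʳ-≤ (suc q) (bernoulli q k) ⟩
  suc q * (suc q * q ^ k + k * suc q ^ k)            ≡⟨ e q (q ^ k) k (suc q ^ k) ⟩
  suc q * (q * q ^ k) + (suc q * q ^ k + k * (suc q * suc q ^ k))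
    ≤⟨ +-monoʳ-≤ (suc q * (q * q ^ k)) (+-monoˡ-≤ _ (*-monoʳ-≤ (suc q) (^-monoˡ-≤ k (n≤1+n q)))) ⟩
  suc q * (q * q ^ k) + (suc q * suc q ^ k + k * (suc q * suc q ^ k)) ∎
  where
  open ≤-Reasoning
  e : ∀ q a k b → suc q * (suc q * a + k * b) ≡ suc q * (q * a) + (suc q * a + k * (suc q * b))
  e = solve-∀

-- The case k = (q+1)/2 of Bernoulli's inequality, where the left side is 1/2.
[1+1/q]^h≤2 : ∀ q h → suc q ≡ 2 * h → suc q ^ h ≤ 2 * q ^ h
[1+1/q]^h≤2 q (suc h) e = *-cancelˡ-≤ (suc h) (+-cancelʳ-≤ (suc h * suc q ^ suc h) _ _ (begin
  suc h * suc q ^ suc h + suc h * suc q ^ suc h      ≡⟨ e1 (suc h) (suc q ^ suc h) ⟩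
  suc q ^ suc h * (2 * suc h)                        ≡⟨ cong (suc q ^ suc h *_) (sym e) ⟩
  suc q ^ suc h * suc q                              ≤⟨ bernoulli q (suc h) ⟩
  suc q * q ^ suc h + suc h * suc q ^ suc h          ≡⟨ cong (λ z → z * q ^ suc h + suc h * suc q ^ suc h) e ⟩
  2 * suc h * q ^ suc h + suc h * suc q ^ suc h      ≡⟨ cong (_+ suc h * suc q ^ suc h) (e2 (suc h) (q ^ suc h)) ⟩
  suc h * (2 * q ^ suc h) + suc h * suc q ^ suc h    ∎))
  where
  open ≤-Reasoning
  e1 : ∀ h x → h * x + h * x ≡ x * (2 * h)
  e1 = solve-∀
  e2 : ∀ h x → 2 * h * x ≡ h * (2 * x)
  e2 = solve-∀

^-monoˡ-≤-* : ∀ k a b → (a * b) ^ k ≡ a ^ k * b ^ k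
^-monoˡ-≤-* zero a b = refl
^-monoˡ-≤-* (suc k) a b = trans (cong (a * b *_) (^-monoˡ-≤-* k a b)) (lem a b (a ^ k) (b ^ k))
  where
  lem : ∀ a b c d → a * b * (c * d) ≡ a * c * (b * d)
  lem = solve-∀

2^-cancel-≤ : ∀ a b → 2 ^ a ≤ 2 ^ b → a ≤ b
2^-cancel-≤ a b p with a ≤? b
... | yes q = q
... | no q = ⊥-elim (<⇒≱ (^-monoʳ-< 2 (s≤s (s≤s z≤n)) (≰⇒> q)) p)

-- With q + 1 = 4D, each 2D letters at most double the potential. Over this length it grows from N ≤
-- 2^b to at most 2^(2b), so a new codeword agrees with every older one in at most 2b places, a 1/D
-- fraction.
codeLength : ℕ → ℕ → ℕ
codeLength D b = 2 * D * b

IsCode : ℕ → ℕ → ℕ → (ℕ → ℕ → ℕ) → Set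
IsCode D b N E =
  (∀ c l → E c l < 4 * D) ×
  (∀ c c′ → c < N → c′ < N → c ≢ c′ → D * agree (codeLength D b) (E c) (E c′) ≤ codeLength D b)

module Extend (D′ b N : ℕ) (N<2^b : N < 2 ^ b) where
  D q : ℕ
  D = suc D′
  q = pred (4 * D)

  q+1 : suc q ≡ 2 * (2 * D)
  q+1 = e D′
    where
    e : ∀ x → 4 * suc x ≡ 2 * (2 * suc x)
    e = solve-∀

  0<q : 0 < q
  0<q = s≤s⁻¹ (≤-trans (≤-trans (s≤s (s≤s z≤n)) (m≤m+n 4 (4 * D′))) (≤-reflexive (e D′)))
    where
    e : ∀ x → 4 + 4 * x ≡ 4 * suc x
    e = solve-∀

  extend : (E : ℕ → ℕ → ℕ) → IsCode D b N E → ∃ λ E′ → IsCode D b (suc N) E′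
  extend E (E< , E≤) = E′ , E′< , E′≤
    where
    open Greedy E N q
    L : ℕ
    L = codeLength D b
    E′ : ℕ → ℕ → ℕ
    E′ c l = if c ≡ᵇ N then letter l else E c l
    E′-old : ∀ {c} → c < N → ∀ l → E′ c l ≡ E c l
    E′-old {c} p l rewrite ≡ᵇ-false {c} {N} (<⇒≢ p) = refl
    E′-new : ∀ l → E′ N l ≡ letter l
    E′-new l rewrite ≡ᵇ-true {N} refl = refl
    E′< : ∀ c l → E′ c l < 4 * D
    E′< c l with c ≡ᵇ N
    ... | true = <-≤-trans (best< (hits l) q 0<q) (n≤1+n q)
    ... | false = E< c l
    cancel : ∀ a → 2 ^ a * q ^ L ≤ 2 ^ (b + b) * q ^ L → a ≤ b + b
    cancel a p = 2^-cancel-≤ a (b + b) (*-cancelʳ-≤ _ _ (q ^ L) {{m^n≢0 q L {{>-nonZero 0<q}}}} p)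
    short : ∀ c → c < N → agree L (E c) letter ≤ b + b
    short c p = cancel _ (begin
      2 ^ agree L (E c) letter * q ^ L  ≡⟨ cong (_* q ^ L) (wt≡2^agree L c) ⟨
      wt L c * q ^ L                    ≤⟨ *-monoˡ-≤ (q ^ L) (Σ<-term N (wt L) c p) ⟩
      pot L * q ^ L                     ≡⟨ *-comm (pot L) (q ^ L) ⟩
      q ^ L * pot L                     ≤⟨ pot-bound L ⟩
      suc q ^ L * N                     ≤⟨ *-monoʳ-≤ (suc q ^ L) (<⇒≤ N<2^b) ⟩
      suc q ^ L * 2 ^ b                 ≡⟨ cong (_* 2 ^ b) (^-*-assoc (suc q) (2 * D) b) ⟨
      (suc q ^ (2 * D)) ^ b * 2 ^ b     ≤⟨ *-monoˡ-≤ (2 ^ b) (^-monoˡ-≤ b ([1+1/q]^h≤2 q (2 * D) q+1)) ⟩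
      (2 * q ^ (2 * D)) ^ b * 2 ^ b     ≡⟨ cong (_* 2 ^ b) (^-monoˡ-≤-* b 2 (q ^ (2 * D))) ⟩
      2 ^ b * (q ^ (2 * D)) ^ b * 2 ^ b ≡⟨ cong (λ z → 2 ^ b * z * 2 ^ b) (^-*-assoc q (2 * D) b) ⟩
      2 ^ b * q ^ L * 2 ^ b             ≡⟨ lem (2 ^ b) (q ^ L) ⟩
      2 ^ b * 2 ^ b * q ^ L             ≡⟨ cong (_* q ^ L) (^-distribˡ-+-* 2 b b) ⟨
      2 ^ (b + b) * q ^ L               ∎)
      where
      open ≤-Reasoning
      lem : ∀ x y → x * y * x ≡ x * x * y
      lem = solve-∀
    new : ∀ c → c < N → D * agree L (E′ c) (E′ N) ≤ L
    new c p = begin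
      D * agree L (E′ c) (E′ N)
        ≡⟨ cong (D *_) (Σ<-cong L (λ l _ → cong₂ (λ x y → ⟦ x ≡ᵇ y ⟧) (E′-old p l) (E′-new l))) ⟩
      D * agree L (E c) letter  ≤⟨ *-monoʳ-≤ D (short c p) ⟩
      D * (b + b)               ≡⟨ lem D b ⟩
      2 * D * b                 ∎
      where
      open ≤-Reasoning
      lem : ∀ d b → d * (b + b) ≡ 2 * d * b
      lem = solve-∀
    E′≤ : ∀ c c′ → c < suc N → c′ < suc N → c ≢ c′ → D * agree L (E′ c) (E′ c′) ≤ L
    E′≤ c c′ p p′ c≢ with m≤n⇒m<n∨m≡n (s≤s⁻¹ p) | m≤n⇒m<n∨m≡n (s≤s⁻¹ p′)
    ... | inj₁ r | inj₁ r′ = ≤-trans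
      (≤-reflexive (cong (D *_) (Σ<-cong L (λ l _ → cong₂ (λ x y → ⟦ x ≡ᵇ y ⟧) (E′-old r l) (E′-old r′ l)))))
      (E≤ c c′ r r′ c≢)
    ... | inj₁ r | inj₂ refl = new c r
    ... | inj₂ refl | inj₁ r′ = ≤-trans (≤-reflexive (cong (D *_) (agree-sym L (E′ c) (E′ c′)))) (new c′ r′)
    ... | inj₂ refl | inj₂ refl = ⊥-elim (c≢ refl)

code-exists : ∀ D b N → 0 < D → N ≤ 2 ^ b → ∃ (IsCode D b N)
code-exists D b zero p _ = (λ _ _ → 0) , (λ _ _ → <-≤-trans p (m≤m+n D _)) , λ _ _ ()
code-exists (suc D) b (suc N) p q =
  let E , E-code = code-exists (suc D) b N p (<⇒≤ q) in Extend.extend D b N q E E-code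

abstract
  -- The construction is deterministic in `d` and `b`, so all nodes know the same code without
  -- communication.
  encode : (d b : ℕ) → ℕ → ℕ → ℕ
  encode d b = proj₁ (code-exists (2 ^ d) b (2 ^ b) (m^n>0 2 d) ≤-refl)

  encode-isCode : ∀ d b → IsCode (2 ^ d) b (2 ^ b) (encode d b)
  encode-isCode d b = proj₂ (code-exists (2 ^ d) b (2 ^ b) (m^n>0 2 d) ≤-refl)

-- Binary logarithms

1≤lg : ∀ x → 1 ≤ lg x
1≤lg x = s≤s z≤n

2^⌊log₂⌋≤ : ∀ x → 0 < x → 2 ^ ⌊log₂ x ⌋ ≤ x
2^⌊log₂⌋≤ x = go x (<-wellFounded x)
  where
  go : ∀ x → Acc _<_ x → 0 < x → 2 ^ ⌊log₂ x ⌋ ≤ x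
  go (suc zero) _ _ = ≤-refl
  go (suc (suc x)) (wf-acc rs) _ = ≤-trans (≤-reflexive (cong (2 ^_) e))
    (≤-trans (*-monoʳ-≤ 2 (go ⌊ suc (suc x) /2⌋ (rs (⌊n/2⌋<n (suc x))) (s≤s z≤n))) h)
    where
    y = suc (suc x)
    1≤log : 1 ≤ ⌊log₂ y ⌋
    1≤log = ⌊log₂⌋-mono-≤ {2} {y} (s≤s (s≤s z≤n))
    e : ⌊log₂ y ⌋ ≡ suc ⌊log₂ ⌊ y /2⌋ ⌋
    e = trans (sym (m+[n∸m]≡n 1≤log)) (cong suc (sym (⌊log₂⌊n/2⌋⌋≡⌊log₂n⌋∸1 y)))
    h : 2 * ⌊ y /2⌋ ≤ y
    h = begin
      ⌊ y /2⌋ + (⌊ y /2⌋ + 0)   ≡⟨ cong (⌊ y /2⌋ +_) (+-identityʳ _) ⟩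
      ⌊ y /2⌋ + ⌊ y /2⌋         ≤⟨ +-monoʳ-≤ ⌊ y /2⌋ (⌊n/2⌋≤⌈n/2⌉ y) ⟩
      ⌊ y /2⌋ + ⌈ y /2⌉         ≡⟨ ⌊n/2⌋+⌈n/2⌉≡n y ⟩
      y                         ∎
      where open ≤-Reasoning

<2^lg : ∀ x → x < 2 ^ lg x
<2^lg x with x <? 2 ^ lg x
... | yes p = p
... | no p = ⊥-elim (<-irrefl refl (≤-trans (≤-reflexive (sym (⌊log₂[2^n]⌋≡n (lg x)))) (⌊log₂⌋-mono-≤ (≮⇒≥ p))))

2^lg≤2* : ∀ x → 0 < x → 2 ^ lg x ≤ 2 * x
2^lg≤2* x p = *-monoʳ-≤ 2 (2^⌊log₂⌋≤ x p)

lg-mono : ∀ {x y} → x ≤ y → lg x ≤ lg y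
lg-mono p = s≤s (⌊log₂⌋-mono-≤ p)

lg[2^] : ∀ k → lg (2 ^ k) ≡ suc k
lg[2^] k = cong suc (⌊log₂[2^n]⌋≡n k)

-- `lg` is the bit length except that `lg 0` is 1; hence the hypothesis `0 < k`.
lg-<2^ : ∀ x k → 0 < k → x < 2 ^ k → lg x ≤ k
lg-<2^ zero k p _ = p
lg-<2^ (suc x) k _ q = ≰⇒> (λ k≤ → <⇒≱ q
  (≤-trans (^-monoʳ-≤ 2 k≤) (2^⌊log₂⌋≤ (suc x) (s≤s z≤n))))

lg-* : ∀ x y → lg (x * y) ≤ lg x + lg y
lg-* x y = lg-<2^ (x * y) (lg x + lg y) (≤-trans (1≤lg x) (m≤m+n _ _))
  (<-≤-trans (*-mono-< (<2^lg x) (<2^lg y)) (≤-reflexive (sym (^-distribˡ-+-* 2 (lg x) (lg y)))))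

n<2^n : ∀ n → n < 2 ^ n
n<2^n zero = s≤s z≤n
n<2^n (suc n) = begin-strict
  suc n               ≤⟨ n<2^n n ⟩
  2 ^ n               <⟨ m<m+n (2 ^ n) (≤-trans (m^n>0 2 n) (m≤m+n _ 0)) ⟩
  2 * 2 ^ n           ∎
  where open ≤-Reasoning

lg≤id : ∀ x → 0 < x → lg x ≤ x
lg≤id x p = lg-<2^ x x p (n<2^n x)

-- Programs for bipartite networks

-- Four fields suffice: the longest message publishes value, class, colour and label of a set.
Msg : Set
Msg = Vec ℕ 4

Fits : ℕ → ∀ {k} → Vec ℕ k → Set
Fits B = All (_< B)

-- Reducing each field modulo `suc B′` makes the size bound hold in every state, so the bandwidth
-- claim needs no invariant. Correctness pays for this: `unpack-pack` asks that the fields fit.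
pack : ∀ {k} → ℕ → Vec ℕ k → ℕ
pack B′ [] = 0
pack B′ (x ∷ xs) = x % suc B′ + suc B′ * pack B′ xs

unpack : ∀ k → ℕ → ℕ → Vec ℕ k
unpack zero B′ z = []
unpack (suc k) B′ z = z % suc B′ ∷ unpack k B′ (z / suc B′)

pack< : ∀ {k} B′ (xs : Vec ℕ k) → pack B′ xs < suc B′ ^ k
pack< B′ [] = s≤s z≤n
pack< {suc k} B′ (x ∷ xs) = begin-strict
  x % suc B′ + suc B′ * pack B′ xs  <⟨ +-monoˡ-< _ (m%n<n x (suc B′)) ⟩
  suc B′ + suc B′ * pack B′ xs      ≡⟨ *-suc (suc B′) (pack B′ xs) ⟨
  suc B′ * suc (pack B′ xs)         ≤⟨ *-monoʳ-≤ (suc B′) (pack< B′ xs) ⟩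
  suc B′ * suc B′ ^ k               ∎
  where open ≤-Reasoning

unpack-pack : ∀ {k} B′ (xs : Vec ℕ k) → Fits (suc B′) xs → unpack k B′ (pack B′ xs) ≡ xs
unpack-pack B′ [] [] = refl
unpack-pack {suc k} B′ (x ∷ xs) (p ∷ ps) = cong₂ _∷_ e₁ (trans (cong (unpack k B′) e₂) (unpack-pack B′ xs ps))
  where
  B = suc B′
  z = pack B′ xs
  x%B : x % B ≡ x
  x%B = m<n⇒m%n≡m p
  e₁ : (x % B + B * z) % B ≡ x
  e₁ = trans (cong (λ y → (x % B + y) % B) (*-comm B z))
       (trans ([m+kn]%n≡m%n (x % B) z B) (trans (m%n%n≡m%n x B) x%B))
  e₂ : (x % B + B * z) / B ≡ z
  e₂ = begin
    (x % B + B * z) / B      ≡⟨ cong₂ (λ a b → (a + b) / B) x%B (*-comm B z) ⟩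
    (x + z * B) / B          ≡⟨ +-distrib-/ x (z * B) (subst (_< B) (sym e₃) (subst (_< B) (sym x%B) p)) ⟩
    x / B + z * B / B        ≡⟨ cong₂ _+_ (m<n⇒m/n≡0 p) (m*n/n≡m z B) ⟩
    z                        ∎
    where
    open ≡-Reasoning
    e₃ : x % B + z * B % B ≡ x % B
    e₃ = trans (cong (x % B +_) (m*n%n≡0 z B)) (+-identityʳ _)

View : Set
View = List (ℕ × Msg)

module Machine (US VS : Set) where

  -- suc extra times (numbered by the last argument of rep), every set node sends
  -- pub and every element node answers by rep, given the identifier of the set;
  -- then both update their memory.
  record Op : Set where
    field
      extra : ℕ
      pub   : VS → Msg
      rep   : US → View → ℕ → ℕ → Msg
      upd   : US → View → US
      fin   : VS → List (List Msg) → VS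
  open Op

  Step : Set
  Step = Op × ℕ

  Mem : Set
  Mem = (US × View) ⊎ (VS × List (List Msg))

  -- `replying` marks the second round of a step, in which the elements answer; `base` is the radix
  -- of `pack` minus one.
  record St : Set where
    constructor mk
    field
      todo     : List Step
      replying : Bool
      mem      : Mem
      base     : ℕ

  stepsOf : Op → List Step
  stepsOf o = applyUpTo (o ,_) (suc (extra o))

  stepsAll : List Op → List Step
  stepsAll [] = []
  stepsAll (o ∷ os) = stepsOf o ++ stepsAll os

  sendSt : St → ℕ → ℕ
  sendSt (mk ((o , β) ∷ _) false (inj₂ (s , _)) B) r = pack B (pub o s)
  sendSt (mk ((o , β) ∷ _) true (inj₁ (s , w)) B) r = pack B (rep o s w r β)
  sendSt _ r = 0

  unpackAll : ℕ → List (ℕ × ℕ) → View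
  unpackAll B = map (λ { (i , z) → i , unpack 4 B z })

  finU : Op → ℕ → US → View → Mem
  finU o β s w = if β ≡ᵇ extra o then inj₁ (upd o s w , w) else inj₁ (s , w)

  finV : Op → ℕ → VS → List (List Msg) → Mem
  finV o β s a = if β ≡ᵇ extra o then inj₂ (fin o s a , []) else inj₂ (s , a)

  receiveSt : St → List (ℕ × ℕ) → St
  receiveSt (mk [] b m B) l = mk [] b m B
  receiveSt (mk ss@(_ ∷ _) false (inj₁ (s , w)) B) l = mk ss true (inj₁ (s , unpackAll B l)) B
  receiveSt (mk ss@(_ ∷ _) false (inj₂ m) B) l = mk ss true (inj₂ m) B
  receiveSt (mk ((o , β) ∷ ss) true (inj₁ (s , w)) B) l = mk ss false (finU o β s w) B
  receiveSt (mk ((o , β) ∷ ss) true (inj₂ (s , a)) B) l =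
    mk ss false (finV o β s (a ++ map proj₂ (unpackAll B l) ∷ [])) B

  outputSt : (VS → Bool) → St → Bool
  outputSt out (mk _ _ (inj₁ _) _) = false
  outputSt out (mk _ _ (inj₂ (s , _)) _) = out s

  algorithm : US → (ℕ → VS) → (ℕ → ℕ → ℕ → List Op) → ℕ → (VS → Bool) → Algorithm ℕ
  algorithm initU initV prog b out = record
    { State = St
    ; init = λ i isV _ n s t → mk (stepsAll (prog n s t)) false
        (if isV then inj₂ (initV i , []) else inj₁ (initU , [])) (pred (suc n ^ b))
    ; send = sendSt
    ; receive = receiveSt
    ; output = outputSt out
    ; rounds = λ n s t → 2 * length (stepsAll (prog n s t))
    }

  blocks : List Op → ℕ
  blocks [] = 0
  blocks (o ∷ os) = suc (extra o) + blocks os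

  blocks-++ : ∀ os os′ → blocks (os ++ os′) ≡ blocks os + blocks os′
  blocks-++ [] os′ = refl
  blocks-++ (o ∷ os) os′ = trans (cong (suc (extra o) +_) (blocks-++ os os′))
    (sym (+-assoc (suc (extra o)) (blocks os) (blocks os′)))

  length-stepsAll : ∀ os → length (stepsAll os) ≡ blocks os
  length-stepsAll [] = refl
  length-stepsAll (o ∷ os) = trans (length-++ (stepsOf o))
    (cong₂ _+_ (length-applyUpTo (o ,_) (suc (extra o))) (length-stepsAll os))

  sendSt< : ∀ B s r → St.base s ≡ B → sendSt s r < suc B ^ 4
  sendSt< B (mk [] _ _ _) r e = m^n>0 (suc B) 4
  sendSt< B (mk ((o , β) ∷ _) false (inj₁ _) _) r e = m^n>0 (suc B) 4
  sendSt< B (mk ((o , β) ∷ _) false (inj₂ (s , _)) _) r refl = pack< B (pub o s)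
  sendSt< B (mk ((o , β) ∷ _) true (inj₁ (s , w)) _) r refl = pack< B (rep o s w r β)
  sendSt< B (mk ((o , β) ∷ _) true (inj₂ _) _) r e = m^n>0 (suc B) 4

  receive-base : ∀ s l → St.base (receiveSt s l) ≡ St.base s
  receive-base (mk [] _ _ _) l = refl
  receive-base (mk (_ ∷ _) false (inj₁ _) _) l = refl
  receive-base (mk (_ ∷ _) false (inj₂ _) _) l = refl
  receive-base (mk (_ ∷ _) true (inj₁ _) _) l = refl
  receive-base (mk (_ ∷ _) true (inj₂ _) _) l = refl

  bandwidth : ∀ iU iV prog b out c → Bandwidth (algorithm iU iV prog b out) c (b * 4)
  bandwidth iU iV prog b out c In k _ x y _ = subst (sendSt (run k y) (Input.ids In x) <_) e
    (sendSt< (pred (suc n ^ b)) (run k y) (Input.ids In x) (base k y))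
    where
    open Run (algorithm iU iV prog b out) In
    base : ∀ k y → St.base (run k y) ≡ pred (suc n ^ b)
    base zero y = refl
    base (suc k) y = trans (receive-base (run k y) _) (base k y)
    e : suc (pred (suc n ^ b)) ^ 4 ≡ suc n ^ (b * 4)
    e = trans (cong (_^ 4) (suc-pred (suc n ^ b) {{m^n≢0 (suc n) b}})) (^-*-assoc (suc n) b 4)

  module Exec (nU nV : ℕ) (adj : Fin nU → Fin nV → Bool) (idV : Fin nV → ℕ) (B : ℕ) where

    Global : Set
    Global = (Fin nU → US) × (Fin nV → VS)

    setsOf : Fin nU → List (Fin nV)
    setsOf u = filterᵇ (adj u) (allFin nV)

    elemsOf : Fin nV → List (Fin nU)
    elemsOf v = filterᵇ (λ u → adj u v) (allFin nU)

    view : Op → Global → Fin nU → View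
    view o g u = map (λ v → idV v , pub o (proj₂ g v)) (setsOf u)

    replies : Op → Global → Fin nV → ℕ → List Msg
    replies o g v β = map (λ u → rep o (proj₁ g u) (view o g u) (idV v) β) (elemsOf v)

    -- The meaning of an operation as one step of the whole network. All algorithms are verified
    -- against it; `runs` shows that the rounds realise it.
    exec : Op → Global → Global
    exec o g = (λ u → upd o (proj₁ g u) (view o g u)) ,
               (λ v → fin o (proj₂ g v) (applyUpTo (replies o g v) (suc (extra o))))

    execs : List Op → Global → Global
    execs [] g = g
    execs (o ∷ os) g = execs os (exec o g)

    Legal : Op → Global → Set
    Legal o g = (∀ v → Fits B (pub o (proj₂ g v))) ×
      (∀ u v β → Fits B (rep o (proj₁ g u) (view o g u) (idV v) β))

    AllLegal : List Op → Global → Set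
    AllLegal [] g = ⊤
    AllLegal (o ∷ os) g = Legal o g × AllLegal os (exec o g)

    -- A Hoare triple that also asserts that no number sent on the way overflows its field.
    Triple : (Global → Set) → List Op → (Global → Set) → Set
    Triple P os Q = ∀ g → P g → AllLegal os g × Q (execs os g)

    seq : ∀ {P Q R} os os′ → Triple P os Q → Triple Q os′ R → Triple P (os ++ os′) R
    seq {Q = Q} {R = R} os os′ t t′ g p = go os g (proj₁ (t g p)) (proj₂ (t g p))
      where
      go : ∀ os g → AllLegal os g → Q (execs os g) → AllLegal (os ++ os′) g × R (execs (os ++ os′) g)
      go [] g _ q = t′ g q
      go (o ∷ os) g (l , ls) q = let a , b = go os (exec o g) ls q in (l , a) , b

    skip : ∀ {P Q : Global → Set} → (∀ g → P g → Q g) → Triple P [] Q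
    skip h g p = tt , h g p

    single : ∀ {P Q : Global → Set} o → (∀ g → P g → Legal o g × Q (exec o g)) → Triple P (o ∷ []) Q
    single o h g p = (proj₁ (h g p) , tt) , proj₂ (h g p)

    conseq : ∀ {P P′ Q Q′ : Global → Set} os → (∀ g → P′ g → P g) → (∀ g → Q g → Q′ g) → Triple P os Q → Triple P′ os Q′
    conseq os f h t g p = let a , b = t g (f g p) in a , h _ b

  for : ℕ → (ℕ → List Op) → List Op
  for zero f = []
  for (suc k) f = for k f ++ f k

  blocks-for : ∀ k f x → (∀ i → i < k → blocks (f i) ≤ x) → blocks (for k f) ≤ k * x
  blocks-for zero f x h = z≤n
  blocks-for (suc k) f x h = begin
    blocks (for k f ++ f k)         ≡⟨ blocks-++ (for k f) (f k) ⟩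
    blocks (for k f) + blocks (f k) ≤⟨ +-mono-≤ (blocks-for k f x (λ i p → h i (m<n⇒m<1+n p))) (h k ≤-refl) ⟩
    k * x + x                       ≡⟨ +-comm (k * x) x ⟩
    x + k * x                       ∎
    where open ≤-Reasoning

  module Loops (nU nV : ℕ) (adj : Fin nU → Fin nV → Bool) (idV : Fin nV → ℕ) (B : ℕ) where
    open Exec nU nV adj idV B

    loop : (I : ℕ → Global → Set) → ∀ k f → (∀ i → i < k → Triple (I i) (f i) (I (suc i))) →
      Triple (I 0) (for k f) (I k)
    loop I zero f h = skip (λ _ p → p)
    loop I (suc k) f h = seq {Q = I k} {R = I (suc k)} (for k f) (f k) (loop I k f (λ i p → h i (m<n⇒m<1+n p))) (h k ≤-refl)

  module Adequacy (initU : US) (initV : ℕ → VS) (prog : ℕ → ℕ → ℕ → List Op) (b : ℕ) (out : VS → Bool)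
                  {c : ℕ} (In : Input c) where
    open Input In
    open Instance inst
    open Run (algorithm initU initV prog b out) In
    idV : Fin nV → ℕ
    idV v = ids (inj₂ v)
    B′ : ℕ
    B′ = pred (suc n ^ b)
    open Exec nU nV adj idV (suc B′)

    -- The view stored at an element is a leftover, overwritten in the first round of the next step;
    -- therefore it is existential.
    record At (k : ℕ) (ss : List Step) (g : Global) (acc : Fin nV → List (List Msg)) : Set where
      field
        atU : ∀ u → ∃ λ w → run k (inj₁ u) ≡ mk ss false (inj₁ (proj₁ g u , w)) B′
        atV : ∀ v → run k (inj₂ v) ≡ mk ss false (inj₂ (proj₂ g v , acc v)) B′
    open At

    module _ (o : Op) (g : Global) (legal : Legal o g) where
      mid : ∀ k β ss acc → At k ((o , β) ∷ ss) g acc →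
        (∀ u → run (suc k) (inj₁ u) ≡ mk ((o , β) ∷ ss) true (inj₁ (proj₁ g u , view o g u)) B′) ×
        (∀ v → run (suc k) (inj₂ v) ≡ mk ((o , β) ∷ ss) true (inj₂ (proj₂ g v , acc v)) B′)
      mid k β ss acc A = mU , mV
        where
        mV : ∀ v → run (suc k) (inj₂ v) ≡ mk ((o , β) ∷ ss) true (inj₂ (proj₂ g v , acc v)) B′
        mV v rewrite atV A v = refl
        mU : ∀ u → run (suc k) (inj₁ u) ≡ mk ((o , β) ∷ ss) true (inj₁ (proj₁ g u , view o g u)) B′
        mU u with atU A u
        ... | w , e rewrite e = cong (λ z → mk ((o , β) ∷ ss) true (inj₁ (proj₁ g u , z)) B′)
          (trans (cong (unpackAll B′) (sym (map-∘ (setsOf u))))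
          (trans (sym (map-∘ (setsOf u))) (map-cong h (setsOf u))))
          where
          h : ∀ v → (idV v , unpack 4 B′ (sendSt (run k (inj₂ v)) (ids (inj₁ u)))) ≡ (idV v , pub o (proj₂ g v))
          h v rewrite atV A v = cong (idV v ,_) (unpack-pack B′ (pub o (proj₂ g v)) (proj₁ legal v))

      end : ∀ k β ss acc → At k ((o , β) ∷ ss) g acc →
        (∀ u → run (suc (suc k)) (inj₁ u) ≡ mk ss false (finU o β (proj₁ g u) (view o g u)) B′) ×
        (∀ v → run (suc (suc k)) (inj₂ v) ≡ mk ss false (finV o β (proj₂ g v) (acc v ++ replies o g v β ∷ [])) B′)
      end k β ss acc A with mid k β ss acc A
      ... | mU , mV = eU , eV
        where
        eU : ∀ u → run (suc (suc k)) (inj₁ u) ≡ mk ss false (finU o β (proj₁ g u) (view o g u)) B′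
        eU u rewrite mU u = refl
        eV : ∀ v → run (suc (suc k)) (inj₂ v) ≡ mk ss false (finV o β (proj₂ g v) (acc v ++ replies o g v β ∷ [])) B′
        eV v rewrite mV v = cong (λ z → mk ss false (finV o β (proj₂ g v) (acc v ++ z ∷ [])) B′)
          (trans (cong (map proj₂ ∘ unpackAll B′) (sym (map-∘ (elemsOf v))))
          (trans (cong (map proj₂) (sym (map-∘ (elemsOf v))))
          (trans (sym (map-∘ (elemsOf v))) (map-cong h (elemsOf v)))))
          where
          h : ∀ u → unpack 4 B′ (sendSt (run (suc k) (inj₁ u)) (ids (inj₂ v))) ≡ rep o (proj₁ g u) (view o g u) (idV v) β
          h u rewrite mU u = unpack-pack B′ (rep o (proj₁ g u) (view o g u) (idV v) β) (proj₂ legal u v β)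

      -- Induction on the number `j` of blocks still to follow the current one, while `acc` holds
      -- the replies of the first `β` blocks. The final time `d` comes with an equation to keep
      -- arithmetic out of the states.
      partial : ∀ k ss acc j β d → j + β ≡ extra o → At k (applyUpTo (λ i → o , β + i) (suc j) ++ ss) g acc →
        (∀ v → acc v ≡ applyUpTo (replies o g v) β) → d ≡ k + 2 * suc j → At d ss (exec o g) (λ _ → [])
      partial k ss acc zero β d e A h refl = subst (λ z → At z ss (exec o g) (λ _ → [])) (sym (+-comm k 2)) A′
        where
        A₀ : At k ((o , β) ∷ ss) g acc
        A₀ = subst (λ z → At k ((o , z) ∷ ss) g acc) (+-identityʳ β) A
        β≡ : (β ≡ᵇ extra o) ≡ true
        β≡ = ≡ᵇ-true e
        A′ : At (2 + k) ss (exec o g) (λ _ → [])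
        atU A′ u = view o g u , trans (proj₁ (end k β ss acc A₀) u)
          (cong (λ z → mk ss false (if z then inj₁ (upd o (proj₁ g u) (view o g u) , view o g u) else inj₁ (proj₁ g u , view o g u)) B′) β≡)
        atV A′ v = trans (proj₂ (end k β ss acc A₀) v) (trans
          (cong (λ z → mk ss false (if z then inj₂ (fin o (proj₂ g v) (acc v ++ replies o g v β ∷ []) , []) else inj₂ (proj₂ g v , acc v ++ replies o g v β ∷ [])) B′) β≡)
          (cong (λ z → mk ss false (inj₂ (fin o (proj₂ g v) z , [])) B′)
            (trans (cong (_++ replies o g v β ∷ []) (h v))
            (trans (applyUpTo-∷ʳ (replies o g v) β) (cong (applyUpTo (replies o g v) ∘ suc) e)))))
      partial k ss acc (suc j) β d e A h refl =
        partial (2 + k) ss acc′ j (suc β) _ (trans (+-suc j β) e) A″ h′ (lem k j)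
        where
        lem : ∀ k j → k + 2 * suc (suc j) ≡ 2 + k + 2 * suc j
        lem = solve-∀
        rest : List Step
        rest = applyUpTo (λ i → o , β + suc i) (suc j) ++ ss
        A₀ : At k ((o , β) ∷ rest) g acc
        A₀ = subst (λ z → At k ((o , z) ∷ rest) g acc) (+-identityʳ β) A
        β≡ : (β ≡ᵇ extra o) ≡ false
        β≡ = ≡ᵇ-false (<⇒≢ (≤-trans (s≤s (m≤n+m β j)) (≤-reflexive e)))
        acc′ : Fin nV → List (List Msg)
        acc′ v = acc v ++ replies o g v β ∷ []
        A′ : At (2 + k) rest g acc′
        atU A′ u = view o g u , trans (proj₁ (end k β rest acc A₀) u)
          (cong (λ z → mk rest false (if z then inj₁ (upd o (proj₁ g u) (view o g u) , view o g u) else inj₁ (proj₁ g u , view o g u)) B′) β≡)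
        atV A′ v = trans (proj₂ (end k β rest acc A₀) v)
          (cong (λ z → mk rest false (if z then inj₂ (fin o (proj₂ g v) (acc′ v) , []) else inj₂ (proj₂ g v , acc′ v)) B′) β≡)
        shift : ∀ (f f′ : ℕ → Step) j → (∀ i → f i ≡ f′ i) → applyUpTo f j ≡ applyUpTo f′ j
        shift f f′ zero h = refl
        shift f f′ (suc j) h = cong₂ _∷_ (h 0) (shift (f ∘ suc) (f′ ∘ suc) j (λ i → h (suc i)))
        A″ : At (2 + k) (applyUpTo (λ i → o , suc β + i) (suc j) ++ ss) g acc′
        A″ = subst (λ z → At (2 + k) (z ++ ss) g acc′) (shift _ _ (suc j) (λ i → cong (o ,_) (+-suc β i))) A′
        h′ : ∀ v → acc′ v ≡ applyUpTo (replies o g v) (suc β)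
        h′ v = trans (cong (_++ replies o g v β ∷ []) (h v)) (applyUpTo-∷ʳ (replies o g v) β)

    runs : ∀ os k g → AllLegal os g → At k (stepsAll os) g (λ _ → []) →
      At (k + 2 * length (stepsAll os)) [] (execs os g) (λ _ → [])
    runs [] k g _ A = subst (λ z → At z [] g (λ _ → [])) (sym (+-identityʳ k)) A
    runs (o ∷ os) k g (l , ls) A = subst (λ z → At z [] (execs (o ∷ os) g) (λ _ → [])) e
      (runs os (k + 2 * suc (extra o)) (exec o g) ls
        (partial o g l k (stepsAll os) (λ _ → []) (extra o) 0 _ (+-identityʳ (extra o)) A (λ _ → refl) refl))
      where
      open ≡-Reasoning
      e : k + 2 * suc (extra o) + 2 * length (stepsAll os) ≡ k + 2 * length (stepsOf o ++ stepsAll os)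
      e = begin
        k + 2 * suc (extra o) + 2 * length (stepsAll os)      ≡⟨ +-assoc k _ _ ⟩
        k + (2 * suc (extra o) + 2 * length (stepsAll os))    ≡⟨ cong (k +_) (*-distribˡ-+ 2 (suc (extra o)) _) ⟨
        k + 2 * (suc (extra o) + length (stepsAll os))        ≡⟨ cong (λ z → k + 2 * (z + length (stepsAll os))) (length-applyUpTo (o ,_) (suc (extra o))) ⟨
        k + 2 * (length (stepsOf o) + length (stepsAll os))   ≡⟨ cong (λ z → k + 2 * z) (length-++ (stepsOf o)) ⟨
        k + 2 * length (stepsOf o ++ stepsAll os)             ∎

    initial : Global
    initial = (λ _ → initU) , (λ v → initV (idV v))

    outputs : AllLegal (prog n s t) initial → ∀ v →
      outputSt out (run R (inj₂ v)) ≡ out (proj₂ (execs (prog n s t) initial) v)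
    outputs l v = cong (outputSt out) (atV (runs (prog n s t) 0 initial l record
      { atU = λ u → [] , refl ; atV = λ v → refl }) v)

-- Colour reduction

digits-< : ∀ q a b x y → x < q → a < b → a * q + x < b * q + y
digits-< q a b x y p l = begin-strict
  a * q + x   <⟨ +-monoʳ-< (a * q) p ⟩
  a * q + q   ≡⟨ +-comm (a * q) q ⟩
  suc a * q   ≤⟨ *-monoˡ-≤ q l ⟩
  b * q       ≤⟨ m≤m+n (b * q) y ⟩
  b * q + y   ∎
  where open ≤-Reasoning

digits-injective : ∀ q a b x y → x < q → y < q → a * q + x ≡ b * q + y → a ≡ b × x ≡ y
digits-injective q a b x y p r e with <-cmp a b
... | tri≈ _ refl _ = refl , +-cancelˡ-≡ (a * q) x y e
... | tri< a<b _ _ = ⊥-elim (<-irrefl e (digits-< q a b x y p a<b))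
... | tri> _ _ b<a = ⊥-elim (<-irrefl (sym e) (digits-< q b a y x r b<a))

∑₃ : ∀ {a b c} → (Fin a → Fin b → Fin c → ℕ) → ℕ
∑₃ e = ∑ λ u → ∑ λ v → ∑ λ v′ → e u v v′

∑₃-mono : ∀ {a b c} {e f : Fin a → Fin b → Fin c → ℕ} → (∀ u v v′ → e u v v′ ≤ f u v v′) → ∑₃ e ≤ ∑₃ f
∑₃-mono h = ∑-mono λ u → ∑-mono λ v → ∑-mono λ v′ → h u v v′

∑₃-+ : ∀ {a b c} (e f : Fin a → Fin b → Fin c → ℕ) → ∑₃ (λ u v v′ → e u v v′ + f u v v′) ≡ ∑₃ e + ∑₃ f
∑₃-+ e f = trans (∑-cong λ u → trans (∑-cong λ v → ∑-+ (e u v) (f u v)) (∑-+ (λ v → ∑ (e u v)) (λ v → ∑ (f u v))))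
  (∑-+ (λ u → ∑ λ v → ∑ (e u v)) (λ u → ∑ λ v → ∑ (f u v)))

∑₃-swap₁₂ : ∀ {a b c} (e : Fin a → Fin b → Fin c → ℕ) → ∑₃ e ≡ ∑ (λ v → ∑ λ u → ∑ (e u v))
∑₃-swap₁₂ e = ∑-swap (λ u v → ∑ (e u v))

∑₃-swap₂₃ : ∀ {a b c} (e : Fin a → Fin b → Fin c → ℕ) → ∑₃ e ≡ ∑₃ (λ u v′ v → e u v v′)
∑₃-swap₂₃ e = ∑-cong λ u → ∑-swap (e u)

-- The weight of the monochromatic pairs; at every element a pair is counted in both orders.
mono : ∀ {a b} → (Fin a → Fin b → Fin b → ℕ) → (Fin b → ℕ) → ℕ
mono e χ = ∑₃ λ u v v′ → e u v v′ * ⟦ χ v ≡ᵇ χ v′ ⟧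

-- A new colour is a position below 2·2^d·b with one of 4·2^d letters, and the product 8·4^d·b is at
-- most 2 to this power.
nextBits : ℕ → ℕ → ℕ
nextBits d b = 3 + 2 * d + lg b

-- One step of colour reduction: every v replaces its colour by a position α of
-- its codeword together with the letter found there.  The position is chosen to
-- minimise a cost in which u contributes its whole weight H as soon as more
-- than a 1/r-fraction of it agrees with v at α, so that u has to send
-- only one bit per position.
module Reduce {nU nV : ℕ} (e : Fin nU → Fin nV → Fin nV → ℕ) (ψ : Fin nV → ℕ)
              (d b r : ℕ) where
  D L : ℕ
  D = 2 ^ d
  L = codeLength D b

  E : ℕ → ℕ → ℕ
  E = encode d b

  differ : Fin nV → Fin nV → ℕ
  differ v v′ = ⟦ not (ψ v ≡ᵇ ψ v′) ⟧

  meet : ℕ → Fin nV → Fin nV → ℕ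
  meet α v v′ = differ v v′ * ⟦ E (ψ v) α ≡ᵇ E (ψ v′) α ⟧

  H : Fin nU → Fin nV → ℕ
  H u v = ∑ λ v′ → e u v v′ * differ v v′

  cnt : Fin nU → Fin nV → ℕ → ℕ
  cnt u v α = ∑ λ v′ → e u v v′ * meet α v v′

  bit : Fin nU → Fin nV → ℕ → Bool
  bit u v α = H u v <ᵇ r * cnt u v α

  cost : Fin nV → ℕ → ℕ
  cost v α = ∑ λ u → ⟦ bit u v α ⟧ * H u v

  position : Fin nV → ℕ
  position v = best (cost v) L

  ψ′ : Fin nV → ℕ
  ψ′ v = position v * (4 * D) + E (ψ v) (position v)

  module _ (0<b : 0 < b) (r²≡D : r * r ≡ D) (ψ< : ∀ v → ψ v < 2 ^ b) where

    0<L : 0 < L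
    0<L = *-mono-≤ {1} {2 * D} {1} {b} (≤-trans (m^n>0 2 d) (m≤m+n D (D + 0))) 0<b

    E< : ∀ c l → E c l < 4 * D
    E< = proj₁ (encode-isCode d b)

    -- Differently coloured sets have distinct codewords, which agree in at most a 1/D fraction of
    -- the positions.
    cnt-sum : ∀ u v → D * Σ< L (cnt u v) ≤ L * H u v
    cnt-sum u v = begin
      D * Σ< L (cnt u v)
        ≡⟨ cong (D *_) (∑-Σ<-swap L (λ v′ α → e u v v′ * meet α v v′)) ⟩
      D * ∑ (λ v′ → Σ< L (λ α → e u v v′ * meet α v v′))
        ≤⟨ ∑-*mono D L pt ⟩
      L * H u v ∎
      where
      open ≤-Reasoning
      ar : ∀ D e x a → D * (e * (x * a)) ≡ e * (x * (D * a))
      ar = solve-∀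
      ar′ : ∀ L e x → e * (x * L) ≡ L * (e * x)
      ar′ = solve-∀
      q : ∀ v′ → differ v v′ * (D * agree L (E (ψ v)) (E (ψ v′))) ≤ differ v v′ * L
      q v′ with ≡ᵇ-cases (ψ v) (ψ v′)
      ... | inj₁ (_ , t) rewrite t = z≤n
      ... | inj₂ (ne , t) rewrite t = *-monoʳ-≤ 1 (proj₂ (encode-isCode d b) _ _ (ψ< v) (ψ< v′) ne)
      pt : ∀ v′ → D * Σ< L (λ α → e u v v′ * meet α v v′) ≤ L * (e u v v′ * differ v v′)
      pt v′ = begin
        D * Σ< L (λ α → e u v v′ * meet α v v′)
          ≡⟨ cong (D *_) (Σ<-*ˡ L (e u v v′) (λ α → meet α v v′)) ⟨
        D * (e u v v′ * Σ< L (λ α → meet α v v′))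
          ≡⟨ cong (λ z → D * (e u v v′ * z)) (Σ<-*ˡ L (differ v v′) _) ⟨
        D * (e u v v′ * (differ v v′ * agree L (E (ψ v)) (E (ψ v′))))
          ≡⟨ ar D (e u v v′) (differ v v′) _ ⟩
        e u v v′ * (differ v v′ * (D * agree L (E (ψ v)) (E (ψ v′))))
          ≤⟨ *-monoʳ-≤ (e u v v′) (q v′) ⟩
        e u v v′ * (differ v v′ * L)
          ≡⟨ ar′ L (e u v v′) (differ v v′) ⟩
        L * (e u v v′ * differ v v′) ∎

    -- Markov's inequality. Replacing the count by an indicator costs a factor `r`, and a gain of
    -- another factor `r` is wanted; this is why the code has D = r².
    bit-sum : ∀ u v → r * Σ< L (λ α → ⟦ bit u v α ⟧ * H u v) ≤ L * H u v
    bit-sum u v = begin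
      r * Σ< L (λ α → ⟦ bit u v α ⟧ * H u v)   ≤⟨ *-monoʳ-≤ r (Σ<-mono L (λ α _ → pt α)) ⟩
      r * Σ< L (λ α → r * cnt u v α)           ≡⟨ cong (r *_) (Σ<-*ˡ L r (cnt u v)) ⟨
      r * (r * Σ< L (cnt u v))                 ≡⟨ *-assoc r r _ ⟨
      r * r * Σ< L (cnt u v)                   ≡⟨ cong (_* Σ< L (cnt u v)) r²≡D ⟩
      D * Σ< L (cnt u v)                       ≤⟨ cnt-sum u v ⟩
      L * H u v                                ∎
      where
      open ≤-Reasoning
      pt : ∀ α → ⟦ bit u v α ⟧ * H u v ≤ r * cnt u v α
      pt α with <ᵇ-cases (H u v) (r * cnt u v α)
      ... | inj₁ (l , t) rewrite t = ≤-trans (≤-reflexive (*-identityˡ _)) (<⇒≤ l)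
      ... | inj₂ (_ , t) rewrite t = z≤n

    cost-position : ∀ v → r * cost v (position v) ≤ ∑ (λ u → H u v)
    cost-position v = *-cancelˡ-≤ L {{>-nonZero 0<L}} (begin
      L * (r * cost v (position v))         ≡⟨ ar L r _ ⟩
      r * (L * cost v (position v))         ≤⟨ *-monoʳ-≤ r (best-avg (cost v) L) ⟩
      r * Σ< L (cost v)                     ≡⟨ cong (r *_) (∑-Σ<-swap L (λ u α → ⟦ bit u v α ⟧ * H u v)) ⟩
      r * ∑ (λ u → Σ< L (λ α → ⟦ bit u v α ⟧ * H u v)) ≤⟨ ∑-*mono r L (λ u → bit-sum u v) ⟩
      L * ∑ (λ u → H u v)                   ∎)
      where
      open ≤-Reasoning
      ar : ∀ a b c → a * (b * c) ≡ b * (a * c)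
      ar = solve-∀

    -- Without the bit the count is at most H/r by definition; with it, the trivial bound H is
    -- charged to the cost of the position.
    cnt≤ : ∀ u v α → r * cnt u v α ≤ H u v + r * (⟦ bit u v α ⟧ * H u v)
    cnt≤ u v α with <ᵇ-cases (H u v) (r * cnt u v α)
    ... | inj₁ (l , t) rewrite t = m≤n⇒m≤o+n (H u v) (*-monoʳ-≤ r (≤-trans
          (∑-mono λ v′ → *-monoʳ-≤ (e u v v′) (≤-trans (*-monoʳ-≤ (differ v v′) (⟦⟧≤1 (E (ψ v) α ≡ᵇ E (ψ v′) α)))
            (≤-reflexive (*-identityʳ (differ v v′)))))
          (≤-reflexive (sym (*-identityˡ (H u v))))))
    ... | inj₂ (l , t) = ≤-trans l (m≤m+n (H u v) _)

    H≤ : ∀ u v → H u v ≤ ∑ (e u v)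
    H≤ u v = ∑-mono λ v′ → ≤-trans (*-monoʳ-≤ (e u v v′) (⟦⟧≤1 _)) (≤-reflexive (*-identityʳ _))

    cnt-position : ∀ v → r * ∑ (λ u → cnt u v (position v)) ≤ 2 * ∑ (λ u → ∑ (e u v))
    cnt-position v = begin
      r * ∑ (λ u → cnt u v α)                              ≡⟨ ∑-*ˡ r (λ u → cnt u v α) ⟩
      ∑ (λ u → r * cnt u v α)                              ≤⟨ ∑-mono (λ u → cnt≤ u v α) ⟩
      ∑ (λ u → H u v + r * (⟦ bit u v α ⟧ * H u v))        ≡⟨ ∑-+ (λ u → H u v) _ ⟩
      ∑ (λ u → H u v) + ∑ (λ u → r * (⟦ bit u v α ⟧ * H u v)) ≡⟨ cong (∑ (λ u → H u v) +_) (∑-*ˡ r (λ u → ⟦ bit u v α ⟧ * H u v)) ⟨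
      ∑ (λ u → H u v) + r * cost v α                       ≤⟨ +-monoʳ-≤ _ (cost-position v) ⟩
      ∑ (λ u → H u v) + ∑ (λ u → H u v)                    ≤⟨ +-mono-≤ (∑-mono (λ u → H≤ u v)) (∑-mono (λ u → H≤ u v)) ⟩
      ∑ (λ u → ∑ (e u v)) + ∑ (λ u → ∑ (e u v))            ≡⟨ cong (∑ (λ u → ∑ (e u v)) +_) (+-identityʳ _) ⟨
      2 * ∑ (λ u → ∑ (e u v))                              ∎
      where
      open ≤-Reasoning
      α = position v

    -- A new colour determines its position and its letter. So two differently coloured sets that
    -- become equal have codewords agreeing at the position of `v`, and the pair can be charged to
    -- `v` alone.
    clash : ∀ v v′ → ⟦ ψ′ v ≡ᵇ ψ′ v′ ⟧ ≤ ⟦ ψ v ≡ᵇ ψ v′ ⟧ + meet (position v) v v′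
    clash v v′ with ≡ᵇ-cases (ψ′ v) (ψ′ v′) | ψ v ≡ᵇ ψ v′
    ... | inj₂ (_ , t) | _ rewrite t = z≤n
    ... | inj₁ (_ , t) | true rewrite t = s≤s z≤n
    ... | inj₁ (eq , t) | false rewrite t
      with digits-injective (4 * D) (position v) (position v′) _ _ (E< _ _) (E< _ _) eq
    ... | p , x rewrite ≡ᵇ-true (trans x (cong (E (ψ v′)) (sym p))) = s≤s z≤n

    mono-reduce : r * mono e ψ′ ≤ r * mono e ψ + 2 * ∑₃ e
    mono-reduce = begin
      r * mono e ψ′
        ≤⟨ *-monoʳ-≤ r (∑₃-mono λ u v v′ → ≤-trans (*-monoʳ-≤ (e u v v′) (clash v v′)) (≤-reflexive (*-distribˡ-+ (e u v v′) _ _))) ⟩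
      r * ∑₃ (λ u v v′ → e u v v′ * ⟦ ψ v ≡ᵇ ψ v′ ⟧ + e u v v′ * meet (position v) v v′)
        ≡⟨ cong (r *_) (∑₃-+ (λ u v v′ → e u v v′ * ⟦ ψ v ≡ᵇ ψ v′ ⟧) (λ u v v′ → e u v v′ * meet (position v) v v′)) ⟩
      r * (mono e ψ + ∑ (λ u → ∑ λ v → cnt u v (position v)))
        ≡⟨ *-distribˡ-+ r (mono e ψ) _ ⟩
      r * mono e ψ + r * ∑ (λ u → ∑ λ v → cnt u v (position v))
        ≡⟨ cong (λ z → r * mono e ψ + r * z) (∑-swap (λ u v → cnt u v (position v))) ⟩
      r * mono e ψ + r * ∑ (λ v → ∑ λ u → cnt u v (position v))
        ≤⟨ +-monoʳ-≤ _ (∑-*mono r 2 cnt-position) ⟩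
      r * mono e ψ + 2 * ∑ (λ v → ∑ λ u → ∑ (e u v))
        ≡⟨ cong (λ z → r * mono e ψ + 2 * z) (∑₃-swap₁₂ e) ⟨
      r * mono e ψ + 2 * ∑₃ e ∎
      where open ≤-Reasoning

    ψ′< : ∀ v → ψ′ v < 2 ^ nextBits d b
    ψ′< v = begin-strict
      position v * (4 * D) + E (ψ v) (position v) <⟨ +-monoʳ-< (position v * (4 * D)) (E< _ _) ⟩
      position v * (4 * D) + 4 * D                ≡⟨ +-comm _ (4 * D) ⟩
      suc (position v) * (4 * D)                  ≤⟨ *-monoˡ-≤ (4 * D) (best< (cost v) L 0<L) ⟩
      2 * D * b * (4 * D)                         ≡⟨ ar D b ⟩
      8 * (D * D) * b                             ≤⟨ *-monoʳ-≤ (8 * (D * D)) (<⇒≤ (<2^lg b)) ⟩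
      8 * (D * D) * 2 ^ lg b                      ≡⟨ cong (λ z → 8 * z * 2 ^ lg b) (^-distribˡ-+-* 2 d d) ⟨
      2 ^ 3 * 2 ^ (d + d) * 2 ^ lg b              ≡⟨ cong (_* 2 ^ lg b) (^-distribˡ-+-* 2 3 (d + d)) ⟨
      2 ^ (3 + (d + d)) * 2 ^ lg b                ≡⟨ ^-distribˡ-+-* 2 (3 + (d + d)) (lg b) ⟨
      2 ^ (3 + (d + d) + lg b)                    ≡⟨ cong (λ z → 2 ^ (3 + (d + z) + lg b)) (+-identityʳ d) ⟨
      2 ^ nextBits d b                            ∎
      where
      open ≤-Reasoning
      ar : ∀ D b → 2 * D * b * (4 * D) ≡ 8 * (D * D) * b
      ar = solve-∀

-- The second hypothesis is what results when the classes of ψ in turn take the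
-- label least used among the earlier classes.
label-mono : ∀ {nU nV} (e : Fin nU → Fin nV → Fin nV → ℕ) (ψ lab : Fin nV → ℕ) ρ →
  (∀ u v v′ → e u v v′ ≡ e u v′ v) →
  (∀ v → ρ * ∑ (λ u → ∑ λ v′ → e u v v′ * (⟦ ψ v′ <ᵇ ψ v ⟧ * ⟦ lab v′ ≡ᵇ lab v ⟧))
       ≤ ∑ (λ u → ∑ λ v′ → e u v v′ * ⟦ ψ v′ <ᵇ ψ v ⟧)) →
  ρ * mono e ψ ≤ ∑₃ e →
  ρ * mono e lab ≤ 2 * ∑₃ e
label-mono e ψ lab ρ symm fair few = begin
  ρ * mono e lab
    ≤⟨ *-monoʳ-≤ ρ (∑₃-mono split) ⟩
  ρ * ∑₃ (λ u v v′ → (e u v v′ * (lt v v′ * eq v v′) + e u v v′ * (lt v′ v * eq v′ v)) + e u v v′ * ⟦ ψ v ≡ᵇ ψ v′ ⟧)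
    ≡⟨ cong (ρ *_) (trans (∑₃-+ (λ u v v′ → e u v v′ * (lt v v′ * eq v v′) + e u v v′ * (lt v′ v * eq v′ v)) (λ u v v′ → e u v v′ * ⟦ ψ v ≡ᵇ ψ v′ ⟧))
        (cong (_+ mono e ψ) (∑₃-+ (λ u v v′ → e u v v′ * (lt v v′ * eq v v′)) (λ u v v′ → e u v v′ * (lt v′ v * eq v′ v))))) ⟩
  ρ * (A + A′ + mono e ψ)
    ≡⟨ cong (λ z → ρ * (A + z + mono e ψ)) A′≡A ⟩
  ρ * (A + A + mono e ψ)
    ≡⟨ ar ρ A (mono e ψ) ⟩
  (ρ * A + ρ * A) + ρ * mono e ψ
    ≤⟨ +-mono-≤ (+-mono-≤ ρA≤ ρA≤) few ⟩
  (B + B) + ∑₃ e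
    ≡⟨ cong (λ z → (B + z) + ∑₃ e) B′≡B ⟨
  (B + B′) + ∑₃ e
    ≡⟨ cong (_+ ∑₃ e) (∑₃-+ (λ u v v′ → e u v v′ * lt v v′) (λ u v v′ → e u v v′ * lt v′ v)) ⟨
  ∑₃ (λ u v v′ → e u v v′ * lt v v′ + e u v v′ * lt v′ v) + ∑₃ e
    ≤⟨ +-monoˡ-≤ (∑₃ e) (∑₃-mono disjoint) ⟩
  ∑₃ e + ∑₃ e
    ≡⟨ cong (∑₃ e +_) (+-identityʳ _) ⟨
  2 * ∑₃ e ∎
  where
  open ≤-Reasoning
  lt eq : _ → _ → ℕ
  lt v v′ = ⟦ ψ v′ <ᵇ ψ v ⟧
  eq v v′ = ⟦ lab v′ ≡ᵇ lab v ⟧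
  A A′ B B′ : ℕ
  A = ∑₃ (λ u v v′ → e u v v′ * (lt v v′ * eq v v′))
  A′ = ∑₃ (λ u v v′ → e u v v′ * (lt v′ v * eq v′ v))
  B = ∑₃ (λ u v v′ → e u v v′ * lt v v′)
  B′ = ∑₃ (λ u v v′ → e u v v′ * lt v′ v)
  ar : ∀ r a m → r * (a + a + m) ≡ (r * a + r * a) + r * m
  ar = solve-∀
  A′≡A : A′ ≡ A
  A′≡A = trans (∑₃-swap₂₃ (λ u v v′ → e u v v′ * (lt v′ v * eq v′ v)))
    (∑-cong λ u → ∑-cong λ v → ∑-cong λ v′ → cong (_* (lt v v′ * eq v v′)) (symm u v′ v))
  B′≡B : B′ ≡ B
  B′≡B = trans (∑₃-swap₂₃ (λ u v v′ → e u v v′ * lt v′ v))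
    (∑-cong λ u → ∑-cong λ v → ∑-cong λ v′ → cong (_* lt v v′) (symm u v′ v))
  ρA≤ : ρ * A ≤ B
  ρA≤ = begin
    ρ * A                                     ≡⟨ cong (ρ *_) (∑₃-swap₁₂ (λ u v v′ → e u v v′ * (lt v v′ * eq v v′))) ⟩
    ρ * ∑ (λ v → ∑ λ u → ∑ λ v′ → e u v v′ * (lt v v′ * eq v v′)) ≡⟨ ∑-*ˡ ρ (λ v → ∑ (λ u → ∑ λ v′ → e u v v′ * (lt v v′ * eq v v′))) ⟩
    ∑ (λ v → ρ * ∑ (λ u → ∑ λ v′ → e u v v′ * (lt v v′ * eq v v′))) ≤⟨ ∑-mono fair ⟩
    ∑ (λ v → ∑ λ u → ∑ λ v′ → e u v v′ * lt v v′) ≡⟨ ∑₃-swap₁₂ (λ u v v′ → e u v v′ * lt v v′) ⟨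
    B                                         ∎
  -- Unless both sets lie in one class of `ψ`, the one in the later class chose its label knowing
  -- the other; the first two summands are the two possible orders.
  split : ∀ u v v′ → e u v v′ * ⟦ lab v ≡ᵇ lab v′ ⟧ ≤
    (e u v v′ * (lt v v′ * eq v v′) + e u v v′ * (lt v′ v * eq v′ v)) + e u v v′ * ⟦ ψ v ≡ᵇ ψ v′ ⟧
  split u v v′ with <-cmp (ψ v) (ψ v′)
  ... | tri< l _ _ rewrite <ᵇ-true l = ≤-trans (≤-reflexive (cong (e u v v′ *_) (sym (*-identityˡ _))))
        (≤-trans (m≤n+m _ (e u v v′ * (lt v v′ * eq v v′))) (m≤m+n _ _))
  ... | tri≈ _ q _ rewrite ≡ᵇ-true q = ≤-trans (*-monoʳ-≤ (e u v v′) (⟦⟧≤1 _)) (m≤n+m _ _)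
  ... | tri> _ _ l rewrite <ᵇ-true l | ≡ᵇ-sym (lab v′) (lab v) =
        ≤-trans (≤-reflexive (cong (e u v v′ *_) (sym (*-identityˡ _)))) (≤-trans (m≤m+n _ _) (m≤m+n _ _))
  disjoint : ∀ u v v′ → e u v v′ * lt v v′ + e u v v′ * lt v′ v ≤ e u v v′
  disjoint u v v′ with <ᵇ-cases (ψ v′) (ψ v)
  ... | inj₁ (l , t) rewrite t | <ᵇ-false (<⇒≤ l) = ≤-reflexive (lem (e u v v′))
    where
    lem : ∀ x → x * 1 + x * 0 ≡ x
    lem = solve-∀
  ... | inj₂ (_ , t) rewrite t | *-zeroʳ (e u v v′) = ≤-trans (*-monoʳ-≤ (e u v v′) (⟦⟧≤1 _)) (≤-reflexive (*-identityʳ _))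

-- The rounding potential

-- Analyses the potential Σ a·y - 8·`quad` y - p·Σ y when all sets in `S`, of value `w`, move at
-- once to 2w or 0. As `quad` runs over ordered pairs, 8 stands for 16 per unordered pair.
module RoundStep {nU nV : ℕ} (e : Fin nU → Fin nV → Fin nV → ℕ) (a : Fin nV → ℕ) (p w : ℕ)
                 (x : Fin nV → ℕ) (S : Fin nV → Bool) where

  quad : (Fin nV → ℕ) → ℕ
  quad y = ∑₃ λ u v v′ → e u v v′ * (y v * y v′)

  G : Fin nV → ℕ
  G v = ∑ λ u → ∑ λ v′ → e u v v′ * x v′

  -- The sign of the partial derivative a - 16·G - p. The potential is linear in each variable, so
  -- doubling and dropping change it by opposite amounts and one of them does not decrease it.
  up? : Fin nV → Bool
  up? v = 16 * G v + p ≤ᵇ a v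

  x′ up dn : Fin nV → ℕ
  x′ v = if S v then (if up? v then 2 * w else 0) else x v
  up v = if S v then (if up? v then w else 0) else 0
  dn v = if S v then (if up? v then 0 else w) else 0

  module _ (symm : ∀ u v v′ → e u v v′ ≡ e u v′ v) (x≡w : ∀ v → S v ≡ true → x v ≡ w) where

    balance : ∀ v → x′ v + dn v ≡ x v + up v
    balance v with S v in s | up? v
    ... | false | _ = refl
    ... | true | true rewrite x≡w v s = lem w
      where
      lem : ∀ w → 2 * w + 0 ≡ w + w
      lem = solve-∀
    ... | true | false rewrite x≡w v s = sym (+-identityʳ w)

    -- Beyond the first-order change, a product changes by (±w)(±w) when both sets move and not at
    -- all otherwise. Decreases are kept on the left in `dn`, since there is no subtraction.
    pair : ∀ v v′ → x′ v * x′ v′ + (dn v * x v′ + x v * dn v′) ≤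
      x v * x v′ + (up v * x v′ + x v * up v′) + ⟦ S v ⟧ * ⟦ S v′ ⟧ * (w * w)
    pair v v′ with S v in s | up? v | S v′ in s′ | up? v′
    ... | false | _ | false | _ = ≤-reflexive (lem (x v) (x v′) (w * w))
      where
      lem : ∀ a b c → a * b + (0 * b + a * 0) ≡ a * b + (0 * b + a * 0) + 0 * 0 * c
      lem = solve-∀
    ... | false | _ | true | true rewrite x≡w v′ s′ = ≤-reflexive (lem (x v) w)
      where
      lem : ∀ a w → a * (2 * w) + (0 * w + a * 0) ≡ a * w + (0 * w + a * w) + 0 * 1 * (w * w)
      lem = solve-∀
    ... | false | _ | true | false rewrite x≡w v′ s′ = ≤-reflexive (lem (x v) w)
      where
      lem : ∀ a w → a * 0 + (0 * w + a * w) ≡ a * w + (0 * w + a * 0) + 0 * 1 * (w * w)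
      lem = solve-∀
    ... | true | true | false | _ rewrite x≡w v s = ≤-reflexive (lem (x v′) w)
      where
      lem : ∀ b w → 2 * w * b + (0 * b + w * 0) ≡ w * b + (w * b + w * 0) + 1 * 0 * (w * w)
      lem = solve-∀
    ... | true | false | false | _ rewrite x≡w v s = ≤-reflexive (lem (x v′) w)
      where
      lem : ∀ b w → 0 * b + (w * b + w * 0) ≡ w * b + (0 * b + w * 0) + 1 * 0 * (w * w)
      lem = solve-∀
    ... | true | true | true | true rewrite x≡w v s | x≡w v′ s′ = ≤-reflexive (lem w)
      where
      lem : ∀ w → 2 * w * (2 * w) + (0 * w + w * 0) ≡ w * w + (w * w + w * w) + 1 * 1 * (w * w)
      lem = solve-∀
    ... | true | true | true | false rewrite x≡w v s | x≡w v′ s′ = ≤-trans (m≤m+n _ (w * w + w * w)) (≤-reflexive (lem w))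
      where
      lem : ∀ w → 2 * w * 0 + (0 * w + w * w) + (w * w + w * w) ≡ w * w + (w * w + w * 0) + 1 * 1 * (w * w)
      lem = solve-∀
    ... | true | false | true | true rewrite x≡w v s | x≡w v′ s′ = ≤-trans (m≤m+n _ (w * w + w * w)) (≤-reflexive (lem w))
      where
      lem : ∀ w → 0 * (2 * w) + (w * w + w * 0) + (w * w + w * w) ≡ w * w + (0 * w + w * w) + 1 * 1 * (w * w)
      lem = solve-∀
    ... | true | false | true | false rewrite x≡w v s | x≡w v′ s′ = ≤-reflexive (lem w)
      where
      lem : ∀ w → 0 * 0 + (w * w + w * w) ≡ w * w + (0 * w + w * 0) + 1 * 1 * (w * w)
      lem = solve-∀

    linear : ∀ (y : Fin nV → ℕ) → ∑₃ (λ u v v′ → e u v v′ * (y v * x v′ + x v * y v′)) ≡ 2 * ∑ (λ v → y v * G v)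
    linear y = begin
      ∑₃ (λ u v v′ → e u v v′ * (y v * x v′ + x v * y v′))
        ≡⟨ ∑-cong (λ u → ∑-cong λ v → ∑-cong λ v′ → *-distribˡ-+ (e u v v′) (y v * x v′) (x v * y v′)) ⟩
      ∑₃ (λ u v v′ → e u v v′ * (y v * x v′) + e u v v′ * (x v * y v′))
        ≡⟨ ∑₃-+ (λ u v v′ → e u v v′ * (y v * x v′)) (λ u v v′ → e u v v′ * (x v * y v′)) ⟩
      A + ∑₃ (λ u v v′ → e u v v′ * (x v * y v′))
        ≡⟨ cong (A +_) (trans (∑₃-swap₂₃ (λ u v v′ → e u v v′ * (x v * y v′)))
             (∑-cong λ u → ∑-cong λ v → ∑-cong λ v′ → cong₂ _*_ (symm u v′ v) (*-comm (x v′) (y v)))) ⟩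
      A + A
        ≡⟨ cong (A +_) (+-identityʳ A) ⟨
      2 * A
        ≡⟨ cong (2 *_) A≡ ⟩
      2 * ∑ (λ v → y v * G v) ∎
      where
      open ≡-Reasoning
      A = ∑₃ (λ u v v′ → e u v v′ * (y v * x v′))
      lem : ∀ a b c → a * (b * c) ≡ b * (a * c)
      lem = solve-∀
      A≡ : A ≡ ∑ (λ v → y v * G v)
      A≡ = trans (∑₃-swap₁₂ (λ u v v′ → e u v v′ * (y v * x v′))) (∑-cong λ v →
        trans (∑-cong λ u → trans (∑-cong λ v′ → lem (e u v v′) (y v) (x v′)) (sym (∑-*ˡ (y v) (λ v′ → e u v v′ * x v′))))
          (sym (∑-*ˡ (y v) (λ u → ∑ λ v′ → e u v v′ * x v′))))

    loss : ℕ
    loss = ∑₃ λ u v v′ → e u v v′ * (⟦ S v ⟧ * ⟦ S v′ ⟧ * (w * w))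

    quad-step : quad x′ + 2 * ∑ (λ v → dn v * G v) ≤ quad x + 2 * ∑ (λ v → up v * G v) + loss
    quad-step = begin
      quad x′ + 2 * ∑ (λ v → dn v * G v)
        ≡⟨ cong (quad x′ +_) (linear dn) ⟨
      quad x′ + ∑₃ (λ u v v′ → e u v v′ * (dn v * x v′ + x v * dn v′))
        ≡⟨ ∑₃-+ (λ u v v′ → e u v v′ * (x′ v * x′ v′)) (λ u v v′ → e u v v′ * (dn v * x v′ + x v * dn v′)) ⟨
      ∑₃ (λ u v v′ → e u v v′ * (x′ v * x′ v′) + e u v v′ * (dn v * x v′ + x v * dn v′))
        ≤⟨ ∑₃-mono pt ⟩
      ∑₃ (λ u v v′ → e u v v′ * (x v * x v′) + e u v v′ * (up v * x v′ + x v * up v′) + e u v v′ * (⟦ S v ⟧ * ⟦ S v′ ⟧ * (w * w)))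
        ≡⟨ ∑₃-+ (λ u v v′ → e u v v′ * (x v * x v′) + e u v v′ * (up v * x v′ + x v * up v′)) (λ u v v′ → e u v v′ * (⟦ S v ⟧ * ⟦ S v′ ⟧ * (w * w))) ⟩
      ∑₃ (λ u v v′ → e u v v′ * (x v * x v′) + e u v v′ * (up v * x v′ + x v * up v′)) + loss
        ≡⟨ cong (_+ loss) (∑₃-+ (λ u v v′ → e u v v′ * (x v * x v′)) (λ u v v′ → e u v v′ * (up v * x v′ + x v * up v′))) ⟩
      quad x + ∑₃ (λ u v v′ → e u v v′ * (up v * x v′ + x v * up v′)) + loss
        ≡⟨ cong (λ z → quad x + z + loss) (linear up) ⟩
      quad x + 2 * ∑ (λ v → up v * G v) + loss ∎
      where
      open ≤-Reasoning
      d3 : ∀ e a b c → e * (a + b + c) ≡ e * a + e * b + e * c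
      d3 = solve-∀
      pt : ∀ u v v′ → e u v v′ * (x′ v * x′ v′) + e u v v′ * (dn v * x v′ + x v * dn v′) ≤
        e u v v′ * (x v * x v′) + e u v v′ * (up v * x v′ + x v * up v′) + e u v v′ * (⟦ S v ⟧ * ⟦ S v′ ⟧ * (w * w))
      pt u v v′ = begin
        e u v v′ * (x′ v * x′ v′) + e u v v′ * (dn v * x v′ + x v * dn v′) ≡⟨ *-distribˡ-+ (e u v v′) _ _ ⟨
        e u v v′ * (x′ v * x′ v′ + (dn v * x v′ + x v * dn v′))            ≤⟨ *-monoʳ-≤ (e u v v′) (pair v v′) ⟩
        e u v v′ * (x v * x v′ + (up v * x v′ + x v * up v′) + ⟦ S v ⟧ * ⟦ S v′ ⟧ * (w * w)) ≡⟨ d3 (e u v v′) _ _ _ ⟩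
        _ ∎

    up-gain : 16 * ∑ (λ v → up v * G v) + p * ∑ up ≤ ∑ (λ v → a v * up v)
    up-gain = begin
      16 * ∑ (λ v → up v * G v) + p * ∑ up                 ≡⟨ cong₂ _+_ (∑-*ˡ 16 (λ v → up v * G v)) (∑-*ˡ p up) ⟩
      ∑ (λ v → 16 * (up v * G v)) + ∑ (λ v → p * up v)     ≡⟨ ∑-+ (λ v → 16 * (up v * G v)) (λ v → p * up v) ⟨
      ∑ (λ v → 16 * (up v * G v) + p * up v)               ≤⟨ ∑-mono pt ⟩
      ∑ (λ v → a v * up v)                                 ∎
      where
      open ≤-Reasoning
      lem : ∀ w g p → 16 * (w * g) + p * w ≡ (16 * g + p) * w
      lem = solve-∀
      lem0 : ∀ g p a → 16 * (0 * g) + p * 0 ≡ a * 0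
      lem0 = solve-∀
      pt : ∀ v → 16 * (up v * G v) + p * up v ≤ a v * up v
      pt v with S v | ≤ᵇ-cases (16 * G v + p) (a v)
      ... | false | _ = ≤-reflexive (lem0 (G v) p (a v))
      ... | true | inj₁ (h , t) rewrite t = ≤-trans (≤-reflexive (lem w (G v) p)) (*-monoˡ-≤ w h)
      ... | true | inj₂ (_ , t) rewrite t = ≤-reflexive (lem0 (G v) p (a v))

    dn-gain : ∑ (λ v → a v * dn v) ≤ 16 * ∑ (λ v → dn v * G v) + p * ∑ dn
    dn-gain = begin
      ∑ (λ v → a v * dn v)                                 ≤⟨ ∑-mono pt ⟩
      ∑ (λ v → 16 * (dn v * G v) + p * dn v)               ≡⟨ ∑-+ (λ v → 16 * (dn v * G v)) (λ v → p * dn v) ⟩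
      ∑ (λ v → 16 * (dn v * G v)) + ∑ (λ v → p * dn v)     ≡⟨ cong₂ _+_ (∑-*ˡ 16 (λ v → dn v * G v)) (∑-*ˡ p dn) ⟨
      16 * ∑ (λ v → dn v * G v) + p * ∑ dn                 ∎
      where
      open ≤-Reasoning
      lem : ∀ w g p → 16 * (w * g) + p * w ≡ (16 * g + p) * w
      lem = solve-∀
      lem0 : ∀ g p a → 16 * (0 * g) + p * 0 ≡ a * 0
      lem0 = solve-∀
      pt : ∀ v → a v * dn v ≤ 16 * (dn v * G v) + p * dn v
      pt v with S v | ≤ᵇ-cases (16 * G v + p) (a v)
      ... | false | _ = ≤-reflexive (sym (lem0 (G v) p (a v)))
      ... | true | inj₁ (h , t) rewrite t = ≤-reflexive (sym (lem0 (G v) p (a v)))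
      ... | true | inj₂ (h , t) rewrite t = ≤-trans (*-monoˡ-≤ w (<⇒≤ h)) (≤-reflexive (sym (lem w (G v) p)))

    ∑-balance : ∑ x′ + ∑ dn ≡ ∑ x + ∑ up
    ∑-balance = trans (sym (∑-+ x′ dn)) (trans (∑-cong balance) (∑-+ x up))

    ∑a-balance : ∑ (λ v → a v * x′ v) + ∑ (λ v → a v * dn v) ≡ ∑ (λ v → a v * x v) + ∑ (λ v → a v * up v)
    ∑a-balance = trans (sym (∑-+ (λ v → a v * x′ v) (λ v → a v * dn v)))
      (trans (∑-cong λ v → trans (sym (*-distribˡ-+ (a v) (x′ v) (dn v)))
        (trans (cong (a v *_) (balance v)) (*-distribˡ-+ (a v) (x v) (up v))))
      (∑-+ (λ v → a v * x v) (λ v → a v * up v)))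

    -- Each set follows its own derivative, so the first-order change does not decrease the
    -- potential; only pairs inside `S` cost anything, at most w² each.
    round-step : ∑ (λ v → a v * x v) + (8 * quad x′ + p * ∑ x′) ≤
                 ∑ (λ v → a v * x′ v) + (8 * quad x + p * ∑ x) + 8 * loss
    round-step = +-cancelʳ-≤ (16 * dg + p * ∑ dn) _ _ (begin
      A + (8 * quad x′ + p * ∑ x′) + (16 * dg + p * ∑ dn)        ≡⟨ l1 A (quad x′) p (∑ x′) dg (∑ dn) ⟩
      A + (8 * (quad x′ + 2 * dg) + p * (∑ x′ + ∑ dn))           ≤⟨ +-monoʳ-≤ A (+-mono-≤ (*-monoʳ-≤ 8 quad-step) (≤-reflexive (cong (p *_) ∑-balance))) ⟩
      A + (8 * (quad x + 2 * ug + loss) + p * (∑ x + ∑ up))      ≡⟨ l2 A (quad x) ug loss p (∑ x) (∑ up) ⟩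
      A + (16 * ug + p * ∑ up) + (8 * quad x + p * ∑ x + 8 * loss) ≤⟨ +-monoˡ-≤ _ (+-monoʳ-≤ A up-gain) ⟩
      A + Au + (8 * quad x + p * ∑ x + 8 * loss)                 ≡⟨ cong (_+ (8 * quad x + p * ∑ x + 8 * loss)) ∑a-balance ⟨
      A′ + Ad + (8 * quad x + p * ∑ x + 8 * loss)                ≤⟨ +-monoˡ-≤ _ (+-monoʳ-≤ A′ dn-gain) ⟩
      A′ + (16 * dg + p * ∑ dn) + (8 * quad x + p * ∑ x + 8 * loss) ≡⟨ l3 A′ (16 * dg + p * ∑ dn) (8 * quad x + p * ∑ x) (8 * loss) ⟩
      A′ + (8 * quad x + p * ∑ x) + 8 * loss + (16 * dg + p * ∑ dn) ∎)
      where
      open ≤-Reasoning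
      A A′ Au Ad ug dg : ℕ
      A = ∑ (λ v → a v * x v)
      A′ = ∑ (λ v → a v * x′ v)
      Au = ∑ (λ v → a v * up v)
      Ad = ∑ (λ v → a v * dn v)
      ug = ∑ (λ v → up v * G v)
      dg = ∑ (λ v → dn v * G v)
      l1 : ∀ A q p s d n → A + (8 * q + p * s) + (16 * d + p * n) ≡ A + (8 * (q + 2 * d) + p * (s + n))
      l1 = solve-∀
      l2 : ∀ A q u l p s n → A + (8 * (q + 2 * u + l) + p * (s + n)) ≡ A + (16 * u + p * n) + (8 * q + p * s + 8 * l)
      l2 = solve-∀
      l3 : ∀ A d n l → A + d + (n + l) ≡ A + n + l + d
      l3 = solve-∀

2ab≤a²+b² : ∀ a b → 2 * (a * b) ≤ a * a + b * b
2ab≤a²+b² a b with ≤-total a b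
... | inj₁ l = subst (λ z → 2 * (a * z) ≤ a * a + z * z) (m+[n∸m]≡n l) (≤-trans (m≤m+n _ ((b ∸ a) * (b ∸ a))) (≤-reflexive (lem a (b ∸ a))))
  where
  lem : ∀ a d → 2 * (a * (a + d)) + d * d ≡ a * a + (a + d) * (a + d)
  lem = solve-∀
... | inj₂ l = subst (λ z → 2 * (z * b) ≤ z * z + b * b) (m+[n∸m]≡n l) (≤-trans (m≤m+n _ ((a ∸ b) * (a ∸ b))) (≤-reflexive (lem b (a ∸ b))))
  where
  lem : ∀ a d → 2 * ((a + d) * a) + d * d ≡ (a + d) * (a + d) + a * a
  lem = solve-∀

module Potential {nU nV : ℕ} (c : Fin nU → Fin nV → Bool) (id : Fin nV → ℕ)
                 (id-inj : ∀ v v′ → id v ≡ id v′ → v ≡ v′) where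

  -- Leaving out the diagonal makes the potential linear in each variable.
  e : Fin nU → Fin nV → Fin nV → ℕ
  e u v v′ = ⟦ c u v ⟧ * (⟦ c u v′ ⟧ * ⟦ not (id v ≡ᵇ id v′) ⟧)

  e-sym : ∀ u v v′ → e u v v′ ≡ e u v′ v
  e-sym u v v′ rewrite ≡ᵇ-sym (id v) (id v′) = lem ⟦ c u v ⟧ ⟦ c u v′ ⟧ ⟦ not (id v′ ≡ᵇ id v) ⟧
    where
    lem : ∀ a b c → a * (b * c) ≡ b * (a * c)
    lem = solve-∀

  X : (Fin nV → ℕ) → Fin nU → ℕ
  X x u = ∑ λ v → ⟦ c u v ⟧ * x v

  B diag : (Fin nV → ℕ) → Fin nU → ℕ
  B x u = ∑ λ v → ∑ λ v′ → e u v v′ * (x v * x v′)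
  diag x u = ∑ λ v → ⟦ c u v ⟧ * (x v * x v)

  X²≡B+diag : ∀ x u → X x u * X x u ≡ B x u + diag x u
  X²≡B+diag x u = begin
    X x u * X x u
      ≡⟨ ∑-*ʳ (X x u) (λ v → ⟦ c u v ⟧ * x v) ⟩
    ∑ (λ v → ⟦ c u v ⟧ * x v * X x u)
      ≡⟨ ∑-cong row ⟩
    ∑ (λ v → ∑ (λ v′ → e u v v′ * (x v * x v′)) + ⟦ c u v ⟧ * (x v * x v))
      ≡⟨ ∑-+ (λ v → ∑ (λ v′ → e u v v′ * (x v * x v′))) (λ v → ⟦ c u v ⟧ * (x v * x v)) ⟩
    B x u + diag x u ∎
    where
    open ≡-Reasoning
    same : Fin nV → Fin nV → ℕ
    same v v′ = ⟦ c u v ⟧ * (⟦ c u v′ ⟧ * ⟦ id v ≡ᵇ id v′ ⟧) * (x v * x v′)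
    l1 : ∀ a b x y → a * x * (b * y) ≡ a * (b * 1) * (x * y) + a * (b * 0) * (x * y)
    l1 = solve-∀
    l2 : ∀ a b x y → a * x * (b * y) ≡ a * (b * 0) * (x * y) + a * (b * 1) * (x * y)
    l2 = solve-∀
    l3 : ∀ a b x → a * (b * 0) * x ≡ 0
    l3 = solve-∀
    pt : ∀ v v′ → ⟦ c u v ⟧ * x v * (⟦ c u v′ ⟧ * x v′) ≡ e u v v′ * (x v * x v′) + same v v′
    pt v v′ with id v ≡ᵇ id v′
    ... | true = l2 ⟦ c u v ⟧ ⟦ c u v′ ⟧ (x v) (x v′)
    ... | false = l1 ⟦ c u v ⟧ ⟦ c u v′ ⟧ (x v) (x v′)
    off : ∀ v v′ → v′ ≢ v → same v v′ ≡ 0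
    off v v′ ne rewrite ≡ᵇ-false {id v} {id v′} (λ q → ne (sym (id-inj v v′ q))) = l3 ⟦ c u v ⟧ ⟦ c u v′ ⟧ (x v * x v′)
    on : ∀ v → same v v ≡ ⟦ c u v ⟧ * (x v * x v)
    on v rewrite ≡ᵇ-true {id v} refl with c u v
    ... | true = refl
    ... | false = refl
    row : ∀ v → ⟦ c u v ⟧ * x v * X x u ≡ ∑ (λ v′ → e u v v′ * (x v * x v′)) + ⟦ c u v ⟧ * (x v * x v)
    row v = trans (∑-*ˡ (⟦ c u v ⟧ * x v) (λ v′ → ⟦ c u v′ ⟧ * x v′)) (trans (∑-cong (pt v))
      (trans (∑-+ (λ v′ → e u v v′ * (x v * x v′)) (same v)) (cong (∑ (λ v′ → e u v v′ * (x v * x v′)) +_)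
        (trans (∑-single v (off v)) (on v)))))

  module _ (W : ℕ) where
    -- The linear coefficient of the potential after multiplication by 16·W², where x/W is the
    -- fractional value.
    value : Fin nV → ℕ
    value v = 16 * W * ∑ (λ u → ⟦ c u v ⟧)

    ∑value : ∀ x → ∑ (λ v → value v * x v) ≡ 16 * W * ∑ (X x)
    ∑value x = begin
      ∑ (λ v → 16 * W * ∑ (λ u → ⟦ c u v ⟧) * x v)          ≡⟨ ∑-cong (λ v → trans (*-assoc (16 * W) _ (x v)) (cong (16 * W *_) (∑-*ʳ (x v) (λ u → ⟦ c u v ⟧)))) ⟩
      ∑ (λ v → 16 * W * ∑ (λ u → ⟦ c u v ⟧ * x v))          ≡⟨ ∑-*ˡ (16 * W) (λ v → ∑ (λ u → ⟦ c u v ⟧ * x v)) ⟨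
      16 * W * ∑ (λ v → ∑ (λ u → ⟦ c u v ⟧ * x v))          ≡⟨ cong (16 * W *_) (∑-swap (λ u v → ⟦ c u v ⟧ * x v)) ⟨
      16 * W * ∑ (X x)                                      ∎
      where open ≡-Reasoning

    module _ (U : Fin nU → Bool) (c⇒U : ∀ u v → c u v ≡ true → U u ≡ true) where

      X≡0 : ∀ x u → U u ≡ false → X x u ≡ 0
      X≡0 x u p = ∑-zero λ v → h v
        where
        h : ∀ v → ⟦ c u v ⟧ * x v ≡ 0
        h v with c u v in q
        ... | false = refl
        ... | true with trans (sym p) (c⇒U u v q)
        ... | ()

      diag≤ : ∀ x u → (∀ v → x v ≤ W) → diag x u ≤ W * X x u
      diag≤ x u h = ≤-trans (∑-mono λ v → ≤-trans (*-monoʳ-≤ ⟦ c u v ⟧ (*-monoˡ-≤ (x v) (h v))) (≤-reflexive (lem ⟦ c u v ⟧ W (x v))))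
        (≤-reflexive (sym (∑-*ˡ W (λ v → ⟦ c u v ⟧ * x v))))
        where
        lem : ∀ a b c → a * (b * c) ≡ b * (a * c)
        lem = solve-∀

      -- From (X − 3W)² ≥ 0.
      quad-bound : ∀ x → (∀ v → x v ≤ W) → ∀ p →
        8 * ∑ (B x) + p ≤ 16 * W * ∑ (X x) + 2 * (W * W) * ∑ (λ u → ⟦ U u ⟧) →
        8 * ∑ (B x) ≤ 52 * (W * W) * ∑ (λ u → ⟦ U u ⟧)
      quad-bound x x≤ p h = *-cancelˡ-≤ 3 (begin
        3 * (8 * β)                          ≤⟨ *-monoʳ-≤ 3 h₁ ⟩
        3 * (16 * W * ξ + 2 * (W * W) * f)   ≡⟨ l4 W ξ f ⟩
        2 * (24 * (W * ξ)) + 6 * (W * W) * f ≤⟨ +-monoˡ-≤ _ (*-monoʳ-≤ 2 h₃) ⟩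
        -- The coefficient 148 + 6 = 154 is rounded up to 156 = 3·52.
        2 * (74 * (W * W) * f) + 6 * (W * W) * f ≤⟨ m≤m+n _ (2 * (W * W) * f) ⟩
        2 * (74 * (W * W) * f) + 6 * (W * W) * f + 2 * (W * W) * f ≡⟨ l5 (W * W) f ⟩
        3 * (52 * (W * W) * f)               ∎)
        where
        open ≤-Reasoning
        β ξ f : ℕ
        β = ∑ (B x)
        ξ = ∑ (X x)
        f = ∑ (λ u → ⟦ U u ⟧)
        h₁ : 8 * β ≤ 16 * W * ξ + 2 * (W * W) * f
        h₁ = ≤-trans (m≤m+n (8 * β) p) h
        l1 : ∀ X W → 40 * (W * X) + 8 * (W * X) ≡ 8 * (2 * (X * (3 * W)))
        l1 = solve-∀
        l2 : ∀ B W X → 8 * (B + W * X + 3 * W * (3 * W)) ≡ 8 * B + 72 * (W * W) * 1 + 8 * (W * X)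
        l2 = solve-∀
        l4 : ∀ W ξ f → 3 * (16 * W * ξ + 2 * (W * W) * f) ≡ 2 * (24 * (W * ξ)) + 6 * (W * W) * f
        l4 = solve-∀
        l5 : ∀ q f → 2 * (74 * q * f) + 6 * q * f + 2 * q * f ≡ 3 * (52 * q * f)
        l5 = solve-∀
        l6 : ∀ W ξ → 24 * (W * ξ) + 16 * W * ξ ≡ 40 * (W * ξ)
        l6 = solve-∀
        l7 : ∀ W ξ f → 16 * W * ξ + 2 * (W * W) * f + 72 * (W * W) * f ≡ 74 * (W * W) * f + 16 * W * ξ
        l7 = solve-∀
        pt : ∀ u → 40 * (W * X x u) ≤ 8 * B x u + 72 * (W * W) * ⟦ U u ⟧
        pt u with U u in q
        ... | false = ≤-trans (≤-reflexive (trans (cong (λ z → 40 * (W * z)) (X≡0 x u q)) (cong (40 *_) (*-zeroʳ W)))) z≤n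
        ... | true = +-cancelʳ-≤ (8 * (W * X x u)) _ _ (begin
          40 * (W * X x u) + 8 * (W * X x u)              ≡⟨ l1 (X x u) W ⟩
          8 * (2 * (X x u * (3 * W)))                     ≤⟨ *-monoʳ-≤ 8 (2ab≤a²+b² (X x u) (3 * W)) ⟩
          8 * (X x u * X x u + 3 * W * (3 * W))           ≡⟨ cong (λ z → 8 * (z + 3 * W * (3 * W))) (X²≡B+diag x u) ⟩
          8 * (B x u + diag x u + 3 * W * (3 * W))        ≤⟨ *-monoʳ-≤ 8 (+-monoˡ-≤ _ (+-monoʳ-≤ (B x u) (diag≤ x u x≤))) ⟩
          8 * (B x u + W * X x u + 3 * W * (3 * W))       ≡⟨ l2 (B x u) W (X x u) ⟩
          8 * B x u + 72 * (W * W) * 1 + 8 * (W * X x u)  ∎)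
        h₂ : 40 * (W * ξ) ≤ 8 * β + 72 * (W * W) * f
        h₂ = begin
          40 * (W * ξ)                                    ≡⟨ cong (40 *_) (∑-*ˡ W (X x)) ⟩
          40 * ∑ (λ u → W * X x u)                        ≡⟨ ∑-*ˡ 40 (λ u → W * X x u) ⟩
          ∑ (λ u → 40 * (W * X x u))                      ≤⟨ ∑-mono pt ⟩
          ∑ (λ u → 8 * B x u + 72 * (W * W) * ⟦ U u ⟧)    ≡⟨ ∑-+ (λ u → 8 * B x u) (λ u → 72 * (W * W) * ⟦ U u ⟧) ⟩
          ∑ (λ u → 8 * B x u) + ∑ (λ u → 72 * (W * W) * ⟦ U u ⟧) ≡⟨ cong₂ _+_ (∑-*ˡ 8 (B x)) (∑-*ˡ (72 * (W * W)) (λ u → ⟦ U u ⟧)) ⟨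
          8 * β + 72 * (W * W) * f                        ∎
        h₃ : 24 * (W * ξ) ≤ 74 * (W * W) * f
        h₃ = +-cancelʳ-≤ (16 * W * ξ) _ _ (begin
          24 * (W * ξ) + 16 * W * ξ                       ≡⟨ l6 W ξ ⟩
          40 * (W * ξ)                                    ≤⟨ h₂ ⟩
          8 * β + 72 * (W * W) * f                        ≤⟨ +-monoˡ-≤ _ h₁ ⟩
          16 * W * ξ + 2 * (W * W) * f + 72 * (W * W) * f ≡⟨ l7 W ξ f ⟩
          74 * (W * W) * f + 16 * W * ξ                   ∎)

    -- (X − h)(3h − X) ≥ 0 for h ≤ X ≤ 2h = W.
    initial-bound : ∀ x h → W ≡ 2 * h → (F : Fin nU → Bool) →
      (∀ u → F u ≡ true → h ≤ X x u × X x u ≤ W) →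
      6 * (W * W) * ∑ (λ u → ⟦ F u ⟧) + 8 * ∑ (B x) ≤ 16 * W * ∑ (X x) + 8 * ∑ (λ u → ⟦ not (F u) ⟧ * B x u)
    initial-bound x h refl F hF = begin
      6 * (W * W) * ∑ (λ u → ⟦ F u ⟧) + 8 * ∑ (B x)
        ≡⟨ cong₂ _+_ (∑-*ˡ (6 * (W * W)) (λ u → ⟦ F u ⟧)) (∑-*ˡ 8 (B x)) ⟩
      ∑ (λ u → 6 * (W * W) * ⟦ F u ⟧) + ∑ (λ u → 8 * B x u)
        ≡⟨ ∑-+ (λ u → 6 * (W * W) * ⟦ F u ⟧) (λ u → 8 * B x u) ⟨
      ∑ (λ u → 6 * (W * W) * ⟦ F u ⟧ + 8 * B x u)
        ≤⟨ ∑-mono pt ⟩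
      ∑ (λ u → 16 * W * X x u + 8 * (⟦ not (F u) ⟧ * B x u))
        ≡⟨ ∑-+ (λ u → 16 * W * X x u) (λ u → 8 * (⟦ not (F u) ⟧ * B x u)) ⟩
      ∑ (λ u → 16 * W * X x u) + ∑ (λ u → 8 * (⟦ not (F u) ⟧ * B x u))
        ≡⟨ cong₂ _+_ (∑-*ˡ (16 * W) (X x)) (∑-*ˡ 8 (λ u → ⟦ not (F u) ⟧ * B x u)) ⟨
      16 * W * ∑ (X x) + 8 * ∑ (λ u → ⟦ not (F u) ⟧ * B x u) ∎
      where
      open ≤-Reasoning
      l0 : ∀ q B → q * 0 + 8 * B ≡ 8 * (1 * B)
      l0 = solve-∀
      l1 : ∀ h d → 6 * (2 * h * (2 * h)) * 1 + 8 * ((h + d) * (h + d)) + 8 * (d * (h + h)) ≡ 16 * (2 * h) * (h + d) + 8 * (d * d)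
      l1 = solve-∀
      key : ∀ h d → h + d ≤ 2 * h → 6 * (2 * h * (2 * h)) * 1 + 8 * ((h + d) * (h + d)) ≤ 16 * (2 * h) * (h + d)
      key h d l = +-cancelʳ-≤ (8 * (d * (h + h))) _ _ (≤-trans (≤-reflexive (l1 h d))
        (+-monoʳ-≤ (16 * (2 * h) * (h + d)) (*-monoʳ-≤ 8 (*-monoʳ-≤ d (≤-trans (m≤n+m d h) (≤-trans l (≤-reflexive (cong (h +_) (+-identityʳ h)))))))))
      pt : ∀ u → 6 * (2 * h * (2 * h)) * ⟦ F u ⟧ + 8 * B x u ≤ 16 * (2 * h) * X x u + 8 * (⟦ not (F u) ⟧ * B x u)
      pt u with F u in q
      ... | false = ≤-trans (≤-reflexive (l0 (6 * (2 * h * (2 * h))) (B x u))) (m≤n+m _ (16 * (2 * h) * X x u))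
      ... | true with hF u q
      ... | a , b = ≤-trans (+-monoʳ-≤ (6 * (2 * h * (2 * h)) * 1) (*-monoʳ-≤ 8 (≤-trans (m≤m+n (B x u) (diag x u)) (≤-reflexive (sym (X²≡B+diag x u))))))
        (≤-trans (subst (λ z → 6 * (2 * h * (2 * h)) * 1 + 8 * (z * z) ≤ 16 * (2 * h) * z) (m+[n∸m]≡n a)
          (key h (X x u ∸ h) (≤-trans (≤-reflexive (m+[n∸m]≡n a)) b)))
        (m≤m+n _ (8 * (0 * B x u))))

    -- For k sets of u chosen, 2k − k(k−1) ≤ 2.
    final-bound : ∀ x (ch : Fin nV → Bool) → (∀ v → x v ≡ ⟦ ch v ⟧ * W) → (Z : Fin nU → Bool) →
      (∀ u v → c u v ≡ true → ch v ≡ true → Z u ≡ true) →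
      16 * W * ∑ (X x) ≤ 16 * (W * W) * ∑ (λ u → ⟦ Z u ⟧) + 8 * ∑ (B x)
    final-bound x ch hx Z hZ = begin
      16 * W * ∑ (X x)                                        ≡⟨ ∑-*ˡ (16 * W) (X x) ⟩
      ∑ (λ u → 16 * W * X x u)                                ≤⟨ ∑-mono pt ⟩
      ∑ (λ u → 16 * (W * W) * ⟦ Z u ⟧ + 8 * B x u)            ≡⟨ ∑-+ (λ u → 16 * (W * W) * ⟦ Z u ⟧) (λ u → 8 * B x u) ⟩
      ∑ (λ u → 16 * (W * W) * ⟦ Z u ⟧) + ∑ (λ u → 8 * B x u)  ≡⟨ cong₂ _+_ (∑-*ˡ (16 * (W * W)) (λ u → ⟦ Z u ⟧)) (∑-*ˡ 8 (B x)) ⟨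
      16 * (W * W) * ∑ (λ u → ⟦ Z u ⟧) + 8 * ∑ (B x)          ∎
      where
      open ≤-Reasoning
      k : Fin nU → ℕ
      k u = ∑ λ v → ⟦ c u v ⟧ * ⟦ ch v ⟧
      X≡ : ∀ u → X x u ≡ k u * W
      X≡ u = trans (∑-cong λ v → trans (cong (⟦ c u v ⟧ *_) (hx v)) (sym (*-assoc ⟦ c u v ⟧ ⟦ ch v ⟧ W)))
        (sym (∑-*ʳ W (λ v → ⟦ c u v ⟧ * ⟦ ch v ⟧)))
      sq : ∀ b W → ⟦ b ⟧ * W * (⟦ b ⟧ * W) ≡ W * (⟦ b ⟧ * W)
      sq true W = cong (_* (1 * W)) (*-identityˡ W)
      sq false W = sym (*-zeroʳ W)
      l1 : ∀ a b c → a * (b * c) ≡ b * (a * c)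
      l1 = solve-∀
      diag≡ : ∀ u → diag x u ≡ W * X x u
      diag≡ u = trans (∑-cong λ v → trans (cong (⟦ c u v ⟧ *_)
          (trans (cong₂ _*_ (hx v) (hx v)) (trans (sq (ch v) W) (cong (W *_) (sym (hx v))))))
          (l1 ⟦ c u v ⟧ W (x v))) (sym (∑-*ˡ W (λ v → ⟦ c u v ⟧ * x v)))
      l2 : ∀ W k → 16 * W * (k * W) + 8 * (W * (k * W)) ≡ 8 * (W * W) * (3 * k)
      l2 = solve-∀
      l3 : ∀ W k z → 8 * (W * W) * (2 * z + k * k) ≡ 16 * (W * W) * z + 8 * (k * W * (k * W))
      l3 = solve-∀
      l4 : ∀ q B D → 16 * q + 8 * (B + D) ≡ 16 * q + 8 * B + 8 * D
      l4 = solve-∀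
      arith : ∀ k → 3 * suc k ≤ 2 * 1 + suc k * suc k
      arith zero = ≤-refl
      arith (suc k) = ≤-trans (m≤m+n _ (k + k * k)) (≤-reflexive (lem k))
        where
        lem : ∀ k → 3 * suc (suc k) + (k + k * k) ≡ 2 * 1 + suc (suc k) * suc (suc k)
        lem = solve-∀
      small : ∀ u → 3 * k u ≤ 2 * ⟦ Z u ⟧ + k u * k u
      small u with Z u in q | k u in r
      ... | _ | zero = z≤n
      ... | true | suc j = arith j
      ... | false | suc j = ⊥-elim (0≢1+n (trans (sym (∑-zero {f = λ v → ⟦ c u v ⟧ * ⟦ ch v ⟧} h)) r))
        where
        h : ∀ v → ⟦ c u v ⟧ * ⟦ ch v ⟧ ≡ 0
        h v with c u v in s | ch v in s′
        ... | false | _ = refl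
        ... | true | false = refl
        ... | true | true with trans (sym q) (hZ u v s s′)
        ... | ()
      pt : ∀ u → 16 * W * X x u ≤ 16 * (W * W) * ⟦ Z u ⟧ + 8 * B x u
      pt u = +-cancelʳ-≤ (8 * (W * X x u)) _ _ (begin
        16 * W * X x u + 8 * (W * X x u)                       ≡⟨ cong (λ z → 16 * W * z + 8 * (W * z)) (X≡ u) ⟩
        16 * W * (k u * W) + 8 * (W * (k u * W))               ≡⟨ l2 W (k u) ⟩
        8 * (W * W) * (3 * k u)                                ≤⟨ *-monoʳ-≤ (8 * (W * W)) (small u) ⟩
        8 * (W * W) * (2 * ⟦ Z u ⟧ + k u * k u)                ≡⟨ l3 W (k u) ⟦ Z u ⟧ ⟩
        16 * (W * W) * ⟦ Z u ⟧ + 8 * (k u * W * (k u * W))     ≡⟨ cong (λ z → 16 * (W * W) * ⟦ Z u ⟧ + 8 * (z * z)) (X≡ u) ⟨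
        16 * (W * W) * ⟦ Z u ⟧ + 8 * (X x u * X x u)           ≡⟨ cong (λ z → 16 * (W * W) * ⟦ Z u ⟧ + 8 * z) (trans (X²≡B+diag x u) (cong (B x u +_) (diag≡ u))) ⟩
        16 * (W * W) * ⟦ Z u ⟧ + 8 * (B x u + W * X x u)       ≡⟨ cong (16 * (W * W) * ⟦ Z u ⟧ +_) (*-distribˡ-+ 8 (B x u) (W * X x u)) ⟩
        16 * (W * W) * ⟦ Z u ⟧ + (8 * B x u + 8 * (W * X x u)) ≡⟨ +-assoc (16 * (W * W) * ⟦ Z u ⟧) _ _ ⟨
        16 * (W * W) * ⟦ Z u ⟧ + 8 * B x u + 8 * (W * X x u)   ∎)

-- The operations of the algorithm

-- `cov` tells whether the element is known to be covered, `θ` is the strict upper bound on the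
-- identifiers of the sets it counts, and `y` is its dual variable.
record US : Set where
  constructor us
  field
    cov : Bool
    θ y : ℕ
open US public

-- `ch` is the output and `x` the scaled fractional value. `col` is the proper colour kept for all
-- stages, `cls` the class built so far, `ψ` and `lab` are the colour and label of the current
-- stage.
record VS : Set where
  constructor vs
  field
    ch : Bool
    x col cls ψ lab : ℕ
open VS public

open Machine US VS public

lsum : ∀ {A : Set} → (A → ℕ) → List A → ℕ
lsum f [] = 0
lsum f (a ∷ l) = f a + lsum f l

nth : ∀ {A : Set} → List (List A) → ℕ → List A
nth [] i = []
nth (l ∷ ls) zero = l
nth (l ∷ ls) (suc i) = nth ls i

nth-applyUpTo : ∀ {A : Set} (f : ℕ → List A) k i → i < k → nth (applyUpTo f k) i ≡ f i
nth-applyUpTo f (suc k) zero p = refl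
nth-applyUpTo f (suc k) (suc i) p = nth-applyUpTo (f ∘ suc) k i (s≤s⁻¹ p)

f₀ f₁ f₂ f₃ : Msg → ℕ
f₀ (a ∷ _ ∷ _ ∷ _ ∷ []) = a
f₁ (_ ∷ a ∷ _ ∷ _ ∷ []) = a
f₂ (_ ∷ _ ∷ a ∷ _ ∷ []) = a
f₃ (_ ∷ _ ∷ _ ∷ a ∷ []) = a

msg : ℕ → Msg
msg a = a ∷ 0 ∷ 0 ∷ 0 ∷ []

msg₂ : ℕ → ℕ → Msg
msg₂ a b = a ∷ b ∷ 0 ∷ 0 ∷ []

viewSum : (ℕ → Msg → ℕ) → View → ℕ
viewSum f = lsum (λ p → f (proj₁ p) (proj₂ p))

-- A field of the receiver itself, recovered from the view: identifiers are distinct, so one term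
-- survives.
own : (Msg → ℕ) → ℕ → View → ℕ
own f r = viewSum (λ i m → ⟦ i ≡ᵇ r ⟧ * f m)

-- A failed search returns the bound itself, so a witness at the bound is found as well; an element
-- may have to count all of its sets.
first : (ℕ → Bool) → ℕ → ℕ
first p zero = 0
first p (suc k) = if p 0 then 0 else suc (first (p ∘ suc) k)

first-true : ∀ (p : ℕ → Bool) k N → N ≤ k → p N ≡ true → p (first p k) ≡ true
first-true p zero zero _ h = h
first-true p (suc k) N l h with p 0 in e
... | true = e
first-true p (suc k) zero l h | false with trans (sym e) h
... | ()
first-true p (suc k) (suc N) l h | false = first-true (p ∘ suc) k N (s≤s⁻¹ l) h

first-minimal : ∀ (p : ℕ → Bool) k i → i < first p k → p i ≡ false
first-minimal p (suc k) i l with p 0 in e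
first-minimal p (suc k) zero l | false = e
first-minimal p (suc k) (suc i) l | false = first-minimal (p ∘ suc) k i (s≤s⁻¹ l)

bitsOf : (ℕ → Bool) → ℕ → ℕ
bitsOf f zero = 0
bitsOf f (suc k) = ⟦ f 0 ⟧ + 2 * bitsOf (f ∘ suc) k

testBit : ℕ → ℕ → ℕ
testBit z zero = z % 2
testBit z (suc i) = testBit (z / 2) i

bitsOf< : ∀ f k → bitsOf f k < 2 ^ k
bitsOf< f zero = s≤s z≤n
bitsOf< f (suc k) = begin-strict
  ⟦ f 0 ⟧ + 2 * bitsOf (f ∘ suc) k   <⟨ s≤s (+-monoˡ-≤ _ (⟦⟧≤1 (f 0))) ⟩
  2 + 2 * bitsOf (f ∘ suc) k         ≡⟨ *-suc 2 (bitsOf (f ∘ suc) k) ⟨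
  2 * suc (bitsOf (f ∘ suc) k)       ≤⟨ *-monoʳ-≤ 2 (bitsOf< (f ∘ suc) k) ⟩
  2 * 2 ^ k                          ∎
  where open ≤-Reasoning

testBit-bitsOf : ∀ f k i → i < k → testBit (bitsOf f k) i ≡ ⟦ f i ⟧
testBit-bitsOf f (suc k) zero p = trans (cong (λ z → (⟦ f 0 ⟧ + z) % 2) (*-comm 2 (bitsOf (f ∘ suc) k)))
  (trans ([m+kn]%n≡m%n ⟦ f 0 ⟧ (bitsOf (f ∘ suc) k) 2) (m<n⇒m%n≡m (s≤s (⟦⟧≤1 (f 0)))))
testBit-bitsOf f (suc k) (suc i) p = trans (cong (λ z → testBit z i) e) (testBit-bitsOf (f ∘ suc) k i (s≤s⁻¹ p))
  where
  b = bitsOf (f ∘ suc) k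
  lt : ⟦ f 0 ⟧ % 2 + b * 2 % 2 < 2
  lt = subst (_< 2) (sym (trans (cong₂ _+_ (m<n⇒m%n≡m (s≤s (⟦⟧≤1 (f 0)))) (m*n%n≡0 b 2)) (+-identityʳ _))) (s≤s (⟦⟧≤1 (f 0)))
  e : (⟦ f 0 ⟧ + 2 * b) / 2 ≡ b
  e = trans (cong (λ z → (⟦ f 0 ⟧ + z) / 2) (*-comm 2 b))
    (trans (+-distrib-/ ⟦ f 0 ⟧ (b * 2) lt) (cong₂ _+_ (m<n⇒m/n≡0 (s≤s (⟦⟧≤1 (f 0)))) (m*n/n≡m b 2)))

-- The digits `suc a` are nonzero, so the number also determines the length of the list.
listCode : ℕ → List ℕ → ℕ
listCode z [] = 0
listCode z (a ∷ l) = suc a + 2 ^ z * listCode z l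

noReply : US → View → ℕ → ℕ → Msg
noReply _ _ _ _ = msg 0

keep : US → View → US
keep τ _ = τ

localOp : (VS → VS) → Op
localOp f = record { extra = 0 ; pub = λ _ → msg 0 ; rep = noReply ; upd = keep ; fin = λ s _ → f s }

unsatisfied : ℕ → US → View → Bool
unsatisfied M τ w = not (cov τ) ∧ (viewSum (λ _ → f₀) w <ᵇ M)

-- Writing 2^j is doubling: unsaturated elements only disappear, so a set that still has `lam` of
-- them had them in all earlier steps and stands at the value written last.
lpOp : (lam M j : ℕ) → Op
lpOp lam M j = record
  { extra = 0
  ; pub = λ s → msg (x s)
  ; rep = λ τ w r β → msg ⟦ unsatisfied M τ w ⟧
  ; upd = keep
  ; fin = λ s a → record s { x = if lam ≤ᵇ lsum f₀ (nth a 0) then 2 ^ j else x s }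
  }

prefixSum : View → ℕ → ℕ
prefixSum w k = viewSum (λ i m → ⟦ i <ᵇ k ⟧ * f₀ m) w

-- A saturated element may have received far more than M through sets raised for the sake of others.
-- Counting only the shortest prefix of identifiers that reaches M brings its total into [M, 2M],
-- where the potential is large. An element with `θ` = 0 counts nothing.
thresholdOp : (M N : ℕ) → Op
thresholdOp M N = record
  { extra = 0
  ; pub = λ s → msg (x s)
  ; rep = noReply
  ; upd = λ τ w → record τ { θ = if cov τ then 0 else (if M ≤ᵇ prefixSum w N then first (λ k → M ≤ᵇ prefixSum w k) N else 0) }
  ; fin = λ s _ → s
  }

pubAll : VS → Msg
pubAll s = x s ∷ cls s ∷ ψ s ∷ lab s ∷ []

-- The number of pairs that an entry (i , m) of the view w forms with
-- the receiver r among the counted active sets of the same class.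
pairWeight : (j : ℕ) → US → View → ℕ → ℕ → Msg → ℕ
pairWeight j τ w r i m =
  ⟦ r <ᵇ θ τ ⟧ * (⟦ i <ᵇ θ τ ⟧ * ⟦ not (r ≡ᵇ i) ⟧) *
  (⟦ own f₀ r w ≡ᵇ 2 ^ j ⟧ * ⟦ f₀ m ≡ᵇ 2 ^ j ⟧) * ⟦ own f₁ r w ≡ᵇ f₁ m ⟧

reduceH : ℕ → US → View → ℕ → ℕ
reduceH j τ w r = viewSum (λ i m → pairWeight j τ w r i m * ⟦ not (own f₂ r w ≡ᵇ f₂ m) ⟧) w

reduceCnt : ℕ → (d b : ℕ) → US → View → ℕ → ℕ → ℕ
reduceCnt j d b τ w r α = viewSum (λ i m → pairWeight j τ w r i m *
  (⟦ not (own f₂ r w ≡ᵇ f₂ m) ⟧ * ⟦ encode d b (own f₂ r w) α ≡ᵇ encode d b (f₂ m) α ⟧)) w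

reduceCost : ℕ → List (List Msg) → ℕ → ℕ
reduceCost wd a α = lsum (λ m → testBit (f₁ m) (α % suc wd) * f₀ m) (nth a (α / suc wd))

-- Position k + β·suc wd is bit k of block β.
reduceOp : (j d b r wd blk : ℕ) → Op
reduceOp j d b r wd blk = record
  { extra = blk
  ; pub = pubAll
  ; rep = λ τ w i β → msg₂ (reduceH j τ w i)
      (bitsOf (λ k → reduceH j τ w i <ᵇ r * reduceCnt j d b τ w i (k + β * suc wd)) (suc wd))
  ; upd = keep
  ; fin = λ s a → let α = best (reduceCost wd a) (codeLength (2 ^ d) b) in
      record s { ψ = α * (4 * 2 ^ d) + encode d b (ψ s) α }
  }

-- The turn of colour `i`. In block β an element reports how many conflicting sets of earlier
-- colours carry label β.
labelOp : (j ρ i : ℕ) → Op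
labelOp j ρ i = record
  { extra = ρ
  ; pub = pubAll
  ; rep = λ τ w r β → msg (viewSum (λ k m → pairWeight j τ w r k m * (⟦ f₂ m <ᵇ i ⟧ * ⟦ f₃ m ≡ᵇ β ⟧)) w)
  ; upd = keep
  ; fin = λ s a → record s { lab = if ψ s ≡ᵇ i then best (λ β → lsum f₀ (nth a β)) ρ else lab s }
  }

-- The two reply fields add up to the number of elements that count the set and to the sum `G` over
-- its conflicts, which is all that the sign of the derivative needs.
roundOp : (lam W j κ : ℕ) → Op
roundOp lam W j κ = record
  { extra = 0
  ; pub = λ s → msg (x s)
  ; rep = λ τ w r β → msg₂ ⟦ r <ᵇ θ τ ⟧
      (⟦ r <ᵇ θ τ ⟧ * viewSum (λ i m → ⟦ i <ᵇ θ τ ⟧ * ⟦ not (r ≡ᵇ i) ⟧ * f₀ m) w)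
  ; upd = keep
  ; fin = λ s a → record s { x = if (x s ≡ᵇ 2 ^ j) ∧ (cls s ≡ᵇ κ)
      then (if 16 * lsum f₁ (nth a 0) + lam * W ≤ᵇ 16 * W * lsum f₀ (nth a 0) then 2 * 2 ^ j else 0)
      else x s }
  }

commitOp : ℕ → Op
commitOp W = record
  { extra = 0
  ; pub = λ s → msg ⟦ x s ≡ᵇ W ⟧
  ; rep = noReply
  ; upd = λ τ w → record τ { cov = cov τ ∨ (0 <ᵇ viewSum (λ _ → f₀) w) }
  ; fin = λ s _ → record s { ch = ch s ∨ (x s ≡ᵇ W) ; x = 0 }
  }

finishOp : ℕ → Op
finishOp N = record
  { extra = 0
  ; pub = λ _ → msg 0
  ; rep = λ τ w r β → msg (⟦ not (cov τ) ⟧ * ⟦ first (λ k → 0 <ᵇ viewSum (λ i _ → ⟦ i ≡ᵇ k ⟧) w) N ≡ᵇ r ⟧)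
  ; upd = keep
  ; fin = λ s a → record s { ch = ch s ∨ (0 <ᵇ lsum f₀ (nth a 0)) }
  }

clashes : (d b : ℕ) → View → ℕ → ℕ
clashes d b w α = viewSum (λ i m → viewSum (λ i′ m′ →
  ⟦ not (i ≡ᵇ i′) ⟧ * ⟦ encode d b (f₀ m) α ≡ᵇ encode d b (f₀ m′) α ⟧) w) w

-- One step of the preliminary proper colouring: each element picks a
-- position at which the codewords of all its sets differ, and the new colour
-- of a set lists, for its elements, these positions and letters.
recolourOp : (d b z : ℕ) → Op
recolourOp d b z = record
  { extra = 0
  ; pub = λ s → msg (col s)
  ; rep = λ τ w r β → msg (best (clashes d b w) (codeLength (2 ^ d) b))
  ; upd = keep
  ; fin = λ s a → record s { col = listCode z
      (map (λ m → f₀ m * (4 * 2 ^ d) + encode d b (col s) (f₀ m)) (nth a 0)) }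
  }

-- The value 0 means that the variable has not started; once a set of the element is chosen, the
-- variable is frozen.
dualY : US → View → ℕ
dualY τ w = if y τ ≡ᵇ 0 then 1 else (if 0 <ᵇ viewSum (λ _ → f₀) w then y τ else 2 * y τ)

dualOp : ℕ → Op
dualOp M = record
  { extra = 0
  ; pub = λ s → msg ⟦ ch s ⟧
  ; rep = λ τ w r β → msg (dualY τ w)
  ; upd = λ τ w → record τ { y = dualY τ w }
  ; fin = λ s a → record s { ch = ch s ∨ (M ≤ᵇ lsum f₀ (nth a 0)) }
  }

lsum-cong : ∀ {A : Set} {f g : A → ℕ} → (∀ a → f a ≡ g a) → ∀ l → lsum f l ≡ lsum g l
lsum-cong h [] = refl
lsum-cong h (a ∷ l) = cong₂ _+_ (h a) (lsum-cong h l)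

lsum-map-filter : ∀ {A B : Set} (f : B → ℕ) (g : A → B) (p : A → Bool) {n} (h : Fin n → A) →
  lsum f (map g (filterᵇ p (tabulate h))) ≡ ∑ (λ i → ⟦ p (h i) ⟧ * f (g (h i)))
lsum-map-filter f g p {zero} h = refl
lsum-map-filter f g p {suc n} h with p (h fz)
... | true = cong₂ _+_ (sym (*-identityˡ _)) (lsum-map-filter f g p (h ∘ fs))
... | false = lsum-map-filter f g p (h ∘ fs)

lsum-allFin : ∀ {B : Set} {n} (f : B → ℕ) (g : Fin n → B) (p : Fin n → Bool) →
  lsum f (map g (filterᵇ p (allFin n))) ≡ ∑ (λ i → ⟦ p i ⟧ * f (g i))
lsum-allFin f g p = lsum-map-filter f g p id

-- Sums over views and replies as sums over the graph

record Network : Set where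
  field
    nU nV     : ℕ
    adj       : Fin nU → Fin nV → Bool
    idV       : Fin nV → ℕ
    idV-inj   : ∀ v v′ → idV v ≡ idV v′ → v ≡ v′

guard-cong : ∀ b {x y : ℕ} → (b ≡ true → x ≡ y) → ⟦ b ⟧ * x ≡ ⟦ b ⟧ * y
guard-cong true h = cong (1 *_) (h refl)
guard-cong false h = refl

guard-zero : ∀ b {x y : ℕ} → (b ≡ true → x ≡ y) → (b ≡ false → y ≡ 0) → ⟦ b ⟧ * x ≡ y
guard-zero true h _ = trans (*-identityˡ _) (h refl)
guard-zero false _ h = sym (h refl)

guard-≤ : ∀ b x → ⟦ b ⟧ * x ≤ x
guard-≤ true x = ≤-reflexive (*-identityˡ x)
guard-≤ false x = z≤n

⟦∧⟧ : ∀ a b → ⟦ a ∧ b ⟧ ≡ ⟦ a ⟧ * ⟦ b ⟧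
⟦∧⟧ true b = sym (*-identityˡ _)
⟦∧⟧ false b = refl

∧-true : ∀ {a b} → a ∧ b ≡ true → a ≡ true × b ≡ true
∧-true {true} {true} _ = refl , refl

module Semantics (N : Network) (Bd : ℕ) where
  open Network N public
  open Exec nU nV adj idV Bd public
  open Loops nU nV adj idV Bd public

  view-sum : ∀ (f : ℕ → Msg → ℕ) o g u →
    viewSum f (view o g u) ≡ ∑ (λ v → ⟦ adj u v ⟧ * f (idV v) (Op.pub o (proj₂ g v)))
  view-sum f o g u = lsum-allFin (λ p → f (proj₁ p) (proj₂ p)) (λ v → idV v , Op.pub o (proj₂ g v)) (adj u)

  replies-sum : ∀ (f : Msg → ℕ) o g v β →
    lsum f (replies o g v β) ≡ ∑ (λ u → ⟦ adj u v ⟧ * f (Op.rep o (proj₁ g u) (view o g u) (idV v) β))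
  replies-sum f o g v β = lsum-allFin f (λ u → Op.rep o (proj₁ g u) (view o g u) (idV v) β) (λ u → adj u v)

  ∑-at : ∀ u v (h : Fin nV → ℕ) → adj u v ≡ true →
    ∑ (λ v′ → ⟦ adj u v′ ⟧ * (⟦ idV v′ ≡ᵇ idV v ⟧ * h v′)) ≡ h v
  ∑-at u v h a = trans (∑-single v off) on
    where
    on : ⟦ adj u v ⟧ * (⟦ idV v ≡ᵇ idV v ⟧ * h v) ≡ h v
    on rewrite a | ≡ᵇ-true {idV v} refl = trans (*-identityˡ _) (*-identityˡ _)
    off : ∀ v′ → v′ ≢ v → ⟦ adj u v′ ⟧ * (⟦ idV v′ ≡ᵇ idV v ⟧ * h v′) ≡ 0
    off v′ ne rewrite ≡ᵇ-false {idV v′} {idV v} (λ q → ne (idV-inj v′ v q)) = *-zeroʳ ⟦ adj u v′ ⟧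

  own-view : ∀ (f : Msg → ℕ) o g u v → adj u v ≡ true → own f (idV v) (view o g u) ≡ f (Op.pub o (proj₂ g v))
  own-view f o g u v a = trans (view-sum (λ i m → ⟦ i ≡ᵇ idV v ⟧ * f m) o g u) (∑-at u v (λ v′ → f (Op.pub o (proj₂ g v′))) a)

  Cover : (Fin nV → Bool) → Set
  Cover S = ∀ u → ∃ λ v → S v ≡ true × adj u v ≡ true

  -- The lower bound on the optimum: each set of a cover accounts for at most `r` of the elements in
  -- `P`.
  charge : ∀ (P : Fin nU → Bool) S → Cover S → ∀ r → (∀ v → ∑ (λ u → ⟦ adj u v ⟧ * ⟦ P u ⟧) ≤ r) →
    ∑ (λ u → ⟦ P u ⟧) ≤ r * ∑ (λ v → ⟦ S v ⟧)
  charge P S cov r h = begin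
    ∑ (λ u → ⟦ P u ⟧)                                       ≤⟨ ∑-mono one ⟩
    ∑ (λ u → ∑ λ v → ⟦ S v ⟧ * (⟦ adj u v ⟧ * ⟦ P u ⟧))     ≡⟨ ∑-swap (λ u v → ⟦ S v ⟧ * (⟦ adj u v ⟧ * ⟦ P u ⟧)) ⟩
    ∑ (λ v → ∑ λ u → ⟦ S v ⟧ * (⟦ adj u v ⟧ * ⟦ P u ⟧))     ≡⟨ ∑-cong (λ v → sym (∑-*ˡ ⟦ S v ⟧ (λ u → ⟦ adj u v ⟧ * ⟦ P u ⟧))) ⟩
    ∑ (λ v → ⟦ S v ⟧ * ∑ (λ u → ⟦ adj u v ⟧ * ⟦ P u ⟧))     ≤⟨ ∑-mono (λ v → *-monoʳ-≤ ⟦ S v ⟧ (h v)) ⟩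
    ∑ (λ v → ⟦ S v ⟧ * r)                                   ≡⟨ ∑-*ʳ r (λ v → ⟦ S v ⟧) ⟨
    ∑ (λ v → ⟦ S v ⟧) * r                                   ≡⟨ *-comm _ r ⟩
    r * ∑ (λ v → ⟦ S v ⟧)                                   ∎
    where
    open ≤-Reasoning
    one : ∀ u → ⟦ P u ⟧ ≤ ∑ (λ v → ⟦ S v ⟧ * (⟦ adj u v ⟧ * ⟦ P u ⟧))
    one u with cov u
    ... | v , s , a = ≤-trans (≤-reflexive e) (term≤∑ (λ v → ⟦ S v ⟧ * (⟦ adj u v ⟧ * ⟦ P u ⟧)) v)
      where
      e : ⟦ P u ⟧ ≡ ⟦ S v ⟧ * (⟦ adj u v ⟧ * ⟦ P u ⟧)
      e rewrite s | a = sym (trans (*-identityˡ _) (*-identityˡ _))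

  fits-msg : ∀ {a} → a < Bd → Fits Bd (msg a)
  fits-msg p = p ∷ q ∷ q ∷ q ∷ []
    where q = ≤-trans (s≤s z≤n) p

  fits-msg₂ : ∀ {a b} → a < Bd → b < Bd → Fits Bd (msg₂ a b)
  fits-msg₂ p p′ = p ∷ p′ ∷ q ∷ q ∷ []
    where q = ≤-trans (s≤s z≤n) p

  localOp-legal : 0 < Bd → ∀ f g → Legal (localOp f) g
  localOp-legal p f g = (λ v → fits-msg p) , (λ u v β → fits-msg p)

-- Doubling of dual variables for t ≤ log s

module Dual (N : Network) (Bd : ℕ) where
  open Semantics N Bd

  module _ (k t : ℕ) (degV : ∀ v → ∑ (λ u → ⟦ adj u v ⟧) ≤ 2 ^ k)
           (degU : ∀ u → ∑ (λ v → ⟦ adj u v ⟧) ≤ t) (W<Bd : 2 ^ k < Bd) where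

    chosen : Global → Fin nV → Bool
    chosen g v = ch (proj₂ g v)

    load : Global → Fin nV → ℕ
    load g v = ∑ λ u → ⟦ adj u v ⟧ * y (proj₁ g u)

    hit : Global → Fin nU → Bool
    hit g u = 0 <ᵇ ∑ (λ v → ⟦ adj u v ⟧ * ⟦ chosen g v ⟧)

    hit-true : ∀ g u v → adj u v ≡ true → chosen g v ≡ true → hit g u ≡ true
    hit-true g u v a c = <ᵇ-true (≤-trans (≤-reflexive e) (term≤∑ (λ v → ⟦ adj u v ⟧ * ⟦ chosen g v ⟧) v))
      where
      e : 1 ≡ ⟦ adj u v ⟧ * ⟦ chosen g v ⟧
      e rewrite a | c = refl

    hit-false : ∀ g u v → adj u v ≡ true → hit g u ≡ false → chosen g v ≡ false
    hit-false g u v a h with chosen g v in c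
    ... | false = refl
    ... | true with trans (sym (hit-true g u v a c)) h
    ... | ()

    record DualInv (value : ℕ) (g : Global) : Set where
      field
        load≤  : ∀ v → load g v ≤ 2 * 2 ^ k
        full   : ∀ v → chosen g v ≡ true → 2 ^ k ≤ load g v
        spare  : ∀ v → chosen g v ≡ false → load g v < 2 ^ k
        y-open : ∀ u → hit g u ≡ false → y (proj₁ g u) ≡ value
        y≤     : ∀ u → y (proj₁ g u) ≤ value
    open DualInv

    -- Treats the start, where all variables go from 0 to 1, together with the doublings. The load
    -- of a chosen set stays, because all its elements are frozen; every other load was below 2^k
    -- and at most doubles.
    step : ∀ g value value′ → value′ ≡ (if value ≡ᵇ 0 then 1 else 2 * value) →
      (value ≡ 0 → ∀ u → hit g u ≡ false) → (0 < value → ∀ u → y (proj₁ g u) ≢ 0) → value′ ≤ 2 ^ k →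
      DualInv value g → Legal (dualOp (2 ^ k)) g × DualInv value′ (exec (dualOp (2 ^ k)) g)
        × (∀ u → y (proj₁ (exec (dualOp (2 ^ k)) g) u) ≢ 0)
    step g value value′ refl start pos v≤ I = legal , inv , nz
      where
      o = dualOp (2 ^ k)
      g′ = exec o g
      new : Fin nU → ℕ
      new u = if y (proj₁ g u) ≡ᵇ 0 then 1 else (if hit g u then y (proj₁ g u) else 2 * y (proj₁ g u))
      new≡ : ∀ u → dualY (proj₁ g u) (view o g u) ≡ new u
      new≡ u = cong (λ z → if y (proj₁ g u) ≡ᵇ 0 then 1 else (if 0 <ᵇ z then y (proj₁ g u) else 2 * y (proj₁ g u)))
        (view-sum (λ _ → f₀) o g u)
      load′ : ∀ v → load g′ v ≡ ∑ (λ u → ⟦ adj u v ⟧ * new u)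
      load′ v = ∑-cong λ u → cong (⟦ adj u v ⟧ *_) (new≡ u)
      sum′ : ∀ v → lsum f₀ (replies o g v 0) ≡ load g′ v
      sum′ v = replies-sum f₀ o g v 0
      new-hit : ∀ u → hit g u ≡ true → y (proj₁ g u) ≢ 0 → new u ≡ y (proj₁ g u)
      new-hit u h ne rewrite ≡ᵇ-false ne | h = refl
      case : value ≡ 0 ⊎ 0 < value
      case = zero∨pos value
      new-open : ∀ u → hit g u ≡ false → new u ≡ value′
      new-open u h rewrite y-open I u h | h = refl
      new≤value′ : ∀ u → new u ≤ value′
      new≤value′ u with hit g u in h
      ... | false rewrite y-open I u h = ≤-refl
      ... | true with case
      ... | inj₁ z with trans (sym h) (start z u)
      ... | ()
      new≤value′ u | true | inj₂ p rewrite ≡ᵇ-false (pos p u) | ≡ᵇ-false (λ q → <⇒≢ p (sym q)) =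
        ≤-trans (y≤ I u) (m≤m+n _ _)
      legal : Legal o g
      legal = (λ v → fits-msg (≤-<-trans (⟦⟧≤1 _) (≤-<-trans (m^n>0 2 k) W<Bd))) ,
        (λ u v β → fits-msg (≤-<-trans (≤-trans (≤-reflexive (new≡ u)) (≤-trans (new≤value′ u) v≤)) W<Bd))
      new-nz : ∀ u → new u ≢ 0
      new-nz u with ≡ᵇ-cases (y (proj₁ g u)) 0
      ... | inj₁ (_ , t) rewrite t = λ ()
      ... | inj₂ (ne , t) rewrite t with hit g u
      ... | true = ne
      ... | false = λ q → ne (m+n≡0⇒m≡0 (y (proj₁ g u)) q)
      nz : ∀ u → y (proj₁ g′ u) ≢ 0
      nz u q = new-nz u (trans (sym (new≡ u)) q)
      new≤1 : value ≡ 0 → ∀ u → new u ≤ 1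
      new≤1 z u = ≤-trans (≤-reflexive (new-open u (start z u))) (≤-reflexive (cong (λ w → if w ≡ᵇ 0 then 1 else 2 * w) z))
      new≤2y : 0 < value → ∀ u → new u ≤ 2 * y (proj₁ g u)
      new≤2y p u rewrite ≡ᵇ-false (pos p u) with hit g u
      ... | true = m≤m+n _ _
      ... | false = ≤-refl
      frozen : ∀ v → chosen g v ≡ true → load g′ v ≡ load g v
      frozen v c = trans (load′ v) (∑-cong λ u → guard-cong (adj u v) λ a →
        let h = hit-true g u v a c in new-hit u h (ne u h))
        where
        ne : ∀ u → hit g u ≡ true → y (proj₁ g u) ≢ 0
        ne u h with case
        ... | inj₂ p = pos p u
        ... | inj₁ z with trans (sym h) (start z u)
        ... | ()
      bound : ∀ v → load g′ v ≤ 2 * 2 ^ k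
      bound v with chosen g v in c
      ... | true = ≤-trans (≤-reflexive (frozen v c)) (load≤ I v)
      ... | false with case
      ... | inj₁ z = begin
        load g′ v                         ≡⟨ load′ v ⟩
        ∑ (λ u → ⟦ adj u v ⟧ * new u)     ≤⟨ ∑-mono (λ u → *-monoʳ-≤ ⟦ adj u v ⟧ (new≤1 z u)) ⟩
        ∑ (λ u → ⟦ adj u v ⟧ * 1)         ≡⟨ ∑-cong (λ u → *-identityʳ ⟦ adj u v ⟧) ⟩
        ∑ (λ u → ⟦ adj u v ⟧)             ≤⟨ degV v ⟩
        2 ^ k                             ≤⟨ m≤m+n (2 ^ k) (1 * 2 ^ k) ⟩
        2 * 2 ^ k                         ∎
        where open ≤-Reasoning
      ... | inj₂ p = begin
        load g′ v                         ≡⟨ load′ v ⟩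
        ∑ (λ u → ⟦ adj u v ⟧ * new u)     ≤⟨ ∑-mono (λ u → ≤-trans (*-monoʳ-≤ ⟦ adj u v ⟧ (new≤2y p u)) (≤-reflexive (lem ⟦ adj u v ⟧ (y (proj₁ g u))))) ⟩
        ∑ (λ u → 2 * (⟦ adj u v ⟧ * y (proj₁ g u))) ≡⟨ ∑-*ˡ 2 (λ u → ⟦ adj u v ⟧ * y (proj₁ g u)) ⟨
        2 * load g v                      ≤⟨ *-monoʳ-≤ 2 (<⇒≤ (spare I v c)) ⟩
        2 * 2 ^ k                         ∎
        where
        open ≤-Reasoning
        lem : ∀ a b → a * (2 * b) ≡ 2 * (a * b)
        lem = solve-∀
      ch′ : ∀ v → chosen g′ v ≡ chosen g v ∨ (2 ^ k ≤ᵇ load g′ v)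
      ch′ v = cong (λ z → chosen g v ∨ (2 ^ k ≤ᵇ z)) (sum′ v)
      full′ : ∀ v → chosen g′ v ≡ true → 2 ^ k ≤ load g′ v
      full′ v c with ∨-true (chosen g v) (trans (sym (ch′ v)) c)
      ... | inj₁ c₀ = ≤-trans (full I v c₀) (≤-reflexive (sym (frozen v c₀)))
      ... | inj₂ e = ≤ᵇ⇒≤ _ _ (≡⇒T e)
      spare′ : ∀ v → chosen g′ v ≡ false → load g′ v < 2 ^ k
      spare′ v c = ≰⇒> λ p → true≢false (trans (sym (≤ᵇ-true p)) (proj₂ (∨-false (chosen g v) (trans (sym (ch′ v)) c))))
      hit-mono : ∀ u → hit g′ u ≡ false → hit g u ≡ false
      hit-mono u h = <ᵇ-false (≤-trans (∑-mono λ v → *-monoʳ-≤ ⟦ adj u v ⟧ (le v)) (≮⇒≥ λ p → true≢false (trans (sym (<ᵇ-true p)) h)))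
        where
        le : ∀ v → ⟦ chosen g v ⟧ ≤ ⟦ chosen g′ v ⟧
        le v = ⟦∨⟧≥ (chosen g v) _
          where
          ⟦∨⟧≥ : ∀ a b → ⟦ a ⟧ ≤ ⟦ a ∨ b ⟧
          ⟦∨⟧≥ true b = ≤-refl
          ⟦∨⟧≥ false b = z≤n
      inv : DualInv value′ g′
      load≤ inv = bound
      full inv = full′
      spare inv = spare′
      y-open inv u h = trans (new≡ u) (new-open u (hit-mono u h))
      y≤ inv u = ≤-trans (≤-reflexive (new≡ u)) (new≤value′ u)

    prog : List Op
    prog = for (suc k) (λ _ → dualOp (2 ^ k) ∷ [])

    -- The first step goes from 0 to 1, so `suc k` steps are needed to reach 2^k.
    I : ℕ → Global → Set
    I zero g = DualInv 0 g × (∀ u → hit g u ≡ false)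
    I (suc i) g = DualInv (2 ^ i) g × (∀ u → y (proj₁ g u) ≢ 0)

    I-step : ∀ i → i < suc k → Triple (I i) (dualOp (2 ^ k) ∷ []) (I (suc i))
    I-step zero _ = single {P = I 0} {Q = I 1} (dualOp (2 ^ k)) λ g p →
      let l , a , b = step g 0 1 refl (λ _ → proj₂ p) (λ ()) (m^n>0 2 k) (proj₁ p) in l , a , b
    I-step (suc i) i< = single {P = I (suc i)} {Q = I (suc (suc i))} (dualOp (2 ^ k)) λ g p →
      let l , a , b = step g (2 ^ i) (2 ^ suc i) (sym (val i)) (λ z → ⊥-elim (<⇒≢ (m^n>0 2 i) (sym z)))
            (λ _ → proj₂ p) (^-monoʳ-≤ 2 (s≤s⁻¹ i<)) (proj₁ p) in l , a , b
      where
      val : ∀ i → (if 2 ^ i ≡ᵇ 0 then 1 else 2 * 2 ^ i) ≡ 2 ^ suc i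
      val i rewrite ≡ᵇ-false (λ q → <⇒≢ (m^n>0 2 i) (sym q)) = refl

    Fresh : Global → Set
    Fresh g = (∀ u → y (proj₁ g u) ≡ 0) × (∀ v → chosen g v ≡ false)

    Result : ℕ → Global → Set
    Result a g = Cover (chosen g) × (∀ S → Cover S → ∑ (λ v → ⟦ chosen g v ⟧) ≤ a * ∑ (λ v → ⟦ S v ⟧))

    start : ∀ g → Fresh g → I 0 g
    start g (y0 , c0) = record
      { load≤ = λ v → ≤-trans (≤-reflexive (l0 v)) z≤n
      ; full = λ v c → ⊥-elim (true≢false (trans (sym c) (c0 v)))
      ; spare = λ v _ → ≤-<-trans (≤-reflexive (l0 v)) (m^n>0 2 k)
      ; y-open = λ u _ → y0 u
      ; y≤ = λ u → ≤-reflexive (y0 u)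
      } , λ u → <ᵇ-false (≤-reflexive (∑-zero λ v → trans (cong (λ z → ⟦ adj u v ⟧ * ⟦ z ⟧) (c0 v)) (*-zeroʳ ⟦ adj u v ⟧)))
      where
      l0 : ∀ v → load g v ≡ 0
      l0 v = ∑-zero λ u → trans (cong (⟦ adj u v ⟧ *_) (y0 u)) (*-zeroʳ ⟦ adj u v ⟧)

    -- Every load is at most 2·2^k while the chosen sets have load at least 2^k.
    finish : Cover (λ _ → true) → ∀ g → I (suc k) g → Result (2 * t) g
    finish feas g (J , _) = cover , small
      where
      cover : Cover (chosen g)
      cover u with hit g u in h
      ... | true = find (<ᵇ⇒< 0 _ (≡⇒T h))
        where
        find : 0 < ∑ (λ v → ⟦ adj u v ⟧ * ⟦ chosen g v ⟧) → ∃ λ v → chosen g v ≡ true × adj u v ≡ true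
        find p = let v , q = ∑-pos (λ v → ⟦ adj u v ⟧ * ⟦ chosen g v ⟧) p in v , both (adj u v) (chosen g v) q
          where
          both : ∀ a c → 0 < ⟦ a ⟧ * ⟦ c ⟧ → c ≡ true × a ≡ true
          both true true _ = refl , refl
      -- A variable that was never frozen has reached 2^k and fills any set of its element alone.
      ... | false with feas u
      ... | v , _ , a = ⊥-elim (<⇒≱ (spare J v (hit-false g u v a h))
        (≤-trans (≤-reflexive e) (term≤∑ (λ u → ⟦ adj u v ⟧ * y (proj₁ g u)) u)))
        where
        e : 2 ^ k ≡ ⟦ adj u v ⟧ * y (proj₁ g u)
        e rewrite a | y-open J u h = sym (*-identityˡ _)
      small : ∀ S → Cover S → ∑ (λ v → ⟦ chosen g v ⟧) ≤ 2 * t * ∑ (λ v → ⟦ S v ⟧)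
      small S cS = *-cancelˡ-≤ (2 ^ k) {{m^n≢0 2 k}} (begin
        2 ^ k * ∑ (λ v → ⟦ chosen g v ⟧)                    ≡⟨ ∑-*ˡ (2 ^ k) (λ v → ⟦ chosen g v ⟧) ⟩
        ∑ (λ v → 2 ^ k * ⟦ chosen g v ⟧)                    ≤⟨ ∑-mono pt ⟩
        ∑ (λ v → load g v)                                  ≡⟨ ∑-swap (λ v u → ⟦ adj u v ⟧ * y (proj₁ g u)) ⟩
        ∑ (λ u → ∑ λ v → ⟦ adj u v ⟧ * y (proj₁ g u))       ≡⟨ ∑-cong (λ u → sym (∑-*ʳ (y (proj₁ g u)) (λ v → ⟦ adj u v ⟧))) ⟩
        ∑ (λ u → ∑ (λ v → ⟦ adj u v ⟧) * y (proj₁ g u))     ≤⟨ ∑-mono (λ u → *-monoˡ-≤ (y (proj₁ g u)) (degU u)) ⟩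
        ∑ (λ u → t * y (proj₁ g u))                         ≡⟨ ∑-*ˡ t (λ u → y (proj₁ g u)) ⟨
        t * ∑ (λ u → y (proj₁ g u))                         ≤⟨ *-monoʳ-≤ t (∑-mono pay) ⟩
        t * ∑ (λ u → ∑ λ v → ⟦ S v ⟧ * (⟦ adj u v ⟧ * y (proj₁ g u))) ≡⟨ cong (t *_) (∑-swap (λ u v → ⟦ S v ⟧ * (⟦ adj u v ⟧ * y (proj₁ g u)))) ⟩
        t * ∑ (λ v → ∑ λ u → ⟦ S v ⟧ * (⟦ adj u v ⟧ * y (proj₁ g u))) ≡⟨ cong (t *_) (∑-cong λ v → sym (∑-*ˡ ⟦ S v ⟧ (λ u → ⟦ adj u v ⟧ * y (proj₁ g u)))) ⟩
        t * ∑ (λ v → ⟦ S v ⟧ * load g v)                    ≤⟨ *-monoʳ-≤ t (∑-mono λ v → *-monoʳ-≤ ⟦ S v ⟧ (load≤ J v)) ⟩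
        t * ∑ (λ v → ⟦ S v ⟧ * (2 * 2 ^ k))                 ≡⟨ cong (t *_) (sym (∑-*ʳ (2 * 2 ^ k) (λ v → ⟦ S v ⟧))) ⟩
        t * (∑ (λ v → ⟦ S v ⟧) * (2 * 2 ^ k))               ≡⟨ lem t (∑ (λ v → ⟦ S v ⟧)) (2 ^ k) ⟩
        2 ^ k * (2 * t * ∑ (λ v → ⟦ S v ⟧))                 ∎)
        where
        open ≤-Reasoning
        lem : ∀ t s w → t * (s * (2 * w)) ≡ w * (2 * t * s)
        lem = solve-∀
        pt : ∀ v → 2 ^ k * ⟦ chosen g v ⟧ ≤ load g v
        pt v with chosen g v in c
        ... | true = ≤-trans (≤-reflexive (*-identityʳ _)) (full J v c)
        ... | false = ≤-trans (≤-reflexive (*-zeroʳ (2 ^ k))) z≤n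
        pay : ∀ u → y (proj₁ g u) ≤ ∑ (λ v → ⟦ S v ⟧ * (⟦ adj u v ⟧ * y (proj₁ g u)))
        pay u with cS u
        ... | v , s , a = ≤-trans (≤-reflexive e) (term≤∑ (λ v → ⟦ S v ⟧ * (⟦ adj u v ⟧ * y (proj₁ g u))) v)
          where
          e : y (proj₁ g u) ≡ ⟦ S v ⟧ * (⟦ adj u v ⟧ * y (proj₁ g u))
          e rewrite s | a = sym (trans (*-identityˡ _) (*-identityˡ _))

    dual-correct : Cover (λ _ → true) → Triple Fresh prog (Result (2 * t))
    dual-correct feas = conseq prog start (finish feas) (loop I (suc k) (λ _ → dualOp (2 ^ k) ∷ []) I-step)

-- The fractional solution for one threshold

module LP (N : Network) (Bd : ℕ) where
  open Semantics N Bd public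

  record Keeps (g₀ g : Global) : Set where
    field
      cov≡ : ∀ u → cov (proj₁ g u) ≡ cov (proj₁ g₀ u)
      ch≡  : ∀ v → ch (proj₂ g v) ≡ ch (proj₂ g₀ v)
      col≡ : ∀ v → col (proj₂ g v) ≡ col (proj₂ g₀ v)
  open Keeps public

  X : Global → Fin nU → ℕ
  X g u = ∑ λ v → ⟦ adj u v ⟧ * x (proj₂ g v)

  counted : Global → Fin nU → Fin nV → Bool
  counted g u v = adj u v ∧ (idV v <ᵇ θ (proj₁ g u))

  isOpen : Global → Fin nU → Bool
  isOpen g u = not (cov (proj₁ g u))

  #open : Global → ℕ
  #open g = ∑ λ u → ⟦ isOpen g u ⟧

  module LPRun (ℓ lam : ℕ) (0<lam : 0 < lam) (degU : ∀ u → ∑ (λ v → ⟦ adj u v ⟧) ≤ 2 ^ ℓ)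
           (W<Bd : 2 ^ suc ℓ < Bd) where

    M W : ℕ
    M = 2 ^ ℓ
    W = 2 ^ suc ℓ

    unsat : Global → Fin nU → Bool
    unsat g u = isOpen g u ∧ (X g u <ᵇ M)

    res : Global → Fin nV → ℕ
    res g v = ∑ λ u → ⟦ adj u v ⟧ * ⟦ unsat g u ⟧

    liveValue : ℕ → ℕ
    liveValue zero = 0
    liveValue (suc i) = 2 ^ i

    -- `live`: sets that still reach the threshold share one value. `paid`: raising a set by some
    -- amount costs `lam` times this amount, and at least `lam` unsaturated elements receive it.
    -- Truncating at 2M loses nothing, since an element that receives anything was below M and at
    -- most doubles.
    record LPInv (g₀ : Global) (j : ℕ) (g : Global) : Set where
      field
        keeps : Keeps g₀ g
        live  : ∀ v → x (proj₂ g v) ≡ liveValue j ⊎ res g v < lam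
        vals  : ∀ v → x (proj₂ g v) ≡ 0 ⊎ ∃ λ i → i < j × x (proj₂ g v) ≡ 2 ^ i
        paid  : lam * ∑ (λ v → x (proj₂ g v)) ≤ ∑ (λ u → ⟦ isOpen g u ⟧ * (X g u ⊓ (2 * M)))
    open LPInv

    vals-bound : ∀ j a → a ≡ 0 ⊎ (∃ λ i → i < j × a ≡ 2 ^ i) → j ≤ suc ℓ → a < Bd
    vals-bound j a (inj₁ refl) _ = ≤-<-trans z≤n W<Bd
    vals-bound j a (inj₂ (i , p , refl)) q = ≤-<-trans (^-monoʳ-≤ 2 (≤-trans (<⇒≤ p) q)) W<Bd

    1<Bd : 1 < Bd
    1<Bd = ≤-<-trans (m^n>0 2 (suc ℓ)) W<Bd

    lp-step : ∀ g₀ j g → j ≤ ℓ → LPInv g₀ j g →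
      Legal (lpOp lam M j) g × LPInv g₀ (suc j) (exec (lpOp lam M j) g)
    lp-step g₀ j g j≤ℓ I = legal , inv
      where
      o = lpOp lam M j
      g′ = exec o g
      xo xn gain : Fin nV → ℕ
      xo v = x (proj₂ g v)
      xn v = if lam ≤ᵇ res g v then 2 ^ j else xo v
      gain v = xn v ∸ xo v
      reply≡ : ∀ u → unsatisfied M (proj₁ g u) (view o g u) ≡ unsat g u
      reply≡ u = cong (λ z → not (cov (proj₁ g u)) ∧ (z <ᵇ M)) (view-sum (λ _ → f₀) o g u)
      xn≡ : ∀ v → x (proj₂ g′ v) ≡ xn v
      xn≡ v = cong (λ z → if lam ≤ᵇ z then 2 ^ j else xo v)
        (trans (replies-sum f₀ o g v 0) (∑-cong λ u → cong (λ z → ⟦ adj u v ⟧ * ⟦ z ⟧) (reply≡ u)))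
      legal : Legal o g
      legal = (λ v → fits-msg (vals-bound j (xo v) (vals I v) (m≤n⇒m≤1+n j≤ℓ))) ,
        (λ u v β → fits-msg (≤-<-trans (⟦⟧≤1 (unsatisfied M (proj₁ g u) (view o g u))) 1<Bd))
      live≤ : liveValue j ≤ 2 ^ j
      live≤ = lem j
        where
        lem : ∀ j → liveValue j ≤ 2 ^ j
        lem zero = z≤n
        lem (suc i) = m≤m+n (2 ^ i) _
      xo≤xn : ∀ v → xo v ≤ xn v
      xo≤xn v with ≤ᵇ-cases lam (res g v)
      ... | inj₂ (_ , e) rewrite e = ≤-refl
      ... | inj₁ (p , e) rewrite e with live I v
      ... | inj₁ q = ≤-trans (≤-reflexive q) live≤
      ... | inj₂ q = ⊥-elim (<⇒≱ q p)
      xo+gain : ∀ v → xo v + gain v ≡ xn v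
      xo+gain v = m+[n∸m]≡n (xo≤xn v)
      gain-res : ∀ v → lam * gain v ≤ gain v * res g v
      gain-res v with ≤ᵇ-cases lam (res g v)
      ... | inj₁ (p , e) = ≤-trans (≤-reflexive (*-comm lam (gain v))) (*-monoʳ-≤ (gain v) p)
      ... | inj₂ (p , e) rewrite e | n∸n≡0 (xo v) = ≤-reflexive (*-zeroʳ lam)
      Δ X′ : Fin nU → ℕ
      Δ u = ∑ λ v → ⟦ adj u v ⟧ * gain v
      X′ u = ∑ λ v → ⟦ adj u v ⟧ * xn v
      X′≡ : ∀ u → X g′ u ≡ X′ u
      X′≡ u = ∑-cong λ v → cong (⟦ adj u v ⟧ *_) (xn≡ v)
      X+Δ : ∀ u → X g u + Δ u ≡ X′ u
      X+Δ u = trans (sym (∑-+ (λ v → ⟦ adj u v ⟧ * xo v) (λ v → ⟦ adj u v ⟧ * gain v)))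
        (∑-cong λ v → trans (sym (*-distribˡ-+ ⟦ adj u v ⟧ (xo v) (gain v))) (cong (⟦ adj u v ⟧ *_) (xo+gain v)))
      X≤X′ : ∀ u → X g u ≤ X′ u
      X≤X′ u = ≤-trans (m≤m+n (X g u) (Δ u)) (≤-reflexive (X+Δ u))
      double : ∀ v → 0 < j → xn v ≤ 2 * xo v
      double v p with ≤ᵇ-cases lam (res g v)
      ... | inj₂ (_ , e) rewrite e = m≤m+n _ _
      ... | inj₁ (q , e) rewrite e with live I v
      ... | inj₂ r = ⊥-elim (<⇒≱ r q)
      ... | inj₁ r = ≤-trans (≤-reflexive (lem j p)) (*-monoʳ-≤ 2 (≤-reflexive (sym r)))
        where
        lem : ∀ j → 0 < j → 2 ^ j ≡ 2 * liveValue j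
        lem (suc i) _ = refl
      one : ∀ v → j ≡ 0 → xn v ≤ 1
      one v refl with ≤ᵇ-cases lam (res g v)
      ... | inj₁ (_ , e) rewrite e = ≤-refl
      ... | inj₂ (_ , e) rewrite e with vals I v
      ... | inj₁ q = ≤-trans (≤-reflexive q) z≤n
      X′≤2M : ∀ u → X g u < M → X′ u ≤ 2 * M
      X′≤2M u p with zero∨pos j
      -- In the first step nothing is doubled; values become at most 1, and the degree is at most M.
      ... | inj₁ z = ≤-trans (∑-mono λ v → *-monoʳ-≤ ⟦ adj u v ⟧ (one v z))
        (≤-trans (≤-reflexive (∑-cong λ v → *-identityʳ ⟦ adj u v ⟧)) (≤-trans (degU u) (m≤m+n M _)))
      ... | inj₂ z = ≤-trans (∑-mono λ v → ≤-trans (*-monoʳ-≤ ⟦ adj u v ⟧ (double v z)) (≤-reflexive (lem ⟦ adj u v ⟧ (xo v))))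
        (≤-trans (≤-reflexive (sym (∑-*ˡ 2 (λ v → ⟦ adj u v ⟧ * xo v)))) (*-monoʳ-≤ 2 (<⇒≤ p)))
        where
        lem : ∀ a b → a * (2 * b) ≡ 2 * (a * b)
        lem = solve-∀
      pay : ∀ u → ⟦ isOpen g u ⟧ * (X g u ⊓ (2 * M)) + ⟦ unsat g u ⟧ * Δ u ≤ ⟦ isOpen g u ⟧ * (X′ u ⊓ (2 * M))
      pay u with isOpen g u | <ᵇ-cases (X g u) M
      ... | false | _ = ≤-refl
      ... | true | inj₂ (_ , e) rewrite e = ≤-trans (≤-reflexive (+-identityʳ _)) (*-monoʳ-≤ 1 (⊓-monoˡ-≤ (2 * M) (X≤X′ u)))
      ... | true | inj₁ (p , e) rewrite e = begin
        1 * (X g u ⊓ (2 * M)) + 1 * Δ u    ≡⟨ cong₂ _+_ (*-identityˡ _) (*-identityˡ (Δ u)) ⟩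
        X g u ⊓ (2 * M) + Δ u              ≤⟨ +-monoˡ-≤ (Δ u) (m⊓n≤m (X g u) (2 * M)) ⟩
        X g u + Δ u                        ≡⟨ X+Δ u ⟩
        X′ u                               ≡⟨ m≤n⇒m⊓n≡m (X′≤2M u p) ⟨
        X′ u ⊓ (2 * M)                     ≡⟨ *-identityˡ _ ⟨
        1 * (X′ u ⊓ (2 * M))               ∎
        where open ≤-Reasoning
      paid′ : lam * ∑ (λ v → x (proj₂ g′ v)) ≤ ∑ (λ u → ⟦ isOpen g′ u ⟧ * (X g′ u ⊓ (2 * M)))
      paid′ = begin
        lam * ∑ (λ v → x (proj₂ g′ v))                   ≡⟨ cong (lam *_) (∑-cong λ v → trans (xn≡ v) (sym (xo+gain v))) ⟩
        lam * ∑ (λ v → xo v + gain v)                    ≡⟨ cong (lam *_) (∑-+ xo gain) ⟩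
        lam * (∑ xo + ∑ gain)                            ≡⟨ *-distribˡ-+ lam (∑ xo) (∑ gain) ⟩
        lam * ∑ xo + lam * ∑ gain                        ≡⟨ cong (lam * ∑ xo +_) (∑-*ˡ lam gain) ⟩
        lam * ∑ xo + ∑ (λ v → lam * gain v)              ≤⟨ +-mono-≤ (paid I) (∑-mono gain-res) ⟩
        A + ∑ (λ v → gain v * res g v)                   ≡⟨ cong (A +_) (∑-cong λ v → ∑-*ˡ (gain v) (λ u → ⟦ adj u v ⟧ * ⟦ unsat g u ⟧)) ⟩
        A + ∑ (λ v → ∑ λ u → gain v * (⟦ adj u v ⟧ * ⟦ unsat g u ⟧)) ≡⟨ cong (A +_) (∑-swap (λ v u → gain v * (⟦ adj u v ⟧ * ⟦ unsat g u ⟧))) ⟩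
        A + ∑ (λ u → ∑ λ v → gain v * (⟦ adj u v ⟧ * ⟦ unsat g u ⟧)) ≡⟨ cong (A +_) (∑-cong λ u → trans (∑-cong λ v → l1 (gain v) ⟦ adj u v ⟧ ⟦ unsat g u ⟧) (sym (∑-*ˡ ⟦ unsat g u ⟧ (λ v → ⟦ adj u v ⟧ * gain v)))) ⟩
        A + ∑ (λ u → ⟦ unsat g u ⟧ * Δ u)                ≡⟨ ∑-+ (λ u → ⟦ isOpen g u ⟧ * (X g u ⊓ (2 * M))) (λ u → ⟦ unsat g u ⟧ * Δ u) ⟨
        ∑ (λ u → ⟦ isOpen g u ⟧ * (X g u ⊓ (2 * M)) + ⟦ unsat g u ⟧ * Δ u) ≤⟨ ∑-mono pay ⟩
        ∑ (λ u → ⟦ isOpen g u ⟧ * (X′ u ⊓ (2 * M)))       ≡⟨ ∑-cong (λ u → cong (λ z → ⟦ isOpen g u ⟧ * (z ⊓ (2 * M))) (sym (X′≡ u))) ⟩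
        ∑ (λ u → ⟦ isOpen g′ u ⟧ * (X g′ u ⊓ (2 * M)))    ∎
        where
        open ≤-Reasoning
        A = ∑ (λ u → ⟦ isOpen g u ⟧ * (X g u ⊓ (2 * M)))
        l1 : ∀ a b c → a * (b * c) ≡ c * (b * a)
        l1 = solve-∀
      unsat-mono : ∀ u → ⟦ unsat g′ u ⟧ ≤ ⟦ unsat g u ⟧
      unsat-mono u with isOpen g u
      ... | false = z≤n
      ... | true with <ᵇ-cases (X g u) M
      ... | inj₁ (_ , e) rewrite e = ⟦⟧≤1 _
      ... | inj₂ (p , e) rewrite e | <ᵇ-false (≤-trans p (≤-trans (X≤X′ u) (≤-reflexive (sym (X′≡ u))))) = z≤n
      live′ : ∀ v → x (proj₂ g′ v) ≡ 2 ^ j ⊎ res g′ v < lam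
      live′ v with ≤ᵇ-cases lam (res g v)
      ... | inj₁ (p , e) = inj₁ (trans (xn≡ v) (cong (λ z → if z then 2 ^ j else xo v) e))
      ... | inj₂ (p , e) = inj₂ (≤-<-trans (∑-mono λ u → *-monoʳ-≤ ⟦ adj u v ⟧ (unsat-mono u)) p)
      vals′ : ∀ v → x (proj₂ g′ v) ≡ 0 ⊎ ∃ λ i → i < suc j × x (proj₂ g′ v) ≡ 2 ^ i
      vals′ v with ≤ᵇ-cases lam (res g v)
      ... | inj₁ (p , e) = inj₂ (j , ≤-refl , trans (xn≡ v) (cong (λ z → if z then 2 ^ j else xo v) e))
      ... | inj₂ (p , e) with vals I v
      ... | inj₁ q = inj₁ (trans (xn≡ v) (trans (cong (λ z → if z then 2 ^ j else xo v) e) q))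
      ... | inj₂ (i , l , q) = inj₂ (i , m<n⇒m<1+n l , trans (xn≡ v) (trans (cong (λ z → if z then 2 ^ j else xo v) e) q))
      inv : LPInv g₀ (suc j) g′
      keeps inv = record { cov≡ = cov≡ (keeps I) ; ch≡ = ch≡ (keeps I) ; col≡ = col≡ (keeps I) }
      live inv = live′
      vals inv = vals′
      paid inv = paid′

    -- A set live to the end has value M and saturates all its elements by itself.
    res-final : ∀ g₀ g → LPInv g₀ (suc ℓ) g → ∀ v → res g v < lam
    res-final g₀ g I v with live I v
    ... | inj₂ p = p
    ... | inj₁ q = ≤-<-trans (≤-reflexive (∑-zero λ u → h u)) 0<lam
      where
      h : ∀ u → ⟦ adj u v ⟧ * ⟦ unsat g u ⟧ ≡ 0
      h u with adj u v in a
      ... | false = refl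
      ... | true = trans (*-identityˡ _) (cong ⟦_⟧ (trans (cong (isOpen g u ∧_) (<ᵇ-false M≤)) (∧-zeroʳ (isOpen g u))))
        where
        M≤ : M ≤ X g u
        M≤ = ≤-trans (≤-reflexive e) (term≤∑ (λ v → ⟦ adj u v ⟧ * x (proj₂ g v)) v)
          where
          e : M ≡ ⟦ adj u v ⟧ * x (proj₂ g v)
          e rewrite a = trans (sym q) (sym (*-identityˡ _))

    saturated : Global → Fin nU → Bool
    saturated g u = isOpen g u ∧ (M ≤ᵇ X g u)

    Xθ : Global → Fin nU → ℕ
    Xθ g u = ∑ λ v → ⟦ counted g u v ⟧ * x (proj₂ g v)

    record LPDone (g₀ g : Global) : Set where
      field
        keeps  : Keeps g₀ g
        vals   : ∀ v → x (proj₂ g v) ≡ 0 ⊎ ∃ λ i → i < suc ℓ × x (proj₂ g v) ≡ 2 ^ i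
        paid   : lam * ∑ (λ v → x (proj₂ g v)) ≤ W * #open g
        few    : ∀ S → Cover S → #open g ≤ ∑ (λ u → ⟦ saturated g u ⟧) + lam * ∑ (λ v → ⟦ S v ⟧)
        bounds : ∀ u → saturated g u ≡ true → M ≤ Xθ g u × Xθ g u ≤ W
        none   : ∀ u → saturated g u ≡ false → θ (proj₁ g u) ≡ 0

    -- Open elements are saturated or charged to a cover with `lam` per set. The upper bound W in
    -- `bounds` holds because the prefix one identifier shorter is below M, and one more identifier
    -- adds at most one value, itself at most M.
    threshold-step : ∀ Nb → (∀ v → idV v < Nb) → ∀ g₀ g → LPInv g₀ (suc ℓ) g →
      Legal (thresholdOp M Nb) g × LPDone g₀ (exec (thresholdOp M Nb) g)
    threshold-step Nb id< g₀ g I = legal , record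
        { keeps = record { cov≡ = cov≡ (keeps I) ; ch≡ = ch≡ (keeps I) ; col≡ = col≡ (keeps I) }
        ; vals = vals I
        ; paid = ≤-trans (paid I) (≤-trans (∑-mono λ u → ≤-trans (*-monoʳ-≤ ⟦ isOpen g u ⟧ (m⊓n≤n (X g u) (2 * M)))
            (≤-reflexive (*-comm ⟦ isOpen g u ⟧ W))) (≤-reflexive (sym (∑-*ˡ W (λ u → ⟦ isOpen g u ⟧)))))
        ; few = λ S c → ≤-trans (≤-trans (∑-mono split) (≤-reflexive (∑-+ (λ u → ⟦ saturated g u ⟧) (λ u → ⟦ unsat g u ⟧))))
            (+-monoʳ-≤ (∑ (λ u → ⟦ saturated g u ⟧)) (charge (unsat g) S c lam (λ v → <⇒≤ (res-final g₀ g I v))))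
        ; bounds = bounds′
        ; none = none′
        }
      where
      o = thresholdOp M Nb
      g′ = exec o g
      legal : Legal o g
      legal = (λ v → fits-msg (vals-bound (suc ℓ) _ (vals I v) ≤-refl)) , (λ u v β → fits-msg (<⇒≤ 1<Bd))
      split : ∀ u → ⟦ isOpen g u ⟧ ≤ ⟦ saturated g u ⟧ + ⟦ unsat g u ⟧
      split u with isOpen g u | ≤ᵇ-cases M (X g u)
      ... | false | _ = z≤n
      ... | true | inj₁ (p , e) rewrite e = s≤s z≤n
      ... | true | inj₂ (p , e) rewrite e | <ᵇ-true p = s≤s z≤n
      pre : Fin nU → ℕ → ℕ
      pre u k = ∑ λ v → ⟦ adj u v ⟧ * (⟦ idV v <ᵇ k ⟧ * x (proj₂ g v))
      pre≡ : ∀ u k → prefixSum (view o g u) k ≡ pre u k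
      pre≡ u k = view-sum (λ i m → ⟦ i <ᵇ k ⟧ * f₀ m) o g u
      preN : ∀ u → pre u Nb ≡ X g u
      preN u = ∑-cong λ v → cong (⟦ adj u v ⟧ *_) (trans (cong (λ z → ⟦ z ⟧ * x (proj₂ g v)) (<ᵇ-true (id< v))) (*-identityˡ _))
      Xθ≡ : ∀ u → Xθ g′ u ≡ pre u (θ (proj₁ g′ u))
      Xθ≡ u = ∑-cong λ v → trans (cong (_* x (proj₂ g v)) (⟦∧⟧ (adj u v) _)) (*-assoc ⟦ adj u v ⟧ _ _)
      full : Fin nU → ℕ → Bool
      full u k = M ≤ᵇ prefixSum (view o g u) k
      none′ : ∀ u → saturated g u ≡ false → θ (proj₁ g′ u) ≡ 0
      none′ u s with cov (proj₁ g u)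
      ... | true = refl
      ... | false rewrite trans (cong (M ≤ᵇ_) (trans (pre≡ u Nb) (preN u))) s = refl
      x≤M : ∀ v → x (proj₂ g v) ≤ M
      x≤M v with vals I v
      ... | inj₁ q = ≤-trans (≤-reflexive q) z≤n
      ... | inj₂ (i , p , q) = ≤-trans (≤-reflexive q) (^-monoʳ-≤ 2 (s≤s⁻¹ p))
      pre0 : ∀ u → pre u 0 ≡ 0
      pre0 u = ∑-zero λ v → *-zeroʳ ⟦ adj u v ⟧
      at-most : ∀ u k → ∑ (λ v → ⟦ adj u v ⟧ * (⟦ idV v ≡ᵇ k ⟧ * x (proj₂ g v))) ≤ M
      at-most u k = ∑-atMostOne _ M
        (λ v → ≤-trans (guard-≤ (adj u v) _) (≤-trans (guard-≤ (idV v ≡ᵇ k) _) (x≤M v)))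
        (λ v v′ p q → idV-inj v v′ (trans (at v p) (sym (at v′ q))))
        where
        at : ∀ v → ⟦ adj u v ⟧ * (⟦ idV v ≡ᵇ k ⟧ * x (proj₂ g v)) ≢ 0 → idV v ≡ k
        at v ne with ≡ᵇ-cases (idV v) k
        ... | inj₁ (q , _) = q
        ... | inj₂ (_ , e) = ⊥-elim (ne (trans (cong (λ z → ⟦ adj u v ⟧ * (⟦ z ⟧ * x (proj₂ g v))) e) (*-zeroʳ ⟦ adj u v ⟧)))
      pre-suc : ∀ u k → pre u (suc k) ≤ pre u k + M
      pre-suc u k = ≤-trans (≤-reflexive (trans (∑-cong λ v →
          trans (cong (λ z → ⟦ adj u v ⟧ * (z * x (proj₂ g v))) (<ᵇ-suc (idV v) k)) (lem ⟦ adj u v ⟧ ⟦ idV v <ᵇ k ⟧ ⟦ idV v ≡ᵇ k ⟧ (x (proj₂ g v))))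
          (∑-+ (λ v → ⟦ adj u v ⟧ * (⟦ idV v <ᵇ k ⟧ * x (proj₂ g v))) (λ v → ⟦ adj u v ⟧ * (⟦ idV v ≡ᵇ k ⟧ * x (proj₂ g v))))))
        (+-monoʳ-≤ (pre u k) (at-most u k))
        where
        lem : ∀ a b c x → a * ((b + c) * x) ≡ a * (b * x) + a * (c * x)
        lem = solve-∀
      bounds′ : ∀ u → saturated g u ≡ true → M ≤ Xθ g′ u × Xθ g′ u ≤ W
      bounds′ u s = subst (λ z → M ≤ z × z ≤ W) (sym (trans (Xθ≡ u) (cong (pre u) θ≡))) (lower , upper)
        where
        k = first (full u) Nb
        fullN : full u Nb ≡ true
        fullN = trans (cong (M ≤ᵇ_) (trans (pre≡ u Nb) (preN u))) (proj₂ (∧-true s))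
        θ≡ : θ (proj₁ g′ u) ≡ k
        θ≡ = trans (cong (λ z → if z then 0 else (if full u Nb then k else 0)) (not-true {cov (proj₁ g u)} (proj₁ (∧-true s))))
          (cong (λ z → if z then k else 0) fullN)
          where
          not-true : ∀ {b} → not b ≡ true → b ≡ false
          not-true {false} _ = refl
        lower : M ≤ pre u k
        lower = ≤-trans (≤ᵇ⇒≤ _ _ (≡⇒T (first-true (full u) Nb Nb ≤-refl fullN))) (≤-reflexive (pre≡ u k))
        upper : pre u k ≤ W
        upper with k in e
        ... | zero = ≤-trans (≤-reflexive (pre0 u)) z≤n
        ... | suc k′ = ≤-trans (pre-suc u k′) (≤-trans (+-monoˡ-≤ M (<⇒≤ below)) (≤-reflexive (cong (M +_) (sym (+-identityʳ M)))))
          where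
          below : pre u k′ < M
          below = ≰⇒> λ p → true≢false (trans (sym (≤ᵇ-true (≤-trans p (≤-reflexive (sym (pre≡ u k′))))))
            (first-minimal (full u) Nb k′ (≤-reflexive (sym e))))

    lpProg : ℕ → List Op
    lpProg Nb = for (suc ℓ) (λ j → lpOp lam M j ∷ []) ++ (thresholdOp M Nb ∷ [])

    lp-correct : ∀ Nb → (∀ v → idV v < Nb) → ∀ g₀ → (∀ v → x (proj₂ g₀ v) ≡ 0) →
      Triple (_≡ g₀) (lpProg Nb) (LPDone g₀)
    lp-correct Nb id< g₀ x0 = seq {P = _≡ g₀} {Q = LPInv g₀ (suc ℓ)} {R = LPDone g₀}
      (for (suc ℓ) (λ j → lpOp lam M j ∷ [])) (thresholdOp M Nb ∷ [])
      (conseq {P = LPInv g₀ 0} {P′ = _≡ g₀} {Q = LPInv g₀ (suc ℓ)} {Q′ = LPInv g₀ (suc ℓ)} (for (suc ℓ) (λ j → lpOp lam M j ∷ [])) (λ { g refl → init }) (λ _ p → p)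
        (loop (LPInv g₀) (suc ℓ) (λ j → lpOp lam M j ∷ [])
          (λ j j< → single {P = LPInv g₀ j} {Q = LPInv g₀ (suc j)} (lpOp lam M j) (λ g → lp-step g₀ j g (s≤s⁻¹ j<)))))
      (single {P = LPInv g₀ (suc ℓ)} {Q = LPDone g₀} (thresholdOp M Nb) (threshold-step Nb id< g₀))
      where
      init : LPInv g₀ 0 g₀
      keeps init = record { cov≡ = λ _ → refl ; ch≡ = λ _ → refl ; col≡ = λ _ → refl }
      live init v = inj₁ (x0 v)
      vals init v = inj₁ (x0 v)
      paid init = ≤-trans (≤-reflexive (trans (cong (lam *_) (∑-zero x0)) (*-zeroʳ lam))) z≤n

-- Splitting the active sets into classes with few conflicts

≤1*≤1 : ∀ {a b} → a ≤ 1 → b ≤ 1 → a * b ≤ 1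
≤1*≤1 p q = *-mono-≤ p q

startOp : Op
startOp = localOp (λ s → record s { ψ = col s ; lab = 0 })

stopOp : ℕ → Op
stopOp ε = localOp (λ s → record s { cls = cls s * 2 ^ ε + lab s })

resetOp : Op
resetOp = localOp (λ s → record s { cls = 0 })

-- With r = 8ρ, four reductions at a loss of 2/r each make a 1/ρ fraction of the pairs
-- monochromatic. The first argument d = 2·(3+ε) gives the code its D = r².
reduces : (j ε wd blk : ℕ) (bits : ℕ → ℕ) → ℕ → List Op
reduces j ε wd blk bits k = reduceOp j (3 + ε + (3 + ε)) (bits k) (2 ^ (3 + ε)) wd blk ∷ []

labels : (j ε : ℕ) → ℕ → List Op
labels j ε i = labelOp j (2 ^ ε) i ∷ []

section : (j ε wd blk : ℕ) (bits : ℕ → ℕ) → List Op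
section j ε wd blk bits = startOp ∷ for 4 (reduces j ε wd blk bits) ++ (for (2 ^ bits 4) (labels j ε) ++ (stopOp ε ∷ []))

colouring : (j ε wd blk : ℕ) (bits : ℕ → ℕ) → List Op
colouring j ε wd blk bits = resetOp ∷ for 8 (λ _ → section j ε wd blk bits)

module Colour (N : Network) (Bd : ℕ) where
  open LP N Bd public

  record Frame (g₀ g : Global) : Set where
    field
      U≡   : ∀ u → proj₁ g u ≡ proj₁ g₀ u
      fch  : ∀ v → ch (proj₂ g v) ≡ ch (proj₂ g₀ v)
      fx   : ∀ v → x (proj₂ g v) ≡ x (proj₂ g₀ v)
      fcol : ∀ v → col (proj₂ g v) ≡ col (proj₂ g₀ v)
  open Frame public

  module Pot (g₀ : Global) = Potential (counted g₀) idV idV-inj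

  module Col (j ε wd blk : ℕ) (bits : ℕ → ℕ) where
    ρ r d : ℕ
    ρ = 2 ^ ε
    r = 2 ^ (3 + ε)
    d = 3 + ε + (3 + ε)

    record Room : Set where
      field
        next   : ∀ k → bits (suc k) ≡ nextBits d (bits k)
        bits>0 : ∀ k → 0 < bits k
        ψ-room : ∀ k → k ≤ 4 → 2 ^ bits k ≤ Bd
        blocks≥ : ∀ k → k < 4 → codeLength (2 ^ d) (bits k) ≤ suc blk * suc wd
        cls-room : ρ ^ 8 ≤ Bd
        nV-room : nV < Bd
        bit-room : 2 ^ suc wd ≤ Bd
        1-room : 1 < Bd

    module _ (room : Room) (g₀ : Global) (x< : ∀ v → x (proj₂ g₀ v) < Bd)
             (col< : ∀ v → col (proj₂ g₀ v) < 2 ^ bits 0)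
             (proper : ∀ u v v′ → adj u v ≡ true → adj u v′ ≡ true → v ≢ v′ → col (proj₂ g₀ v) ≢ col (proj₂ g₀ v′)) where
      open Room room

      -- Conflicts between sets active on level `j`. The variant `eC` keeps those within one class
      -- of the earlier stages, the only ones that a stage still has to split.
      eJ : Fin nU → Fin nV → Fin nV → ℕ
      eJ u v v′ = Pot.e g₀ u v v′ * (⟦ x (proj₂ g₀ v) ≡ᵇ 2 ^ j ⟧ * ⟦ x (proj₂ g₀ v′) ≡ᵇ 2 ^ j ⟧)

      eC : (Fin nV → ℕ) → Fin nU → Fin nV → Fin nV → ℕ
      eC cl u v v′ = eJ u v v′ * ⟦ cl v ≡ᵇ cl v′ ⟧

      eJ-sym : ∀ u v v′ → eJ u v v′ ≡ eJ u v′ v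
      eJ-sym u v v′ = cong₂ _*_ (Pot.e-sym g₀ u v v′) (*-comm ⟦ x (proj₂ g₀ v) ≡ᵇ 2 ^ j ⟧ _)

      eC-sym : ∀ cl u v v′ → eC cl u v v′ ≡ eC cl u v′ v
      eC-sym cl u v v′ = cong₂ _*_ (eJ-sym u v v′) (cong ⟦_⟧ (≡ᵇ-sym (cl v) (cl v′)))

      eC-nonadj : ∀ cl u v v′ → adj u v ≡ false → eC cl u v v′ ≡ 0
      eC-nonadj cl u v v′ a rewrite a = refl

      eC-zero : ∀ cl u v v′ → ¬ (adj u v ≡ true × adj u v′ ≡ true × v ≢ v′) → eC cl u v v′ ≡ 0
      eC-zero cl u v v′ h with adj u v | adj u v′ | ≡ᵇ-cases (idV v) (idV v′)
      ... | false | _ | _ = refl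
      ... | true | false | _ rewrite *-zeroʳ ⟦ idV v <ᵇ θ (proj₁ g₀ u) ⟧ = refl
      ... | true | true | inj₂ (ne , _) = ⊥-elim (h (refl , refl , λ { refl → ne refl }))
      ... | true | true | inj₁ (_ , q) rewrite q | *-zeroʳ ⟦ idV v′ <ᵇ θ (proj₁ g₀ u) ⟧ | *-zeroʳ ⟦ idV v <ᵇ θ (proj₁ g₀ u) ⟧ = refl

      total : (Fin nV → ℕ) → ℕ
      total cl = ∑₃ (eC cl)

      module _ (o : Op) (pub≡ : ∀ s → Op.pub o s ≡ pubAll s) (g : Global) (F : Frame g₀ g) where
        private
          cl : Fin nV → ℕ
          cl v = cls (proj₂ g v)

        own-pub : ∀ f u v → adj u v ≡ true → own f (idV v) (view o g u) ≡ f (pubAll (proj₂ g v))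
        own-pub f u v a = trans (own-view f o g u v a) (cong f (pub≡ (proj₂ g v)))

        pairWeight≡ : ∀ u v v′ → adj u v ≡ true →
          ⟦ adj u v′ ⟧ * pairWeight j (proj₁ g u) (view o g u) (idV v) (idV v′) (pubAll (proj₂ g v′)) ≡ eC cl u v v′
        pairWeight≡ u v v′ a rewrite own-pub f₀ u v a | own-pub f₁ u v a | U≡ F u | fx F v | fx F v′
          | ⟦∧⟧ (adj u v′) (idV v′ <ᵇ θ (proj₁ g₀ u)) | a =
          lem ⟦ adj u v′ ⟧ ⟦ idV v <ᵇ θ (proj₁ g₀ u) ⟧ ⟦ idV v′ <ᵇ θ (proj₁ g₀ u) ⟧ ⟦ not (idV v ≡ᵇ idV v′) ⟧
            (⟦ x (proj₂ g₀ v) ≡ᵇ 2 ^ j ⟧ * ⟦ x (proj₂ g₀ v′) ≡ᵇ 2 ^ j ⟧) ⟦ cl v ≡ᵇ cl v′ ⟧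
          where
          lem : ∀ a b c n p q → a * (b * (c * n) * p * q) ≡ b * (a * c * n) * p * q
          lem = solve-∀

        pairSum≡ : ∀ (f : ℕ → Msg → ℕ) (f′ : Fin nV → Fin nV → ℕ) u v → adj u v ≡ true →
          (∀ v′ → f (idV v) (pubAll (proj₂ g v′)) ≡ f′ v v′) →
          viewSum (λ i m → pairWeight j (proj₁ g u) (view o g u) (idV v) i m * f (idV v) m) (view o g u)
            ≡ ∑ (λ v′ → eC cl u v v′ * f′ v v′)
        pairSum≡ f f′ u v a h = trans (view-sum (λ i m → pairWeight j (proj₁ g u) (view o g u) (idV v) i m * f (idV v) m) o g u)
          (∑-cong λ v′ → trans (cong (λ z → ⟦ adj u v′ ⟧ * (pairWeight j (proj₁ g u) (view o g u) (idV v) (idV v′) z * f (idV v) z)) (pub≡ (proj₂ g v′)))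
            (trans (sym (*-assoc ⟦ adj u v′ ⟧ _ _)) (cong₂ _*_ (pairWeight≡ u v v′ a) (h v′))))

        pairWeight≤1 : ∀ u i k m → pairWeight j (proj₁ g u) (view o g u) i k m ≤ 1
        pairWeight≤1 u i k m = ≤1*≤1 (≤1*≤1
          (≤1*≤1 (⟦⟧≤1 (i <ᵇ θ (proj₁ g u))) (≤1*≤1 (⟦⟧≤1 (k <ᵇ θ (proj₁ g u))) (⟦⟧≤1 (not (i ≡ᵇ k)))))
          (≤1*≤1 (⟦⟧≤1 (own f₀ i (view o g u) ≡ᵇ 2 ^ j)) (⟦⟧≤1 (f₀ m ≡ᵇ 2 ^ j))))
          (⟦⟧≤1 (own f₁ i (view o g u) ≡ᵇ f₁ m))

        pairSum≤ : ∀ (f : ℕ → Msg → ℕ) u i → (∀ k m → f k m ≤ 1) →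
          viewSum (λ k m → pairWeight j (proj₁ g u) (view o g u) i k m * f k m) (view o g u) ≤ nV
        pairSum≤ f u i h = ≤-trans (≤-reflexive (view-sum (λ k m → pairWeight j (proj₁ g u) (view o g u) i k m * f k m) o g u))
          (≤-trans (∑-mono {g = λ _ → 1} λ v → ≤1*≤1 (⟦⟧≤1 (adj u v)) (≤1*≤1 (pairWeight≤1 u i (idV v) (Op.pub o (proj₂ g v))) (h (idV v) (Op.pub o (proj₂ g v)))))
            (≤-reflexive (trans (∑-const nV 1) (*-identityʳ nV))))

      module _ (k : ℕ) (k<4 : k < 4) (g : Global) (F : Frame g₀ g) where
        private
          o = reduceOp j d (bits k) r wd blk
          cg ps : Fin nV → ℕ
          cg v = cls (proj₂ g v)
          ps v = ψ (proj₂ g v)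
        module R = Reduce (eC cg) ps d (bits k) r

        H≡ : ∀ u v → adj u v ≡ true → reduceH j (proj₁ g u) (view o g u) (idV v) ≡ R.H u v
        H≡ u v a = pairSum≡ o (λ _ → refl) g F (λ i m → ⟦ not (own f₂ i (view o g u) ≡ᵇ f₂ m) ⟧) R.differ u v a
          (λ v′ → cong (λ z → ⟦ not (z ≡ᵇ ps v′) ⟧) (own-pub o (λ _ → refl) g F f₂ u v a))

        cnt≡ : ∀ u v α → adj u v ≡ true → reduceCnt j d (bits k) (proj₁ g u) (view o g u) (idV v) α ≡ R.cnt u v α
        cnt≡ u v α a = pairSum≡ o (λ _ → refl) g F
          (λ i m → ⟦ not (own f₂ i (view o g u) ≡ᵇ f₂ m) ⟧ * ⟦ encode d (bits k) (own f₂ i (view o g u)) α ≡ᵇ encode d (bits k) (f₂ m) α ⟧)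
          (R.meet α) u v a
          (λ v′ → cong (λ z → ⟦ not (z ≡ᵇ ps v′) ⟧ * ⟦ encode d (bits k) z α ≡ᵇ encode d (bits k) (ps v′) α ⟧)
            (own-pub o (λ _ → refl) g F f₂ u v a))

        -- Decodes bit `α % suc wd` of block `α / suc wd`. Elements outside the set send no reply,
        -- and their mathematical cost is 0.
        cost≡ : ∀ v α → α < codeLength (2 ^ d) (bits k) →
          reduceCost wd (applyUpTo (replies o g v) (suc blk)) α ≡ R.cost v α
        cost≡ v α α< = trans (cong (lsum _) (nth-applyUpTo (replies o g v) (suc blk) (α / suc wd)
            (m<n*o⇒m/o<n (<-≤-trans α< (blocks≥ k k<4)))))
          (trans (replies-sum (λ m → testBit (f₁ m) (α % suc wd) * f₀ m) o g v (α / suc wd)) (∑-cong pt))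
          where
          pt : ∀ u → ⟦ adj u v ⟧ * (testBit (bitsOf (λ i → reduceH j (proj₁ g u) (view o g u) (idV v) <ᵇ
                  r * reduceCnt j d (bits k) (proj₁ g u) (view o g u) (idV v) (i + α / suc wd * suc wd)) (suc wd)) (α % suc wd)
                * reduceH j (proj₁ g u) (view o g u) (idV v)) ≡ ⟦ R.bit u v α ⟧ * R.H u v
          pt u = guard-zero (adj u v)
            (λ a → cong₂ _*_
              (trans (testBit-bitsOf (λ i → reduceH j (proj₁ g u) (view o g u) (idV v) <ᵇ
                  r * reduceCnt j d (bits k) (proj₁ g u) (view o g u) (idV v) (i + α / suc wd * suc wd)) (suc wd) (α % suc wd) (m%n<n α (suc wd)))
                (cong₂ (λ h c → ⟦ h <ᵇ r * c ⟧) (H≡ u v a)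
                  (trans (cnt≡ u v (α % suc wd + α / suc wd * suc wd) a) (cong (R.cnt u v) (sym (m≡m%n+[m/n]*n α (suc wd)))))))
              (H≡ u v a))
            (λ a → trans (cong (⟦ R.bit u v α ⟧ *_) (∑-zero λ v′ → cong (_* R.differ v v′) (eC-nonadj cg u v v′ a))) (*-zeroʳ ⟦ R.bit u v α ⟧))

        ψ-exec : ∀ v → ψ (proj₂ (exec o g) v) ≡ R.ψ′ v
        ψ-exec v = cong (λ α → α * (4 * 2 ^ d) + encode d (bits k) (ps v) α)
          (best-cong (codeLength (2 ^ d) (bits k)) (cost≡ v))

        reduce-legal : (∀ v → cls (proj₂ g v) < Bd) → (∀ v → ψ (proj₂ g v) < Bd) → (∀ v → lab (proj₂ g v) < Bd) → Legal o g
        reduce-legal hc hψ hl = (λ v → subst (_< Bd) (sym (fx F v)) (x< v) ∷ hc v ∷ hψ v ∷ hl v ∷ []) ,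
          (λ u v β → fits-msg₂ (≤-<-trans (pairSum≤ o (λ _ → refl) g F (λ _ m → ⟦ not (own f₂ (idV v) (view o g u) ≡ᵇ f₂ m) ⟧) u (idV v) (λ _ _ → ⟦⟧≤1 _)) nV-room)
            (<-≤-trans (bitsOf< (λ i → reduceH j (proj₁ g u) (view o g u) (idV v) <ᵇ r * reduceCnt j d (bits k) (proj₁ g u) (view o g u) (idV v) (i + β * suc wd)) (suc wd)) bit-room))

      record RInv (cl : Fin nV → ℕ) (k : ℕ) (g : Global) : Set where
        field
          frame : Frame g₀ g
          cls≡  : ∀ v → cls (proj₂ g v) ≡ cl v
          lab0  : ∀ v → lab (proj₂ g v) ≡ 0
          ψ<    : ∀ v → ψ (proj₂ g v) < 2 ^ bits k
          few   : r * mono (eC cl) (λ v → ψ (proj₂ g v)) ≤ k * (2 * total cl)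
      open RInv

      eC-cong : ∀ {c c′ : Fin nV → ℕ} → (∀ v → c v ≡ c′ v) → ∀ u v v′ → eC c u v v′ ≡ eC c′ u v v′
      eC-cong h u v v′ = cong₂ (λ a b → eJ u v v′ * ⟦ a ≡ᵇ b ⟧) (h v) (h v′)

      mono-cong : ∀ {e e′ : Fin nU → Fin nV → Fin nV → ℕ} {χ χ′ : Fin nV → ℕ} →
        (∀ u v v′ → e u v v′ ≡ e′ u v v′) → (∀ v → χ v ≡ χ′ v) → mono e χ ≡ mono e′ χ′
      mono-cong he hχ = ∑-cong λ u → ∑-cong λ v → ∑-cong λ v′ → cong₂ _*_ (he u v v′) (cong₂ (λ a b → ⟦ a ≡ᵇ b ⟧) (hχ v) (hχ v′))

      total-cong : ∀ {c c′ : Fin nV → ℕ} → (∀ v → c v ≡ c′ v) → total c ≡ total c′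
      total-cong h = ∑-cong λ u → ∑-cong λ v → ∑-cong λ v′ → eC-cong h u v v′

      reduce-step : ∀ cl → (∀ v → cl v < Bd) → ∀ k → k < 4 → ∀ g → RInv cl k g →
        Legal (reduceOp j d (bits k) r wd blk) g × RInv cl (suc k) (exec (reduceOp j d (bits k) r wd blk) g)
      reduce-step cl cl< k k<4 g I =
        reduce-legal k k<4 g (frame I) (λ v → subst (_< Bd) (sym (cls≡ I v)) (cl< v))
          (λ v → <-≤-trans (ψ< I v) (ψ-room k (<⇒≤ k<4))) (λ v → subst (_< Bd) (sym (lab0 I v)) (<⇒≤ 1-room)) ,
        record { frame = record { U≡ = U≡ (frame I) ; fch = fch (frame I) ; fx = fx (frame I) ; fcol = fcol (frame I) }
               ; cls≡ = cls≡ I ; lab0 = lab0 I ; ψ< = ψ<′ ; few = few′ }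
        where
        g′ = exec (reduceOp j d (bits k) r wd blk) g
        r² : r * r ≡ 2 ^ d
        r² = sym (^-distribˡ-+-* 2 (3 + ε) (3 + ε))
        ψ≡′ : ∀ v → ψ (proj₂ g′ v) ≡ R.ψ′ k k<4 g (frame I) v
        ψ≡′ = ψ-exec k k<4 g (frame I)
        ψ<′ : ∀ v → ψ (proj₂ g′ v) < 2 ^ bits (suc k)
        ψ<′ v = subst₂ (λ a b → a < 2 ^ b) (sym (ψ≡′ v)) (sym (next k)) (R.ψ′< k k<4 g (frame I) (bits>0 k) r² (ψ< I) v)
        few′ : r * mono (eC cl) (λ v → ψ (proj₂ g′ v)) ≤ suc k * (2 * total cl)
        few′ = begin
          r * mono (eC cl) (λ v → ψ (proj₂ g′ v))
            ≡⟨ cong (r *_) (mono-cong (λ u v v′ → sym (eC-cong (cls≡ I) u v v′)) ψ≡′) ⟩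
          r * mono (eC (λ v → cls (proj₂ g v))) (R.ψ′ k k<4 g (frame I))
            ≤⟨ R.mono-reduce k k<4 g (frame I) (bits>0 k) r² (ψ< I) ⟩
          r * mono (eC (λ v → cls (proj₂ g v))) (λ v → ψ (proj₂ g v)) + 2 * total (λ v → cls (proj₂ g v))
            ≡⟨ cong₂ (λ a b → r * a + 2 * b) (mono-cong {χ = λ v → ψ (proj₂ g v)} {χ′ = λ v → ψ (proj₂ g v)} (eC-cong (cls≡ I)) (λ _ → refl)) (total-cong (cls≡ I)) ⟩
          r * mono (eC cl) (λ v → ψ (proj₂ g v)) + 2 * total cl
            ≤⟨ +-monoˡ-≤ (2 * total cl) (few I) ⟩
          k * (2 * total cl) + 2 * total cl ≡⟨ +-comm (k * (2 * total cl)) _ ⟩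
          suc k * (2 * total cl) ∎
          where open ≤-Reasoning

      fair : (Fin nV → ℕ) → (Fin nV → ℕ) → (Fin nV → ℕ) → Fin nV → Set
      fair cl ps lb v = ρ * ∑ (λ u → ∑ λ v′ → eC cl u v v′ * (⟦ ps v′ <ᵇ ps v ⟧ * ⟦ lb v′ ≡ᵇ lb v ⟧))
        ≤ ∑ (λ u → ∑ λ v′ → eC cl u v v′ * ⟦ ps v′ <ᵇ ps v ⟧)

      -- `ps` is the colouring at the start of the labelling, and `done` says that the colours below
      -- `i` have had their turn.
      record LInv (cl ps : Fin nV → ℕ) (i : ℕ) (g : Global) : Set where
        field
          frame : Frame g₀ g
          cls≡  : ∀ v → cls (proj₂ g v) ≡ cl v
          ψ≡    : ∀ v → ψ (proj₂ g v) ≡ ps v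
          lab<  : ∀ v → lab (proj₂ g v) < ρ
          done  : ∀ v → ps v < i → fair cl ps (λ v → lab (proj₂ g v)) v

      ρ>0 : 0 < ρ
      ρ>0 = m^n>0 2 ε

      label-step : ∀ cl ps → (∀ v → cl v < Bd) → (∀ v → ps v < Bd) → ∀ i g → LInv cl ps i g →
        Legal (labelOp j ρ i) g × LInv cl ps (suc i) (exec (labelOp j ρ i) g)
      label-step cl ps cl< ps< i g I = legal , record
        { frame = record { U≡ = U≡ F ; fch = fch F ; fx = fx F ; fcol = fcol F }
        ; cls≡ = LInv.cls≡ I ; ψ≡ = LInv.ψ≡ I ; lab< = lab<′ ; done = done′ }
        where
        o = labelOp j ρ i
        g′ = exec o g
        F = LInv.frame I
        cg pg lg₀ lg′ : Fin nV → ℕ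
        cg v = cls (proj₂ g v)
        pg v = ψ (proj₂ g v)
        lg₀ v = lab (proj₂ g v)
        lg′ v = lab (proj₂ g′ v)
        cost : Fin nV → ℕ → ℕ
        cost v β = ∑ λ u → ∑ λ v′ → eC cl u v v′ * (⟦ ps v′ <ᵇ i ⟧ * ⟦ lg₀ v′ ≡ᵇ β ⟧)
        label-cost≡ : ∀ v β → β < ρ → lsum f₀ (nth (applyUpTo (replies o g v) (suc ρ)) β) ≡ cost v β
        label-cost≡ v β β< = trans (cong (lsum f₀) (nth-applyUpTo (replies o g v) (suc ρ) β (m<n⇒m<1+n β<)))
          (trans (replies-sum f₀ o g v β) (∑-cong pt))
          where
          pt : ∀ u → ⟦ adj u v ⟧ * viewSum (λ k m → pairWeight j (proj₁ g u) (view o g u) (idV v) k m * (⟦ f₂ m <ᵇ i ⟧ * ⟦ f₃ m ≡ᵇ β ⟧)) (view o g u)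
            ≡ ∑ λ v′ → eC cl u v v′ * (⟦ ps v′ <ᵇ i ⟧ * ⟦ lg₀ v′ ≡ᵇ β ⟧)
          pt u = guard-zero (adj u v) (λ a → trans
            (pairSum≡ o (λ _ → refl) g F (λ _ m → ⟦ f₂ m <ᵇ i ⟧ * ⟦ f₃ m ≡ᵇ β ⟧) (λ _ v′ → ⟦ pg v′ <ᵇ i ⟧ * ⟦ lg₀ v′ ≡ᵇ β ⟧) u v a (λ _ → refl))
            (∑-cong λ v′ → cong₂ _*_ (eC-cong (LInv.cls≡ I) u v v′) (cong (λ z → ⟦ z <ᵇ i ⟧ * ⟦ lg₀ v′ ≡ᵇ β ⟧) (LInv.ψ≡ I v′))))
            (λ a → ∑-zero λ v′ → cong (_* (⟦ ps v′ <ᵇ i ⟧ * ⟦ lg₀ v′ ≡ᵇ β ⟧)) (eC-nonadj cl u v v′ a))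
        legal : Legal o g
        legal = (λ v → subst (_< Bd) (sym (fx F v)) (x< v) ∷ subst (_< Bd) (sym (LInv.cls≡ I v)) (cl< v)
            ∷ subst (_< Bd) (sym (LInv.ψ≡ I v)) (ps< v) ∷ <-≤-trans (LInv.lab< I v) ρ≤Bd ∷ []) ,
          (λ u v β → fits-msg (≤-<-trans (pairSum≤ o (λ _ → refl) g F (λ _ m → ⟦ f₂ m <ᵇ i ⟧ * ⟦ f₃ m ≡ᵇ β ⟧) u (idV v)
            (λ _ m → ≤1*≤1 (⟦⟧≤1 (f₂ m <ᵇ i)) (⟦⟧≤1 _))) nV-room))
          where
          ρ≤Bd : ρ ≤ Bd
          ρ≤Bd = ≤-trans (≤-trans (≤-reflexive (sym (*-identityʳ ρ))) (*-monoʳ-≤ ρ (m^n>0 ρ {{m^n≢0 2 ε}} 7))) cls-room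
        new : ∀ v → ps v ≡ i → lg′ v ≡ best (cost v) ρ
        new v q = trans (cong (λ z → if z then best (λ β → lsum f₀ (nth (applyUpTo (replies o g v) (suc ρ)) β)) ρ else lg₀ v)
          (≡ᵇ-true (trans (LInv.ψ≡ I v) q))) (best-cong ρ (label-cost≡ v))
        old : ∀ v → ps v ≢ i → lg′ v ≡ lg₀ v
        old v q = cong (λ z → if z then best (λ β → lsum f₀ (nth (applyUpTo (replies o g v) (suc ρ)) β)) ρ else lg₀ v)
          (≡ᵇ-false (λ p → q (trans (sym (LInv.ψ≡ I v)) p)))
        lab<′ : ∀ v → lg′ v < ρ
        lab<′ v with ps v ≟ i
        ... | yes q = subst (_< ρ) (sym (new v q)) (best< (cost v) ρ ρ>0)
        ... | no q = subst (_< ρ) (sym (old v q)) (LInv.lab< I v)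
        -- The turn of colour `i` relabels no set of an earlier colour, so fairness established
        -- before remains valid.
        swap-lab : ∀ u v v′ k c → k ≤ i → eC cl u v v′ * (⟦ ps v′ <ᵇ k ⟧ * ⟦ lg′ v′ ≡ᵇ c ⟧) ≡ eC cl u v v′ * (⟦ ps v′ <ᵇ k ⟧ * ⟦ lg₀ v′ ≡ᵇ c ⟧)
        swap-lab u v v′ k c k≤i = cong (eC cl u v v′ *_) (guard-cong (ps v′ <ᵇ k) λ h →
          cong (λ z → ⟦ z ≡ᵇ c ⟧) (old v′ (<⇒≢ (<-≤-trans (<ᵇ⇒< (ps v′) k (≡⇒T h)) k≤i))))
        done′ : ∀ v → ps v < suc i → fair cl ps lg′ v
        done′ v p with m≤n⇒m<n∨m≡n (s≤s⁻¹ p)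
        ... | inj₁ q = ≤-trans (≤-reflexive (cong (ρ *_) (∑-cong λ u → ∑-cong λ v′ →
            trans (swap-lab u v v′ (ps v) (lg′ v) (<⇒≤ q)) (cong (λ z → eC cl u v v′ * (⟦ ps v′ <ᵇ ps v ⟧ * ⟦ lg₀ v′ ≡ᵇ z ⟧)) (old v (<⇒≢ q))))))
          (LInv.done I v q)
        ... | inj₂ refl = begin
          ρ * ∑ (λ u → ∑ λ v′ → eC cl u v v′ * (⟦ ps v′ <ᵇ ps v ⟧ * ⟦ lg′ v′ ≡ᵇ lg′ v ⟧))
            ≡⟨ cong (ρ *_) (∑-cong λ u → ∑-cong λ v′ → trans (swap-lab u v v′ (ps v) (lg′ v) ≤-refl)
                 (cong (λ z → eC cl u v v′ * (⟦ ps v′ <ᵇ ps v ⟧ * ⟦ lg₀ v′ ≡ᵇ z ⟧)) (new v refl))) ⟩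
          ρ * cost v (best (cost v) ρ)
            ≤⟨ best-avg (cost v) ρ ⟩
          Σ< ρ (cost v)
            ≡⟨ ∑-Σ<-swap ρ (λ u β → ∑ λ v′ → eC cl u v v′ * (⟦ ps v′ <ᵇ ps v ⟧ * ⟦ lg₀ v′ ≡ᵇ β ⟧)) ⟩
          ∑ (λ u → Σ< ρ (λ β → ∑ λ v′ → eC cl u v v′ * (⟦ ps v′ <ᵇ ps v ⟧ * ⟦ lg₀ v′ ≡ᵇ β ⟧)))
            ≡⟨ ∑-cong (λ u → ∑-Σ<-swap ρ (λ v′ β → eC cl u v v′ * (⟦ ps v′ <ᵇ ps v ⟧ * ⟦ lg₀ v′ ≡ᵇ β ⟧))) ⟩
          ∑ (λ u → ∑ λ v′ → Σ< ρ (λ β → eC cl u v v′ * (⟦ ps v′ <ᵇ ps v ⟧ * ⟦ lg₀ v′ ≡ᵇ β ⟧)))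
            ≤⟨ ∑-mono (λ u → ∑-mono (pt u)) ⟩
          ∑ (λ u → ∑ λ v′ → eC cl u v v′ * ⟦ ps v′ <ᵇ ps v ⟧) ∎
          where
          open ≤-Reasoning
          pt : ∀ u v′ → Σ< ρ (λ β → eC cl u v v′ * (⟦ ps v′ <ᵇ ps v ⟧ * ⟦ lg₀ v′ ≡ᵇ β ⟧)) ≤ eC cl u v v′ * ⟦ ps v′ <ᵇ ps v ⟧
          pt u v′ = begin
            Σ< ρ (λ β → eC cl u v v′ * (⟦ ps v′ <ᵇ ps v ⟧ * ⟦ lg₀ v′ ≡ᵇ β ⟧))
              ≡⟨ Σ<-cong ρ (λ β _ → *-assoc (eC cl u v v′) ⟦ ps v′ <ᵇ ps v ⟧ _) ⟨
            Σ< ρ (λ β → eC cl u v v′ * ⟦ ps v′ <ᵇ ps v ⟧ * ⟦ lg₀ v′ ≡ᵇ β ⟧)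
              ≡⟨ Σ<-*ˡ ρ (eC cl u v v′ * ⟦ ps v′ <ᵇ ps v ⟧) (λ β → ⟦ lg₀ v′ ≡ᵇ β ⟧) ⟨
            eC cl u v v′ * ⟦ ps v′ <ᵇ ps v ⟧ * Σ< ρ (λ β → ⟦ lg₀ v′ ≡ᵇ β ⟧)
              ≤⟨ *-monoʳ-≤ (eC cl u v v′ * ⟦ ps v′ <ᵇ ps v ⟧) (Σ<-≡ᵇ≤1 ρ (lg₀ v′)) ⟩
            eC cl u v v′ * ⟦ ps v′ <ᵇ ps v ⟧ * 1 ≡⟨ *-identityʳ _ ⟩
            eC cl u v v′ * ⟦ ps v′ <ᵇ ps v ⟧ ∎

      -- Each stage multiplies the number of classes by ρ and the surviving conflicts by at most
      -- 2/ρ.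
      record SInv (i : ℕ) (g : Global) : Set where
        field
          frame : Frame g₀ g
          cls<  : ∀ v → cls (proj₂ g v) < ρ ^ i
          few   : ρ ^ i * total (λ v → cls (proj₂ g v)) ≤ 2 ^ i * ∑₃ eJ

      open SInv

      section-at : ∀ i → i < 8 → ∀ g₁ → SInv i g₁ → Triple (_≡ g₁) (section j ε wd blk bits) (SInv (suc i))
      section-at i i<8 g₁ S = seq {P = _≡ g₁} {Q = RInv cl 0} {R = SInv (suc i)} (startOp ∷ []) (for 4 (reduces j ε wd blk bits) ++ (for (2 ^ bits 4) (labels j ε) ++ (stopOp ε ∷ []))) A
        (seq {P = RInv cl 0} {Q = RInv cl 4} {R = SInv (suc i)} (for 4 (reduces j ε wd blk bits)) (for (2 ^ bits 4) (labels j ε) ++ (stopOp ε ∷ [])) B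
          (seq {P = RInv cl 4} {Q = Labelled} {R = SInv (suc i)} (for (2 ^ bits 4) (labels j ε)) (stopOp ε ∷ []) C D))
        where
        cl : Fin nV → ℕ
        cl v = cls (proj₂ g₁ v)
        cl<Bd : ∀ v → cl v < Bd
        cl<Bd v = <-≤-trans (cls< S v) (≤-trans (^-monoʳ-≤ ρ {{m^n≢0 2 ε}} (<⇒≤ i<8)) cls-room)
        -- A stage restarts from the proper colouring, which has no monochromatic conflict.
        no-mono : ∀ u v v′ → eC cl u v v′ * ⟦ col (proj₂ g₁ v) ≡ᵇ col (proj₂ g₁ v′) ⟧ ≡ 0
        no-mono u v v′ with ≡ᵇ-cases (col (proj₂ g₁ v)) (col (proj₂ g₁ v′))
        ... | inj₂ (_ , q) rewrite q = *-zeroʳ (eC cl u v v′)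
        ... | inj₁ (p , _) = cong (_* ⟦ col (proj₂ g₁ v) ≡ᵇ col (proj₂ g₁ v′) ⟧) (eC-zero cl u v v′
          λ { (a , a′ , ne) → proper u v v′ a a′ ne (trans (sym (fcol (SInv.frame S) v)) (trans p (fcol (SInv.frame S) v′))) })
        A : Triple (_≡ g₁) (startOp ∷ []) (RInv cl 0)
        A = single {P = _≡ g₁} {Q = RInv cl 0} startOp λ { g refl → localOp-legal (<⇒≤ 1-room) (λ s → record s { ψ = col s ; lab = 0 }) g , record
          { frame = record { U≡ = U≡ (SInv.frame S) ; fch = fch (SInv.frame S) ; fx = fx (SInv.frame S) ; fcol = fcol (SInv.frame S) }
          ; cls≡ = λ _ → refl
          ; lab0 = λ _ → refl
          ; ψ< = λ v → subst (_< 2 ^ bits 0) (sym (fcol (SInv.frame S) v)) (col< v)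
          ; few = ≤-trans (≤-reflexive (trans (cong (r *_) (∑-zero λ u → ∑-zero λ v → ∑-zero λ v′ → no-mono u v v′)) (*-zeroʳ r))) z≤n
          } }
        B : Triple (RInv cl 0) (for 4 (reduces j ε wd blk bits)) (RInv cl 4)
        B = loop (RInv cl) 4 (reduces j ε wd blk bits) (λ k k<4 →
          single {P = RInv cl k} {Q = RInv cl (suc k)} (reduceOp j d (bits k) r wd blk) (reduce-step cl cl<Bd k k<4))
        Labelled : Global → Set
        Labelled g = ∃ λ ps → (∀ v → ps v < 2 ^ bits 4) × r * mono (eC cl) ps ≤ 4 * (2 * total cl) × LInv cl ps (2 ^ bits 4) g
        C : Triple (RInv cl 4) (for (2 ^ bits 4) (labels j ε)) Labelled
        C g I = let a , b = loop (LInv cl ps) (2 ^ bits 4) (labels j ε) (λ i _ →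
                      single {P = LInv cl ps i} {Q = LInv cl ps (suc i)} (labelOp j ρ i)
                        (label-step cl ps cl<Bd (λ v → <-≤-trans (ψ< I v) (ψ-room 4 ≤-refl)) i)) g init
                in a , ps , ψ< I , RInv.few I , b
          where
          ps : Fin nV → ℕ
          ps v = ψ (proj₂ g v)
          init : LInv cl ps 0 g
          init = record { frame = RInv.frame I ; cls≡ = RInv.cls≡ I ; ψ≡ = λ _ → refl
                        ; lab< = λ v → subst (_< ρ) (sym (lab0 I v)) ρ>0 ; done = λ v () }
        D : Triple Labelled (stopOp ε ∷ []) (SInv (suc i))
        D = single {P = Labelled} {Q = SInv (suc i)} (stopOp ε) λ g → λ { (ps , ps< , few′ , L) →
          localOp-legal (<⇒≤ 1-room) (λ s → record s { cls = cls s * 2 ^ ε + lab s }) g , post g ps ps< few′ L }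
          where
          post : ∀ g ps → (∀ v → ps v < 2 ^ bits 4) → r * mono (eC cl) ps ≤ 4 * (2 * total cl) →
            LInv cl ps (2 ^ bits 4) g → SInv (suc i) (exec (stopOp ε) g)
          post g ps ps< few′ L = record
            { frame = record { U≡ = U≡ (LInv.frame L) ; fch = fch (LInv.frame L) ; fx = fx (LInv.frame L) ; fcol = fcol (LInv.frame L) }
            ; cls< = new<
            ; few = begin
                ρ * ρ ^ i * total new                ≤⟨ *-monoʳ-≤ (ρ * ρ ^ i) (∑₃-mono finer) ⟩
                ρ * ρ ^ i * mono (eC cl) lb          ≡⟨ l1 ρ (ρ ^ i) (mono (eC cl) lb) ⟩
                ρ ^ i * (ρ * mono (eC cl) lb)        ≤⟨ *-monoʳ-≤ (ρ ^ i) (label-mono (eC cl) ps lb ρ (eC-sym cl) (λ v → LInv.done L v (ps< v)) ps-few) ⟩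
                ρ ^ i * (2 * total cl)               ≡⟨ l2 (ρ ^ i) (total cl) ⟩
                2 * (ρ ^ i * total cl)               ≤⟨ *-monoʳ-≤ 2 (few S) ⟩
                2 * (2 ^ i * ∑₃ eJ)                  ≡⟨ *-assoc 2 (2 ^ i) (∑₃ eJ) ⟨
                2 * 2 ^ i * ∑₃ eJ                    ∎
            }
            where
            open ≤-Reasoning
            lb new : Fin nV → ℕ
            lb v = lab (proj₂ g v)
            new v = cls (proj₂ g v) * 2 ^ ε + lb v
            l1 : ∀ a b c → a * b * c ≡ b * (a * c)
            l1 = solve-∀
            l2 : ∀ a b → a * (2 * b) ≡ 2 * (a * b)
            l2 = solve-∀
            l3 : ∀ ρ m → 8 * (ρ * m) ≡ 2 * (2 * (2 * ρ)) * m
            l3 = solve-∀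
            l4 : ∀ t → 4 * (2 * t) ≡ 8 * t
            l4 = solve-∀
            ps-few : ρ * mono (eC cl) ps ≤ total cl
            ps-few = *-cancelˡ-≤ 8 (≤-trans (≤-reflexive (l3 ρ (mono (eC cl) ps))) (≤-trans few′ (≤-reflexive (l4 (total cl)))))
            new< : ∀ v → new v < ρ * ρ ^ i
            new< v = <-≤-trans (+-monoʳ-< (cls (proj₂ g v) * ρ) (LInv.lab< L v))
              (≤-trans (≤-reflexive (+-comm (cls (proj₂ g v) * ρ) ρ))
              (≤-trans (*-monoˡ-≤ ρ (subst (λ z → suc z ≤ ρ ^ i) (sym (LInv.cls≡ L v)) (cls< S v))) (≤-reflexive (*-comm (ρ ^ i) ρ))))
            finer : ∀ u v v′ → eC new u v v′ ≤ eC cl u v v′ * ⟦ lb v ≡ᵇ lb v′ ⟧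
            finer u v v′ with ≡ᵇ-cases (new v) (new v′)
            ... | inj₂ (_ , q) rewrite q = ≤-trans (≤-reflexive (*-zeroʳ (eJ u v v′))) z≤n
            ... | inj₁ (p , q) with digits-injective ρ (cls (proj₂ g v)) (cls (proj₂ g v′)) (lb v) (lb v′) (LInv.lab< L v) (LInv.lab< L v′) p
            ... | c≡ , l≡ rewrite q | ≡ᵇ-true l≡ | ≡ᵇ-true (trans (sym (LInv.cls≡ L v)) (trans c≡ (LInv.cls≡ L v′))) =
              ≤-reflexive (sym (*-identityʳ (eJ u v v′ * 1)))

      colouring-correct : Triple (_≡ g₀) (colouring j ε wd blk bits) (SInv 8)
      colouring-correct = seq {P = _≡ g₀} {Q = SInv 0} {R = SInv 8} (resetOp ∷ []) (for 8 (λ _ → section j ε wd blk bits))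
        (single {P = _≡ g₀} {Q = SInv 0} resetOp λ { g refl → localOp-legal (<⇒≤ 1-room) (λ s → record s { cls = 0 }) g , init })
        (loop SInv 8 (λ _ → section j ε wd blk bits) (λ i i<8 g S → section-at i i<8 g S g refl))
        where
        init : SInv 0 (exec resetOp g₀)
        init = record { frame = record { U≡ = λ _ → refl ; fch = λ _ → refl ; fx = λ _ → refl ; fcol = λ _ → refl }
                      ; cls< = λ _ → s≤s z≤n
                      ; few = *-monoʳ-≤ 1 (∑₃-mono λ u v v′ → ≤-reflexive (*-identityʳ (eJ u v v′))) }

-- Rounding the fractional solution level by level

roundOps : (lam W j : ℕ) → ℕ → List Op
roundOps lam W j κ = roundOp lam W j κ ∷ []

level : (ε wd blk : ℕ) (bits : ℕ → ℕ) (lam W : ℕ) → ℕ → List Op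
level ε wd blk bits lam W j = colouring j ε wd blk bits ++ for ((2 ^ ε) ^ 8) (roundOps lam W j)

module Rounding (N : Network) (Bd : ℕ) where
  open Colour N Bd public

  record Fixed (g₀ g : Global) : Set where
    field
      U≡′  : ∀ u → proj₁ g u ≡ proj₁ g₀ u
      ch≡′ : ∀ v → ch (proj₂ g v) ≡ ch (proj₂ g₀ v)
      col≡′ : ∀ v → col (proj₂ g v) ≡ col (proj₂ g₀ v)
  open Fixed public

  module RoundRun (ε wd blk : ℕ) (bits : ℕ → ℕ) (room : ∀ j → Col.Room j ε wd blk bits) (ℓ lam : ℕ)
           (big : nV * 2 ^ suc ℓ < Bd) (W<Bd′ : 2 ^ suc ℓ < Bd) (gL : Global)
           (col< : ∀ v → col (proj₂ gL v) < 2 ^ bits 0)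
           (proper : ∀ u v v′ → adj u v ≡ true → adj u v′ ≡ true → v ≢ v′ → col (proj₂ gL v) ≢ col (proj₂ gL v′)) where

    private
      W p ρ⁸ : ℕ
      W = 2 ^ suc ℓ
      p = lam * W
      ρ⁸ = (2 ^ ε) ^ 8

    module P = Potential (counted gL) idV idV-inj

    quad : (Fin nV → ℕ) → ℕ
    quad y = ∑₃ λ u v v′ → P.e u v v′ * (y v * y v′)

    gainP lossN : (Fin nV → ℕ) → ℕ
    gainP y = ∑ (λ v → P.value W v * y v)
    lossN y = 8 * quad y + p * ∑ y

    xs : Global → Fin nV → ℕ
    xs g v = x (proj₂ g v)

    -- Level `j` eliminates the value 2^j; at `suc ℓ` only 0 and W are left.
    Scale : ℕ → ℕ → Set
    Scale j a = a ≡ 0 ⊎ ∃ λ i → j ≤ i × i ≤ suc ℓ × a ≡ 2 ^ i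

    scale≤ : ∀ {j a} → Scale j a → a ≤ W
    scale≤ (inj₁ refl) = z≤n
    scale≤ (inj₂ (i , _ , q , refl)) = ^-monoʳ-≤ 2 q

    counted≡ : ∀ {g} → Fixed gL g → ∀ u v → counted g u v ≡ counted gL u v
    counted≡ F u v = cong (λ z → adj u v ∧ (idV v <ᵇ θ z)) (U≡′ F u)

    e≡ : ∀ {g} → Fixed gL g → ∀ u v v′ → Pot.e g u v v′ ≡ P.e u v v′
    e≡ F u v v′ = cong₂ (λ a b → ⟦ a ⟧ * (⟦ b ⟧ * ⟦ not (idV v ≡ᵇ idV v′) ⟧)) (counted≡ F u v) (counted≡ F u v′)

    module _ (j : ℕ) (j≤ℓ : j ≤ ℓ) (x₁ cl : Fin nV → ℕ) (sc : ∀ v → Scale j (x₁ v)) where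

      eX : Fin nU → Fin nV → Fin nV → ℕ
      eX u v v′ = P.e u v v′ * (⟦ x₁ v ≡ᵇ 2 ^ j ⟧ * ⟦ x₁ v′ ≡ᵇ 2 ^ j ⟧)

      spent : ℕ → ℕ
      spent κ = ∑₃ λ u v v′ → eX u v v′ * ⟦ cl v ≡ᵇ cl v′ ⟧ * (⟦ cl v <ᵇ κ ⟧ * (2 ^ j * 2 ^ j))

      -- `later` identifies the sets about to move with the active sets at the start of the level,
      -- so that their losses are part of `eX`; `spent κ` bounds the losses of the classes below
      -- `κ`.
      record KInv (κ : ℕ) (g : Global) : Set where
        field
          fixed : Fixed gL g
          cls≡  : ∀ v → cls (proj₂ g v) ≡ cl v
          scale : ∀ v → Scale j (xs g v)
          later : ∀ v → κ ≤ cl v → xs g v ≡ x₁ v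
          moved : ∀ v → cl v < κ → Scale (suc j) (xs g v)
          bal   : gainP x₁ + lossN (xs g) ≤ gainP (xs g) + lossN x₁ + 8 * spent κ
      open KInv

      round-op-step : ∀ κ g → KInv κ g → Legal (roundOp lam W j κ) g × KInv (suc κ) (exec (roundOp lam W j κ) g)
      round-op-step κ g I = legal , record
        { fixed = record { U≡′ = U≡′ (fixed I) ; ch≡′ = ch≡′ (fixed I) ; col≡′ = col≡′ (fixed I) }
        ; cls≡ = cls≡ I ; scale = scale′ ; later = later′ ; moved = moved′ ; bal = bal′ }
        where
        o = roundOp lam W j κ
        g′ = exec o g
        S : Fin nV → Bool
        S v = (xs g v ≡ᵇ 2 ^ j) ∧ (cls (proj₂ g v) ≡ᵇ κ)
        module R = RoundStep P.e (P.value W) p (2 ^ j) (xs g) S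
        θ≡ : ∀ u → θ (proj₁ g u) ≡ θ (proj₁ gL u)
        θ≡ u = cong θ (U≡′ (fixed I) u)
        cnt≡ : ∀ v → lsum f₀ (replies o g v 0) ≡ ∑ (λ u → ⟦ counted gL u v ⟧)
        cnt≡ v = trans (replies-sum f₀ o g v 0) (∑-cong λ u → trans (sym (⟦∧⟧ (adj u v) _))
          (cong (λ z → ⟦ adj u v ∧ (idV v <ᵇ z) ⟧) (θ≡ u)))
        G≡ : ∀ v → lsum f₁ (replies o g v 0) ≡ R.G v
        G≡ v = trans (replies-sum f₁ o g v 0) (∑-cong λ u → trans
          (cong (λ z → ⟦ adj u v ⟧ * (⟦ idV v <ᵇ θ (proj₁ g u) ⟧ * z)) (view-sum (λ i m → ⟦ i <ᵇ θ (proj₁ g u) ⟧ * ⟦ not (idV v ≡ᵇ i) ⟧ * f₀ m) o g u))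
          (trans (cong (λ z → ⟦ adj u v ⟧ * (⟦ idV v <ᵇ z ⟧ * ∑ (λ v′ → ⟦ adj u v′ ⟧ * (⟦ idV v′ <ᵇ z ⟧ * ⟦ not (idV v ≡ᵇ idV v′) ⟧ * xs g v′)))) (θ≡ u))
          (trans (cong (⟦ adj u v ⟧ *_) (∑-*ˡ ⟦ idV v <ᵇ θ (proj₁ gL u) ⟧ (λ v′ → ⟦ adj u v′ ⟧ * (⟦ idV v′ <ᵇ θ (proj₁ gL u) ⟧ * ⟦ not (idV v ≡ᵇ idV v′) ⟧ * xs g v′))))
          (trans (∑-*ˡ ⟦ adj u v ⟧ (λ v′ → ⟦ idV v <ᵇ θ (proj₁ gL u) ⟧ * (⟦ adj u v′ ⟧ * (⟦ idV v′ <ᵇ θ (proj₁ gL u) ⟧ * ⟦ not (idV v ≡ᵇ idV v′) ⟧ * xs g v′))))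
          (∑-cong λ v′ → trans (lem ⟦ adj u v ⟧ ⟦ idV v <ᵇ θ (proj₁ gL u) ⟧ ⟦ adj u v′ ⟧ ⟦ idV v′ <ᵇ θ (proj₁ gL u) ⟧ ⟦ not (idV v ≡ᵇ idV v′) ⟧ (xs g v′))
            (sym (cong₂ (λ a b → a * (b * ⟦ not (idV v ≡ᵇ idV v′) ⟧) * xs g v′) (⟦∧⟧ (adj u v) _) (⟦∧⟧ (adj u v′) _))))))))
          where
          lem : ∀ a b c d n y → a * (b * (c * (d * n * y))) ≡ a * b * (c * d * n) * y
          lem = solve-∀
        x≡ : ∀ v → xs g′ v ≡ R.x′ v
        x≡ v = cong₂ (λ s t → if S v then (if 16 * s + lam * W ≤ᵇ 16 * W * t then 2 * 2 ^ j else 0) else xs g v) (G≡ v) (cnt≡ v)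
        legal : Legal o g
        legal = (λ v → fits-msg (≤-<-trans (scale≤ (scale I v)) W<Bd′)) ,
          (λ u v β → fits-msg₂ (≤-<-trans (≤-trans (⟦⟧≤1 (idV v <ᵇ θ (proj₁ g u))) (m^n>0 2 (suc ℓ))) W<Bd′)
            (≤-<-trans (≤-trans (guard-≤ (idV v <ᵇ θ (proj₁ g u)) _) (≤-trans (≤-reflexive (view-sum (λ i m → ⟦ i <ᵇ θ (proj₁ g u) ⟧ * ⟦ not (idV v ≡ᵇ i) ⟧ * f₀ m) o g u))
              (≤-trans (∑-mono {g = λ _ → W} (λ v′ → ≤-trans (guard-≤ (adj u v′) _) (≤-trans (≤-reflexive (*-assoc ⟦ idV v′ <ᵇ θ (proj₁ g u) ⟧ ⟦ not (idV v ≡ᵇ idV v′) ⟧ (xs g v′)))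
                  (≤-trans (guard-≤ (idV v′ <ᵇ θ (proj₁ g u)) _) (≤-trans (guard-≤ (not (idV v ≡ᵇ idV v′)) _) (scale≤ (scale I v′)))))))
                (≤-reflexive (∑-const nV W))))) big))
        S⇒ : ∀ v → S v ≡ true → xs g v ≡ 2 ^ j × cl v ≡ κ
        S⇒ v s = ≡ᵇ⇒≡ _ _ (≡⇒T (proj₁ (∧-true s))) , trans (sym (cls≡ I v)) (≡ᵇ⇒≡ _ _ (≡⇒T (proj₂ (∧-true {xs g v ≡ᵇ 2 ^ j} s))))
        keep-x : ∀ v → S v ≡ false → xs g′ v ≡ xs g v
        keep-x v s = trans (x≡ v) (cong (λ z → if z then (if R.up? v then 2 * 2 ^ j else 0) else xs g v) s)
        round-x : ∀ v → S v ≡ true → Scale (suc j) (xs g′ v)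
        round-x v s with bool? (R.up? v)
        ... | inj₁ q = inj₂ (suc j , ≤-refl , s≤s j≤ℓ , trans (x≡ v) (cong₂ (λ z w → if z then (if w then 2 * 2 ^ j else 0) else xs g v) s q))
        ... | inj₂ q = inj₁ (trans (x≡ v) (cong₂ (λ z w → if z then (if w then 2 * 2 ^ j else 0) else xs g v) s q))
        weaken : ∀ {a} → Scale (suc j) a → Scale j a
        weaken (inj₁ q) = inj₁ q
        weaken (inj₂ (i , q , r)) = inj₂ (i , <⇒≤ q , r)
        scale′ : ∀ v → Scale j (xs g′ v)
        scale′ v with bool? (S v)
        ... | inj₁ s = weaken (round-x v s)
        ... | inj₂ s = subst (Scale j) (sym (keep-x v s)) (scale I v)
        not-S : ∀ v → cl v ≢ κ → S v ≡ false
        not-S v ne with bool? (S v)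
        ... | inj₂ s = s
        ... | inj₁ s = ⊥-elim (ne (proj₂ (S⇒ v s)))
        later′ : ∀ v → suc κ ≤ cl v → xs g′ v ≡ x₁ v
        later′ v q = trans (keep-x v (not-S v (λ r → <⇒≢ q (sym r)))) (later I v (<⇒≤ q))
        moved′ : ∀ v → cl v < suc κ → Scale (suc j) (xs g′ v)
        moved′ v q with m≤n⇒m<n∨m≡n (s≤s⁻¹ q)
        ... | inj₁ l = subst (Scale (suc j)) (sym (keep-x v (not-S v (<⇒≢ l)))) (moved I v l)
        ... | inj₂ c≡ with bool? (S v)
        ... | inj₁ s = round-x v s
        ... | inj₂ s with scale I v
        ... | inj₁ z = inj₁ (trans (keep-x v s) z)
        ... | inj₂ (i , j≤i , i≤ , z) with m≤n⇒m<n∨m≡n j≤i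
        ... | inj₁ j<i = inj₂ (i , j<i , i≤ , trans (keep-x v s) z)
        ... | inj₂ refl = ⊥-elim (true≢false (trans (sym (cong₂ _∧_ (≡ᵇ-true z) (≡ᵇ-true (trans (cls≡ I v) c≡)))) s))
        -- Sets moving together all belong to class `κ`, so a pair of them is a conflict inside one
        -- class.
        loss≤ : R.loss P.e-sym (λ v s → proj₁ (S⇒ v s)) ≤ ∑₃ (λ u v v′ → eX u v v′ * ⟦ cl v ≡ᵇ cl v′ ⟧ * (⟦ cl v ≡ᵇ κ ⟧ * (2 ^ j * 2 ^ j)))
        loss≤ = ∑₃-mono pt
          where
          pt : ∀ u v v′ → P.e u v v′ * (⟦ S v ⟧ * ⟦ S v′ ⟧ * (2 ^ j * 2 ^ j)) ≤ eX u v v′ * ⟦ cl v ≡ᵇ cl v′ ⟧ * (⟦ cl v ≡ᵇ κ ⟧ * (2 ^ j * 2 ^ j))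
          pt u v v′ with bool? (S v) | bool? (S v′)
          ... | inj₂ s | _ rewrite s = ≤-trans (≤-reflexive (*-zeroʳ (P.e u v v′))) z≤n
          ... | inj₁ s | inj₂ s′ rewrite s | s′ = ≤-trans (≤-reflexive (*-zeroʳ (P.e u v v′))) z≤n
          ... | inj₁ s | inj₁ s′ = ≤-reflexive (trans (cong₂ (λ a b → P.e u v v′ * (⟦ a ⟧ * ⟦ b ⟧ * (2 ^ j * 2 ^ j))) s s′) (sym (trans (cong₂ (λ a b → P.e u v v′ * a * ⟦ cl v ≡ᵇ cl v′ ⟧ * (b * (2 ^ j * 2 ^ j)))
              (cong₂ _*_ (act v s) (act v′ s′)) (cong ⟦_⟧ (≡ᵇ-true (proj₂ (S⇒ v s)))))
              (trans (cong (λ z → P.e u v v′ * (1 * 1) * ⟦ z ⟧ * (1 * (2 ^ j * 2 ^ j))) (≡ᵇ-true (trans (proj₂ (S⇒ v s)) (sym (proj₂ (S⇒ v′ s′))))))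
                (lem (P.e u v v′) (2 ^ j * 2 ^ j))))))
            where
            lem : ∀ e w → e * (1 * 1) * 1 * (1 * w) ≡ e * (1 * 1 * w)
            lem = solve-∀
            act : ∀ v → S v ≡ true → ⟦ x₁ v ≡ᵇ 2 ^ j ⟧ ≡ 1
            act v s = cong ⟦_⟧ (≡ᵇ-true (trans (sym (later I v (≤-reflexive (sym (proj₂ (S⇒ v s)))))) (proj₁ (S⇒ v s))))
        spent-suc : spent (suc κ) ≡ spent κ + ∑₃ (λ u v v′ → eX u v v′ * ⟦ cl v ≡ᵇ cl v′ ⟧ * (⟦ cl v ≡ᵇ κ ⟧ * (2 ^ j * 2 ^ j)))
        spent-suc = trans (∑-cong λ u → ∑-cong λ v → ∑-cong λ v′ → trans
            (cong (λ z → eX u v v′ * ⟦ cl v ≡ᵇ cl v′ ⟧ * (z * (2 ^ j * 2 ^ j))) (<ᵇ-suc (cl v) κ))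
            (lem (eX u v v′ * ⟦ cl v ≡ᵇ cl v′ ⟧) ⟦ cl v <ᵇ κ ⟧ ⟦ cl v ≡ᵇ κ ⟧ (2 ^ j * 2 ^ j)))
          (∑₃-+ (λ u v v′ → eX u v v′ * ⟦ cl v ≡ᵇ cl v′ ⟧ * (⟦ cl v <ᵇ κ ⟧ * (2 ^ j * 2 ^ j))) (λ u v v′ → eX u v v′ * ⟦ cl v ≡ᵇ cl v′ ⟧ * (⟦ cl v ≡ᵇ κ ⟧ * (2 ^ j * 2 ^ j))))
          where
          lem : ∀ a b c w → a * ((b + c) * w) ≡ a * (b * w) + a * (c * w)
          lem = solve-∀
        bal′ : gainP x₁ + lossN (xs g′) ≤ gainP (xs g′) + lossN x₁ + 8 * spent (suc κ)
        bal′ = +-cancelˡ-≤ (gainP (xs g) + lossN (xs g)) _ _ (begin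
          gainP (xs g) + lossN (xs g) + (gainP x₁ + lossN (xs g′))     ≡⟨ l1 (gainP (xs g)) (lossN (xs g)) (gainP x₁) (lossN (xs g′)) ⟩
          gainP x₁ + lossN (xs g) + (gainP (xs g) + lossN (xs g′))     ≤⟨ +-mono-≤ (bal I) step ⟩
          gainP (xs g) + lossN x₁ + 8 * spent κ + (gainP (xs g′) + lossN (xs g) + 8 * more) ≡⟨ l2 (gainP (xs g)) (lossN x₁) (spent κ) (gainP (xs g′)) (lossN (xs g)) more ⟩
          gainP (xs g) + lossN (xs g) + (gainP (xs g′) + lossN x₁ + 8 * (spent κ + more)) ≡⟨ cong (λ z → gainP (xs g) + lossN (xs g) + (gainP (xs g′) + lossN x₁ + 8 * z)) spent-suc ⟨
          gainP (xs g) + lossN (xs g) + (gainP (xs g′) + lossN x₁ + 8 * spent (suc κ)) ∎)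
          where
          open ≤-Reasoning
          more = ∑₃ (λ u v v′ → eX u v v′ * ⟦ cl v ≡ᵇ cl v′ ⟧ * (⟦ cl v ≡ᵇ κ ⟧ * (2 ^ j * 2 ^ j)))
          l1 : ∀ a b c d → a + b + (c + d) ≡ c + b + (a + d)
          l1 = solve-∀
          l2 : ∀ a b s c d m → a + b + 8 * s + (c + d + 8 * m) ≡ a + d + (c + b + 8 * (s + m))
          l2 = solve-∀
          step : gainP (xs g) + lossN (xs g′) ≤ gainP (xs g′) + lossN (xs g) + 8 * more
          step = begin
            gainP (xs g) + lossN (xs g′)   ≡⟨ cong (gainP (xs g) +_) (cong₂ (λ a b → 8 * a + p * b)
              (∑-cong λ u → ∑-cong λ v → ∑-cong λ v′ → cong₂ (λ a b → P.e u v v′ * (a * b)) (x≡ v) (x≡ v′)) (∑-cong x≡)) ⟩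
            gainP (xs g) + lossN R.x′      ≤⟨ R.round-step P.e-sym (λ v s → proj₁ (S⇒ v s)) ⟩
            gainP R.x′ + lossN (xs g) + 8 * R.loss P.e-sym (λ v s → proj₁ (S⇒ v s)) ≤⟨ +-monoʳ-≤ (gainP R.x′ + lossN (xs g)) (*-monoʳ-≤ 8 loss≤) ⟩
            gainP R.x′ + lossN (xs g) + 8 * more ≡⟨ cong (λ z → z + lossN (xs g) + 8 * more) (∑-cong λ v → cong (P.value W v *_) (sym (x≡ v))) ⟩
            gainP (xs g′) + lossN (xs g) + 8 * more ∎

      -- Active sets have x = 2^j, so their pairs are part of quad x₁.
      active-quad : ∑₃ eX * (2 ^ j * 2 ^ j) ≤ quad x₁
      active-quad = ≤-trans (≤-reflexive (trans (∑-*ʳ (2 ^ j * 2 ^ j) (λ u → ∑ λ v → ∑ (eX u v))) (∑-cong λ u →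
          trans (∑-*ʳ (2 ^ j * 2 ^ j) (λ v → ∑ (eX u v))) (∑-cong λ v → ∑-*ʳ (2 ^ j * 2 ^ j) (eX u v))))) (∑₃-mono pt)
        where
        z : ∀ e w → e * 0 * w ≡ 0
        z = solve-∀
        pt : ∀ u v v′ → eX u v v′ * (2 ^ j * 2 ^ j) ≤ P.e u v v′ * (x₁ v * x₁ v′)
        pt u v v′ with ≡ᵇ-cases (x₁ v) (2 ^ j) | ≡ᵇ-cases (x₁ v′) (2 ^ j)
        ... | inj₂ (_ , q) | _ rewrite q | z (P.e u v v′) (2 ^ j * 2 ^ j) = z≤n
        ... | inj₁ (_ , q) | inj₂ (_ , q′) rewrite q | q′ | z (P.e u v v′) (2 ^ j * 2 ^ j) = z≤n
        ... | inj₁ (r , q) | inj₁ (r′ , q′) rewrite q | q′ | *-identityʳ (P.e u v v′) = *-monoʳ-≤ (P.e u v v′) (≤-reflexive (sym (cong₂ _*_ r r′)))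

    -- C bounds ρ⁸ times the loss of one level: eight stages leave 2^8/ρ⁸ of the active pairs, and
    -- 8·`quad` is at most 52·W²·f. With 13312 = 256·52, the hypothesis `cap` below makes all levels
    -- together lose at most W²·f.
    f C : ℕ
    f = #open gL
    C = 256 * (52 * (W * W) * f)

    module _ (start-ok : lossN (xs gL) ≤ gainP (xs gL) + W * W * f) (cap : suc ℓ * 13312 ≤ ρ⁸)
             (only-open : ∀ u v → counted gL u v ≡ true → isOpen gL u ≡ true)
             (scale₀ : ∀ v → Scale 0 (xs gL v)) where

      record LevelInv (j : ℕ) (g : Global) : Set where
        field
          fixed : Fixed gL g
          scale : ∀ v → Scale j (xs g v)
          loss  : ℕ
          bal   : gainP (xs gL) + lossN (xs g) ≤ gainP (xs g) + lossN (xs gL) + loss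
          small : ρ⁸ * loss ≤ j * C

      gainP-cong : ∀ {y y′ : Fin nV → ℕ} → (∀ v → y v ≡ y′ v) → gainP y ≡ gainP y′
      gainP-cong h = ∑-cong λ v → cong (P.value W v *_) (h v)

      lossN-cong : ∀ {y y′ : Fin nV → ℕ} → (∀ v → y v ≡ y′ v) → lossN y ≡ lossN y′
      lossN-cong h = cong₂ (λ a b → 8 * a + p * b)
        (∑-cong λ u → ∑-cong λ v → ∑-cong λ v′ → cong₂ (λ a b → P.e u v v′ * (a * b)) (h v) (h v′)) (∑-cong h)

      loss≤W²f : ∀ j loss → j ≤ suc ℓ → ρ⁸ * loss ≤ j * C → loss ≤ W * W * f
      loss≤W²f j loss j≤ h = *-cancelˡ-≤ ρ⁸ {{m^n≢0 (2 ^ ε) 8 {{m^n≢0 2 ε}}}} (begin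
        ρ⁸ * loss                     ≤⟨ h ⟩
        j * C                         ≤⟨ *-monoˡ-≤ C j≤ ⟩
        suc ℓ * C                     ≡⟨ cong (suc ℓ *_) (l1 (W * W) f) ⟩
        suc ℓ * (13312 * (W * W * f)) ≡⟨ *-assoc (suc ℓ) 13312 (W * W * f) ⟨
        suc ℓ * 13312 * (W * W * f)   ≤⟨ *-monoˡ-≤ (W * W * f) cap ⟩
        ρ⁸ * (W * W * f)              ∎)
        where
        open ≤-Reasoning
        l1 : ∀ q f → 256 * (52 * q * f) ≡ 13312 * (q * f)
        l1 q f = trans (cong (256 *_) (*-assoc 52 q f)) (sym (*-assoc 256 52 (q * f)))

      -- The potential starts no lower than -W²·f and has lost at most W²·f since. A potential of at
      -- least -2W²·f limits the pairs, and this limit pays for the loss of the next level.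
      quad≤ : ∀ j g → j ≤ suc ℓ → LevelInv j g → 8 * quad (xs g) ≤ 52 * (W * W) * f
      quad≤ j g j≤ I = P.quad-bound W (isOpen gL) only-open (xs g) (λ v → scale≤ (scale v)) (p * ∑ (xs g))
        (≤-trans (+-cancelˡ-≤ (gainP (xs gL)) _ _ (begin
          gainP (xs gL) + lossN (xs g)                           ≤⟨ bal ⟩
          gainP (xs g) + lossN (xs gL) + loss                    ≤⟨ +-mono-≤ (+-monoʳ-≤ (gainP (xs g)) start-ok) (loss≤W²f j loss j≤ small) ⟩
          gainP (xs g) + (gainP (xs gL) + W * W * f) + W * W * f ≡⟨ l1 (gainP (xs g)) (gainP (xs gL)) (W * W) f ⟩
          gainP (xs gL) + (gainP (xs g) + 2 * (W * W) * f)       ∎))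
          (≤-reflexive (cong (_+ 2 * (W * W) * f) (P.∑value W (xs g)))))
        where
        open ≤-Reasoning
        open LevelInv I
        l1 : ∀ a b q f → a + (b + q * f) + q * f ≡ b + (a + 2 * q * f)
        l1 = solve-∀

      level-at : ∀ j → j ≤ ℓ → ∀ g₁ → LevelInv j g₁ → Triple (_≡ g₁) (level ε wd blk bits lam W j) (LevelInv (suc j))
      level-at j j≤ℓ g₁ I = seq {P = _≡ g₁} {Q = Coloured} {R = LevelInv (suc j)}
          (colouring j ε wd blk bits) (for ρ⁸ (roundOps lam W j))
          (Col.colouring-correct j ε wd blk bits (room j) g₁ x<₁ col<₁ proper₁) rounds
        where
        open LevelInv I
        x<₁ : ∀ v → xs g₁ v < Bd
        x<₁ v = ≤-<-trans (scale≤ (scale v)) W<Bd′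
        col<₁ : ∀ v → col (proj₂ g₁ v) < 2 ^ bits 0
        col<₁ v = subst (_< 2 ^ bits 0) (sym (col≡′ fixed v)) (col< v)
        proper₁ : ∀ u v v′ → adj u v ≡ true → adj u v′ ≡ true → v ≢ v′ → col (proj₂ g₁ v) ≢ col (proj₂ g₁ v′)
        proper₁ u v v′ a a′ ne q = proper u v v′ a a′ ne (trans (sym (col≡′ fixed v)) (trans q (col≡′ fixed v′)))
        Coloured : Global → Set
        Coloured = Col.SInv j ε wd blk bits (room j) g₁ x<₁ col<₁ proper₁ 8
        x₁ : Fin nV → ℕ
        x₁ = xs g₁
        rounds : Triple Coloured (for ρ⁸ (roundOps lam W j)) (LevelInv (suc j))
        rounds g S = proj₁ run , post
          where
          module S = Col.SInv S
          cl : Fin nV → ℕ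
          cl v = cls (proj₂ g v)
          K : ℕ → Global → Set
          K = KInv j j≤ℓ x₁ cl scale
          fixed₁ : Fixed gL g
          fixed₁ = record
            { U≡′ = λ u → trans (Frame.U≡ S.frame u) (U≡′ fixed u)
            ; ch≡′ = λ v → trans (Frame.fch S.frame v) (ch≡′ fixed v)
            ; col≡′ = λ v → trans (Frame.fcol S.frame v) (col≡′ fixed v) }
          init : K 0 g
          init = record
            { fixed = fixed₁ ; cls≡ = λ _ → refl
            ; scale = λ v → subst (Scale j) (sym (Frame.fx S.frame v)) (scale v)
            ; later = λ v _ → Frame.fx S.frame v
            ; moved = λ v ()
            ; bal = ≤-trans (≤-reflexive (cong₂ _+_ (gainP-cong (λ v → sym (Frame.fx S.frame v))) (lossN-cong (Frame.fx S.frame)))) (m≤m+n _ _) }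
          run : AllLegal (for ρ⁸ (roundOps lam W j)) g × K ρ⁸ (execs (for ρ⁸ (roundOps lam W j)) g)
          run = loop K ρ⁸ (roundOps lam W j) (λ κ _ → single {P = K κ} {Q = K (suc κ)} (roundOp lam W j κ)
                  (round-op-step j j≤ℓ x₁ cl scale κ)) g init
          g₂ : Global
          g₂ = execs (for ρ⁸ (roundOps lam W j)) g
          module K₂ = KInv (proj₂ run)
          w² sp : ℕ
          w² = 2 ^ j * 2 ^ j
          sp = spent j j≤ℓ x₁ cl scale ρ⁸
          eX₁ : Fin nU → Fin nV → Fin nV → ℕ
          eX₁ = eX j j≤ℓ x₁ cl scale
          sp≤ : sp ≤ mono eX₁ cl * w²
          sp≤ = ≤-trans (∑₃-mono λ u v v′ → *-monoʳ-≤ (eX₁ u v v′ * ⟦ cl v ≡ᵇ cl v′ ⟧) (guard-≤ (cl v <ᵇ ρ⁸) w²))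
            (≤-reflexive (sym (trans (∑-*ʳ w² (λ u → ∑ λ v → ∑ (λ v′ → eX₁ u v v′ * ⟦ cl v ≡ᵇ cl v′ ⟧))) (∑-cong λ u →
              trans (∑-*ʳ w² (λ v → ∑ (λ v′ → eX₁ u v v′ * ⟦ cl v ≡ᵇ cl v′ ⟧))) (∑-cong λ v → ∑-*ʳ w² (λ v′ → eX₁ u v v′ * ⟦ cl v ≡ᵇ cl v′ ⟧))))))
          few₁ : ρ⁸ * mono eX₁ cl ≤ 256 * ∑₃ eX₁
          few₁ = subst₂ (λ a b → ρ⁸ * a ≤ 256 * b)
            (∑-cong λ u → ∑-cong λ v → ∑-cong λ v′ → cong (λ z → z * (⟦ x₁ v ≡ᵇ 2 ^ j ⟧ * ⟦ x₁ v′ ≡ᵇ 2 ^ j ⟧) * ⟦ cl v ≡ᵇ cl v′ ⟧) (e≡ fixed u v v′))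
            (∑-cong λ u → ∑-cong λ v → ∑-cong λ v′ → cong (λ z → z * (⟦ x₁ v ≡ᵇ 2 ^ j ⟧ * ⟦ x₁ v′ ≡ᵇ 2 ^ j ⟧)) (e≡ fixed u v v′))
            S.few
          sp-small : ρ⁸ * (8 * sp) ≤ C
          sp-small = begin
            ρ⁸ * (8 * sp)                        ≤⟨ *-monoʳ-≤ ρ⁸ (*-monoʳ-≤ 8 sp≤) ⟩
            ρ⁸ * (8 * (mono eX₁ cl * w²))        ≡⟨ l1 ρ⁸ (mono eX₁ cl) w² ⟩
            8 * (ρ⁸ * mono eX₁ cl * w²)          ≤⟨ *-monoʳ-≤ 8 (*-monoˡ-≤ w² few₁) ⟩
            8 * (256 * ∑₃ eX₁ * w²)              ≡⟨ l2 (∑₃ eX₁) w² 256 ⟩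
            256 * (8 * (∑₃ eX₁ * w²))            ≤⟨ *-monoʳ-≤ 256 (*-monoʳ-≤ 8 (active-quad j j≤ℓ x₁ cl scale)) ⟩
            256 * (8 * quad x₁)                  ≤⟨ *-monoʳ-≤ 256 (quad≤ j g₁ (m≤n⇒m≤1+n j≤ℓ) I) ⟩
            256 * (52 * (W * W) * f)             ∎
            where
            open ≤-Reasoning
            l1 : ∀ r m w → r * (8 * (m * w)) ≡ 8 * (r * m * w)
            l1 = solve-∀
            l2 : ∀ m w c → 8 * (c * m * w) ≡ c * (8 * (m * w))
            l2 = solve-∀
          post : LevelInv (suc j) g₂
          post = record
            { fixed = K₂.fixed
            ; scale = λ v → K₂.moved v (S.cls< v)
            ; loss = loss + 8 * sp
            ; bal = +-cancelˡ-≤ (gainP x₁ + lossN x₁) _ _ (begin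
                gainP x₁ + lossN x₁ + (gainP (xs gL) + lossN (xs g₂))   ≡⟨ l1 (gainP x₁) (lossN x₁) (gainP (xs gL)) (lossN (xs g₂)) ⟩
                gainP (xs gL) + lossN x₁ + (gainP x₁ + lossN (xs g₂))   ≤⟨ +-mono-≤ bal K₂.bal ⟩
                gainP x₁ + lossN (xs gL) + loss + (gainP (xs g₂) + lossN x₁ + 8 * sp) ≡⟨ l2 (gainP x₁) (lossN (xs gL)) loss (gainP (xs g₂)) (lossN x₁) (8 * sp) ⟩
                gainP x₁ + lossN x₁ + (gainP (xs g₂) + lossN (xs gL) + (loss + 8 * sp)) ∎)
            ; small = begin
                ρ⁸ * (loss + 8 * sp)        ≡⟨ *-distribˡ-+ ρ⁸ loss (8 * sp) ⟩
                ρ⁸ * loss + ρ⁸ * (8 * sp)   ≤⟨ +-mono-≤ small sp-small ⟩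
                j * C + C                   ≡⟨ +-comm (j * C) C ⟩
                suc j * C                   ∎
            }
            where
            open ≤-Reasoning
            l1 : ∀ a b c d → a + b + (c + d) ≡ c + b + (a + d)
            l1 = solve-∀
            l2 : ∀ a b l c d s → a + b + l + (c + d + s) ≡ a + d + (c + b + (l + s))
            l2 = solve-∀

      record Rounded (g : Global) : Set where
        field
          fixed : Fixed gL g
          value : ∀ v → xs g v ≡ 0 ⊎ xs g v ≡ W
          bal   : gainP (xs gL) + lossN (xs g) ≤ gainP (xs g) + lossN (xs gL) + W * W * f

      levels-correct : Triple (_≡ gL) (for (suc ℓ) (level ε wd blk bits lam W)) Rounded
      levels-correct = conseq {P = LevelInv 0} {P′ = _≡ gL} {Q = LevelInv (suc ℓ)} {Q′ = Rounded}
        (for (suc ℓ) (level ε wd blk bits lam W)) (λ { g refl → init }) finish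
        (loop LevelInv (suc ℓ) (level ε wd blk bits lam W) (λ j j< g I → level-at j (s≤s⁻¹ j<) g I g refl))
        where
        init : LevelInv 0 gL
        init = record
          { fixed = record { U≡′ = λ _ → refl ; ch≡′ = λ _ → refl ; col≡′ = λ _ → refl }
          ; scale = scale₀ ; loss = 0
          ; bal = m≤m+n _ 0
          ; small = ≤-trans (≤-reflexive (*-zeroʳ ρ⁸)) z≤n }
        finish : ∀ g → LevelInv (suc ℓ) g → Rounded g
        finish g I = record
          { fixed = LevelInv.fixed I
          ; value = λ v → two (LevelInv.scale I v)
          ; bal = ≤-trans (LevelInv.bal I) (+-monoʳ-≤ (gainP (xs g) + lossN (xs gL)) (loss≤W²f (suc ℓ) (LevelInv.loss I) ≤-refl (LevelInv.small I))) }
          where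
          two : ∀ {a} → Scale (suc ℓ) a → a ≡ 0 ⊎ a ≡ W
          two (inj₁ q) = inj₁ q
          two (inj₂ (i , l , u , q)) = inj₂ (trans q (cong (2 ^_) (≤-antisym u l)))

-- Iterations, thresholds and the approximation factor

levels : (ε wd blk : ℕ) (bits : ℕ → ℕ) (ℓ lam : ℕ) → List Op
levels ε wd blk bits ℓ lam = for (suc ℓ) (level ε wd blk bits lam (2 ^ suc ℓ))

lpPart : (ℓ Nb lam : ℕ) → List Op
lpPart ℓ Nb lam = for (suc ℓ) (λ j → lpOp lam (2 ^ ℓ) j ∷ []) ++ (thresholdOp (2 ^ ℓ) Nb ∷ [])

iteration : (ε wd blk : ℕ) (bits : ℕ → ℕ) (ℓ Nb lam : ℕ) → List Op
iteration ε wd blk bits ℓ Nb lam = lpPart ℓ Nb lam ++ (levels ε wd blk bits ℓ lam ++ (commitOp (2 ^ suc ℓ) ∷ []))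

four : (ε wd blk : ℕ) (bits : ℕ → ℕ) (ℓ Nb lam : ℕ) → List Op
four ε wd blk bits ℓ Nb lam = for 4 (λ _ → iteration ε wd blk bits ℓ Nb lam)

scales : (ε wd blk : ℕ) (bits : ℕ → ℕ) (ℓ Nb k : ℕ) → ℕ → List Op
scales ε wd blk bits ℓ Nb k i = four ε wd blk bits ℓ Nb (2 ^ (k ∸ i))

phases : (ε wd blk : ℕ) (bits : ℕ → ℕ) (ℓ Nb k : ℕ) → List Op
phases ε wd blk bits ℓ Nb k = for (suc k) (scales ε wd blk bits ℓ Nb k) ++ (finishOp Nb ∷ [])

module Phase (N : Network) (Bd : ℕ) where
  open Rounding N Bd public

  #ch : Global → ℕ
  #ch g = ∑ λ v → ⟦ ch (proj₂ g v) ⟧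

  module PhaseRun (ε wd blk : ℕ) (bits : ℕ → ℕ) (room : ∀ j → Col.Room j ε wd blk bits) (ℓ Nb : ℕ)
           (big : nV * 2 ^ suc ℓ < Bd) (W<Bd : 2 ^ suc ℓ < Bd) (cap : suc ℓ * 13312 ≤ (2 ^ ε) ^ 8)
           (degU : ∀ u → ∑ (λ v → ⟦ adj u v ⟧) ≤ 2 ^ ℓ) (id< : ∀ v → idV v < Nb) where

    private
      W : ℕ
      W = 2 ^ suc ℓ

    record Ready (g : Global) : Set where
      field
        x0   : ∀ v → x (proj₂ g v) ≡ 0
        cov⇒ : ∀ u → cov (proj₁ g u) ≡ true → ∃ λ v → ch (proj₂ g v) ≡ true × adj u v ≡ true
        col< : ∀ v → col (proj₂ g v) < 2 ^ bits 0
        proper : ∀ u v v′ → adj u v ≡ true → adj u v′ ≡ true → v ≢ v′ → col (proj₂ g v) ≢ col (proj₂ g v′)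
    open Ready

    -- `gain` bounds two things at once: dropping the new sets it shrinks the open elements towards
    -- a multiple of `lam`·OPT, and dropping the remaining open elements it bounds the number of new
    -- sets.
    record Progress (lam : ℕ) (g g′ : Global) : Set where
      field
        ready : Ready g′
        grow  : #ch g ≤ #ch g′
        gain  : ∀ S → Cover S → lam * #ch g′ + 4 * #open g + 16 * #open g′ ≤
          lam * #ch g + 16 * #open g + 6 * (lam * ∑ (λ v → ⟦ S v ⟧))
    open Progress

    module _ (lam : ℕ) (0<lam : 0 < lam) (g₀ : Global) (R₀ : Ready g₀) where
      module LR = LPRun ℓ lam 0<lam degU W<Bd

      module _ (gL : Global) (D : LR.LPDone g₀ gL) where
        open LR.LPDone D

        colL< : ∀ v → col (proj₂ gL v) < 2 ^ bits 0
        colL< v = subst (_< 2 ^ bits 0) (sym (col≡ keeps v)) (col< R₀ v)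
        properL : ∀ u v v′ → adj u v ≡ true → adj u v′ ≡ true → v ≢ v′ → col (proj₂ gL v) ≢ col (proj₂ gL v′)
        properL u v v′ a a′ ne q = proper R₀ u v v′ a a′ ne (trans (sym (col≡ keeps v)) (trans q (col≡ keeps v′)))

        module P = Potential (counted gL) idV idV-inj

        uncounted : ∀ u → LR.saturated gL u ≡ false → ∀ v → counted gL u v ≡ false
        uncounted u s v = trans (cong (λ z → adj u v ∧ (idV v <ᵇ z)) (none u s)) (∧-zeroʳ (adj u v))

        only-open : ∀ u v → counted gL u v ≡ true → isOpen gL u ≡ true
        only-open u v c with bool? (LR.saturated gL u)
        ... | inj₁ s = proj₁ (∧-true s)
        ... | inj₂ s = ⊥-elim (true≢false (trans (sym c) (uncounted u s v)))

        B-zero : ∀ y u → ⟦ not (LR.saturated gL u) ⟧ * P.B y u ≡ 0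
        B-zero y u with bool? (LR.saturated gL u)
        ... | inj₁ s rewrite s = refl
        ... | inj₂ s = trans (cong (⟦ not (LR.saturated gL u) ⟧ *_) (∑-zero λ v → ∑-zero λ v′ →
            cong (λ z → ⟦ z ⟧ * (⟦ counted gL u v′ ⟧ * ⟦ not (idV v ≡ᵇ idV v′) ⟧) * (y v * y v′)) (uncounted u s v)))
          (*-zeroʳ ⟦ not (LR.saturated gL u) ⟧)

        xL : Fin nV → ℕ
        xL v = x (proj₂ gL v)

        #sat f : ℕ
        #sat = ∑ λ u → ⟦ LR.saturated gL u ⟧
        f = #open gL

        initial : 6 * (W * W) * #sat + 8 * ∑ (P.B xL) ≤ 16 * W * ∑ (P.X xL)
        initial = ≤-trans (P.initial-bound W xL (2 ^ ℓ) refl (LR.saturated gL) bounds)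
          (≤-reflexive (trans (cong (λ z → 16 * W * ∑ (P.X xL) + 8 * z) (∑-zero (B-zero xL))) (+-identityʳ _)))

        paidW : lam * W * ∑ xL ≤ W * W * f
        paidW = begin
          lam * W * ∑ xL    ≡⟨ l1 lam W (∑ xL) ⟩
          W * (lam * ∑ xL)  ≤⟨ *-monoʳ-≤ W paid ⟩
          W * (W * f)       ≡⟨ *-assoc W W f ⟨
          W * W * f         ∎
          where
          open ≤-Reasoning
          l1 : ∀ a b c → a * b * c ≡ b * (a * c)
          l1 = solve-∀

        -- The linear term outweighs the pairs, and `paidW` bounds the penalty; so the potential
        -- starts at -W²·f or above.
        start-ok : 8 * ∑ (P.B xL) + lam * W * ∑ xL ≤ ∑ (λ v → P.value W v * xL v) + W * W * f
        start-ok = +-mono-≤ (≤-trans (m≤n+m (8 * ∑ (P.B xL)) (6 * (W * W) * #sat)) (≤-trans initial (≤-reflexive (sym (P.∑value W xL))))) paidW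

        scale₀ : ∀ v → x (proj₂ gL v) ≡ 0 ⊎ ∃ λ i → 0 ≤ i × i ≤ suc ℓ × x (proj₂ gL v) ≡ 2 ^ i
        scale₀ v with vals v
        ... | inj₁ q = inj₁ q
        ... | inj₂ (i , l , q) = inj₂ (i , z≤n , <⇒≤ l , q)

        RoundedL : Global → Set
        RoundedL = RoundRun.Rounded ε wd blk bits room ℓ lam big W<Bd gL colL< properL start-ok cap only-open scale₀

        levelsL : Triple (_≡ gL) (levels ε wd blk bits ℓ lam) RoundedL
        levelsL = RoundRun.levels-correct ε wd blk bits room ℓ lam big W<Bd gL colL< properL start-ok cap only-open scale₀

        commitL : ∀ g → RoundedL g → Legal (commitOp W) g × Progress lam g₀ (exec (commitOp W) g)
        commitL g RD = legal , record { ready = ready′ ; grow = grow′ ; gain = gain′ }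
          where
          module RD = RoundRun.Rounded RD
          o = commitOp W
          g′ = exec o g
          yv : Fin nV → ℕ
          yv v = x (proj₂ g v)
          new : Fin nV → Bool
          new v = yv v ≡ᵇ W
          hit : Fin nU → Bool
          hit u = 0 <ᵇ ∑ (λ v → ⟦ adj u v ⟧ * ⟦ new v ⟧)
          1<Bd : 1 < Bd
          1<Bd = ≤-<-trans (m^n>0 2 (suc ℓ)) W<Bd
          legal : Legal o g
          legal = (λ v → fits-msg (≤-<-trans (⟦⟧≤1 (new v)) 1<Bd)) , (λ u v β → fits-msg (<⇒≤ 1<Bd))
          cov′ : ∀ u → cov (proj₁ g′ u) ≡ cov (proj₁ g u) ∨ hit u
          cov′ u = cong (λ z → cov (proj₁ g u) ∨ (0 <ᵇ z)) (view-sum (λ _ → f₀) o g u)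
          cov₀ : ∀ u → cov (proj₁ g u) ≡ cov (proj₁ g₀ u)
          cov₀ u = trans (cong cov (Fixed.U≡′ RD.fixed u)) (cov≡ keeps u)
          ch₀ : ∀ v → ch (proj₂ g v) ≡ ch (proj₂ g₀ v)
          ch₀ v = trans (Fixed.ch≡′ RD.fixed v) (ch≡ keeps v)
          col₀ : ∀ v → col (proj₂ g v) ≡ col (proj₂ g₀ v)
          col₀ v = trans (Fixed.col≡′ RD.fixed v) (col≡ keeps v)
          both : ∀ a c → 0 < ⟦ a ⟧ * ⟦ c ⟧ → a ≡ true × c ≡ true
          both true true _ = refl , refl
          ready′ : Ready g′
          x0 ready′ v = refl
          cov⇒ ready′ u c with ∨-true (cov (proj₁ g u)) (trans (sym (cov′ u)) c)
          ... | inj₁ q = let v , s , a = cov⇒ R₀ u (trans (sym (cov₀ u)) q) in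
            v , cong (_∨ new v) (trans (ch₀ v) s) , a
          ... | inj₂ q = let v , r = ∑-pos (λ v → ⟦ adj u v ⟧ * ⟦ new v ⟧) (<ᵇ⇒< 0 _ (≡⇒T q))
                             a , s = both (adj u v) (new v) r
                         in v , trans (cong (ch (proj₂ g v) ∨_) s) (∨-zeroʳ (ch (proj₂ g v))) , a
          col< ready′ v = subst (_< 2 ^ bits 0) (sym (col₀ v)) (col< R₀ v)
          proper ready′ u v v′ a a′ ne q = proper R₀ u v v′ a a′ ne (trans (sym (col₀ v)) (trans q (col₀ v′)))
          y≡ : ∀ v → yv v ≡ ⟦ new v ⟧ * W
          y≡ v with RD.value v
          ... | inj₂ q rewrite ≡ᵇ-true q = trans q (sym (*-identityˡ W))
          ... | inj₁ q rewrite ≡ᵇ-false {yv v} {W} (λ r → <⇒≢ (m^n>0 2 (suc ℓ)) (trans (sym q) r)) = q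
          #new #hit fo : ℕ
          #new = ∑ λ v → ⟦ new v ⟧
          #hit = ∑ λ u → ⟦ isOpen gL u ∧ hit u ⟧
          fo = #open g₀
          f≡ : f ≡ fo
          f≡ = ∑-cong λ u → cong (λ z → ⟦ not z ⟧) (cov≡ keeps u)
          split : f ≡ #open g′ + #hit
          split = trans (∑-cong λ u → pt u) (∑-+ (λ u → ⟦ isOpen g′ u ⟧) (λ u → ⟦ isOpen gL u ∧ hit u ⟧))
            where
            tab : ∀ a b → ⟦ not a ⟧ ≡ ⟦ not (a ∨ b) ⟧ + ⟦ not a ∧ b ⟧
            tab true b = refl
            tab false true = refl
            tab false false = refl
            pt : ∀ u → ⟦ isOpen gL u ⟧ ≡ ⟦ isOpen g′ u ⟧ + ⟦ isOpen gL u ∧ hit u ⟧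
            pt u = trans (tab (cov (proj₁ gL u)) (hit u)) (cong (λ z → ⟦ not z ⟧ + ⟦ isOpen gL u ∧ hit u ⟧)
              (trans (cong (λ z → cov z ∨ hit u) (sym (Fixed.U≡′ RD.fixed u))) (sym (cov′ u))))
          ch-count : #ch g′ ≤ #ch g₀ + #new
          ch-count = ≤-trans (∑-mono λ v → ≤-trans (⟦∨⟧≤ (ch (proj₂ g v)) (new v)) (≤-reflexive (cong (λ z → ⟦ z ⟧ + ⟦ new v ⟧) (ch₀ v))))
            (≤-reflexive (∑-+ (λ v → ⟦ ch (proj₂ g₀ v) ⟧) (λ v → ⟦ new v ⟧)))
            where
            ⟦∨⟧≤ : ∀ a b → ⟦ a ∨ b ⟧ ≤ ⟦ a ⟧ + ⟦ b ⟧
            ⟦∨⟧≤ true b = m≤m+n 1 ⟦ b ⟧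
            ⟦∨⟧≤ false b = ≤-refl
          grow′ : #ch g₀ ≤ #ch g′
          grow′ = ∑-mono λ v → ≤-trans (≤-reflexive (cong ⟦_⟧ (sym (ch₀ v)))) (⟦∨⟧≥ (ch (proj₂ g v)) (new v))
            where
            ⟦∨⟧≥ : ∀ a b → ⟦ a ⟧ ≤ ⟦ a ∨ b ⟧
            ⟦∨⟧≥ true b = ≤-refl
            ⟦∨⟧≥ false b = z≤n
          final : 16 * W * ∑ (P.X yv) ≤ 16 * (W * W) * #hit + 8 * ∑ (P.B yv)
          final = P.final-bound W yv new y≡ (λ u → isOpen gL u ∧ hit u) λ u v c n →
            cong₂ _∧_ (only-open u v c) (<ᵇ-true (≤-trans (≤-reflexive (sym (cong₂ (λ a b → ⟦ a ⟧ * ⟦ b ⟧) (proj₁ (∧-true {adj u v} c)) n)))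
              (term≤∑ (λ v → ⟦ adj u v ⟧ * ⟦ new v ⟧) v)))
          ∑y : ∑ yv ≡ #new * W
          ∑y = trans (∑-cong y≡) (sym (∑-*ʳ W (λ v → ⟦ new v ⟧)))
          B₀ B₁ : ℕ
          B₀ = ∑ (P.B xL)
          B₁ = ∑ (P.B yv)
          -- Compares the potential before and after rounding and divides by W². One f on the right
          -- is the penalty at the start, the other the loss in rounding.
          ledger : 6 * #sat + lam * #new ≤ 16 * #hit + 2 * f
          ledger = *-cancelˡ-≤ (W * W) {{m*n≢0 W W {{m^n≢0 2 (suc ℓ)}} {{m^n≢0 2 (suc ℓ)}}}} (+-cancelʳ-≤ (8 * B₀ + 8 * B₁) _ _ (begin
            W * W * (6 * #sat + lam * #new) + (8 * B₀ + 8 * B₁)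
              ≡⟨ l1 W #sat lam #new B₀ B₁ ⟩
            (6 * (W * W) * #sat + 8 * B₀) + (8 * B₁ + lam * W * (#new * W))
              ≤⟨ +-monoˡ-≤ _ initial ⟩
            16 * W * ∑ (P.X xL) + (8 * B₁ + lam * W * (#new * W))
              ≡⟨ cong₂ (λ a b → a + (8 * B₁ + lam * W * b)) (P.∑value W xL) ∑y ⟨
            ∑ (λ v → P.value W v * xL v) + (8 * B₁ + lam * W * ∑ yv)
              ≤⟨ RD.bal ⟩
            ∑ (λ v → P.value W v * yv v) + (8 * B₀ + lam * W * ∑ xL) + W * W * f
              ≤⟨ +-monoˡ-≤ _ (+-mono-≤ (≤-trans (≤-reflexive (P.∑value W yv)) final) (+-monoʳ-≤ (8 * B₀) paidW)) ⟩
            16 * (W * W) * #hit + 8 * B₁ + (8 * B₀ + W * W * f) + W * W * f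
              ≡⟨ l2 (W * W) #hit B₁ B₀ f ⟩
            W * W * (16 * #hit + 2 * f) + (8 * B₀ + 8 * B₁) ∎))
            where
            open ≤-Reasoning
            l1 : ∀ W s l n b c → W * W * (6 * s + l * n) + (8 * b + 8 * c) ≡ (6 * (W * W) * s + 8 * b) + (8 * c + l * W * (n * W))
            l1 = solve-∀
            l2 : ∀ q h c b f → 16 * q * h + 8 * c + (8 * b + q * f) + q * f ≡ q * (16 * h + 2 * f) + (8 * b + 8 * c)
            l2 = solve-∀
          gain′ : ∀ S → Cover S → lam * #ch g′ + 4 * #open g₀ + 16 * #open g′ ≤
            lam * #ch g₀ + 16 * #open g₀ + 6 * (lam * ∑ (λ v → ⟦ S v ⟧))
          -- All but `lam`·OPT open elements are saturated, and the newly covered ones are the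
          -- difference of the open counts; both are substituted into `ledger`.
          gain′ S cS = +-cancelʳ-≤ (2 * f) _ _ (begin
            lam * #ch g′ + 4 * fo + 16 * #open g′ + 2 * f
              ≤⟨ +-monoˡ-≤ _ (+-monoˡ-≤ _ (+-monoˡ-≤ _ (*-monoʳ-≤ lam ch-count))) ⟩
            lam * (#ch g₀ + #new) + 4 * fo + 16 * #open g′ + 2 * f
              ≡⟨ cong (λ z → lam * (#ch g₀ + #new) + 4 * z + 16 * #open g′ + 2 * f) f≡ ⟨
            lam * (#ch g₀ + #new) + 4 * f + 16 * #open g′ + 2 * f
              ≡⟨ l1 lam (#ch g₀) #new f (#open g′) ⟩
            6 * f + (lam * #ch g₀ + lam * #new + 16 * #open g′)
              ≤⟨ +-monoˡ-≤ _ (*-monoʳ-≤ 6 (few S cS)) ⟩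
            6 * (#sat + lam * O) + (lam * #ch g₀ + lam * #new + 16 * #open g′)
              ≡⟨ l2 #sat (lam * O) (lam * #ch g₀) (lam * #new) (#open g′) ⟩
            (6 * #sat + lam * #new) + (lam * #ch g₀ + 6 * (lam * O) + 16 * #open g′)
              ≤⟨ +-monoˡ-≤ _ ledger ⟩
            (16 * #hit + 2 * f) + (lam * #ch g₀ + 6 * (lam * O) + 16 * #open g′)
              ≡⟨ l3 #hit f (lam * #ch g₀) (6 * (lam * O)) (#open g′) ⟩
            lam * #ch g₀ + 16 * (#open g′ + #hit) + 6 * (lam * O) + 2 * f
              ≡⟨ cong (λ z → lam * #ch g₀ + 16 * z + 6 * (lam * O) + 2 * f) (trans (sym split) f≡) ⟩
            lam * #ch g₀ + 16 * fo + 6 * (lam * O) + 2 * f ∎)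
            where
            open ≤-Reasoning
            O = ∑ (λ v → ⟦ S v ⟧)
            l1 : ∀ l c n f o → l * (c + n) + 4 * f + 16 * o + 2 * f ≡ 6 * f + (l * c + l * n + 16 * o)
            l1 = solve-∀
            l2 : ∀ s q c n o → 6 * (s + q) + (c + n + 16 * o) ≡ (6 * s + n) + (c + 6 * q + 16 * o)
            l2 = solve-∀
            l3 : ∀ h f c q o → (16 * h + 2 * f) + (c + q + 16 * o) ≡ c + 16 * (o + h) + q + 2 * f
            l3 = solve-∀

      iteration-correct : Triple (_≡ g₀) (iteration ε wd blk bits ℓ Nb lam) (Progress lam g₀)
      iteration-correct = seq {P = _≡ g₀} {Q = LR.LPDone g₀} {R = Progress lam g₀}
        (lpPart ℓ Nb lam) (levels ε wd blk bits ℓ lam ++ (commitOp (2 ^ suc ℓ) ∷ []))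
        (LR.lp-correct Nb id< g₀ (x0 R₀))
        λ gL D → seq {P = _≡ gL} {Q = RoundedL gL D} {R = Progress lam g₀}
          (levels ε wd blk bits ℓ lam) (commitOp (2 ^ suc ℓ) ∷ []) (levelsL gL D)
          (single {P = RoundedL gL D} {Q = Progress lam g₀} (commitOp (2 ^ suc ℓ)) (commitL gL D)) gL refl

    record Bound (num den b lam : ℕ) (g : Global) : Set where
      field
        ready : Ready g
        open≤ : ∀ S → Cover S → den * #open g ≤ num * (lam * ∑ (λ v → ⟦ S v ⟧))
        open≤6 : ∀ S → Cover S → #open g ≤ 6 * (lam * ∑ (λ v → ⟦ S v ⟧))
        ch≤   : ∀ S → Cover S → #ch g ≤ b * ∑ (λ v → ⟦ S v ⟧)
    open Bound

    -- `gain` yields 8·f′ ≤ 6·f + 3·`lam`·OPT. With f ≤ 6·`lam`·OPT it also allows (12·6 + 6)·OPT =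
    -- 78·OPT new sets.
    bound-step : ∀ num den b lam → 0 < lam → ∀ g g′ → Bound num den b lam g → Progress lam g g′ →
      Bound (6 * num + 3 * den) (8 * den) (78 + b) lam g′
    bound-step num den b lam 0<lam g g′ Bd₀ Pr = record
      { ready = Progress.ready Pr
      ; open≤ = λ S c → begin
          8 * den * #open g′                          ≡⟨ l1 den (#open g′) ⟩
          den * (8 * #open g′)                        ≤⟨ *-monoʳ-≤ den (shrink S c) ⟩
          den * (6 * #open g + 3 * L S)               ≡⟨ l2 den (#open g) (L S) ⟩
          6 * (den * #open g) + 3 * den * L S         ≤⟨ +-monoˡ-≤ _ (*-monoʳ-≤ 6 (open≤ Bd₀ S c)) ⟩
          6 * (num * L S) + 3 * den * L S             ≡⟨ l3 num (L S) den ⟩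
          (6 * num + 3 * den) * L S                   ∎
      ; open≤6 = λ S c → *-cancelˡ-≤ 8 (begin
          8 * #open g′                                ≤⟨ shrink S c ⟩
          6 * #open g + 3 * L S                       ≤⟨ +-monoˡ-≤ _ (*-monoʳ-≤ 6 (open≤6 Bd₀ S c)) ⟩
          6 * (6 * L S) + 3 * L S                     ≤⟨ m≤m+n _ (9 * L S) ⟩
          6 * (6 * L S) + 3 * L S + 9 * L S           ≡⟨ l4 (L S) ⟩
          8 * (6 * L S)                               ∎)
      ; ch≤ = λ S c → *-cancelˡ-≤ lam {{>-nonZero 0<lam}} (+-cancelʳ-≤ (4 * #open g) _ _ (begin
          lam * #ch g′ + 4 * #open g                              ≤⟨ m≤m+n _ (16 * #open g′) ⟩
          lam * #ch g′ + 4 * #open g + 16 * #open g′              ≤⟨ Progress.gain Pr S c ⟩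
          lam * #ch g + 16 * #open g + 6 * L S                    ≡⟨ l5 (lam * #ch g) (#open g) (L S) ⟩
          lam * #ch g + 12 * #open g + 6 * L S + 4 * #open g      ≤⟨ +-monoˡ-≤ _ (+-monoˡ-≤ _ (+-mono-≤ (*-monoʳ-≤ lam (ch≤ Bd₀ S c)) (*-monoʳ-≤ 12 (open≤6 Bd₀ S c)))) ⟩
          lam * (b * O S) + 12 * (6 * L S) + 6 * L S + 4 * #open g ≡⟨ cong (_+ 4 * #open g) (l6 lam b (O S)) ⟩
          lam * ((78 + b) * O S) + 4 * #open g                    ∎)) }
      where
      open ≤-Reasoning
      O L : (Fin nV → Bool) → ℕ
      O S = ∑ (λ v → ⟦ S v ⟧)
      L S = lam * O S
      l1 : ∀ d f → 8 * d * f ≡ d * (8 * f)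
      l1 = solve-∀
      l2 : ∀ d f l → d * (6 * f + 3 * l) ≡ 6 * (d * f) + 3 * d * l
      l2 = solve-∀
      l3 : ∀ n l d → 6 * (n * l) + 3 * d * l ≡ (6 * n + 3 * d) * l
      l3 = solve-∀
      l4 : ∀ l → 6 * (6 * l) + 3 * l + 9 * l ≡ 8 * (6 * l)
      l4 = solve-∀
      l5 : ∀ c f l → c + 16 * f + 6 * l ≡ c + 12 * f + 6 * l + 4 * f
      l5 = solve-∀
      l6 : ∀ l b o → l * (b * o) + 12 * (6 * (l * o)) + 6 * (l * o) ≡ l * ((78 + b) * o)
      l6 = solve-∀
      l7 : ∀ c f f′ → c + 4 * f + 16 * f′ ≡ 2 * (8 * f′) + (c + 4 * f)
      l7 = solve-∀
      l8 : ∀ c f l → c + 16 * f + 6 * l ≡ 2 * (6 * f + 3 * l) + (c + 4 * f)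
      l8 = solve-∀
      shrink : ∀ S → Cover S → 8 * #open g′ ≤ 6 * #open g + 3 * L S
      shrink S c = *-cancelˡ-≤ 2 (+-cancelʳ-≤ (lam * #ch g + 4 * #open g) _ _ (begin
        2 * (8 * #open g′) + (lam * #ch g + 4 * #open g)          ≡⟨ l7 (lam * #ch g) (#open g) (#open g′) ⟨
        lam * #ch g + 4 * #open g + 16 * #open g′                 ≤⟨ +-monoˡ-≤ _ (+-monoˡ-≤ _ (*-monoʳ-≤ lam (grow Pr))) ⟩
        lam * #ch g′ + 4 * #open g + 16 * #open g′                ≤⟨ Progress.gain Pr S c ⟩
        lam * #ch g + 16 * #open g + 6 * L S                      ≡⟨ l8 (lam * #ch g) (#open g) (L S) ⟩
        2 * (6 * #open g + 3 * L S) + (lam * #ch g + 4 * #open g) ∎))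

    -- The excess of the number of open elements over 3/2·lam·OPT shrinks by
    -- 3/4 in each iteration; four of them bring the number from 6·lam·OPT below 3·lam·OPT.
    num : ℕ → ℕ
    num zero = 6
    num (suc i) = 6 * num i + 3 * 8 ^ i

    four-correct : ∀ lam → 0 < lam → ∀ b → Triple (Bound 6 1 b lam) (four ε wd blk bits ℓ Nb lam) (Bound 11976 4096 (4 * 78 + b) lam)
    four-correct lam 0<lam b = loop (λ i → Bound (num i) (8 ^ i) (i * 78 + b) lam) 4 (λ _ → iteration ε wd blk bits ℓ Nb lam)
      λ i _ g B → let a , p = iteration-correct lam 0<lam g (ready B) g refl in
        a , subst (λ z → Bound (num (suc i)) (8 ^ suc i) z lam (execs (iteration ε wd blk bits ℓ Nb lam) g)) (sym (+-assoc 78 (i * 78) b))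
          (bound-step (num i) (8 ^ i) (i * 78 + b) lam 0<lam g (execs (iteration ε wd blk bits ℓ Nb lam) g) B p)

    module _ (k : ℕ) (degV : ∀ v → ∑ (λ u → ⟦ adj u v ⟧) ≤ 2 ^ k) (feasible : Cover (λ _ → true)) where

      -- Division by 2^i gives 6·λ·OPT open elements for λ = 2^(k-i). The 3·λ·OPT left after a
      -- threshold are 6·(λ/2)·OPT for the next one.
      record ScaleInv (i : ℕ) (g : Global) : Set where
        field
          ready : Ready g
          open≤ : ∀ S → Cover S → 2 ^ i * #open g ≤ 6 * (2 ^ k * ∑ (λ v → ⟦ S v ⟧))
          ch≤   : ∀ S → Cover S → #ch g ≤ i * 312 * ∑ (λ v → ⟦ S v ⟧)

      scale-step : ∀ i → i < suc k → Triple (ScaleInv i) (scales ε wd blk bits ℓ Nb k i) (ScaleInv (suc i))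
      scale-step i i≤k = conseq {P = Bound 6 1 (i * 312) lam} {P′ = ScaleInv i} {Q = Bound 11976 4096 (4 * 78 + i * 312) lam} {Q′ = ScaleInv (suc i)}
        (four ε wd blk bits ℓ Nb lam) before after (four-correct lam (m^n>0 2 (k ∸ i)) (i * 312))
        where
        lam : ℕ
        lam = 2 ^ (k ∸ i)
        lam* : 2 ^ i * lam ≡ 2 ^ k
        lam* = trans (sym (^-distribˡ-+-* 2 i (k ∸ i))) (cong (2 ^_) (m+[n∸m]≡n (s≤s⁻¹ i≤k)))
        l1 : ∀ a b o → a * (6 * (b * o)) ≡ 6 * (a * b * o)
        l1 = solve-∀
        l2 : ∀ a b o → 2 * a * (3 * (b * o)) ≡ 6 * (a * b * o)
        l2 = solve-∀
        before : ∀ g → ScaleInv i g → Bound 6 1 (i * 312) lam g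
        before g I = record
          { ready = ScaleInv.ready I
          ; open≤ = λ S c → ≤-trans (≤-reflexive (*-identityˡ _)) (six S c)
          ; open≤6 = six
          ; ch≤ = ScaleInv.ch≤ I }
          where
          six : ∀ S → Cover S → #open g ≤ 6 * (lam * ∑ (λ v → ⟦ S v ⟧))
          six S c = *-cancelˡ-≤ (2 ^ i) {{m^n≢0 2 i}} (≤-trans (ScaleInv.open≤ I S c) (≤-reflexive
            (trans (cong (λ z → 6 * (z * ∑ (λ v → ⟦ S v ⟧))) (sym lam*)) (sym (l1 (2 ^ i) lam _)))))
        after : ∀ g → Bound 11976 4096 (4 * 78 + i * 312) lam g → ScaleInv (suc i) g
        after g B = record
          { ready = Bound.ready B
          ; open≤ = λ S c → ≤-trans (*-monoʳ-≤ (2 ^ suc i) (three S c)) (≤-reflexive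
              (trans (l2 (2 ^ i) lam _) (cong (λ z → 6 * (z * ∑ (λ v → ⟦ S v ⟧))) lam*)))
          ; ch≤ = Bound.ch≤ B }
          where
          three : ∀ S → Cover S → #open g ≤ 3 * (lam * ∑ (λ v → ⟦ S v ⟧))
          -- 11976 is the fourth value of `num`, over 8^4 = 4096; the quotient is just below 3.
          three S c = *-cancelˡ-≤ 4096 (≤-trans (Bound.open≤ B S c) (≤-trans (*-monoˡ-≤ (lam * ∑ (λ v → ⟦ S v ⟧)) (≤ᵇ⇒≤ 11976 12288 tt))
            (≤-reflexive (*-assoc 4096 3 (lam * ∑ (λ v → ⟦ S v ⟧))))))

      Result : ℕ → Global → Set
      Result a g = Cover (λ v → ch (proj₂ g v)) × (∀ S → Cover S → #ch g ≤ a * ∑ (λ v → ⟦ S v ⟧))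

      -- After the threshold 1 at most 3·OPT elements are open, and one set is added for each.
      finish-step : ∀ g → ScaleInv (suc k) g → Legal (finishOp Nb) g × Result (suc k * 312 + 3) (exec (finishOp Nb) g)
      finish-step g I = legal , cover , small
        where
        o = finishOp Nb
        g′ = exec o g
        R : Ready g
        R = ScaleInv.ready I
        hasId : Fin nU → ℕ → Bool
        hasId u i = 0 <ᵇ viewSum (λ k _ → ⟦ k ≡ᵇ i ⟧) (view o g u)
        least : Fin nU → ℕ
        least u = first (hasId u) Nb
        hasId≡ : ∀ u i → viewSum (λ k _ → ⟦ k ≡ᵇ i ⟧) (view o g u) ≡ ∑ (λ v → ⟦ adj u v ⟧ * ⟦ idV v ≡ᵇ i ⟧)
        hasId≡ u i = view-sum (λ k _ → ⟦ k ≡ᵇ i ⟧) o g u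
        1<Bd : 1 < Bd
        1<Bd = ≤-<-trans (m^n>0 2 (suc ℓ)) W<Bd
        legal : Legal o g
        legal = (λ v → fits-msg (<⇒≤ 1<Bd)) , (λ u v β → fits-msg (≤-<-trans (≤1*≤1 (⟦⟧≤1 (isOpen g u)) (⟦⟧≤1 (least u ≡ᵇ idV v))) 1<Bd))
        picked : Fin nV → ℕ
        picked v = ∑ λ u → ⟦ adj u v ⟧ * (⟦ isOpen g u ⟧ * ⟦ least u ≡ᵇ idV v ⟧)
        ch′ : ∀ v → ch (proj₂ g′ v) ≡ ch (proj₂ g v) ∨ (0 <ᵇ picked v)
        ch′ v = cong (λ z → ch (proj₂ g v) ∨ (0 <ᵇ z)) (replies-sum f₀ o g v 0)
        both : ∀ a c → 0 < ⟦ a ⟧ * ⟦ c ⟧ → a ≡ true × c ≡ true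
        both true true _ = refl , refl
        cover : Cover (λ v → ch (proj₂ g′ v))
        cover u with bool? (cov (proj₁ g u))
        ... | inj₁ q = let v , s , a = Ready.cov⇒ R u q in v , trans (ch′ v) (cong (_∨ (0 <ᵇ picked v)) s) , a
        ... | inj₂ q = v , trans (ch′ v) (trans (cong (ch (proj₂ g v) ∨_) (<ᵇ-true pick)) (∨-zeroʳ (ch (proj₂ g v)))) , a
          where
          v₀ : Fin nV
          v₀ = proj₁ (feasible u)
          has₀ : hasId u (idV v₀) ≡ true
          has₀ = <ᵇ-true (≤-trans (≤-reflexive (sym (cong₂ (λ a b → ⟦ a ⟧ * ⟦ b ⟧) (proj₂ (proj₂ (feasible u))) (≡ᵇ-true {idV v₀} refl))))
            (≤-trans (term≤∑ (λ v → ⟦ adj u v ⟧ * ⟦ idV v ≡ᵇ idV v₀ ⟧) v₀) (≤-reflexive (sym (hasId≡ u (idV v₀))))))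
          found : ∃ λ v → 0 < ⟦ adj u v ⟧ * ⟦ idV v ≡ᵇ least u ⟧
          found = ∑-pos (λ v → ⟦ adj u v ⟧ * ⟦ idV v ≡ᵇ least u ⟧) (≤-trans (<ᵇ⇒< 0 _ (≡⇒T
            (first-true (hasId u) Nb (idV v₀) (<⇒≤ (id< v₀)) has₀))) (≤-reflexive (hasId≡ u (least u))))
          v : Fin nV
          v = proj₁ found
          a : adj u v ≡ true
          a = proj₁ (both (adj u v) (idV v ≡ᵇ least u) (proj₂ found))
          id≡ : (least u ≡ᵇ idV v) ≡ true
          id≡ = trans (≡ᵇ-sym (least u) (idV v)) (proj₂ (both (adj u v) (idV v ≡ᵇ least u) (proj₂ found)))
          pick : 0 < picked v
          pick = ≤-trans (≤-reflexive (sym (trans (cong₂ (λ a b → ⟦ a ⟧ * (⟦ not b ⟧ * ⟦ least u ≡ᵇ idV v ⟧)) a q) (cong (λ z → 1 * (1 * ⟦ z ⟧)) id≡))))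
            (term≤∑ (λ u → ⟦ adj u v ⟧ * (⟦ isOpen g u ⟧ * ⟦ least u ≡ᵇ idV v ⟧)) u)
        pick-sum : ∑ picked ≤ #open g
        pick-sum = ≤-trans (≤-reflexive (∑-swap (λ v u → ⟦ adj u v ⟧ * (⟦ isOpen g u ⟧ * ⟦ least u ≡ᵇ idV v ⟧)))) (∑-mono λ u →
          ∑-atMostOne _ ⟦ isOpen g u ⟧
            (λ v → ≤-trans (guard-≤ (adj u v) _) (≤-trans (*-monoʳ-≤ ⟦ isOpen g u ⟧ (⟦⟧≤1 _)) (≤-reflexive (*-identityʳ _))))
            (λ v v′ p q → idV-inj v v′ (trans (sym (at u v p)) (at u v′ q))))
          where
          at : ∀ u v → ⟦ adj u v ⟧ * (⟦ isOpen g u ⟧ * ⟦ least u ≡ᵇ idV v ⟧) ≢ 0 → least u ≡ idV v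
          at u v ne with ≡ᵇ-cases (least u) (idV v)
          ... | inj₁ (q , _) = q
          ... | inj₂ (_ , e) = ⊥-elim (ne (trans (cong (λ z → ⟦ adj u v ⟧ * (⟦ isOpen g u ⟧ * ⟦ z ⟧)) e)
            (trans (cong (⟦ adj u v ⟧ *_) (*-zeroʳ ⟦ isOpen g u ⟧)) (*-zeroʳ ⟦ adj u v ⟧))))
        small : ∀ S → Cover S → #ch g′ ≤ (suc k * 312 + 3) * ∑ (λ v → ⟦ S v ⟧)
        small S c = begin
          #ch g′                                     ≤⟨ ∑-mono (λ v → ≤-trans (≤-reflexive (cong ⟦_⟧ (ch′ v))) (or-bound (ch (proj₂ g v)) (picked v))) ⟩
          ∑ (λ v → ⟦ ch (proj₂ g v) ⟧ + picked v)     ≡⟨ ∑-+ (λ v → ⟦ ch (proj₂ g v) ⟧) picked ⟩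
          #ch g + ∑ picked                           ≤⟨ +-mono-≤ (ScaleInv.ch≤ I S c) (≤-trans pick-sum three) ⟩
          suc k * 312 * O + 3 * O                    ≡⟨ *-distribʳ-+ O (suc k * 312) 3 ⟨
          (suc k * 312 + 3) * O                      ∎
          where
          open ≤-Reasoning
          O = ∑ (λ v → ⟦ S v ⟧)
          or-bound : ∀ a n → ⟦ a ∨ (0 <ᵇ n) ⟧ ≤ ⟦ a ⟧ + n
          or-bound true n = m≤m+n 1 n
          or-bound false zero = z≤n
          or-bound false (suc n) = s≤s z≤n
          l1 : ∀ w o → 6 * (w * o) ≡ 2 * w * (3 * o)
          l1 = solve-∀
          three : #open g ≤ 3 * O
          three = *-cancelˡ-≤ (2 ^ suc k) {{m^n≢0 2 (suc k)}} (≤-trans (ScaleInv.open≤ I S c) (≤-reflexive (l1 (2 ^ k) O)))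

      phases-correct : (g₀ : Global) → Ready g₀ → (∀ v → ch (proj₂ g₀ v) ≡ false) →
        Triple (_≡ g₀) (phases ε wd blk bits ℓ Nb k) (Result (suc k * 312 + 3))
      phases-correct g₀ R c0 = seq {P = _≡ g₀} {Q = ScaleInv (suc k)} {R = Result (suc k * 312 + 3)}
        (for (suc k) (scales ε wd blk bits ℓ Nb k)) (finishOp Nb ∷ [])
        (conseq {P = ScaleInv 0} {P′ = _≡ g₀} {Q = ScaleInv (suc k)} {Q′ = ScaleInv (suc k)}
          (for (suc k) (scales ε wd blk bits ℓ Nb k)) (λ { g refl → init }) (λ _ p → p)
          (loop ScaleInv (suc k) (scales ε wd blk bits ℓ Nb k) scale-step))
        (single {P = ScaleInv (suc k)} {Q = Result (suc k * 312 + 3)} (finishOp Nb) finish-step)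
        where
        init : ScaleInv 0 g₀
        init = record
          { ready = R
          ; open≤ = λ S c → ≤-trans (≤-reflexive (*-identityˡ _)) (≤-trans
              (charge (isOpen g₀) S c (2 ^ k) (λ v → ≤-trans (∑-mono λ u → ≤-trans (*-monoʳ-≤ ⟦ adj u v ⟧ (⟦⟧≤1 (isOpen g₀ u))) (≤-reflexive (*-identityʳ _))) (degV v)))
              (m≤m+n _ _))
          ; ch≤ = λ S c → ≤-reflexive (∑-zero λ v → cong ⟦_⟧ (c0 v)) }

-- The preliminary proper colouring

listCode< : ∀ z l → (∀ y → 2 ^ z ≤ suc y → lsum (λ a → ⟦ a ≡ᵇ y ⟧) l ≡ 0) → listCode z l < 2 ^ (z * length l)
listCode< z [] h = m^n>0 2 (z * 0)
listCode< z (a ∷ l) h = begin-strict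
  suc a + 2 ^ z * listCode z l        <⟨ +-monoˡ-< _ sa< ⟩
  2 ^ z + 2 ^ z * listCode z l        ≡⟨ *-suc (2 ^ z) (listCode z l) ⟨
  2 ^ z * suc (listCode z l)          ≤⟨ *-monoʳ-≤ (2 ^ z) (listCode< z l (λ y p → m+n≡0⇒n≡0 ⟦ a ≡ᵇ y ⟧ (h y p))) ⟩
  2 ^ z * 2 ^ (z * length l)          ≡⟨ ^-distribˡ-+-* 2 z (z * length l) ⟨
  2 ^ (z + z * length l)              ≡⟨ cong (2 ^_) (*-suc z (length l)) ⟨
  2 ^ (z * suc (length l))            ∎
  where
  open ≤-Reasoning
  sa< : suc a < 2 ^ z
  sa< = ≰⇒> λ p → 0≢1+n (trans (sym (m+n≡0⇒m≡0 ⟦ a ≡ᵇ a ⟧ (h a p))) (cong ⟦_⟧ (≡ᵇ-true {a} refl)))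

-- The hypotheses say that the digits `suc a` are below 2^z. They are phrased by counting
-- occurrences because sums over the neighbourhood have this form.
listCode-injective : ∀ z l l′ → (∀ y → 2 ^ z ≤ suc y → lsum (λ a → ⟦ a ≡ᵇ y ⟧) l ≡ 0) →
  (∀ y → 2 ^ z ≤ suc y → lsum (λ a → ⟦ a ≡ᵇ y ⟧) l′ ≡ 0) → listCode z l ≡ listCode z l′ → l ≡ l′
listCode-injective z [] [] h h′ e = refl
listCode-injective z (a ∷ l) (a′ ∷ l′) h h′ e
  with digits-injective (2 ^ z) (listCode z l) (listCode z l′) (suc a) (suc a′) (small a l h) (small a′ l′ h′)
    (trans (swap a l) (trans e (sym (swap a′ l′))))
  where
  small : ∀ a l → (∀ y → 2 ^ z ≤ suc y → lsum (λ a → ⟦ a ≡ᵇ y ⟧) (a ∷ l) ≡ 0) → suc a < 2 ^ z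
  small a l h = ≰⇒> λ p → 0≢1+n (trans (sym (m+n≡0⇒m≡0 ⟦ a ≡ᵇ a ⟧ (h a p))) (cong ⟦_⟧ (≡ᵇ-true {a} refl)))
  swap : ∀ a l → listCode z l * 2 ^ z + suc a ≡ suc a + 2 ^ z * listCode z l
  swap a l = trans (+-comm (listCode z l * 2 ^ z) (suc a)) (cong (suc a +_) (*-comm (listCode z l) (2 ^ z)))
... | p , q = cong₂ _∷_ (suc-injective q) (listCode-injective z l l′ (λ y r → m+n≡0⇒n≡0 ⟦ a ≡ᵇ y ⟧ (h y r))
    (λ y r → m+n≡0⇒n≡0 ⟦ a′ ≡ᵇ y ⟧ (h′ y r)) p)

length-lsum : ∀ {A : Set} (l : List A) → length l ≡ lsum (λ _ → 1) l
length-lsum [] = refl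
length-lsum (a ∷ l) = cong suc (length-lsum l)

recolourOps : (d : ℕ) (bits : ℕ → ℕ) → ℕ → List Op
recolourOps d bits i = recolourOp d (bits i) (suc (nextBits d (bits i))) ∷ []

module Precolouring (N : Network) (Bd : ℕ) where
  open Phase N Bd public

  module PreRun (ℓ k : ℕ) (degU : ∀ u → ∑ (λ v → ⟦ adj u v ⟧) < 2 ^ ℓ) (degV : ∀ v → ∑ (λ u → ⟦ adj u v ⟧) ≤ 2 ^ k) where

    d : ℕ
    d = ℓ + ℓ

    record Proper (b : ℕ) (g : Global) : Set where
      field
        x0   : ∀ v → x (proj₂ g v) ≡ 0
        cov0 : ∀ u → cov (proj₁ g u) ≡ false
        ch0  : ∀ v → ch (proj₂ g v) ≡ false
        col< : ∀ v → col (proj₂ g v) < 2 ^ b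
        proper : ∀ u v v′ → adj u v ≡ true → adj u v′ ≡ true → v ≢ v′ → col (proj₂ g v) ≢ col (proj₂ g v′)
    open Proper

    -- An element has fewer than D = 4^ℓ ordered pairs of sets, each agreeing in at most a 1/D
    -- fraction of the positions; hence some position separates all of its sets.
    recolour-step : ∀ b → 0 < b → 2 ^ b ≤ Bd → codeLength (2 ^ d) b ≤ Bd → ∀ g → Proper b g →
      Legal (recolourOp d b (suc (nextBits d b))) g ×
      Proper (2 ^ k * suc (nextBits d b)) (exec (recolourOp d b (suc (nextBits d b))) g)
    recolour-step b 0<b b-room L-room g I = legal , record
      { x0 = x0 I ; cov0 = cov0 I ; ch0 = ch0 I ; col< = col<′ ; proper = proper′ }
      where
      D L z : ℕ
      D = 2 ^ d
      L = codeLength D b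
      z = suc (nextBits d b)
      o = recolourOp d b z
      g′ = exec o g
      E : ℕ → ℕ → ℕ
      E = encode d b
      cg : Fin nV → ℕ
      cg v = col (proj₂ g v)
      0<L : 0 < L
      0<L = *-mono-≤ {1} {2 * D} {1} {b} (≤-trans (m^n>0 2 d) (m≤m+n D (D + 0))) 0<b
      α : Fin nU → ℕ
      α u = best (clashes d b (view o g u)) L
      α< : ∀ u → α u < L
      α< u = best< (clashes d b (view o g u)) L 0<L
      legal : Legal o g
      legal = (λ v → fits-msg (<-≤-trans (col< I v) b-room)) , (λ u v β → fits-msg (<-≤-trans (α< u) L-room))
      ne : Fin nV → Fin nV → ℕ
      ne v v′ = ⟦ not (idV v ≡ᵇ idV v′) ⟧
      clash : Fin nU → ℕ → ℕ
      clash u a = ∑ λ v → ⟦ adj u v ⟧ * ∑ (λ v′ → ⟦ adj u v′ ⟧ * (ne v v′ * ⟦ E (cg v) a ≡ᵇ E (cg v′) a ⟧))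
      clash≡ : ∀ u a → clashes d b (view o g u) a ≡ clash u a
      clash≡ u a = trans (view-sum (λ i m → viewSum (λ i′ m′ → ⟦ not (i ≡ᵇ i′) ⟧ * ⟦ E (f₀ m) a ≡ᵇ E (f₀ m′) a ⟧) (view o g u)) o g u)
        (∑-cong λ v → cong (⟦ adj u v ⟧ *_) (view-sum (λ i′ m′ → ⟦ not (idV v ≡ᵇ i′) ⟧ * ⟦ E (cg v) a ≡ᵇ E (f₀ m′) a ⟧) o g u))
      dg : Fin nU → ℕ
      dg u = ∑ λ v → ⟦ adj u v ⟧
      clash-sum : ∀ u → D * Σ< L (clash u) ≤ L * (dg u * dg u)
      clash-sum u = begin
        D * Σ< L (clash u)
          ≡⟨ cong (D *_) (∑-Σ<-swap L (λ v a → ⟦ adj u v ⟧ * ∑ (λ v′ → ⟦ adj u v′ ⟧ * (ne v v′ * ⟦ E (cg v) a ≡ᵇ E (cg v′) a ⟧)))) ⟩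
        D * ∑ (λ v → Σ< L (λ a → ⟦ adj u v ⟧ * ∑ (λ v′ → ⟦ adj u v′ ⟧ * (ne v v′ * ⟦ E (cg v) a ≡ᵇ E (cg v′) a ⟧))))
          ≤⟨ ∑-*mono D L row ⟩
        L * ∑ (λ v → ⟦ adj u v ⟧ * dg u)
          ≡⟨ cong (L *_) (∑-*ʳ (dg u) (λ v → ⟦ adj u v ⟧)) ⟨
        L * (dg u * dg u) ∎
        where
        open ≤-Reasoning
        l1 : ∀ a b c → a * (b * c) ≡ b * (a * c)
        l1 = solve-∀
        l2 : ∀ D a n s → D * (a * (n * s)) ≡ a * (n * (D * s))
        l2 = solve-∀
        entry : ∀ v v′ → adj u v ≡ true → D * Σ< L (λ a → ⟦ adj u v′ ⟧ * (ne v v′ * ⟦ E (cg v) a ≡ᵇ E (cg v′) a ⟧)) ≤ L * ⟦ adj u v′ ⟧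
        entry v v′ av = ≤-trans (≤-reflexive (trans (cong (D *_) (trans (sym (Σ<-*ˡ L ⟦ adj u v′ ⟧ (λ a → ne v v′ * ⟦ E (cg v) a ≡ᵇ E (cg v′) a ⟧)))
            (cong (⟦ adj u v′ ⟧ *_) (sym (Σ<-*ˡ L (ne v v′) (λ a → ⟦ E (cg v) a ≡ᵇ E (cg v′) a ⟧)))))) (l2 D ⟦ adj u v′ ⟧ (ne v v′) (agree L (E (cg v)) (E (cg v′))))))
          (≤-trans (final (adj u v′) refl) (≤-reflexive (*-comm ⟦ adj u v′ ⟧ L)))
          where
          final : ∀ b′ → adj u v′ ≡ b′ → ⟦ adj u v′ ⟧ * (ne v v′ * (D * agree L (E (cg v)) (E (cg v′)))) ≤ ⟦ adj u v′ ⟧ * L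
          final false q rewrite q = z≤n
          final true q with ≡ᵇ-cases (idV v) (idV v′)
          ... | inj₁ (_ , r) rewrite r | *-zeroʳ ⟦ adj u v′ ⟧ = z≤n
          ... | inj₂ (n , r) rewrite r = *-monoʳ-≤ ⟦ adj u v′ ⟧ (≤-trans (≤-reflexive (*-identityˡ _))
            (proj₂ (encode-isCode d b) (cg v) (cg v′) (col< I v) (col< I v′) (proper I u v v′ av q (λ { refl → n refl }))))
        row : ∀ v → D * Σ< L (λ a → ⟦ adj u v ⟧ * ∑ (λ v′ → ⟦ adj u v′ ⟧ * (ne v v′ * ⟦ E (cg v) a ≡ᵇ E (cg v′) a ⟧))) ≤ L * (⟦ adj u v ⟧ * dg u)
        row v = begin
          D * Σ< L (λ a → ⟦ adj u v ⟧ * ∑ (λ v′ → ⟦ adj u v′ ⟧ * (ne v v′ * ⟦ E (cg v) a ≡ᵇ E (cg v′) a ⟧)))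
            ≡⟨ cong (D *_) (Σ<-*ˡ L ⟦ adj u v ⟧ (λ a → ∑ (λ v′ → ⟦ adj u v′ ⟧ * (ne v v′ * ⟦ E (cg v) a ≡ᵇ E (cg v′) a ⟧)))) ⟨
          D * (⟦ adj u v ⟧ * Σ< L (λ a → ∑ (λ v′ → ⟦ adj u v′ ⟧ * (ne v v′ * ⟦ E (cg v) a ≡ᵇ E (cg v′) a ⟧))))
            ≡⟨ l1 D ⟦ adj u v ⟧ _ ⟩
          ⟦ adj u v ⟧ * (D * Σ< L (λ a → ∑ (λ v′ → ⟦ adj u v′ ⟧ * (ne v v′ * ⟦ E (cg v) a ≡ᵇ E (cg v′) a ⟧))))
            ≡⟨ cong (λ s → ⟦ adj u v ⟧ * (D * s)) (∑-Σ<-swap L (λ v′ a → ⟦ adj u v′ ⟧ * (ne v v′ * ⟦ E (cg v) a ≡ᵇ E (cg v′) a ⟧))) ⟩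
          ⟦ adj u v ⟧ * (D * ∑ (λ v′ → Σ< L (λ a → ⟦ adj u v′ ⟧ * (ne v v′ * ⟦ E (cg v) a ≡ᵇ E (cg v′) a ⟧))))
            ≤⟨ guarded (adj u v) refl ⟩
          ⟦ adj u v ⟧ * (L * dg u) ≡⟨ l1 ⟦ adj u v ⟧ L (dg u) ⟩
          L * (⟦ adj u v ⟧ * dg u) ∎
          where
          guarded : ∀ b′ → adj u v ≡ b′ → ⟦ adj u v ⟧ * (D * ∑ (λ v′ → Σ< L (λ a → ⟦ adj u v′ ⟧ * (ne v v′ * ⟦ E (cg v) a ≡ᵇ E (cg v′) a ⟧)))) ≤ ⟦ adj u v ⟧ * (L * dg u)
          guarded false q rewrite q = z≤n
          guarded true q = *-monoʳ-≤ ⟦ adj u v ⟧ (∑-*mono D L (λ v′ → entry v v′ q))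
      no-clash : ∀ u → clash u (α u) ≡ 0
      no-clash u with zero∨pos (clash u (α u))
      ... | inj₁ q = q
      ... | inj₂ q = ⊥-elim (<⇒≱ deg²<D (*-cancelˡ-≤ L {{>-nonZero 0<L}} (begin
        L * D                                       ≡⟨ *-comm L D ⟩
        D * L                                       ≡⟨ cong (D *_) (*-identityʳ L) ⟨
        D * (L * 1)                                 ≤⟨ *-monoʳ-≤ D (*-monoʳ-≤ L (≤-trans q (≤-reflexive (sym (clash≡ u (α u)))))) ⟩
        D * (L * clashes d b (view o g u) (α u))    ≤⟨ *-monoʳ-≤ D (best-avg (clashes d b (view o g u)) L) ⟩
        D * Σ< L (clashes d b (view o g u))         ≡⟨ cong (D *_) (Σ<-cong L (λ a _ → clash≡ u a)) ⟩
        D * Σ< L (clash u)                          ≤⟨ clash-sum u ⟩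
        L * (dg u * dg u)                         ∎)))
        where
        open ≤-Reasoning
        deg²<D : dg u * dg u < D
        deg²<D = <-≤-trans (*-mono-< (degU u) (degU u)) (≤-reflexive (sym (^-distribˡ-+-* 2 ℓ ℓ)))
      separated : ∀ u v v′ → adj u v ≡ true → adj u v′ ≡ true → v ≢ v′ → E (cg v) (α u) ≢ E (cg v′) (α u)
      separated u v v′ a a′ n q = 0≢1+n (trans (sym (∑-≡0⇒ (trans (sym (*-identityˡ _)) (trans (cong (λ w → ⟦ w ⟧ * inner) (sym a))
          (∑-≡0⇒ (no-clash u) v))) v′)) r)
        where
        inner : ℕ
        inner = ∑ (λ v′ → ⟦ adj u v′ ⟧ * (ne v v′ * ⟦ E (cg v) (α u) ≡ᵇ E (cg v′) (α u) ⟧))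
        r : ⟦ adj u v′ ⟧ * (ne v v′ * ⟦ E (cg v) (α u) ≡ᵇ E (cg v′) (α u) ⟧) ≡ 1
        r = cong₂ (λ x y → ⟦ x ⟧ * y) a′ (cong₂ (λ x y → ⟦ not x ⟧ * ⟦ y ⟧) (≡ᵇ-false (λ s → n (idV-inj v v′ s))) (≡ᵇ-true q))
      digit : Fin nV → Fin nU → ℕ
      digit v u = α u * (4 * D) + E (cg v) (α u)
      digitM : Fin nV → Msg → ℕ
      digitM v m = f₀ m * (4 * D) + E (cg v) (f₀ m)
      list : Fin nV → List ℕ
      list v = map (digitM v) (replies o g v 0)
      list≡ : ∀ v → list v ≡ map (digit v) (elemsOf v)
      list≡ v = sym (map-∘ (elemsOf v))
      occ : ∀ v y → lsum (λ a → ⟦ a ≡ᵇ y ⟧) (list v) ≡ ∑ (λ u → ⟦ adj u v ⟧ * ⟦ digit v u ≡ᵇ y ⟧)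
      occ v y = trans (cong (lsum (λ a → ⟦ a ≡ᵇ y ⟧)) (list≡ v)) (lsum-allFin (λ a → ⟦ a ≡ᵇ y ⟧) (digit v) (λ u → adj u v))
      digit< : ∀ v u → suc (digit v u) < 2 ^ z
      digit< v u = begin-strict
        suc (α u * (4 * D) + E (cg v) (α u))  ≤⟨ +-monoʳ-< (α u * (4 * D)) (proj₁ (encode-isCode d b) _ _) ⟩
        α u * (4 * D) + 4 * D                 ≡⟨ +-comm _ (4 * D) ⟩
        suc (α u) * (4 * D)                   ≤⟨ *-monoˡ-≤ (4 * D) (α< u) ⟩
        2 * D * b * (4 * D)                   ≡⟨ ar D b ⟩
        8 * (D * D) * b                       ≤⟨ *-monoʳ-≤ (8 * (D * D)) (<⇒≤ (<2^lg b)) ⟩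
        8 * (D * D) * 2 ^ lg b                ≡⟨ cong (λ z → 8 * z * 2 ^ lg b) (^-distribˡ-+-* 2 d d) ⟨
        2 ^ 3 * 2 ^ (d + d) * 2 ^ lg b        ≡⟨ cong (_* 2 ^ lg b) (^-distribˡ-+-* 2 3 (d + d)) ⟨
        2 ^ (3 + (d + d)) * 2 ^ lg b          ≡⟨ ^-distribˡ-+-* 2 (3 + (d + d)) (lg b) ⟨
        2 ^ (3 + (d + d) + lg b)              ≡⟨ cong (λ z → 2 ^ (3 + (d + z) + lg b)) (+-identityʳ d) ⟨
        2 ^ nextBits d b                      <⟨ ^-monoʳ-< 2 (s≤s (s≤s z≤n)) {nextBits d b} {z} ≤-refl ⟩
        2 ^ z                                 ∎
        where
        open ≤-Reasoning
        ar : ∀ D b → 2 * D * b * (4 * D) ≡ 8 * (D * D) * b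
        ar = solve-∀
      list< : ∀ v y → 2 ^ z ≤ suc y → lsum (λ a → ⟦ a ≡ᵇ y ⟧) (list v) ≡ 0
      list< v y p = trans (occ v y) (∑-zero λ u → trans (cong (λ q → ⟦ adj u v ⟧ * ⟦ q ⟧)
        (≡ᵇ-false {digit v u} {y} (λ q → <⇒≱ (digit< v u) (≤-trans p (≤-reflexive (cong suc (sym q))))))) (*-zeroʳ ⟦ adj u v ⟧))
      length≤ : ∀ v → length (list v) ≤ 2 ^ k
      length≤ v = ≤-trans (≤-reflexive (trans (cong length (list≡ v)) (trans (length-lsum (map (digit v) (elemsOf v)))
        (trans (lsum-allFin (λ _ → 1) (digit v) (λ u → adj u v)) (∑-cong λ u → *-identityʳ ⟦ adj u v ⟧))))) (degV v)
      col<′ : ∀ v → col (proj₂ g′ v) < 2 ^ (2 ^ k * z)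
      col<′ v = <-≤-trans (listCode< z (list v) (list< v)) (^-monoʳ-≤ 2 (≤-trans (*-monoʳ-≤ z (length≤ v)) (≤-reflexive (*-comm z (2 ^ k)))))
      -- If the lists of v and v′ were equal, the entry of v for u would occur in the list of v′,
      -- perhaps for another element u′. The position is part of the entry, so v and v′ would have
      -- the same letter at the position of u, which separates them.
      proper′ : ∀ u v v′ → adj u v ≡ true → adj u v′ ≡ true → v ≢ v′ → col (proj₂ g′ v) ≢ col (proj₂ g′ v′)
      proper′ u v v′ a a′ n q = separated u v v′ a a′ n (trans (proj₂ same) (cong (E (cg v′)) (sym (proj₁ same))))
        where
        lists : list v ≡ list v′
        lists = listCode-injective z (list v) (list v′) (list< v) (list< v′) q
        found : ∃ λ u′ → 0 < ⟦ adj u′ v′ ⟧ * ⟦ digit v′ u′ ≡ᵇ digit v u ⟧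
        found = ∑-pos _ (≤-trans (≤-trans (≤-reflexive (sym (cong₂ (λ a b → ⟦ a ⟧ * ⟦ b ⟧) a (≡ᵇ-true {digit v u} refl))))
          (term≤∑ (λ u′ → ⟦ adj u′ v ⟧ * ⟦ digit v u′ ≡ᵇ digit v u ⟧) u))
          (≤-reflexive (trans (sym (occ v (digit v u))) (trans (cong (lsum (λ a → ⟦ a ≡ᵇ digit v u ⟧)) lists) (occ v′ (digit v u))))))
        both : ∀ a c → 0 < ⟦ a ⟧ * ⟦ c ⟧ → c ≡ true
        both true true _ = refl
        u′ : Fin nU
        u′ = proj₁ found
        same : α u ≡ α u′ × E (cg v) (α u) ≡ E (cg v′) (α u′)
        same = digits-injective (4 * D) (α u) (α u′) _ _ (proj₁ (encode-isCode d b) _ _) (proj₁ (encode-isCode d b) _ _)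
          (sym (≡ᵇ⇒≡ _ _ (≡⇒T (both (adj u′ v′) _ (proj₂ found)))))

    recolours-correct : ∀ K (bits : ℕ → ℕ) → (∀ i → 0 < bits i) → (∀ i → bits (suc i) ≡ 2 ^ k * suc (nextBits d (bits i))) →
      (∀ i → i < K → 2 ^ bits i ≤ Bd) → (∀ i → i < K → codeLength (2 ^ d) (bits i) ≤ Bd) →
      Triple (Proper (bits 0)) (for K (recolourOps d bits)) (Proper (bits K))
    recolours-correct K bits pos next room₁ room₂ = loop (λ i → Proper (bits i)) K (recolourOps d bits) λ i i<K →
      single {P = Proper (bits i)} {Q = Proper (bits (suc i))} (recolourOp d (bits i) (suc (nextBits d (bits i)))) λ g I →
        let a , p = recolour-step (bits i) (pos i) (room₁ i i<K) (room₂ i i<K) g I in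
        a , subst (λ b → Proper b (exec (recolourOp d (bits i) (suc (nextBits d (bits i)))) g)) (sym (next i)) p

-- Iterated logarithms and the length of the preliminary colours

suc-double<2^ : ∀ j → suc (2 * j) < 2 ^ suc j
suc-double<2^ zero = s≤s (s≤s z≤n)
suc-double<2^ (suc j) = begin-strict
  suc (2 * suc j)           ≡⟨ e j ⟩
  2 + suc (2 * j)           <⟨ +-monoʳ-< 2 (suc-double<2^ j) ⟩
  2 + 2 ^ suc j             ≤⟨ +-monoˡ-≤ (2 ^ suc j) (≤-trans (*-monoʳ-≤ 2 (m^n>0 2 j)) ≤-refl) ⟩
  2 ^ suc j + 2 ^ suc j     ≡⟨ cong (2 ^ suc j +_) (+-identityʳ _) ⟨
  2 ^ suc (suc j)           ∎
  where
  open ≤-Reasoning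
  e : ∀ j → suc (2 * suc j) ≡ 2 + suc (2 * j)
  e = solve-∀

2lg≤ : ∀ x → 2 * lg x ≤ x + 2
2lg≤ x = begin
  2 * lg x            ≤⟨ *-monoʳ-≤ 2 (lg-<2^ x (suc j) (s≤s z≤n) (≤-<-trans x≤ (suc-double<2^ j))) ⟩
  2 * suc j           ≡⟨ *-suc 2 j ⟩
  2 + 2 * j           ≤⟨ +-monoʳ-≤ 2 2j≤ ⟩
  2 + x               ≡⟨ +-comm 2 x ⟩
  x + 2               ∎
  where
  open ≤-Reasoning
  j = x / 2
  split : x ≡ x % 2 + 2 * j
  split = trans (m≡m%n+[m/n]*n x 2) (cong (x % 2 +_) (*-comm j 2))
  x≤ : x ≤ suc (2 * j)
  x≤ = ≤-trans (≤-reflexive split) (+-monoˡ-≤ (2 * j) (s≤s⁻¹ (m%n<n x 2)))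
  2j≤ : 2 * j ≤ x
  2j≤ = ≤-trans (m≤n+m (2 * j) (x % 2)) (≤-reflexive (sym split))

⌊log₂⌋< : ∀ m → 1 < m → ⌊log₂ m ⌋ < m
⌊log₂⌋< m p = ≤-trans (lg-<2^ m m (<⇒≤ p) (n<2^n m)) ≤-refl

-- β i stands for lg of the number of bits of a colour after i preliminary steps.
module LogStar (g q : ℕ) (q≥4 : 4 ≤ q) where

  H C : ℕ
  H = 2 * g + 4
  C = 2 ^ q

  C-large : 2 * lg C + 4 ≤ C
  C-large = ≤-trans (≤-reflexive (cong (λ z → 2 * z + 4) (lg[2^] q))) (subst (λ z → 2 * suc z + 4 ≤ 2 ^ z) (m+[n∸m]≡n q≥4) (go (q ∸ 4)))
    where
    go : ∀ i → 2 * suc (4 + i) + 4 ≤ 2 ^ (4 + i)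
    go zero = ≤ᵇ⇒≤ 14 16 tt
    go (suc i) = begin
      2 * suc (4 + suc i) + 4         ≡⟨ e i ⟩
      2 + (2 * suc (4 + i) + 4)       ≤⟨ +-mono-≤ (≤-trans (≤ᵇ⇒≤ 2 14 tt) (≤-trans (m≤m+n 14 (2 * i)) (≤-reflexive (e′ i)))) ≤-refl ⟩
      (2 * suc (4 + i) + 4) + (2 * suc (4 + i) + 4) ≤⟨ +-mono-≤ (go i) (go i) ⟩
      2 ^ (4 + i) + 2 ^ (4 + i)       ≡⟨ cong (2 ^ (4 + i) +_) (+-identityʳ _) ⟨
      2 ^ (4 + suc i)                 ∎
      where
      open ≤-Reasoning
      e : ∀ i → 2 * suc (4 + suc i) + 4 ≡ 2 + (2 * suc (4 + i) + 4)
      e = solve-∀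
      e′ : ∀ i → 14 + 2 * i ≡ 2 * suc (4 + i) + 4
      e′ = solve-∀

  -- H is chosen so that g + (H + 2)/2 ≤ H; below H the recursion cannot escape.
  stay : ∀ a → a ≤ H → g + lg a ≤ H
  stay a p = *-cancelˡ-≤ 2 (begin
    2 * (g + lg a)            ≡⟨ *-distribˡ-+ 2 g (lg a) ⟩
    2 * g + 2 * lg a          ≤⟨ +-monoʳ-≤ (2 * g) (≤-trans (2lg≤ a) (+-monoˡ-≤ 2 p)) ⟩
    2 * g + (2 * g + 4 + 2)   ≤⟨ m≤m+n _ 2 ⟩
    2 * g + (2 * g + 4 + 2) + 2 ≡⟨ e g ⟩
    2 * H                     ∎)
    where
    open ≤-Reasoning
    e : ∀ g → 2 * g + (2 * g + 4 + 2) + 2 ≡ 2 * (2 * g + 4)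
    e = solve-∀

  -- If `lg a` ≤ g the additive term dominates and the bound is already below H. Otherwise g +
  -- `lg a` ≤ 2·`lg a`, and C is large enough to absorb the factor 2 together with `lg C`.
  drop : ∀ a m → 1 < m → a ≤ C * m → g + lg a ≤ H ⊎ g + lg a ≤ C * ⌊log₂ m ⌋
  drop a m 1<m p with ≤-total (lg a) g
  ... | inj₁ q = inj₁ (≤-trans (+-monoʳ-≤ g q) (≤-trans (≤-reflexive (cong (g +_) (sym (+-identityʳ g)))) (m≤m+n (2 * g) 4)))
  ... | inj₂ q = inj₂ (begin
    g + lg a                          ≤⟨ +-monoˡ-≤ (lg a) q ⟩
    lg a + lg a                       ≡⟨ cong (lg a +_) (+-identityʳ _) ⟨
    2 * lg a                          ≤⟨ *-monoʳ-≤ 2 (≤-trans (lg-mono p) (lg-* C m)) ⟩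
    2 * (lg C + suc ⌊log₂ m ⌋)        ≡⟨ e (lg C) ⌊log₂ m ⌋ ⟩
    2 * lg C + 2 + 2 * ⌊log₂ m ⌋      ≤⟨ lin ⌊log₂ m ⌋ (⌊log₂⌋-mono-≤ {2} {m} 1<m) ⟩
    C * ⌊log₂ m ⌋                     ∎)
    where
    open ≤-Reasoning
    e : ∀ a b → 2 * (a + suc b) ≡ 2 * a + 2 + 2 * b
    e = solve-∀
    lin : ∀ w → 1 ≤ w → 2 * lg C + 2 + 2 * w ≤ C * w
    lin (suc w) _ = begin
      2 * lg C + 2 + 2 * suc w         ≡⟨ e₁ (lg C) w ⟩
      2 * lg C + 4 + 2 * w             ≤⟨ +-mono-≤ C-large (*-monoˡ-≤ w (≤-trans (≤-trans (≤ᵇ⇒≤ 2 4 tt) (m≤n+m 4 (2 * lg C))) C-large)) ⟩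
      C + C * w                        ≡⟨ *-suc C w ⟨
      C * suc w                        ∎
      where
      e₁ : ∀ a w → 2 * a + 2 + 2 * suc w ≡ 2 * a + 4 + 2 * w
      e₁ = solve-∀

  -- Follows the recursion of `logStarAux`. The bound C·m instead of m leaves room for a constant
  -- factor in the identifier lengths; for m ≤ 1 both alternatives give H + C.
  settle : ∀ fuel m → m ≤ fuel → (β : ℕ → ℕ) → (∀ i → β (suc i) ≤ g + lg (β i)) →
    β 0 ≤ H ⊎ β 0 ≤ C * m → β (logStarAux fuel m) ≤ H + C
  settle zero zero _ β step (inj₁ p) = ≤-trans p (m≤m+n H C)
  settle zero zero _ β step (inj₂ p) = ≤-trans p (≤-trans (≤-reflexive (*-zeroʳ C)) z≤n)
  settle (suc f) m m≤ β step h with ≤ᵇ-cases m 1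
  ... | inj₁ (p , e) rewrite e with h
  ... | inj₁ q = ≤-trans q (m≤m+n H C)
  ... | inj₂ q = ≤-trans q (≤-trans (*-monoʳ-≤ C p) (≤-trans (≤-reflexive (*-identityʳ C)) (m≤n+m C H)))
  settle (suc f) m m≤ β step h | inj₂ (p , e) rewrite e =
    settle f ⌊log₂ m ⌋ (s≤s⁻¹ (≤-trans (⌊log₂⌋< m p) m≤)) (β ∘ suc) (λ i → step (suc i)) (next h)
    where
    next : β 0 ≤ H ⊎ β 0 ≤ C * m → β 1 ≤ H ⊎ β 1 ≤ C * ⌊log₂ m ⌋
    next (inj₁ q) = inj₁ (≤-trans (step 0) (stay (β 0) q))
    next (inj₂ q) with drop (β 0) m p q
    ... | inj₁ r = inj₁ (≤-trans (step 0) r)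
    ... | inj₂ r = inj₂ (≤-trans (step 0) r)

-- A new colour lists at most 2^k entries, one for each element of the set; the additional bit makes
-- room for the digits `suc a`.
preBits : (k ℓ b : ℕ) → ℕ → ℕ
preBits k ℓ b zero = b
preBits k ℓ b (suc i) = 2 ^ k * suc (nextBits (ℓ + ℓ) (preBits k ℓ b i))

-- The steps are taken only if the first does not lengthen the colours. By monotonicity no later one
-- does, so all colours fit into messages as the identifiers do.
preSteps : (k ℓ b n : ℕ) → ℕ
preSteps k ℓ b n = if preBits k ℓ b 1 ≤ᵇ b then logStar n else 0

module PreBits (k t b n : ℕ) (k<t : k < t) (0<b : 0 < b) where
  private
    ℓ g : ℕ
    ℓ = lg t
    g = 4 + 2 * t
    B : ℕ → ℕ
    B = preBits k ℓ b

  0<t : 0 < t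
  0<t = ≤-<-trans z≤n k<t

  B>0 : ∀ i → 0 < B i
  B>0 zero = 0<b
  B>0 (suc i) = *-mono-≤ {1} {2 ^ k} {1} (m^n>0 2 k) (s≤s z≤n)

  -- Here the case distinction pays: k < t bounds the list length 2^k by 2^t, so one step takes lg
  -- of the length to O(t) plus an iterated logarithm, independently of s.
  B-step : ∀ i → B (suc i) < 2 ^ (g + lg (lg (B i)))
  B-step i = begin-strict
    2 ^ k * suc (nextBits (ℓ + ℓ) (B i))      ≤⟨ *-mono-≤ (^-monoʳ-≤ 2 (<⇒≤ k<t)) (≤-trans inner (*-monoʳ-≤ (16 * 2 ^ t) ≤-refl)) ⟩
    2 ^ t * (16 * 2 ^ t * lg (B i))           ≡⟨ e (2 ^ t) (lg (B i)) ⟩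
    2 ^ 4 * (2 ^ t * 2 ^ t) * lg (B i)        ≡⟨ cong (_* lg (B i)) (trans (cong (2 ^ 4 *_) (trans (sym (^-distribˡ-+-* 2 t t)) (cong (2 ^_) (cong (t +_) (sym (+-identityʳ t)))))) (sym (^-distribˡ-+-* 2 4 (2 * t)))) ⟩
    2 ^ g * lg (B i)                          <⟨ *-monoʳ-< (2 ^ g) {{m^n≢0 2 g}} (<2^lg (lg (B i))) ⟩
    2 ^ g * 2 ^ lg (lg (B i))                 ≡⟨ ^-distribˡ-+-* 2 g (lg (lg (B i))) ⟨
    2 ^ (g + lg (lg (B i)))                   ∎
    where
    open ≤-Reasoning
    e : ∀ x l → x * (16 * x * l) ≡ 16 * (x * x) * l
    e = solve-∀
    inner : suc (nextBits (ℓ + ℓ) (B i)) ≤ 16 * 2 ^ t * lg (B i)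
    inner = begin
      4 + 2 * (ℓ + ℓ) + lg (B i)              ≤⟨ +-monoˡ-≤ (lg (B i)) (+-monoʳ-≤ 4 (*-monoʳ-≤ 2 (+-mono-≤ ℓ≤ ℓ≤))) ⟩
      4 + 2 * (2 ^ t + 2 ^ t) + lg (B i)      ≤⟨ +-mono-≤ (+-monoˡ-≤ (2 * (2 ^ t + 2 ^ t)) (*-monoʳ-≤ 4 (m^n>0 2 t))) (≤-trans (≤-reflexive (sym (*-identityˡ (lg (B i))))) (*-monoˡ-≤ (lg (B i)) (m^n>0 2 t))) ⟩
      4 * 2 ^ t + 2 * (2 ^ t + 2 ^ t) + 2 ^ t * lg (B i) ≡⟨ cong (_+ 2 ^ t * lg (B i)) (e₂ (2 ^ t)) ⟩
      8 * 2 ^ t * 1 + 2 ^ t * lg (B i)        ≤⟨ +-monoˡ-≤ _ (*-monoʳ-≤ (8 * 2 ^ t) (1≤lg (B i))) ⟩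
      8 * 2 ^ t * lg (B i) + 2 ^ t * lg (B i) ≤⟨ m≤m+n _ (7 * 2 ^ t * lg (B i)) ⟩
      8 * 2 ^ t * lg (B i) + 2 ^ t * lg (B i) + 7 * 2 ^ t * lg (B i) ≡⟨ e₃ (2 ^ t) (lg (B i)) ⟩
      16 * 2 ^ t * lg (B i)                   ∎
      where
      ℓ≤ : ℓ ≤ 2 ^ t
      ℓ≤ = ≤-trans (lg≤id t 0<t) (<⇒≤ (n<2^n t))
      e₂ : ∀ x → 4 * x + 2 * (x + x) ≡ 8 * x * 1
      e₂ = solve-∀
      e₃ : ∀ x l → 8 * x * l + x * l + 7 * x * l ≡ 16 * x * l
      e₃ = solve-∀

  lgB-step : ∀ i → lg (B (suc i)) ≤ g + lg (lg (B i))
  lgB-step i = lg-<2^ (B (suc i)) (g + lg (lg (B i))) (s≤s z≤n) (B-step i)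

  decreasing : B 1 ≤ b → ∀ i → B i ≤ b
  decreasing h i = go i
    where
    down : ∀ i → B (suc i) ≤ B i
    down zero = h
    down (suc i) = *-monoʳ-≤ (2 ^ k) (s≤s (+-monoʳ-≤ (3 + 2 * (ℓ + ℓ)) (lg-mono (down i))))
    go : ∀ i → B i ≤ b
    go zero = ≤-refl
    go (suc i) = ≤-trans (down i) (go i)

  K : ℕ
  K = preSteps k ℓ b n

  K≤ : K ≤ logStar n
  K≤ with preBits k ℓ b 1 ≤ᵇ b
  ... | true = ≤-refl
  ... | false = z≤n

  B≤ : ∀ i → i ≤ K → B i ≤ b
  B≤ i p with ≤ᵇ-cases (preBits k ℓ b 1) b
  ... | inj₁ (h , _) = decreasing h i
  B≤ zero p | inj₂ (_ , e) = ≤-refl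
  B≤ (suc i) p | inj₂ (_ , e) rewrite e with p
  ... | ()

  -- Without a preliminary step b < 2^g·lg b, which bounds b as well.
  final-bits : ∀ q → 4 ≤ q → lg b ≤ 2 ^ q * n → lg (B K) ≤ (16 + 2 ^ q) * t
  final-bits q q≥4 lgb≤ with ≤ᵇ-cases (preBits k ℓ b 1) b
  ... | inj₁ (h , e) rewrite e = ≤-trans (L.settle n n ≤-refl (λ i → lg (B i)) lgB-step (inj₂ lgb≤)) (begin
      2 * (4 + 2 * t) + 4 + 2 ^ q          ≡⟨ e₁ t (2 ^ q) ⟩
      12 * 1 + 2 ^ q * 1 + 4 * t           ≤⟨ +-monoˡ-≤ (4 * t) (+-mono-≤ (*-monoʳ-≤ 12 0<t) (*-monoʳ-≤ (2 ^ q) 0<t)) ⟩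
      12 * t + 2 ^ q * t + 4 * t           ≡⟨ e₂ t (2 ^ q) ⟩
      (16 + 2 ^ q) * t                     ∎)
    where
    open ≤-Reasoning
    module L = LogStar g q q≥4
    e₁ : ∀ t c → 2 * (4 + 2 * t) + 4 + c ≡ 12 * 1 + c * 1 + 4 * t
    e₁ = solve-∀
    e₂ : ∀ t c → 12 * t + c * t + 4 * t ≡ (16 + c) * t
    e₂ = solve-∀
  ... | inj₂ (h , e) rewrite e = ≤-trans small (*-monoˡ-≤ t (m≤m+n 16 (2 ^ q)))
    where
    open ≤-Reasoning
    β = lg b
    l1 : β ≤ suc (g + lg β)
    l1 = 2^-cancel-≤ β (suc (g + lg β)) (begin
      2 ^ β                      ≤⟨ 2^lg≤2* b 0<b ⟩
      2 * b                      ≤⟨ *-monoʳ-≤ 2 (<⇒≤ (<-trans h (B-step 0))) ⟩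
      2 ^ suc (g + lg β)         ∎)
    l2 : 2 * β ≤ 2 * g + 4 + β
    l2 = begin
      2 * β                      ≤⟨ *-monoʳ-≤ 2 l1 ⟩
      2 * suc (g + lg β)         ≡⟨ e₁ g (lg β) ⟩
      2 * g + 2 + 2 * lg β       ≤⟨ +-monoʳ-≤ (2 * g + 2) (2lg≤ β) ⟩
      2 * g + 2 + (β + 2)        ≡⟨ e₂ g β ⟩
      2 * g + 4 + β              ∎
      where
      e₁ : ∀ g l → 2 * suc (g + l) ≡ 2 * g + 2 + 2 * l
      e₁ = solve-∀
      e₂ : ∀ g l → 2 * g + 2 + (l + 2) ≡ 2 * g + 4 + l
      e₂ = solve-∀
    small : β ≤ 16 * t
    small = begin
      β                          ≤⟨ +-cancelʳ-≤ β _ _ (≤-trans (≤-reflexive (cong (β +_) (sym (+-identityʳ β)))) l2) ⟩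
      2 * (4 + 2 * t) + 4        ≡⟨ e₁ t ⟩
      12 * 1 + 4 * t             ≤⟨ +-monoˡ-≤ (4 * t) (*-monoʳ-≤ 12 0<t) ⟩
      12 * t + 4 * t             ≡⟨ e₂ t ⟩
      16 * t                     ∎
      where
      e₁ : ∀ t → 2 * (4 + 2 * t) + 4 ≡ 12 * 1 + 4 * t
      e₁ = solve-∀
      e₂ : ∀ t → 12 * t + 4 * t ≡ 16 * t
      e₂ = solve-∀

-- There are 2^(8·labelExponent ℓ) = Θ(ℓ) classes.  This exponent and the numbers
-- below are abstract because products with large literal powers of two must not unfold.
abstract
  labelExponent : ℕ → ℕ
  labelExponent ℓ = 3 + lg ℓ / 8

  labelExponent-upper : ∀ ℓ → labelExponent ℓ * 8 ≤ 24 + lg ℓ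
  labelExponent-upper ℓ = ≤-trans (≤-reflexive (*-distribʳ-+ 8 3 (lg ℓ / 8))) (+-monoʳ-≤ 24 (m/n*n≤m (lg ℓ) 8))

  -- Rounding lg ℓ down to a multiple of 8 loses at most 7 of the 3·8; the remaining 17 give room
  -- for 2·13312 ≤ 2^17.
  labelExponent-lower : ∀ ℓ → 17 + lg ℓ ≤ labelExponent ℓ * 8
  labelExponent-lower ℓ = begin
    17 + lg ℓ                           ≡⟨ cong (17 +_) (m≡m%n+[m/n]*n (lg ℓ) 8) ⟩
    17 + (lg ℓ % 8 + lg ℓ / 8 * 8)      ≤⟨ +-monoʳ-≤ 17 (+-monoˡ-≤ (lg ℓ / 8 * 8) (s≤s⁻¹ (m%n<n (lg ℓ) 8))) ⟩
    17 + (7 + lg ℓ / 8 * 8)             ≡⟨ *-distribʳ-+ 8 3 (lg ℓ / 8) ⟨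
    labelExponent ℓ * 8                 ∎
    where open ≤-Reasoning

  labelExponent-linear : ∀ ℓ → labelExponent ℓ ≤ 3 + lg ℓ
  labelExponent-linear ℓ = +-monoʳ-≤ 3 (m/n≤m (lg ℓ) 8)

-- Parameters and the complete program

startBits : (c k ℓ n : ℕ) → ℕ
-- Identifiers below n^c have at most c·`lg n` bits; `suc c` keeps the length positive for c = 0.
startBits c k ℓ n = preBits k ℓ (suc c * lg n) (preSteps k ℓ (suc c * lg n) n)

mainBits : (c k ℓ n : ℕ) → ℕ → ℕ
mainBits c k ℓ n zero = startBits c k ℓ n
mainBits c k ℓ n (suc i) = nextBits (3 + labelExponent ℓ + (3 + labelExponent ℓ)) (mainBits c k ℓ n i)

-- A code of length 2·2^d·b is sent in blocks of `lg n` bits. As b ≤ (c + 125)·`lg n`, the number of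
-- blocks does not depend on n; here 125 = 1 + 4·31, with 31·`lg n` bits added by each of four
-- reductions.
lastBlock : (c ℓ : ℕ) → ℕ
lastBlock c ℓ = 2 * 2 ^ (3 + labelExponent ℓ + (3 + labelExponent ℓ)) * (c + 125)

prePart : (c k ℓ n : ℕ) → List Op
prePart c k ℓ n = for (preSteps k ℓ (suc c * lg n) n) (recolourOps (ℓ + ℓ) (preBits k ℓ (suc c * lg n)))

abstract
  phasePart : (c k ℓ n : ℕ) → List Op
  phasePart c k ℓ n = phases (labelExponent ℓ) ⌊log₂ n ⌋ (lastBlock c ℓ) (mainBits c k ℓ n) ℓ (n ^ c) k

  phasePart≡ : ∀ c k ℓ n → phasePart c k ℓ n ≡ phases (labelExponent ℓ) ⌊log₂ n ⌋ (lastBlock c ℓ) (mainBits c k ℓ n) ℓ (n ^ c) k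
  phasePart≡ c k ℓ n = refl

mainProgram : (c k ℓ n : ℕ) → List Op
mainProgram c k ℓ n = prePart c k ℓ n ++ phasePart c k ℓ n

-- The given degree bounds may be far larger than n; clipped at n they remain valid, and all
-- messages stay polynomial in n.
program : (c n s t : ℕ) → List Op
program c n s t =
  if t ⊓ n ≤ᵇ lg (s ⊓ n) then for (suc (lg (s ⊓ n))) (λ _ → dualOp (2 ^ lg (s ⊓ n)) ∷ [])
  else mainProgram c (lg (s ⊓ n)) (lg (t ⊓ n)) n

-- The factor 2 comes from 2^(`lg n`) ≤ (n+1)².
bandwidthExponent : ℕ → ℕ
bandwidthExponent c = 2 * (c + 125)

msgBound : (c n : ℕ) → ℕ
msgBound c n = suc (pred (suc n ^ bandwidthExponent c))

msgBound≡ : ∀ c n → msgBound c n ≡ suc n ^ bandwidthExponent c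
msgBound≡ c n = suc-pred (suc n ^ bandwidthExponent c) {{m^n≢0 (suc n) (bandwidthExponent c)}}

-- Message sizes and the number of operations

module Exponents where
  abstract
    c15 c17 c24 : ℕ
    c15 = 15
    c17 = 17
    c24 = 24

    15≡c15 : 15 ≡ c15
    15≡c15 = refl

    24≤c24 : 24 ≤ c24
    24≤c24 = ≤-refl

    c24≤24 : c24 ≤ 24
    c24≤24 = ≤-refl

    c17≤17 : c17 ≤ 17
    c17≤17 = ≤-refl

    2*13312≤2^c17 : 2 * 13312 ≤ 2 ^ c17
    2*13312≤2^c17 = ≤ᵇ⇒≤ (2 * 13312) (2 ^ 17) tt

open Exponents

-- The constant of `final-bits` for q = 4 + suc c, large enough for `lg` (suc c · `lg n`) ≤ 2^q·n.
agreeConst : ℕ → ℕ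
agreeConst c = 16 + 2 ^ (4 + suc c)

abstract
  blockConst labelConst sectionConst levelConst iterationConst : ℕ → ℕ
  blockConst c = 1 + 128 * (c + 125)
  labelConst c = 2 ^ suc (suc c15) * (agreeConst c + 66)
  sectionConst c = 2 + 4 * blockConst c + labelConst c
  levelConst c = (2 + 8 * sectionConst c) * 2 ^ suc c24
  iterationConst c = 4 + 2 * levelConst c

  blockConst≡ : ∀ c → blockConst c ≡ 1 + 128 * (c + 125)
  blockConst≡ c = refl

  labelConst≡ : ∀ c → labelConst c ≡ 2 ^ suc (suc c15) * (agreeConst c + 66)
  labelConst≡ c = refl

  sectionConst≡ : ∀ c → sectionConst c ≡ 2 + 4 * blockConst c + labelConst c
  sectionConst≡ c = refl

  levelConst≡ : ∀ c → levelConst c ≡ (2 + 8 * sectionConst c) * 2 ^ suc c24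
  levelConst≡ c = refl

  iterationConst≡ : ∀ c → iterationConst c ≡ 4 + 2 * levelConst c
  iterationConst≡ c = refl

roundConst : ℕ → ℕ
roundConst c = 8 * iterationConst c + 1

module RoomFor (c n : ℕ) (0<n : 0 < n) where
  w Cb : ℕ
  w = lg n
  Cb = c + 125

  2^w≤ : 2 ^ w ≤ suc n ^ 2
  2^w≤ = begin
    2 ^ w               ≤⟨ 2^lg≤2* n 0<n ⟩
    2 * n               ≤⟨ m≤m+n (2 * n) (n * n + 1) ⟩
    2 * n + (n * n + 1) ≡⟨ e n ⟩
    suc n ^ 2           ∎
    where
    open ≤-Reasoning
    e : ∀ n → 2 * n + (n * n + 1) ≡ suc n * (suc n * 1)
    e = solve-∀

  room : ∀ a → a ≤ Cb → 2 ^ (a * w) ≤ msgBound c n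
  room a p = begin
    2 ^ (a * w)          ≡⟨ trans (cong (2 ^_) (*-comm a w)) (sym (^-*-assoc 2 w a)) ⟩
    (2 ^ w) ^ a          ≤⟨ ^-monoˡ-≤ a 2^w≤ ⟩
    (suc n ^ 2) ^ a      ≡⟨ ^-*-assoc (suc n) 2 a ⟩
    suc n ^ (2 * a)      ≤⟨ ^-monoʳ-≤ (suc n) (*-monoʳ-≤ 2 p) ⟩
    suc n ^ (2 * Cb)     ≡⟨ msgBound≡ c n ⟨
    msgBound c n         ∎
    where open ≤-Reasoning

  room≤ : ∀ m a → m ≤ a * w → a ≤ Cb → 2 ^ m ≤ msgBound c n
  room≤ m a p q = ≤-trans (^-monoʳ-≤ 2 p) (room a q)

  k≤Cb : ∀ k → k ≤ 125 → k ≤ Cb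
  k≤Cb k p = ≤-trans p (m≤n+m 125 c)

  1≤w : 1 ≤ w
  1≤w = 1≤lg n

  const≤ : ∀ k → k ≤ k * w
  const≤ k = ≤-trans (≤-reflexive (sym (*-identityʳ k))) (*-monoʳ-≤ k 1≤w)

module MainParams (c n k t : ℕ) (k<t : k < t) (t≤n : t ≤ n) where
  0<t : 0 < t
  0<t = ≤-<-trans z≤n k<t
  0<n : 0 < n
  0<n = ≤-trans 0<t t≤n
  open RoomFor c n 0<n public

  ℓ ε d q b₀ Bd blk : ℕ
  ℓ = lg t
  ε = labelExponent ℓ
  d = 3 + ε + (3 + ε)
  q = 3 + 2 * d
  b₀ = suc c * lg n
  Bd = msgBound c n
  blk = lastBlock c ℓ

  bits : ℕ → ℕ
  bits = mainBits c k ℓ n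

  1≤ℓ : 1 ≤ ℓ
  1≤ℓ = 1≤lg t

  ℓ≤w : ℓ ≤ w
  ℓ≤w = lg-mono t≤n

  0<b₀ : 0 < b₀
  0<b₀ = ≤-trans 1≤w (m≤m+n w (c * w))

  module PB = PreBits k t b₀ n k<t 0<b₀

  lgℓ≤w : lg ℓ ≤ w
  lgℓ≤w = ≤-trans (lg≤id ℓ 1≤ℓ) ℓ≤w

  8ε≤ : ε * 8 ≤ c24 + lg ℓ
  8ε≤ = ≤-trans (labelExponent-upper ℓ) (+-monoˡ-≤ (lg ℓ) 24≤c24)

  8ε≥ : c17 + lg ℓ ≤ ε * 8
  8ε≥ = ≤-trans (+-monoˡ-≤ (lg ℓ) c17≤17) (labelExponent-lower ℓ)

  R8 : ℕ
  R8 = (2 ^ ε) ^ 8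

  R8≡ : R8 ≡ 2 ^ (ε * 8)
  R8≡ = ^-*-assoc 2 ε 8

  suc≤2* : ∀ {x} → 1 ≤ x → suc x ≤ 2 * x
  suc≤2* {x} p = ≤-trans (+-monoˡ-≤ x p) (≤-reflexive (cong (x +_) (sym (+-identityʳ x))))

  cap-for : ∀ m → 2 * m ≤ 2 ^ c17 → suc ℓ * m ≤ R8
  cap-for m h = begin
    suc ℓ * m              ≤⟨ *-monoˡ-≤ m (suc≤2* 1≤ℓ) ⟩
    2 * ℓ * m              ≡⟨ e ℓ m ⟩
    ℓ * (2 * m)            ≤⟨ *-mono-≤ (<⇒≤ (<2^lg ℓ)) h ⟩
    2 ^ lg ℓ * 2 ^ c17     ≡⟨ trans (*-comm (2 ^ lg ℓ) (2 ^ c17)) (sym (^-distribˡ-+-* 2 c17 (lg ℓ))) ⟩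
    2 ^ (c17 + lg ℓ)       ≤⟨ ^-monoʳ-≤ 2 8ε≥ ⟩
    2 ^ (ε * 8)            ≡⟨ R8≡ ⟨
    R8                     ∎
    where
    open ≤-Reasoning
    e : ∀ ℓ m → 2 * ℓ * m ≡ ℓ * (2 * m)
    e = solve-∀

  cap : suc ℓ * 13312 ≤ R8
  cap = cap-for 13312 2*13312≤2^c17

  R8≤ : R8 ≤ 2 ^ suc c24 * ℓ
  R8≤ = begin
    R8                     ≡⟨ R8≡ ⟩
    2 ^ (ε * 8)            ≤⟨ ^-monoʳ-≤ 2 8ε≤ ⟩
    2 ^ (c24 + lg ℓ)       ≡⟨ ^-distribˡ-+-* 2 c24 (lg ℓ) ⟩
    2 ^ c24 * 2 ^ lg ℓ     ≤⟨ *-monoʳ-≤ (2 ^ c24) (2^lg≤2* ℓ 1≤ℓ) ⟩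
    2 ^ c24 * (2 * ℓ)      ≡⟨ e (2 ^ c24) ℓ ⟩
    2 ^ suc c24 * ℓ        ∎
    where
    open ≤-Reasoning
    e : ∀ c l → c * (2 * l) ≡ 2 * c * l
    e = solve-∀

  q≡ : q ≡ 15 + 4 * ε
  q≡ = e ε
    where
    e : ∀ ε → 3 + 2 * (3 + ε + (3 + ε)) ≡ 15 + 4 * ε
    e = solve-∀

  ε≤ : ε ≤ 4 * w
  ε≤ = ≤-trans (labelExponent-linear ℓ) (≤-trans (+-mono-≤ (const≤ 3) lgℓ≤w) (≤-reflexive (+-comm (3 * w) w)))

  q≤ : q ≤ 31 * w
  q≤ = begin
    q                      ≡⟨ q≡ ⟩
    15 + 4 * ε             ≤⟨ +-mono-≤ (const≤ 15) (*-monoʳ-≤ 4 ε≤) ⟩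
    15 * w + 4 * (4 * w)   ≡⟨ e w ⟩
    31 * w                 ∎
    where
    open ≤-Reasoning
    e : ∀ w → 15 * w + 4 * (4 * w) ≡ 31 * w
    e = solve-∀

  bits>0 : ∀ i → 0 < bits i
  bits>0 zero = PB.B>0 PB.K
  bits>0 (suc i) = s≤s z≤n

  bits≤ : ∀ i → bits i ≤ (suc c + i * 31) * w
  bits≤ zero = ≤-trans (PB.B≤ PB.K ≤-refl) (≤-reflexive (cong (_* w) (sym (+-identityʳ (suc c)))))
  bits≤ (suc i) = begin
    q + lg (bits i)                      ≤⟨ +-mono-≤ q≤ (≤-trans (lg≤id (bits i) (bits>0 i)) (bits≤ i)) ⟩
    31 * w + (suc c + i * 31) * w        ≡⟨ e w (suc c) (i * 31) ⟩
    (suc c + suc i * 31) * w             ∎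
    where
    open ≤-Reasoning
    e : ∀ w c j → 31 * w + (c + j) * w ≡ (c + (31 + j)) * w
    e = solve-∀

  coef≤ : ∀ i → i ≤ 4 → suc c + i * 31 ≤ Cb
  coef≤ i p = ≤-trans (+-monoʳ-≤ (suc c) (*-monoˡ-≤ 31 p)) (≤-reflexive (sym (+-suc c 124)))

  bits-room : ∀ i → i ≤ 4 → 2 ^ bits i ≤ Bd
  bits-room i p = room≤ (bits i) _ (bits≤ i) (coef≤ i p)

  blocks≥ : ∀ i → i < 4 → codeLength (2 ^ d) (bits i) ≤ suc blk * w
  blocks≥ i p = begin
    2 * 2 ^ d * bits i          ≤⟨ *-monoʳ-≤ (2 * 2 ^ d) (≤-trans (bits≤ i) (*-monoˡ-≤ w (coef≤ i (<⇒≤ p)))) ⟩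
    2 * 2 ^ d * (Cb * w)        ≡⟨ *-assoc (2 * 2 ^ d) Cb w ⟨
    blk * w                     ≤⟨ *-monoˡ-≤ w (n≤1+n blk) ⟩
    suc blk * w                 ∎
    where open ≤-Reasoning

  cls-room : R8 ≤ Bd
  cls-room = ≤-trans (≤-reflexive R8≡) (room≤ (ε * 8) 25 (begin
    ε * 8             ≤⟨ 8ε≤ ⟩
    c24 + lg ℓ        ≤⟨ +-mono-≤ (≤-trans c24≤24 (const≤ 24)) lgℓ≤w ⟩
    24 * w + w        ≡⟨ +-comm (24 * w) w ⟩
    25 * w            ∎) (k≤Cb 25 (≤ᵇ⇒≤ 25 125 tt)))
    where open ≤-Reasoning

  2^w<Bd : ∀ a → a ≤ 3 → 2 ^ (a * w) < Bd
  2^w<Bd a p = <-≤-trans (^-monoʳ-< 2 (s≤s (s≤s z≤n)) {a * w} {4 * w} (begin-strict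
    a * w     ≤⟨ *-monoˡ-≤ w p ⟩
    3 * w     <⟨ m<n+m (3 * w) 1≤w ⟩
    4 * w     ∎)) (room 4 (k≤Cb 4 (≤ᵇ⇒≤ 4 125 tt)))
    where open ≤-Reasoning

  sucℓ≤ : suc ℓ ≤ 2 * w
  sucℓ≤ = ≤-trans (+-mono-≤ 1≤w ℓ≤w) (≤-reflexive (cong (w +_) (sym (+-identityʳ w))))

  W<Bd : 2 ^ suc ℓ < Bd
  W<Bd = ≤-<-trans (^-monoʳ-≤ 2 sucℓ≤) (2^w<Bd 2 (≤ᵇ⇒≤ 2 3 tt))

  big : ∀ nV → nV ≤ n → nV * 2 ^ suc ℓ < Bd
  big nV p = ≤-<-trans (begin
    nV * 2 ^ suc ℓ              ≤⟨ *-mono-≤ (≤-trans p (<⇒≤ (<2^lg n))) (^-monoʳ-≤ 2 sucℓ≤) ⟩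
    2 ^ w * 2 ^ (2 * w)         ≡⟨ ^-distribˡ-+-* 2 w (2 * w) ⟨
    2 ^ (3 * w)                 ∎) (2^w<Bd 3 ≤-refl)
    where open ≤-Reasoning

  small<Bd : ∀ m → m ≤ n → m < Bd
  small<Bd m p = <-trans (≤-<-trans p (<2^lg n)) (subst (λ z → 2 ^ z < Bd) (*-identityˡ w) (2^w<Bd 1 (≤ᵇ⇒≤ 1 3 tt)))

  pre-room : ∀ i → i < PB.K → 2 ^ preBits k ℓ b₀ i ≤ Bd
  pre-room i p = room≤ _ (suc c) (PB.B≤ i (<⇒≤ p)) (≤-trans (≤-reflexive (sym (+-identityʳ (suc c)))) (coef≤ 0 z≤n))

  pre-code-room : ∀ i → i < PB.K → codeLength (2 ^ (ℓ + ℓ)) (preBits k ℓ b₀ i) ≤ Bd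
  pre-code-room i p = begin
    2 * 2 ^ (ℓ + ℓ) * B           ≤⟨ *-monoʳ-≤ (2 * 2 ^ (ℓ + ℓ)) (<⇒≤ (n<2^n B)) ⟩
    2 ^ suc (ℓ + ℓ) * 2 ^ B       ≡⟨ ^-distribˡ-+-* 2 (suc (ℓ + ℓ)) B ⟨
    2 ^ (suc (ℓ + ℓ) + B)         ≤⟨ room≤ _ (suc c + 3) (begin
        suc (ℓ + ℓ) + B             ≤⟨ +-mono-≤ (+-mono-≤ 1≤w (+-mono-≤ ℓ≤w ℓ≤w)) (PB.B≤ i (<⇒≤ p)) ⟩
        w + (w + w) + suc c * w     ≡⟨ e w (suc c) ⟩
        (suc c + 3) * w             ∎)
        (≤-trans (+-monoʳ-≤ (suc c) (≤ᵇ⇒≤ 3 124 tt)) (≤-reflexive (sym (+-suc c 124)))) ⟩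
    Bd                            ∎
    where
    open ≤-Reasoning
    B = preBits k ℓ b₀ i
    e : ∀ w c → w + (w + w) + c * w ≡ (c + 3) * w
    e = solve-∀

  -- Round complexity

  A : ℕ
  A = agreeConst c

  lg-bits₀ : lg (bits 0) ≤ A * t
  lg-bits₀ = PB.final-bits (4 + suc c) (m≤m+n 4 (suc c)) (begin
    lg (suc c * w)                ≤⟨ lg-* (suc c) w ⟩
    lg (suc c) + lg w             ≤⟨ +-mono-≤ (lg≤id (suc c) (s≤s z≤n)) (≤-trans (lg≤id w 1≤w) (lg≤id n 0<n)) ⟩
    suc c + n                     ≤⟨ +-monoˡ-≤ n (≤-trans (≤-reflexive (sym (*-identityʳ (suc c)))) (*-monoʳ-≤ (suc c) 0<n)) ⟩
    suc c * n + n                 ≡⟨ +-comm (suc c * n) n ⟩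
    suc (suc c) * n               ≤⟨ *-monoˡ-≤ n (≤-trans (n<2^n (suc c)) (^-monoʳ-≤ 2 (m≤n+m (suc c) 4))) ⟩
    2 ^ (4 + suc c) * n           ∎)
    where open ≤-Reasoning

  -- The lengths after one, two and three reductions are at most (q + A)·t, (2q + A + 1)·`lg t` and
  -- q + 2q + A + 1 + `lg` (`lg t`). Since q is linear in ε and the double logarithm is at most 8ε,
  -- the last is O(2^ε).
  bits₃≤ : bits 3 ≤ (A + 66) * 2 ^ ε
  bits₃≤ = begin
    q + lg (bits 2)                         ≤⟨ +-monoʳ-≤ q (≤-trans (lg-mono b₂) (≤-trans (lg-* (2 * q + A + 1) ℓ) (+-monoˡ-≤ (lg ℓ) (lg≤id _ (m≤n+m 1 (2 * q + A)))))) ⟩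
    q + (2 * q + A + 1 + lg ℓ)              ≤⟨ +-monoʳ-≤ q (+-monoʳ-≤ (2 * q + A + 1) (≤-trans (m≤n+m (lg ℓ) c17) 8ε≥)) ⟩
    q + (2 * q + A + 1 + ε * 8)             ≡⟨ cong (λ z → z + (2 * z + A + 1 + ε * 8)) q≡ ⟩
    15 + 4 * ε + (2 * (15 + 4 * ε) + A + 1 + ε * 8) ≡⟨ e₃ ε A ⟩
    A * 1 + 46 * 1 + 20 * ε                 ≤⟨ +-mono-≤ (+-mono-≤ (*-monoʳ-≤ A (m^n>0 2 ε)) (*-monoʳ-≤ 46 (m^n>0 2 ε))) (*-monoʳ-≤ 20 (<⇒≤ (n<2^n ε))) ⟩
    A * 2 ^ ε + 46 * 2 ^ ε + 20 * 2 ^ ε     ≡⟨ e₄ A (2 ^ ε) ⟩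
    (A + 66) * 2 ^ ε                        ∎
    where
    open ≤-Reasoning
    e₃ : ∀ ε A → 15 + 4 * ε + (2 * (15 + 4 * ε) + A + 1 + ε * 8) ≡ A * 1 + 46 * 1 + 20 * ε
    e₃ = solve-∀
    e₄ : ∀ A r → A * r + 46 * r + 20 * r ≡ (A + 66) * r
    e₄ = solve-∀
    b₁ : bits 1 ≤ (q + A) * t
    b₁ = begin
      q + lg (bits 0)       ≤⟨ +-mono-≤ (≤-trans (≤-reflexive (sym (*-identityʳ q))) (*-monoʳ-≤ q 0<t)) lg-bits₀ ⟩
      q * t + A * t         ≡⟨ *-distribʳ-+ t q A ⟨
      (q + A) * t           ∎
    b₂ : bits 2 ≤ (2 * q + A + 1) * ℓ
    b₂ = begin
      q + lg (bits 1)                 ≤⟨ +-monoʳ-≤ q (≤-trans (lg-mono b₁) (≤-trans (lg-* (q + A) t) (+-monoˡ-≤ ℓ (lg≤id (q + A) (s≤s z≤n))))) ⟩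
      q + (q + A + ℓ)                 ≡⟨ e₁ q A ℓ ⟩
      (2 * q + A) * 1 + ℓ             ≤⟨ +-monoˡ-≤ ℓ (*-monoʳ-≤ (2 * q + A) 1≤ℓ) ⟩
      (2 * q + A) * ℓ + ℓ             ≡⟨ e₂ (2 * q + A) ℓ ⟩
      (2 * q + A + 1) * ℓ             ∎
      where
      e₁ : ∀ q A ℓ → q + (q + A + ℓ) ≡ (2 * q + A) * 1 + ℓ
      e₁ = solve-∀
      e₂ : ∀ a ℓ → a * ℓ + ℓ ≡ (a + 1) * ℓ
      e₂ = solve-∀

  2^ε*≤R8 : ∀ i → i ≤ 8 → 2 ^ (i * ε) ≤ R8
  2^ε*≤R8 i p = ≤-trans (^-monoʳ-≤ 2 (≤-trans (*-monoˡ-≤ ε p) (≤-reflexive (*-comm 8 ε)))) (≤-reflexive (sym R8≡))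

  1≤R8 : 1 ≤ R8
  1≤R8 = 2^ε*≤R8 0 z≤n

  blk≤ : suc blk ≤ blockConst c * R8
  blk≤ = begin
    1 + 2 * 2 ^ d * Cb                ≡⟨ cong (λ z → 1 + 2 * z * Cb) (trans (cong (2 ^_) (e₀ ε)) (^-distribˡ-+-* 2 6 (2 * ε))) ⟩
    1 + 2 * (2 ^ 6 * 2 ^ (2 * ε)) * Cb ≤⟨ +-mono-≤ 1≤R8 (*-monoˡ-≤ Cb (*-monoʳ-≤ 2 (*-monoʳ-≤ 64 (2^ε*≤R8 2 (≤ᵇ⇒≤ 2 8 tt))))) ⟩
    R8 + 2 * (64 * R8) * Cb           ≡⟨ e₁ R8 Cb ⟩
    (1 + 128 * Cb) * R8               ≡⟨ cong (_* R8) (blockConst≡ c) ⟨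
    blockConst c * R8                 ∎
    where
    open ≤-Reasoning
    e₀ : ∀ ε → 3 + ε + (3 + ε) ≡ 6 + 2 * ε
    e₀ = solve-∀
    e₁ : ∀ r c → r + 2 * (64 * r) * c ≡ (1 + 128 * c) * r
    e₁ = solve-∀

  -- With ρ = 2^ε the number of colours is O(2^q · `bits 3`) = O(ρ^4 · ρ), and a turn takes ρ + 1
  -- blocks: O(ρ^6), within the budget ρ^8.
  labels≤ : 2 ^ bits 4 * suc (2 ^ ε) ≤ labelConst c * R8
  labels≤ = begin
    2 ^ (q + lg (bits 3)) * suc (2 ^ ε)         ≡⟨ cong (_* suc (2 ^ ε)) (^-distribˡ-+-* 2 q (lg (bits 3))) ⟩
    2 ^ q * 2 ^ lg (bits 3) * suc (2 ^ ε)       ≤⟨ *-mono-≤ (*-monoʳ-≤ (2 ^ q) (≤-trans (2^lg≤2* (bits 3) (bits>0 3)) (*-monoʳ-≤ 2 bits₃≤))) (suc≤2* (m^n>0 2 ε)) ⟩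
    2 ^ q * (2 * ((A + 66) * 2 ^ ε)) * (2 * 2 ^ ε) ≡⟨ cong (λ z → z * (2 * ((A + 66) * 2 ^ ε)) * (2 * 2 ^ ε)) 2^q≡ ⟩
    2 ^ c15 * 2 ^ (4 * ε) * (2 * ((A + 66) * 2 ^ ε)) * (2 * 2 ^ ε) ≡⟨ e₁ (2 ^ c15) (2 ^ (4 * ε)) (A + 66) (2 ^ ε) ⟩
    2 * (2 * 2 ^ c15) * (A + 66) * (2 ^ (4 * ε) * (2 ^ ε * 2 ^ ε)) ≡⟨ cong (2 * (2 * 2 ^ c15) * (A + 66) *_) six ⟩
    2 * (2 * 2 ^ c15) * (A + 66) * 2 ^ (6 * ε)  ≤⟨ *-monoʳ-≤ (2 * (2 * 2 ^ c15) * (A + 66)) (2^ε*≤R8 6 (≤ᵇ⇒≤ 6 8 tt)) ⟩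
    2 * (2 * 2 ^ c15) * (A + 66) * R8           ≡⟨ cong (_* R8) (labelConst≡ c) ⟨
    labelConst c * R8                           ∎
    where
    open ≤-Reasoning
    2^q≡ : 2 ^ q ≡ 2 ^ c15 * 2 ^ (4 * ε)
    2^q≡ = trans (cong (2 ^_) (trans q≡ (cong (_+ 4 * ε) 15≡c15))) (^-distribˡ-+-* 2 c15 (4 * ε))
    e₁ : ∀ c x a r → c * x * (2 * (a * r)) * (2 * r) ≡ 2 * (2 * c) * a * (x * (r * r))
    e₁ = solve-∀
    e₂ : ∀ ε → 4 * ε + (ε + ε) ≡ 6 * ε
    e₂ = solve-∀
    six : 2 ^ (4 * ε) * (2 ^ ε * 2 ^ ε) ≡ 2 ^ (6 * ε)
    six = trans (cong (2 ^ (4 * ε) *_) (sym (^-distribˡ-+-* 2 ε ε)))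
      (trans (sym (^-distribˡ-+-* 2 (4 * ε) (ε + ε))) (cong (2 ^_) (e₂ ε)))

  section-blocks : ∀ j → blocks (section j (labelExponent ℓ) ⌊log₂ n ⌋ (lastBlock c ℓ) (mainBits c k ℓ n)) ≤ sectionConst c * R8
  section-blocks j = begin
    1 + blocks (reds ++ (labs ++ (stopOp (labelExponent ℓ) ∷ [])))        ≡⟨ cong (1 +_) (trans (blocks-++ reds (labs ++ (stopOp (labelExponent ℓ) ∷ []))) (cong (blocks reds +_) (blocks-++ labs (stopOp (labelExponent ℓ) ∷ [])))) ⟩
    1 + (blocks reds + (blocks labs + 1))                 ≤⟨ +-monoʳ-≤ 1 (+-mono-≤
        (blocks-for 4 (reduces j (labelExponent ℓ) ⌊log₂ n ⌋ (lastBlock c ℓ) (mainBits c k ℓ n)) (suc blk) (λ _ _ → ≤-reflexive (+-identityʳ (suc blk))))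
        (+-monoˡ-≤ 1 (blocks-for (2 ^ mainBits c k ℓ n 4) (labels j (labelExponent ℓ)) (suc (2 ^ ε)) (λ _ _ → ≤-reflexive (+-identityʳ (suc (2 ^ ε))))))) ⟩
    1 + (4 * suc blk + (2 ^ bits 4 * suc (2 ^ ε) + 1))    ≤⟨ +-mono-≤ 1≤R8 (+-mono-≤ (*-monoʳ-≤ 4 blk≤) (+-mono-≤ labels≤ 1≤R8)) ⟩
    R8 + (4 * (blockConst c * R8) + (labelConst c * R8 + R8)) ≡⟨ e R8 (blockConst c) (labelConst c) ⟩
    (2 + 4 * blockConst c + labelConst c) * R8            ≡⟨ cong (_* R8) (sectionConst≡ c) ⟨
    sectionConst c * R8                                   ∎
    where
    open ≤-Reasoning
    reds labs : List Op
    reds = for 4 (reduces j (labelExponent ℓ) ⌊log₂ n ⌋ (lastBlock c ℓ) (mainBits c k ℓ n))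
    labs = for (2 ^ mainBits c k ℓ n 4) (labels j (labelExponent ℓ))
    e : ∀ r a b → r + (4 * (a * r) + (b * r + r)) ≡ (2 + 4 * a + b) * r
    e = solve-∀

  level-blocks : ∀ lam W j → blocks (level (labelExponent ℓ) ⌊log₂ n ⌋ (lastBlock c ℓ) (mainBits c k ℓ n) lam W j) ≤ levelConst c * ℓ
  level-blocks lam W j = begin
    blocks (level (labelExponent ℓ) ⌊log₂ n ⌋ (lastBlock c ℓ) (mainBits c k ℓ n) lam W j)
      ≡⟨ blocks-++ (colouring j (labelExponent ℓ) ⌊log₂ n ⌋ (lastBlock c ℓ) (mainBits c k ℓ n)) (for R8 (roundOps lam W j)) ⟩
    1 + blocks (for 8 (λ _ → section j (labelExponent ℓ) ⌊log₂ n ⌋ (lastBlock c ℓ) (mainBits c k ℓ n))) + blocks (for R8 (roundOps lam W j))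
      ≤⟨ +-mono-≤ (+-monoʳ-≤ 1 (blocks-for 8 (λ _ → section j (labelExponent ℓ) ⌊log₂ n ⌋ (lastBlock c ℓ) (mainBits c k ℓ n)) (sectionConst c * R8) (λ _ _ → section-blocks j)))
           (blocks-for R8 (roundOps lam W j) 1 (λ _ _ → ≤-refl)) ⟩
    1 + 8 * (sectionConst c * R8) + R8 * 1
      ≤⟨ +-monoˡ-≤ (R8 * 1) (+-monoˡ-≤ (8 * (sectionConst c * R8)) 1≤R8) ⟩
    R8 + 8 * (sectionConst c * R8) + R8 * 1       ≡⟨ e R8 (sectionConst c) ⟩
    (2 + 8 * sectionConst c) * R8                 ≤⟨ *-monoʳ-≤ (2 + 8 * sectionConst c) R8≤ ⟩
    (2 + 8 * sectionConst c) * (2 ^ suc c24 * ℓ)  ≡⟨ *-assoc (2 + 8 * sectionConst c) (2 ^ suc c24) ℓ ⟨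
    (2 + 8 * sectionConst c) * 2 ^ suc c24 * ℓ    ≡⟨ cong (_* ℓ) (levelConst≡ c) ⟨
    levelConst c * ℓ                  ∎
    where
    open ≤-Reasoning
    e : ∀ r c → r + 8 * (c * r) + r * 1 ≡ (2 + 8 * c) * r
    e = solve-∀

  iteration-blocks : ∀ Nb lam → blocks (iteration (labelExponent ℓ) ⌊log₂ n ⌋ (lastBlock c ℓ) (mainBits c k ℓ n) ℓ Nb lam) ≤ iterationConst c * (ℓ * ℓ)
  iteration-blocks Nb lam = begin
    blocks (iteration (labelExponent ℓ) ⌊log₂ n ⌋ (lastBlock c ℓ) (mainBits c k ℓ n) ℓ Nb lam)
      ≡⟨ trans (blocks-++ (lpPart ℓ Nb lam) (levels (labelExponent ℓ) ⌊log₂ n ⌋ (lastBlock c ℓ) (mainBits c k ℓ n) ℓ lam ++ (commitOp (2 ^ suc ℓ) ∷ []))) (cong₂ _+_ (blocks-++ (for (suc ℓ) (λ j → lpOp lam (2 ^ ℓ) j ∷ [])) (thresholdOp (2 ^ ℓ) Nb ∷ []))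
           (blocks-++ (levels (labelExponent ℓ) ⌊log₂ n ⌋ (lastBlock c ℓ) (mainBits c k ℓ n) ℓ lam) (commitOp (2 ^ suc ℓ) ∷ []))) ⟩
    blocks (for (suc ℓ) (λ j → lpOp lam (2 ^ ℓ) j ∷ [])) + 1 + (blocks (levels (labelExponent ℓ) ⌊log₂ n ⌋ (lastBlock c ℓ) (mainBits c k ℓ n) ℓ lam) + 1)
      ≤⟨ +-mono-≤ (+-monoˡ-≤ 1 (blocks-for (suc ℓ) (λ j → lpOp lam (2 ^ ℓ) j ∷ []) 1 (λ _ _ → ≤-refl)))
           (+-monoˡ-≤ 1 (blocks-for (suc ℓ) (level (labelExponent ℓ) ⌊log₂ n ⌋ (lastBlock c ℓ) (mainBits c k ℓ n) lam (2 ^ suc ℓ)) (levelConst c * ℓ) (λ j _ → level-blocks lam (2 ^ suc ℓ) j))) ⟩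
    suc ℓ * 1 + 1 + (suc ℓ * (levelConst c * ℓ) + 1)
      ≤⟨ +-mono-≤ (+-monoˡ-≤ 1 (*-monoˡ-≤ 1 (suc≤2* 1≤ℓ))) (+-monoˡ-≤ 1 (*-monoˡ-≤ (levelConst c * ℓ) (suc≤2* 1≤ℓ))) ⟩
    2 * ℓ * 1 + 1 + (2 * ℓ * (levelConst c * ℓ) + 1)
      ≤⟨ +-mono-≤ (+-mono-≤ (*-monoʳ-≤ (2 * ℓ) 1≤ℓ) 1≤ℓ²) (+-monoʳ-≤ (2 * ℓ * (levelConst c * ℓ)) 1≤ℓ²) ⟩
    2 * ℓ * ℓ + ℓ * ℓ + (2 * ℓ * (levelConst c * ℓ) + ℓ * ℓ) ≡⟨ e ℓ (levelConst c) ⟩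
    (4 + 2 * levelConst c) * (ℓ * ℓ) ≡⟨ cong (_* (ℓ * ℓ)) (iterationConst≡ c) ⟨
    iterationConst c * (ℓ * ℓ) ∎
    where
    open ≤-Reasoning
    1≤ℓ² : 1 ≤ ℓ * ℓ
    1≤ℓ² = *-mono-≤ 1≤ℓ 1≤ℓ
    e : ∀ ℓ c → 2 * ℓ * ℓ + ℓ * ℓ + (2 * ℓ * (c * ℓ) + ℓ * ℓ) ≡ (4 + 2 * c) * (ℓ * ℓ)
    e = solve-∀

  phases-blocks : 1 ≤ k → blocks (phasePart c k ℓ n) ≤ 2 * k * (4 * (iterationConst c * (ℓ * ℓ))) + k * (ℓ * ℓ)
  phases-blocks 1≤k = begin
    blocks (phasePart c k ℓ n)
      ≡⟨ cong blocks (phasePart≡ c k ℓ n) ⟩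
    blocks (phases (labelExponent ℓ) ⌊log₂ n ⌋ (lastBlock c ℓ) (mainBits c k ℓ n) ℓ (n ^ c) k)
      ≡⟨ blocks-++ (for (suc k) (scales (labelExponent ℓ) ⌊log₂ n ⌋ (lastBlock c ℓ) (mainBits c k ℓ n) ℓ (n ^ c) k)) (finishOp (n ^ c) ∷ []) ⟩
    blocks (for (suc k) (scales (labelExponent ℓ) ⌊log₂ n ⌋ (lastBlock c ℓ) (mainBits c k ℓ n) ℓ (n ^ c) k)) + 1
      ≤⟨ +-monoˡ-≤ 1 (blocks-for (suc k) (scales (labelExponent ℓ) ⌊log₂ n ⌋ (lastBlock c ℓ) (mainBits c k ℓ n) ℓ (n ^ c) k) (4 * (iterationConst c * (ℓ * ℓ))) (λ i _ →
           blocks-for 4 (λ _ → iteration (labelExponent ℓ) ⌊log₂ n ⌋ (lastBlock c ℓ) (mainBits c k ℓ n) ℓ (n ^ c) (2 ^ (k ∸ i))) (iterationConst c * (ℓ * ℓ)) (λ _ _ → iteration-blocks (n ^ c) (2 ^ (k ∸ i))))) ⟩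
    suc k * (4 * (iterationConst c * (ℓ * ℓ))) + 1
      ≤⟨ +-mono-≤ (*-monoˡ-≤ (4 * (iterationConst c * (ℓ * ℓ))) (suc≤2* 1≤k)) (*-mono-≤ 1≤k (*-mono-≤ 1≤ℓ 1≤ℓ)) ⟩
    2 * k * (4 * (iterationConst c * (ℓ * ℓ))) + k * (ℓ * ℓ) ∎
    where open ≤-Reasoning

  pre-blocks : blocks (prePart c k ℓ n) ≤ logStar n
  pre-blocks = ≤-trans (blocks-for (preSteps k ℓ (suc c * lg n) n) (recolourOps (ℓ + ℓ) (preBits k ℓ (suc c * lg n))) 1 (λ _ _ → ≤-refl))
    (≤-trans (≤-reflexive (*-identityʳ _)) PB.K≤)

  main-arith : ∀ s k c l → s + (2 * k * (4 * (c * l)) + k * l) ≤ (8 * c + 1) * (k * l + s)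
  main-arith s k c l = ≤-trans (m≤m+n _ (8 * c * s)) (≤-reflexive (e s k c l))
    where
    e : ∀ s k c l → s + (2 * k * (4 * (c * l)) + k * l) + 8 * c * s ≡ (8 * c + 1) * (k * l + s)
    e = solve-∀

  main-blocks : 1 ≤ k → blocks (mainProgram c k ℓ n) ≤ roundConst c * (k * (ℓ * ℓ) + logStar n)
  main-blocks 1≤k = ≤-trans (≤-reflexive (blocks-++ (prePart c k ℓ n) (phasePart c k ℓ n)))
    (≤-trans (+-mono-≤ pre-blocks (phases-blocks 1≤k)) (main-arith (logStar n) k (iterationConst c) (ℓ * ℓ)))

-- Correctness on actual inputs and the final bounds

∣∣≡∑ : ∀ {n} (S : Subset n) → ∣ S ∣ ≡ ∑ (λ v → ⟦ lookup S v ⟧)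
∣∣≡∑ [] = refl
∣∣≡∑ (inside ∷ S) = cong suc (∣∣≡∑ S)
∣∣≡∑ (outside ∷ S) = ∣∣≡∑ S

-- The identifier is the first proper colour.
initV : ℕ → VS
initV i = vs false 0 i 0 0 0

initU : US
initU = us false 0 0

setCover : ℕ → Algorithm ℕ
setCover c = algorithm initU initV (program c) (bandwidthExponent c) ch

module SetCoverRun {c : ℕ} (In : Input c) where
  open Input In
  open Instance inst
  module A = Adequacy initU initV (program c) (bandwidthExponent c) ch In

  n : ℕ
  n = size inst

  N : Network
  N = record { nU = nU ; nV = nV ; adj = adj ; idV = λ v → ids (inj₂ v)
             ; idV-inj = λ v v′ q → inj₂-injective (idsInj q) }
    where
    inj₂-injective : ∀ {v v′ : Fin nV} → inj₂ v ≡ inj₂ v′ → v ≡ v′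
    inj₂-injective refl = refl

  open Semantics N (msgBound c n) using (Global; Cover; AllLegal; execs; Triple; conseq; seq)

  ∑≤n : ∀ {m} (p : Fin m → Bool) → ∑ (λ i → ⟦ p i ⟧) ≤ m
  ∑≤n {m} p = ≤-trans (∑-mono (λ i → ⟦⟧≤1 (p i))) (≤-reflexive (trans (∑-const m 1) (*-identityʳ m)))

  degree-count : ∀ {m} {B : Set} (f : Fin m → B) (p : Fin m → Bool) → length (map f (filterᵇ p (allFin m))) ≡ ∑ (λ i → ⟦ p i ⟧)
  degree-count f p = trans (length-lsum (map f (filterᵇ p (allFin _)))) (trans (lsum-allFin (λ _ → 1) f p) (∑-cong λ i → *-identityʳ ⟦ p i ⟧))

  degU≤ : ∀ u → ∑ (λ v → ⟦ adj u v ⟧) ≤ t ⊓ n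
  degU≤ u = ⊓-glb (≤-trans (≤-reflexive (sym (degree-count inj₂ (adj u)))) (degU u)) (≤-trans (∑≤n (adj u)) (m≤n+m nV nU))

  degV≤ : ∀ v → ∑ (λ u → ⟦ adj u v ⟧) ≤ s ⊓ n
  degV≤ v = ⊓-glb (≤-trans (≤-reflexive (sym (degree-count inj₁ (λ u → adj u v)))) (degV v)) (≤-trans (∑≤n (λ u → adj u v)) (m≤m+n nU nV))

  all-cover : Cover (λ _ → true)
  all-cover u = let v , a = feasible u in v , refl , T⇒≡ a

  k : ℕ
  k = lg (s ⊓ n)

  ℓ : ℕ
  ℓ = lg (t ⊓ n)

  degV-pow : ∀ v → ∑ (λ u → ⟦ adj u v ⟧) ≤ 2 ^ k
  degV-pow v = ≤-trans (degV≤ v) (<⇒≤ (<2^lg (s ⊓ n)))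

  -- 627 = 312 + 315: each of the k + 1 thresholds takes 4·78 = 312 sets per optimal set and the
  -- last step 3, so 312·k + 315 must be covered with k ≥ 1. The dual case needs only 2·k.
  Goal : Global → Set
  Goal g = Cover (λ v → ch (proj₂ g v)) × (∀ S → Cover S → ∑ (λ v → ⟦ ch (proj₂ g v) ⟧) ≤ 627 * k * ∑ (λ v → ⟦ S v ⟧))

  goal-from : ∀ a → a ≤ 627 * k → ∀ g → Cover (λ v → ch (proj₂ g v)) × (∀ S → Cover S → ∑ (λ v → ⟦ ch (proj₂ g v) ⟧) ≤ a * ∑ (λ v → ⟦ S v ⟧)) → Goal g
  goal-from a h g (p , q) = p , λ S c → ≤-trans (q S c) (*-monoˡ-≤ (∑ (λ v → ⟦ S v ⟧)) h)

  module _ (0<n : 0 < n) where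

    dual-case : t ⊓ n ≤ k → Triple (_≡ A.initial) (for (suc k) (λ _ → dualOp (2 ^ k) ∷ [])) Goal
    dual-case t≤k = conseq {P = D.Fresh k (t ⊓ n) degV-pow degU≤ room} {P′ = _≡ A.initial}
        {Q = D.Result k (t ⊓ n) degV-pow degU≤ room (2 * (t ⊓ n))} {Q′ = Goal}
        (for (suc k) (λ _ → dualOp (2 ^ k) ∷ [])) (λ { g refl → (λ _ → refl) , (λ _ → refl) })
        (goal-from (2 * (t ⊓ n)) (*-mono-≤ {2} {627} (≤ᵇ⇒≤ 2 627 tt) t≤k)) (D.dual-correct k (t ⊓ n) degV-pow degU≤ room all-cover)
      where
      module D = Dual N (msgBound c n)
      module R = RoomFor c n 0<n
      room : 2 ^ k < msgBound c n
      room = <-≤-trans (^-monoʳ-< 2 (s≤s (s≤s z≤n)) {k} {2 * R.w} (begin-strict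
        k           ≤⟨ lg-mono (m⊓n≤n s n) ⟩
        R.w         <⟨ m<m+n R.w (≤-trans R.1≤w (≤-reflexive (sym (+-identityʳ R.w)))) ⟩
        2 * R.w     ∎)) (R.room 2 (R.k≤Cb 2 (≤ᵇ⇒≤ 2 125 tt)))
        where open ≤-Reasoning

    main-case : k < t ⊓ n → Triple (_≡ A.initial) (mainProgram c k ℓ n) Goal
    main-case k<t = seq {P = _≡ A.initial} {Q = Pr.Proper (preBits k ℓ (suc c * lg n) (preSteps k ℓ (suc c * lg n) n))} {R = Goal}
        (prePart c k ℓ n) (phasePart c k ℓ n) pre main
      where
      module MP = MainParams c n k (t ⊓ n) k<t (m⊓n≤n t n)
      module Pr₀ = Precolouring N (msgBound c n)
      degU< : ∀ u → ∑ (λ v → ⟦ adj u v ⟧) < 2 ^ ℓ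
      degU< u = ≤-<-trans (degU≤ u) (<2^lg (t ⊓ n))
      module Pr = Pr₀.PreRun ℓ k degU< degV-pow
      id<2^ : ∀ v → ids (inj₂ v) < 2 ^ (suc c * lg n)
      id<2^ v = <-≤-trans (idsBnd (inj₂ v)) (begin
        n ^ c                    ≤⟨ ^-monoˡ-≤ c (<⇒≤ (<2^lg n)) ⟩
        (2 ^ lg n) ^ c           ≡⟨ trans (^-*-assoc 2 (lg n) c) (cong (2 ^_) (*-comm (lg n) c)) ⟩
        2 ^ (c * lg n)           ≤⟨ ^-monoʳ-≤ 2 (m≤n+m (c * lg n) (lg n)) ⟩
        2 ^ (suc c * lg n)       ∎)
        where open ≤-Reasoning
      start : Pr.Proper (suc c * lg n) A.initial
      start = record { x0 = λ _ → refl ; cov0 = λ _ → refl ; ch0 = λ _ → refl ; col< = id<2^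
                     ; proper = λ u v v′ _ _ ne q → ne (Network.idV-inj N v v′ q) }
      pre : Triple (_≡ A.initial) (prePart c k ℓ n)
        (Pr.Proper (preBits k ℓ (suc c * lg n) (preSteps k ℓ (suc c * lg n) n)))
      pre g refl = Pr.recolours-correct (preSteps k ℓ (suc c * lg n) n) (preBits k ℓ (suc c * lg n)) MP.PB.B>0 (λ _ → refl)
        MP.pre-room MP.pre-code-room A.initial start
      room : ∀ j → Pr₀.Col.Room j (labelExponent ℓ) ⌊log₂ n ⌋ (lastBlock c ℓ) (mainBits c k ℓ n)
      room j = record
        { next = λ _ → refl
        ; bits>0 = MP.bits>0
        ; ψ-room = MP.bits-room
        ; blocks≥ = MP.blocks≥
        ; cls-room = MP.cls-room
        ; nV-room = MP.small<Bd nV (m≤n+m nV nU)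
        ; bit-room = <⇒≤ (subst (λ z → 2 ^ z < msgBound c n) (*-identityˡ MP.w) (MP.2^w<Bd 1 (≤ᵇ⇒≤ 1 3 tt)))
        ; 1-room = MP.small<Bd 1 MP.0<n }
      module PR = Pr₀.PhaseRun (labelExponent ℓ) ⌊log₂ n ⌋ (lastBlock c ℓ) (mainBits c k ℓ n) room ℓ (n ^ c) (MP.big nV (m≤n+m nV nU)) MP.W<Bd MP.cap
        (λ u → <⇒≤ (degU< u)) (λ v → idsBnd (inj₂ v))
      factor : suc k * 312 + 3 ≤ 627 * k
      factor = begin
        suc k * 312 + 3           ≡⟨ e k ⟩
        k * 312 + 315 * 1         ≤⟨ +-monoʳ-≤ (k * 312) (*-monoʳ-≤ 315 (1≤lg (s ⊓ n))) ⟩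
        k * 312 + 315 * k         ≡⟨ e′ k ⟩
        627 * k                   ∎
        where
        open ≤-Reasoning
        e : ∀ k → suc k * 312 + 3 ≡ k * 312 + 315 * 1
        e = solve-∀
        e′ : ∀ k → k * 312 + 315 * k ≡ 627 * k
        e′ = solve-∀
      main : Triple (Pr.Proper (preBits k ℓ (suc c * lg n) (preSteps k ℓ (suc c * lg n) n))) (phasePart c k ℓ n) Goal
      main g P = conseq {P = _≡ g} {P′ = _≡ g} {Q = PR.Result k degV-pow all-cover (suc k * 312 + 3)} {Q′ = Goal}
        (phasePart c k ℓ n) (λ _ q → q) (goal-from (suc k * 312 + 3) factor) (rename (phasePart c k ℓ n) phasePart-eq) g refl
        where
        module P = Pr.Proper P
        ready : PR.Ready g
        ready = record { x0 = P.x0 ; cov⇒ = λ u q → ⊥-elim (true≢false (trans (sym q) (P.cov0 u))) ; col< = P.col< ; proper = P.proper }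
        phasePart-eq : phasePart c k ℓ n ≡ phases (labelExponent ℓ) ⌊log₂ n ⌋ (lastBlock c ℓ) (mainBits c k ℓ n) ℓ (n ^ c) k
        phasePart-eq = phasePart≡ c k ℓ n
        run : Triple (_≡ g) (phases (labelExponent ℓ) ⌊log₂ n ⌋ (lastBlock c ℓ) (mainBits c k ℓ n) ℓ (n ^ c) k) (PR.Result k degV-pow all-cover (suc k * 312 + 3))
        run = PR.phases-correct k degV-pow all-cover g ready P.ch0
        rename : (os : List Op) → os ≡ phases (labelExponent ℓ) ⌊log₂ n ⌋ (lastBlock c ℓ) (mainBits c k ℓ n) ℓ (n ^ c) k → Triple (_≡ g) os (PR.Result k degV-pow all-cover (suc k * 312 + 3))
        rename os refl = run

    outcome : AllLegal (program c n s t) A.initial × Goal (execs (program c n s t) A.initial)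
    outcome with ≤ᵇ-cases (t ⊓ n) (lg (s ⊓ n))
    ... | inj₁ (p , e) rewrite e = dual-case p A.initial refl
    ... | inj₂ (p , e) rewrite e = main-case p A.initial refl

  open Run (setCover c) In using (Vout)

  correct : IsCover inst Vout × ((S : Subset nV) → IsCover inst S → ∣ Vout ∣ ≤ 627 * lg s * ∣ S ∣)
  correct with zero∨pos n
  -- Without nodes the message bound is 1 and no run can be legal in the sense required above, but
  -- nothing has to be covered.
  ... | inj₁ z = (λ u → ⊥-elim (no-elem u (m+n≡0⇒m≡0 nU z))) , λ S _ → ≤-trans (∣p∣≤n Vout) (≤-trans (≤-reflexive (m+n≡0⇒n≡0 nU z)) z≤n)
    where
    no-elem : ∀ {m} → Fin m → m ≢ 0
    no-elem fz ()
    no-elem (fs i) ()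
  ... | inj₂ p = cover , small
    where
    g : Global
    g = execs (program c n s t) A.initial
    out≡ : ∀ v → lookup Vout v ≡ ch (proj₂ g v)
    out≡ v = trans (lookup∘tabulate _ v) (A.outputs (proj₁ (outcome p)) v)
    cover : IsCover inst Vout
    cover u = let v , q , a = proj₁ (proj₂ (outcome p)) u in
      v , lookup⇒[]= v Vout (trans (out≡ v) q) , ≡⇒T a
    small : (S : Subset nV) → IsCover inst S → ∣ Vout ∣ ≤ 627 * lg s * ∣ S ∣
    small S cS = begin
      ∣ Vout ∣                                  ≡⟨ trans (∣∣≡∑ Vout) (∑-cong λ v → cong ⟦_⟧ (out≡ v)) ⟩
      ∑ (λ v → ⟦ ch (proj₂ g v) ⟧)              ≤⟨ proj₂ (proj₂ (outcome p)) (lookup S) (λ u → let v , i , a = cS u in v , []=⇒lookup i , T⇒≡ a) ⟩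
      627 * k * ∑ (λ v → ⟦ lookup S v ⟧)        ≤⟨ *-monoˡ-≤ _ (*-monoʳ-≤ 627 (lg-mono (m⊓n≤m s n))) ⟩
      627 * lg s * ∑ (λ v → ⟦ lookup S v ⟧)     ≡⟨ cong (627 * lg s *_) (∣∣≡∑ S) ⟨
      627 * lg s * ∣ S ∣                        ∎
      where open ≤-Reasoning

program-rounds : ∀ c n s t → Algorithm.rounds (setCover c) n s t ≤ 2 * roundConst c * (lg s * (lg t * lg t) + logStar n)
program-rounds c n s t = begin
  2 * length (stepsAll (program c n s t))                         ≡⟨ cong (2 *_) (length-stepsAll (program c n s t)) ⟩
  2 * blocks (program c n s t)                                    ≤⟨ *-monoʳ-≤ 2 bound ⟩
  2 * (roundConst c * (lg s * (lg t * lg t) + logStar n))         ≡⟨ *-assoc 2 (roundConst c) _ ⟨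
  2 * roundConst c * (lg s * (lg t * lg t) + logStar n)           ∎
  where
  open ≤-Reasoning
  k = lg (s ⊓ n)
  mono-rhs : k * (lg (t ⊓ n) * lg (t ⊓ n)) + logStar n ≤ lg s * (lg t * lg t) + logStar n
  mono-rhs = +-monoˡ-≤ (logStar n) (*-mono-≤ (lg-mono (m⊓n≤m s n)) (*-mono-≤ (lg-mono (m⊓n≤m t n)) (lg-mono (m⊓n≤m t n))))
  2≤ : 2 ≤ roundConst c
  2≤ = ≤-trans (≤-trans (≤ᵇ⇒≤ 2 8 tt) (≤-trans (≤-reflexive (sym (*-identityʳ 8))) (*-monoʳ-≤ 8 (≤-trans (s≤s z≤n) (≤-reflexive (sym (iterationConst≡ c))))))) (m≤m+n _ 1)
  bound : blocks (program c n s t) ≤ roundConst c * (lg s * (lg t * lg t) + logStar n)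
  bound with ≤ᵇ-cases (t ⊓ n) (lg (s ⊓ n))
  ... | inj₂ (p , e) rewrite e = ≤-trans (MainParams.main-blocks c n k (t ⊓ n) p (m⊓n≤n t n) (1≤lg (s ⊓ n))) (*-monoʳ-≤ (roundConst c) mono-rhs)
  ... | inj₁ (p , e) rewrite e = begin
    blocks (for (suc k) (λ _ → dualOp (2 ^ k) ∷ []))              ≤⟨ blocks-for (suc k) (λ _ → dualOp (2 ^ k) ∷ []) 1 (λ _ _ → ≤-refl) ⟩
    suc k * 1                                                     ≤⟨ ≤-trans (≤-reflexive (*-identityʳ (suc k))) (+-mono-≤ (1≤lg (s ⊓ n)) (≤-reflexive (sym (+-identityʳ k)))) ⟩
    2 * k                                                         ≤⟨ *-mono-≤ 2≤ (≤-trans (≤-reflexive (sym (*-identityʳ k))) (≤-trans (*-monoʳ-≤ k (*-mono-≤ (1≤lg (t ⊓ n)) (1≤lg (t ⊓ n)))) (m≤m+n _ (logStar n)))) ⟩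
    roundConst c * (k * (lg (t ⊓ n) * lg (t ⊓ n)) + logStar n)    ≤⟨ *-monoʳ-≤ (roundConst c) mono-rhs ⟩
    roundConst c * (lg s * (lg t * lg t) + logStar n)             ∎

-- The bound achieved, with an additive log* n, is below the one claimed for CONGEST because all
-- logarithms here are at least 1.
local≤congest : ∀ a b c d → 1 ≤ a → 1 ≤ b → 1 ≤ c → a * (b * b) + d ≤ a * (b * b * c + b * d)
local≤congest a b c d pa pb pc = begin
  a * (b * b) + d                       ≡⟨ e a b d ⟩
  a * (b * b * 1) + 1 * (1 * d)         ≤⟨ +-mono-≤ (*-monoʳ-≤ a (*-monoʳ-≤ (b * b) pc)) (*-mono-≤ pa (*-monoˡ-≤ d pb)) ⟩
  a * (b * b * c) + a * (b * d)         ≡⟨ *-distribˡ-+ a (b * b * c) (b * d) ⟨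
  a * (b * b * c + b * d)               ∎
  where
  open ≤-Reasoning
  e : ∀ a b d → a * (b * b) + d ≡ a * (b * b * 1) + 1 * (1 * d)
  e = solve-∀

theorem5p2 : (c : ℕ) →
    (Σ Set λ Msg → Σ (Algorithm Msg) λ A → ∃[ a ] ∃[ K ]
    (Correct A c a ×
    ((n s t : ℕ) → Algorithm.rounds A n s t ≤ K * (lg s * (lg t * lg t) + logStar n))))
    ×
    (Σ (Algorithm ℕ) λ A → ∃[ a ] ∃[ K ] ∃[ b ]
    (Correct A c a × Bandwidth A c b ×
    ((n s t : ℕ) → Algorithm.rounds A n s t ≤
    K * (lg s * (lg t * lg t * lg (lg t) + lg t * logStar n)))))
theorem5p2 c =
  (ℕ , setCover c , 627 , 2 * roundConst c , SetCoverRun.correct , program-rounds c) ,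
  (setCover c , 627 , 2 * roundConst c , bandwidthExponent c * 4 , SetCoverRun.correct ,
    bandwidth initU initV (program c) (bandwidthExponent c) ch c ,
    λ n s t → ≤-trans (program-rounds c n s t) (*-monoʳ-≤ (2 * roundConst c) (local≤congest (lg s) (lg t) (lg (lg t)) (logStar n) (1≤lg s) (1≤lg t) (1≤lg (lg t)))))
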